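{- Let $n,k$ be integers with $1\le k<n/2$ and let $A(n,k)=\mathrm{Aut}(D(\mathrm{GP}(n,k)))$. Then: \begin{enumerate} \item[(i)] If $n$ and $k$ are both odd: if $k^2\not\equiv\pm1\pmod n$ then $A(n,k)\cong F(2n)$; if $k^2\equiv 1\pmod n$ then $A(n,k)\cong J(2n,k)$; if $k^2\equiv -1\pmod n$ then $A(n,k)\cong H(2n,k)$. \item[(ii)] If $n$ is odd, $k$ is even and $(n,k)\ne(5,2)$: if $k^2\not\equiv\pm1\pmod n$ then $A(n,k)\cong F(2n)$; if $k^2\equiv1\pmod n$ then $A(n,k)\cong J(2n,n-k)$; if $k^2\equiv-1\pmod n$ then $A(n,k)\cong H(2n,n-k)$. Moreover $A(5,2)\cong S_5\times\mathbb{Z}_2$. \item[(iii)] If $n$ is even, $k$ is odd and $(n,k)\notin\{(4,1),(8,3),(10,3),(12,5),(24,5)\}$: if $k^2\not\equiv\pm1\pmod n$ then $A(n,k)\cong F(n)\wr S_2$; if $k^2\equiv1\pmod n$ then $A(n,k)\cong J(n,k)\wr S_2$; if $k^2\equiv -1\pmod n$ then $A(n,k)\cong H(n,k)\wr S_2$. Moreover $A(4,1)\cong(S_4\times\mathbb{Z}_2)\wr S_2$, $A(8,3)\cong(\mathrm{GL}(2,3)\rtimes\mathbb{Z}_2)\wr S_2$, $A(10,3)\cong(S_5\times\mathbb{Z}_2)\wr S_2$, $A(12,5)\cong(S_4\times S_3)\wr S_2$, $A(24,5)\cong((\mathrm{GL}(2,3)\times\mathbb{Z}_3)\rtimes\mathbb{Z}_2)\wr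 S_2$. \item[(iv)] If $n$ and $k$ are both even and $(n,k)\neq(10,2)$: if $k^2\equiv1\pmod{n/2}$ then $A(n,k)\cong L(n,k)$; if $k^2\equiv-1\pmod{n/2}$ then $A(n,k)\cong M(n,k)$; if $n=4k$ then $A(n,k)\cong N(n,k)$; if $k^2\not\equiv\pm1\pmod{n/2}$ and $n\ne4k$ then $A(n,k)\cong K(n,k)$. Moreover $A(10,2)\cong(A_5\times\mathbb{Z}_2^2)\rtimes\mathbb{Z}_2$. \end{enumerate}
   Context: $\mathrm{GP}(n,k)$ ($1\le k<n/2$) is the graph on $u_0,\dots,u_{n-1},v_0,\dots,v_{n-1}$ with edges $\{u_i,u_{i+1}\},\{u_i,v_i\},\{v_i,v_{i+k}\}$ (subscripts mod $n$). $D(\Gamma)=\Gamma\times K_2$ is the canonical double cover: vertex set $V(\Gamma)\times\mathbb{Z}_2$, $(u,x)\sim(v,y)$ iff $u\sim v$ and $x\neq y$. The groups are defined by presentations: $F(n)=\langle\rho,\delta\mid \rho^n=\delta^2=1,\ \delta\rho\delta=\rho^{ -1}\rangle$; $H(n,k)=\langle\rho,\alpha\mid\rho^n=\alpha^4=1,\ \alpha\rho\alpha^{ -1}=\rho^k\rangle$; $J(n,k)=\langle\rho,\delta,\alpha\mid\rho^n=\delta^2=\alpha^2=1,\ \delta\rho\delta=\rho^{ -1},\ \alpha\rho\alpha=\rho^k,\ \alpha\delta\alpha=\delta\rangle$; $K(n,k)=\langle\rho,\delta,\beta\mid\rho^n=\delta^2=\beta^2=1,\ \delta\rho\delta=\rho^{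 -1},\ \beta\rho\beta=\rho,\ \beta\delta\beta=\delta\rangle$; $L(n,k)=\langle\rho,\delta,\beta,\lambda\mid \rho^n=\delta^2=\beta^2=\lambda^4=1,\ \delta\rho\delta=\rho^{ -1},\ \beta\rho\beta=\rho,\ \beta\delta\beta=\delta,\ \lambda^{ -1}\rho\lambda=\rho^{k^2+k-1},\ \lambda^{ -1}\delta\lambda=\delta,\ \lambda^{ -1}\beta\lambda=\rho^{n/2}\beta,\ \lambda^2=\rho^{n/2}\rangle$; $M(n,k)=\langle\rho,\delta,\beta,\tau\mid \rho^n=\delta^2=\beta^2=\tau^4=1,\ \delta\rho\delta=\rho^{ -1},\ \beta\rho\beta=\rho,\ \beta\delta\beta=\delta,\ \tau^{ -1}\rho\tau=\rho^{n/2+k},\ \tau^{ -1}\delta\tau=\delta,\ \tau^{ -1}\beta\tau=\rho^{n/2}\beta,\ \tau^2=\rho^{n/2}\delta\rangle$; $N(n,k)=\langle\rho,\delta,\beta,\theta\mid \rho^n=\delta^2=\beta^2=\theta^2=1,\ \delta\rho\delta=\rho^{ -1},\ \beta\rho\beta=\rho,\ \beta\delta\beta=\delta,\ \theta\rho\theta=\rho^{2k+1},\ \theta\delta\theta=\delta,\ \theta\beta\theta=\rho^{n/2}\beta\rangle$. $\wr$ denotes the wreath product. -}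

module Defs where

open import Level using (0ℓ)
open import Data.Nat using (ℕ; zero; suc; _+_; _*_; _∸_; _%_; ⌊_/2⌋)
open import Data.Nat.DivMod using (m%n<n)
import Data.Nat.Properties
open import Data.Empty using (⊥-elim)
open import Data.Nat.Divisibility using (_∣_; ∣m∣n⇒∣m+n; _∣0)
open import Data.Fin using (Fin; toℕ; fromℕ<; _≟_)
import Data.Fin
open import Data.Bool using (Bool; true; false; not; _xor_)
open import Data.Product using (Σ; ∃; _×_; _,_; proj₁; proj₂)
open import Data.Sum using (_⊎_)
open import Data.List using (List; []; _∷_; _++_; reverse; map; length; replicate; concat)
open import Data.List.Properties using (length-++)
open import Data.List.Membership.Propositional using (_∈_)
open import Data.Unit using (⊤; tt)
open import Relation.Nullary using (¬_; yes; no)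
open import Relation.Binary.PropositionalEquality using (_≡_; refl; sym; trans; cong; cong₂; subst; subst₂)
open import Function.Bundles using (_↔_; Inverse; _⇔_; mk⇔; Equivalence)
open import Function.Properties.Inverse using (↔-refl; ↔-sym; ↔-trans)
open import Algebra.Bundles.Raw using (RawGroup)
open import Algebra.Morphism.Structures using (module GroupMorphisms)

-- Group isomorphism (between raw groups; all groups below are genuine
-- groups, built concretely)

_≅_ : RawGroup 0ℓ 0ℓ → RawGroup 0ℓ 0ℓ → Set
G ≅ H = ∃ λ (f : RawGroup.Carrier G → RawGroup.Carrier H) →
          GroupMorphisms.IsGroupIsomorphism G H f

infix 4 _≅_

shift : ∀ {n} → ℕ → Fin n → Fin n
shift {zero}  j ()
shift {suc m} j i = fromℕ< (m%n<n (toℕ i + j) (suc m))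

data GPV (n : ℕ) : Set where
  u v : Fin n → GPV n

data GPEdge (n k : ℕ) : GPV n → GPV n → Set where
  outer : ∀ i → GPEdge n k (u i) (u (shift 1 i))
  spoke : ∀ i → GPEdge n k (u i) (v i)
  inner : ∀ i → GPEdge n k (v i) (v (shift k i))

GPAdj : ∀ n k → GPV n → GPV n → Set
GPAdj n k x y = GPEdge n k x y ⊎ GPEdge n k y x

-- D(GP(n,k)) = GP(n,k) × K₂ : vertex set V(GP(n,k)) × ℤ₂
DV : ℕ → Set
DV n = GPV n × Bool

DAdj : ∀ n k → DV n → DV n → Set
DAdj n k (x , a) (y , b) = GPAdj n k x y × ¬ (a ≡ b)

record PermClosed (A : Set) (P : A ↔ A → Set) : Set where
  field
    P-id  : P ↔-refl
    P-∘   : ∀ {f g} → P f → P g → P (↔-trans g f)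
    P-inv : ∀ {f} → P f → P (↔-sym f)

PermGroup : (A : Set) (P : A ↔ A → Set) → PermClosed A P → RawGroup 0ℓ 0ℓ
PermGroup A P cl = record
  { Carrier = Σ (A ↔ A) P
  ; _≈_ = λ f g → ∀ x → Inverse.to (proj₁ f) x ≡ Inverse.to (proj₁ g) x
  ; _∙_ = λ f g → ↔-trans (proj₁ g) (proj₁ f) , P-∘ (proj₂ f) (proj₂ g)
  ; ε = ↔-refl , P-id
  ; _⁻¹ = λ f → ↔-sym (proj₁ f) , P-inv (proj₂ f)
  }
  where open PermClosed cl

Sym : Set → RawGroup 0ℓ 0ℓ
Sym A = PermGroup A (λ _ → ⊤) record { P-id = tt ; P-∘ = λ _ _ → tt ; P-inv = λ _ → tt }

S : ℕ → RawGroup 0ℓ 0ℓ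
S m = Sym (Fin m)

IsAut : ∀ n k → DV n ↔ DV n → Set
IsAut n k f = ∀ x y → DAdj n k x y ⇔ DAdj n k (Inverse.to f x) (Inverse.to f y)

private
  aut-closed : ∀ n k → PermClosed (DV n) (IsAut n k)
  aut-closed n k = record
    { P-id  = λ x y → mk⇔ (λ d → d) (λ d → d)
    ; P-∘   = λ {f} {g} pf pg x y →
        mk⇔ (λ d → Equivalence.to (pf _ _) (Equivalence.to (pg x y) d))
            (λ d → Equivalence.from (pg x y) (Equivalence.from (pf _ _) d))
    ; P-inv = λ {f} pf x y →
        let open Inverse f
            e = pf (from x) (from y)
            fx = strictlyInverseˡ x
            fy = strictlyInverseˡ y
        in mk⇔ (λ d → Equivalence.from e (subst₂ (DAdj n k) (sym fx) (sym fy) d))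
               (λ d → subst₂ (DAdj n k) fx fy (Equivalence.to e d))
    }

A : ℕ → ℕ → RawGroup 0ℓ 0ℓ
A n k = PermGroup (DV n) (IsAut n k) (aut-closed n k)

swapF : ∀ {m} → Fin m → Fin m → Fin m → Fin m
swapF i j x with x ≟ i | x ≟ j
... | yes _ | _     = j
... | no _  | yes _ = i
... | no _  | no _  = x

Transp : ℕ → Set
Transp m = Σ (Fin m × Fin m) λ p → ¬ (proj₁ p ≡ proj₂ p)

applyT : ∀ {m} → List (Transp m) → Fin m → Fin m
applyT []                    x = x
applyT (((i , j) , _) ∷ ts) x = swapF i j (applyT ts x)

IsEven : ∀ m → Fin m ↔ Fin m → Set
IsEven m f = ∃ λ (ts : List (Transp m)) →
  (2 ∣ length ts) × (∀ x → Inverse.to f x ≡ applyT ts x)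

private
  revT : ∀ {m} → List (Transp m) → List (Transp m)
  revT []       = []
  revT (t ∷ ts) = revT ts ++ (t ∷ [])

  applyT-++ : ∀ {m} (ts us : List (Transp m)) x →
              applyT (ts ++ us) x ≡ applyT ts (applyT us x)
  applyT-++ []       us x = refl
  applyT-++ (((i , j) , _) ∷ ts) us x = cong (swapF i j) (applyT-++ ts us x)

  swap-swap : ∀ {m} (i j x : Fin m) → swapF i j (swapF i j x) ≡ x
  swap-swap i j x with x ≟ i | x ≟ j
  ... | yes x≡i | _ with j ≟ i | j ≟ j
  ...   | yes j≡i | _     = trans j≡i (sym x≡i)
  ...   | no _    | yes _ = sym x≡i
  ...   | no _    | no j≢j = ⊥-elim (j≢j refl)
  swap-swap i j x | no x≢i | yes x≡j with i ≟ i
  ... | yes _ = sym x≡j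
  ... | no i≢i = ⊥-elim (i≢i refl)
  swap-swap i j x | no x≢i | no x≢j with x ≟ i | x ≟ j
  ... | yes x≡i | _ = ⊥-elim (x≢i x≡i)
  ... | no _ | yes x≡j = ⊥-elim (x≢j x≡j)
  ... | no _ | no _ = refl

  applyT-rev : ∀ {m} (ts : List (Transp m)) x → applyT (revT ts) (applyT ts x) ≡ x
  applyT-rev []       x = refl
  applyT-rev (((i , j) , p) ∷ ts) x =
    trans (applyT-++ (revT ts) _ _)
          (trans (cong (applyT (revT ts)) (swap-swap i j (applyT ts x)))
                 (applyT-rev ts x))

  length-revT : ∀ {m} (ts : List (Transp m)) → length (revT ts) ≡ length ts
  length-revT []       = refl
  length-revT (t ∷ ts) = trans (length-++ (revT ts))
    (trans (cong (_+ 1) (length-revT ts)) (Data.Nat.Properties.+-comm (length ts) 1))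

  even-closed : ∀ m → PermClosed (Fin m) (IsEven m)
  even-closed m = record
    { P-id  = [] , 2 ∣0 , λ x → refl
    ; P-∘   = λ {f} {g} (ts , ets , pf) (us , eus , pg) →
        ts ++ us ,
        subst (2 ∣_) (sym (length-++ ts)) (∣m∣n⇒∣m+n ets eus) ,
        λ x → trans (cong (Inverse.to f) (pg x))
                (trans (pf _) (sym (applyT-++ ts us x)))
    ; P-inv = λ {f} (ts , ets , pf) →
        revT ts ,
        subst (2 ∣_) (sym (length-revT ts)) ets ,
        λ x → let open Inverse f in
          trans (sym (applyT-rev ts (from x)))
                (cong (applyT (revT ts)) (trans (sym (pf (from x))) (strictlyInverseˡ x)))
    }

Alt : ℕ → RawGroup 0ℓ 0ℓ
Alt m = PermGroup (Fin m) (IsEven m) (even-closed m)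

Z : (m : ℕ) .{{_ : Data.Nat.NonZero m}} → RawGroup 0ℓ 0ℓ
Z m = record
  { Carrier = Fin m
  ; _≈_ = _≡_
  ; _∙_ = λ a b → fromℕ< (m%n<n (toℕ a + toℕ b) m)
  ; ε = fromℕ< (m%n<n 0 m)
  ; _⁻¹ = λ a → fromℕ< (m%n<n (m ∸ toℕ a) m)
  }

_×G_ : RawGroup 0ℓ 0ℓ → RawGroup 0ℓ 0ℓ → RawGroup 0ℓ 0ℓ
G ×G H = record
  { Carrier = G.Carrier × H.Carrier
  ; _≈_ = λ p q → G._≈_ (proj₁ p) (proj₁ q) × H._≈_ (proj₂ p) (proj₂ q)
  ; _∙_ = λ p q → G._∙_ (proj₁ p) (proj₁ q) , H._∙_ (proj₂ p) (proj₂ q)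
  ; ε = G.ε , H.ε
  ; _⁻¹ = λ p → G._⁻¹ (proj₁ p) , H._⁻¹ (proj₂ p)
  }
  where module G = RawGroup G
        module H = RawGroup H

infixr 6 _×G_

-- N ⋊_σ ℤ₂, where the generator of ℤ₂ = ({false,true}, xor) acts on N by σ
-- (σ is required elsewhere to be an automorphism of N with σ² = id)
SemiZ2 : (N : RawGroup 0ℓ 0ℓ) → (RawGroup.Carrier N → RawGroup.Carrier N) → RawGroup 0ℓ 0ℓ
SemiZ2 N σ = record
  { Carrier = N.Carrier × Bool
  ; _≈_ = λ p q → N._≈_ (proj₁ p) (proj₁ q) × proj₂ p ≡ proj₂ q
  ; _∙_ = λ p q → N._∙_ (proj₁ p) (act (proj₂ p) (proj₁ q)) , proj₂ p xor proj₂ q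
  ; ε = N.ε , false
  ; _⁻¹ = λ p → act (proj₂ p) (N._⁻¹ (proj₁ p)) , proj₂ p
  }
  where module N = RawGroup N
        act : Bool → N.Carrier → N.Carrier
        act false x = x
        act true  x = σ x

IsInvolAut : (N : RawGroup 0ℓ 0ℓ) → (RawGroup.Carrier N → RawGroup.Carrier N) → Set
IsInvolAut N σ = GroupMorphisms.IsGroupIsomorphism N N σ ×
                 (∀ x → RawGroup._≈_ N (σ (σ x)) x)

_≀S₂ : RawGroup 0ℓ 0ℓ → RawGroup 0ℓ 0ℓ
G ≀S₂ = SemiZ2 (G ×G G) (λ p → proj₂ p , proj₁ p)

𝔽₃ : Set
𝔽₃ = Fin 3

_+₃_ _*₃_ : 𝔽₃ → 𝔽₃ → 𝔽₃
a +₃ b = fromℕ< (m%n<n (toℕ a + toℕ b) 3)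
a *₃ b = fromℕ< (m%n<n (toℕ a * toℕ b) 3)

𝔽₃² : Set
𝔽₃² = 𝔽₃ × 𝔽₃

_⊕_ : 𝔽₃² → 𝔽₃² → 𝔽₃²
(a , b) ⊕ (c , d) = (a +₃ c) , (b +₃ d)

_⊙_ : 𝔽₃ → 𝔽₃² → 𝔽₃²
c ⊙ (a , b) = (c *₃ a) , (c *₃ b)

IsLinear : 𝔽₃² ↔ 𝔽₃² → Set
IsLinear f = (∀ x y → to (x ⊕ y) ≡ to x ⊕ to y) × (∀ c x → to (c ⊙ x) ≡ c ⊙ to x)
  where open Inverse f

private
  lin-closed : PermClosed 𝔽₃² IsLinear
  lin-closed = record
    { P-id  = (λ x y → refl) , (λ c x → refl)
    ; P-∘   = λ {f} {g} (af , sf) (ag , sg) →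
        (λ x y → trans (cong (Inverse.to f) (ag x y)) (af (Inverse.to g x) (Inverse.to g y))) ,
        (λ c x → trans (cong (Inverse.to f) (sg c x)) (sf c (Inverse.to g x)))
    ; P-inv = λ {f} (af , sf) → let open Inverse f in
        (λ x y → trans (cong from (sym (cong₂ _⊕_ (strictlyInverseˡ x) (strictlyInverseˡ y))))
                   (trans (cong from (sym (af (from x) (from y))))
                          (strictlyInverseʳ _))) ,
        (λ c x → trans (cong from (sym (cong (c ⊙_) (strictlyInverseˡ x))))
                   (trans (cong from (sym (sf c (from x))))
                          (strictlyInverseʳ _)))
    }

GL₂₃ : RawGroup 0ℓ 0ℓ
GL₂₃ = PermGroup 𝔽₃² IsLinear lin-closed

-- a letter is a generator together with an exponent sign (true = inverse)
Word : ℕ → Set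
Word g = List (Fin g × Bool)

invW : ∀ {g} → Word g → Word g
invW w = reverse (map (λ l → proj₁ l , not (proj₂ l)) w)

data Equiv {g : ℕ} (R : List (Word g × Word g)) : Word g → Word g → Set where
  e-refl   : ∀ {w} → Equiv R w w
  e-sym    : ∀ {w w′} → Equiv R w w′ → Equiv R w′ w
  e-trans  : ∀ {w₁ w₂ w₃} → Equiv R w₁ w₂ → Equiv R w₂ w₃ → Equiv R w₁ w₃
  e-cong   : ∀ {a a′ b b′} → Equiv R a a′ → Equiv R b b′ → Equiv R (a ++ b) (a′ ++ b′)
  e-cancel : ∀ x s → Equiv R ((x , s) ∷ (x , not s) ∷ []) []
  e-rel    : ∀ {l r} → (l , r) ∈ R → Equiv R l r

Presented : (g : ℕ) → List (Word g × Word g) → RawGroup 0ℓ 0ℓ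
Presented g R = record
  { Carrier = Word g
  ; _≈_ = Equiv R
  ; _∙_ = _++_
  ; ε = []
  ; _⁻¹ = invW
  }

gen gen⁻¹ : ∀ {g} → Fin g → Word g
gen x = (x , false) ∷ []
gen⁻¹ x = (x , true) ∷ []

_^w_ : ∀ {g} → Word g → ℕ → Word g
w ^w m = concat (replicate m w)

infixr 5 _·_
_·_ : ∀ {g} → Word g → Word g → Word g
_·_ = _++_

infix 4 _==_
_==_ : ∀ {g} → Word g → Word g → Word g × Word g
l == r = l , r

private
  g0 : ∀ {g} → Fin (suc g)
  g0 = Data.Fin.zero
  g1 : ∀ {g} → Fin (suc (suc g))
  g1 = Data.Fin.suc Data.Fin.zero
  g2 : ∀ {g} → Fin (suc (suc (suc g)))
  g2 = Data.Fin.suc (Data.Fin.suc Data.Fin.zero)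
  g3 : ∀ {g} → Fin (suc (suc (suc (suc g))))
  g3 = Data.Fin.suc (Data.Fin.suc (Data.Fin.suc Data.Fin.zero))

F : ℕ → RawGroup 0ℓ 0ℓ
F n = Presented 2
  ( (ρ ^w n == []) ∷ (δ ^w 2 == []) ∷ (δ · ρ · δ == gen⁻¹ g0) ∷ [])
  where ρ δ : Word 2
        ρ = gen g0
        δ = gen g1

H : ℕ → ℕ → RawGroup 0ℓ 0ℓ
H n k = Presented 2
  ( (ρ ^w n == []) ∷ (α ^w 4 == []) ∷ (α · ρ · gen⁻¹ g1 == ρ ^w k) ∷ [])
  where ρ α : Word 2
        ρ = gen g0
        α = gen g1

J : ℕ → ℕ → RawGroup 0ℓ 0ℓ
J n k = Presented 3
  ( (ρ ^w n == []) ∷ (δ ^w 2 == []) ∷ (α ^w 2 == [])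
  ∷ (δ · ρ · δ == gen⁻¹ g0) ∷ (α · ρ · α == ρ ^w k) ∷ (α · δ · α == δ) ∷ [])
  where ρ δ α : Word 3
        ρ = gen g0
        δ = gen g1
        α = gen g2

K : ℕ → ℕ → RawGroup 0ℓ 0ℓ
K n k = Presented 3
  ( (ρ ^w n == []) ∷ (δ ^w 2 == []) ∷ (β ^w 2 == [])
  ∷ (δ · ρ · δ == gen⁻¹ g0) ∷ (β · ρ · β == ρ) ∷ (β · δ · β == δ) ∷ [])
  where ρ δ β : Word 3
        ρ = gen g0
        δ = gen g1
        β = gen g2

L : ℕ → ℕ → RawGroup 0ℓ 0ℓ
L n k = Presented 4
  ( (ρ ^w n == []) ∷ (δ ^w 2 == []) ∷ (β ^w 2 == []) ∷ (λ′ ^w 4 == [])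
  ∷ (δ · ρ · δ == gen⁻¹ g0) ∷ (β · ρ · β == ρ) ∷ (β · δ · β == δ)
  ∷ (gen⁻¹ g3 · ρ · λ′ == ρ ^w (k * k + k ∸ 1))
  ∷ (gen⁻¹ g3 · δ · λ′ == δ)
  ∷ (gen⁻¹ g3 · β · λ′ == ρ ^w ⌊ n /2⌋ · β)
  ∷ (λ′ ^w 2 == ρ ^w ⌊ n /2⌋) ∷ [])
  where ρ δ β λ′ : Word 4
        ρ = gen g0
        δ = gen g1
        β = gen g2
        λ′ = gen g3

M : ℕ → ℕ → RawGroup 0ℓ 0ℓ
M n k = Presented 4
  ( (ρ ^w n == []) ∷ (δ ^w 2 == []) ∷ (β ^w 2 == []) ∷ (τ ^w 4 == [])
  ∷ (δ · ρ · δ == gen⁻¹ g0) ∷ (β · ρ · β == ρ) ∷ (β · δ · β == δ)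
  ∷ (gen⁻¹ g3 · ρ · τ == ρ ^w (⌊ n /2⌋ + k))
  ∷ (gen⁻¹ g3 · δ · τ == δ)
  ∷ (gen⁻¹ g3 · β · τ == ρ ^w ⌊ n /2⌋ · β)
  ∷ (τ ^w 2 == ρ ^w ⌊ n /2⌋ · δ) ∷ [])
  where ρ δ β τ : Word 4
        ρ = gen g0
        δ = gen g1
        β = gen g2
        τ = gen g3

N : ℕ → ℕ → RawGroup 0ℓ 0ℓ
N n k = Presented 4
  ( (ρ ^w n == []) ∷ (δ ^w 2 == []) ∷ (β ^w 2 == []) ∷ (θ ^w 2 == [])
  ∷ (δ · ρ · δ == gen⁻¹ g0) ∷ (β · ρ · β == ρ) ∷ (β · δ · β == δ)
  ∷ (θ · ρ · θ == ρ ^w (2 * k + 1))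
  ∷ (θ · δ · θ == δ)
  ∷ (θ · β · θ == ρ ^w ⌊ n /2⌋ · β) ∷ [])
  where ρ δ β θ : Word 4
        ρ = gen g0
        δ = gen g1
        β = gen g2
        θ = gen g3

-- Congruences k² ≡ ±1 (mod m), for k ≥ 1

_²≡1[mod_] : ℕ → ℕ → Set
k ²≡1[mod m ] = m ∣ (k * k ∸ 1)

_²≡-1[mod_] : ℕ → ℕ → Set
k ²≡-1[mod m ] = m ∣ (k * k + 1)

-- D(GP(n,k)), or GP(n,k) itself when the double cover splits into two copies of it, is a quotient of the graph with
-- vertices Bool × ℤ × ℤ, in which the two sides are stepped along the first and the second coordinate, by a lattice Λ
-- of translations. Outside finitely many (n , k), spokes and rim edges lie in different numbers of closed
-- non-backtracking walks of length 8. These numbers depend only on the short vectors of Λ, which for n > 64 are the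
-- multiples of a single one, because n divides their determinants; the smaller n are evaluated one by one. Hence
-- every automorphism preserves the spokes, and following it along the 8-cycles shows that it is affine with a signed
-- permutation matrix preserving Λ as linear part; the presentations describe these affine maps. The exceptional
-- graphs are given explicit models on which the group acts, and a search over s-arcs shows that there are no further
-- automorphisms.

module Submission where

-- A step along each rim, with the spokes between them, spans an 8-cycle in every one of these
-- graphs; a spoke lies on four such cycles and a rim edge on two. This makes 8 the natural length,
-- and only further relations in Λ can disturb the difference. Closed non-backtracking walks are
-- counted instead of cycles because they obey a recursion along darts in which Λ enters only
-- through the membership of finitely many displacements. The quotient ℤ²/Λ is cyclic unless n and k
-- are both even, and then it is ℤ/n × ℤ/2. The case distinctions of the theorem record which signed
-- permutation matrices preserve Λ: the exchange of the coordinates asks for k² = 1 and the quarter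
-- turn for k² = -1, modulo n or n/2, while a reflection of one coordinate survives only for n = 4k
-- with n and k even. Group orders are never compared. A presentation is shown to have no hidden
-- relations by bringing words into a normal form that acts trivially only when it is trivial; for
-- the exceptional graphs surjectivity comes from a chain of point stabilisers.

-- Faithful and full actions on graphs; two copies of a connected graph.

module Automorphisms where

  open import Defs
  open import Level using (0ℓ)
  open import Data.Nat using (ℕ)
  open import Data.Bool using (Bool; true; false; not; _xor_)
  open import Data.Bool.Properties using () renaming (_≟_ to _≟ᵇ_)
  open import Data.Product using (∃; _×_; _,_; proj₁; proj₂)
  open import Data.Sum using (_⊎_; inj₁; inj₂)
  open import Function.Base using (_∘_; id)
  open import Function.Bundles using (Inverse; mk↔ₛ′; mk⇔; Equivalence)
  open import Relation.Binary.PropositionalEquality using (_≡_; refl; sym; trans; cong; cong₂; subst₂)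
  open import Relation.Nullary using (¬_; yes; no; contradiction)
  open import Algebra.Bundles.Raw using (RawGroup)

  record Auto (V : Set) (_∼_ : V → V → Set) : Set where
    field
      to from  : V → V
      to-from  : ∀ x → to (from x) ≡ x
      from-to  : ∀ x → from (to x) ≡ x
      to-adj   : ∀ {x y} → x ∼ y → to x ∼ to y
      from-adj : ∀ {x y} → x ∼ y → from x ∼ from y

    to-injective : ∀ {x y} → to x ≡ to y → x ≡ y
    to-injective e = trans (sym (from-to _)) (trans (cong from e) (from-to _))

    to-adj⁻ : ∀ {x y} → to x ∼ to y → x ∼ y
    to-adj⁻ e = subst₂ _∼_ (from-to _) (from-to _) (from-adj e)

  open Auto

  module _ {V : Set} {_∼_ : V → V → Set} where

    idₐ : Auto V _∼_
    idₐ = record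
      { to = id ; from = id ; to-from = λ _ → refl ; from-to = λ _ → refl
      ; to-adj = id ; from-adj = id }

    infixr 9 _∘ₐ_
    _∘ₐ_ : Auto V _∼_ → Auto V _∼_ → Auto V _∼_
    f ∘ₐ g = record
      { to = to f ∘ to g ; from = from g ∘ from f
      ; to-from = λ x → trans (cong (to f) (to-from g _)) (to-from f x)
      ; from-to = λ x → trans (cong (from g) (from-to f _)) (from-to g x)
      ; to-adj = to-adj f ∘ to-adj g ; from-adj = from-adj g ∘ from-adj f }

    _⁻¹ₐ : Auto V _∼_ → Auto V _∼_
    f ⁻¹ₐ = record
      { to = from f ; from = to f ; to-from = from-to f ; from-to = to-from f
      ; to-adj = from-adj f ; from-adj = to-adj f }

  -- An isomorphism from H onto the automorphism group, unfolded into a faithful and full action, so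
  -- that it can be moved along graph isomorphisms and doubled before it is compared with `A`. The
  -- laws of the inverse are fields because H is only a raw group.
  record Represents (H : RawGroup 0ℓ 0ℓ) (V : Set) (_∼_ : V → V → Set) : Set where
    private module H = RawGroup H
    field
      act      : H.Carrier → V → V
      act-cong : ∀ {g h} → g H.≈ h → ∀ x → act g x ≡ act h x
      faithful : ∀ {g h} → (∀ x → act g x ≡ act h x) → g H.≈ h
      act-∙    : ∀ g h x → act (g H.∙ h) x ≡ act g (act h x)
      act-ε    : ∀ x → act H.ε x ≡ x
      act-⁻¹ˡ  : ∀ g x → act (g H.⁻¹) (act g x) ≡ x
      act-⁻¹ʳ  : ∀ g x → act g (act (g H.⁻¹) x) ≡ x
      act-adj  : ∀ g {x y} → x ∼ y → act g x ∼ act g y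
      full     : (f : Auto V _∼_) → ∃ λ g → ∀ x → act g x ≡ to f x

    auto : H.Carrier → Auto V _∼_
    auto g = record
      { to = act g ; from = act (g H.⁻¹) ; to-from = act-⁻¹ʳ g ; from-to = act-⁻¹ˡ g
      ; to-adj = act-adj g ; from-adj = act-adj (g H.⁻¹) }

  module _ {H : RawGroup 0ℓ 0ℓ} {n k : ℕ} (R : Represents H (DV n) (DAdj n k)) where
    private
      module H = RawGroup H
      module G = RawGroup (A n k)
    open Represents R

    -- The map sends an automorphism to the element that `full` provides. Every equation required in
    -- H follows by comparing actions, because `faithful` reflects equality.
    A≅ : A n k ≅ H
    A≅ = toH , record
      { isGroupMonomorphism = record
        { isGroupHomomorphism = record
          { isMonoidHomomorphism = record
            { isMagmaHomomorphism = record
              { isRelHomomorphism = record { cong = λ {f} {g} e → faithful λ x →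
                  trans (toH-act f x) (trans (e x) (sym (toH-act g x))) }
              ; homo = λ f g → faithful λ x →
                  trans (toH-act (f G.∙ g) x) (sym (trans (act-∙ (toH f) (toH g) x)
                    (trans (toH-act f _) (cong (Inverse.to (proj₁ f)) (toH-act g x))))) }
            ; ε-homo = faithful λ x → trans (toH-act G.ε x) (sym (act-ε x)) }
          ; ⁻¹-homo = λ f → faithful λ x → trans (toH-act (f G.⁻¹) x)
              (sym (trans (cong (act (toH f H.⁻¹)) (sym
                (trans (toH-act f _) (Inverse.strictlyInverseˡ (proj₁ f) x))))
                (act-⁻¹ˡ (toH f) _))) }
        ; injective = λ {f} {g} e x → trans (sym (toH-act f x)) (trans (act-cong e x) (toH-act g x)) }
      ; surjective = λ h → perm h , λ {z} e → faithful λ x → trans (toH-act z x) (e x) }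
      where
      toAuto : G.Carrier → Auto (DV n) (DAdj n k)
      toAuto (b , p) = record
        { to = Inverse.to b ; from = Inverse.from b
        ; to-from = Inverse.strictlyInverseˡ b ; from-to = Inverse.strictlyInverseʳ b
        ; to-adj = Equivalence.to (p _ _)
        ; from-adj = λ d → Equivalence.from (p _ _)
            (subst₂ (DAdj n k) (sym (Inverse.strictlyInverseˡ b _)) (sym (Inverse.strictlyInverseˡ b _)) d) }
      toH : G.Carrier → H.Carrier
      toH f = proj₁ (full (toAuto f))
      toH-act : ∀ f x → act (toH f) x ≡ Inverse.to (proj₁ f) x
      toH-act f = proj₂ (full (toAuto f))
      perm : H.Carrier → G.Carrier
      perm h = mk↔ₛ′ (act h) (act (h H.⁻¹)) (act-⁻¹ʳ h) (act-⁻¹ˡ h) ,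
        λ z y → mk⇔ (act-adj h) (to-adj⁻ (auto h))

  record GraphIso (V : Set) (_∼_ : V → V → Set) (W : Set) (_≈_ : W → W → Set) : Set where
    field
      f : V → W
      g : W → V
      fg : ∀ y → f (g y) ≡ y
      gf : ∀ x → g (f x) ≡ x
      f-adj : ∀ {x y} → x ∼ y → f x ≈ f y
      g-adj : ∀ {x y} → x ≈ y → g x ∼ g y

  transport : ∀ {H V _∼_ W _≈_} → GraphIso V _∼_ W _≈_ → Represents H V _∼_ → Represents H W _≈_
  transport {H} I R = record
    { act = λ h y → f (act h (g y))
    ; act-cong = λ e y → cong f (act-cong e (g y))
    ; faithful = λ e → faithful λ x → trans (cong (act _) (sym (gf x)))
        (trans (trans (sym (gf _)) (trans (cong g (e (f x))) (gf _))) (cong (act _) (gf x)))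
    ; act-∙ = λ a b y → cong f (trans (act-∙ a b (g y)) (cong (act a) (sym (gf _))))
    ; act-ε = λ y → trans (cong f (act-ε (g y))) (fg y)
    ; act-⁻¹ˡ = λ h y → trans (cong f (trans (cong (act _) (gf _)) (act-⁻¹ˡ h (g y)))) (fg y)
    ; act-⁻¹ʳ = λ h y → trans (cong f (trans (cong (act _) (gf _)) (act-⁻¹ʳ h (g y)))) (fg y)
    ; act-adj = λ h e → f-adj (act-adj h (g-adj e))
    ; full = λ α → let h , p = full (pull α) in
        h , λ y → trans (cong f (p (g y))) (trans (fg _) (cong (to α) (fg y)))
    }
    where
    open GraphIso I
    open Represents R
    pull : Auto _ _ → Auto _ _
    pull α = record
      { to = λ x → g (to α (f x)) ; from = λ x → g (from α (f x))
      ; to-from = λ x → trans (cong (g ∘ to α) (fg _)) (trans (cong g (to-from α _)) (gf x))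
      ; from-to = λ x → trans (cong (g ∘ from α) (fg _)) (trans (cong g (from-to α _)) (gf x))
      ; to-adj = λ e → g-adj (to-adj α (f-adj e))
      ; from-adj = λ e → g-adj (from-adj α (f-adj e)) }

  -- Edges may be traversed in both directions, since the relation is not assumed to be symmetric.
  data Path {V : Set} (_∼_ : V → V → Set) (x : V) : V → Set where
    here : Path _∼_ x x
    step : ∀ {y z} → Path _∼_ x y → (y ∼ z) ⊎ (z ∼ y) → Path _∼_ x z

  module _ {V : Set} (_∼_ : V → V → Set) where
    Twice : V × Bool → V × Bool → Set
    Twice (x , a) (y , b) = (x ∼ y) × a ≡ b

  module Wreath {H V} {_∼_ : V → V → Set} (R : Represents H V _∼_)
                (x₀ : V) (connected : ∀ x → Path _∼_ x₀ x) where
    private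
      module W = RawGroup (H ≀S₂)
      module H = RawGroup H
    open Represents R

    pick : H.Carrier × H.Carrier → Bool → H.Carrier
    pick (g , h) false = g
    pick (g , h) true  = h

    -- The point first changes copies if s says so and is then moved by the component belonging to
    -- the copy of arrival. This is the order that multiplication in `SemiZ2` with the exchange of
    -- factors prescribes.
    wact : W.Carrier → V × Bool → V × Bool
    wact (gh , s) (x , a) = act (pick gh (s xor a)) x , s xor a

    private
      -- Edges of the doubled graph stay within one copy, so the copy containing the image cannot
      -- change along a path from `x₀`.
      layer : (f : Auto (V × Bool) (Twice _∼_)) → ∀ a x → proj₂ (to f (x , a)) ≡ proj₂ (to f (x₀ , a))
      layer f a x = go (connected x)
        where
        go : ∀ {y} → Path _∼_ x₀ y → proj₂ (to f (y , a)) ≡ proj₂ (to f (x₀ , a))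
        go here = refl
        go (step p (inj₁ e)) = trans (sym (proj₂ (to-adj f (e , refl)))) (go p)
        go (step p (inj₂ e)) = trans (proj₂ (to-adj f (e , refl))) (go p)

      swaps : Auto (V × Bool) (Twice _∼_) → Bool
      swaps f = proj₂ (to f (x₀ , false))

      xor-not : ∀ a b → ¬ (a ≡ b) → a ≡ b xor true
      xor-not false false p = contradiction refl p
      xor-not false true  p = refl
      xor-not true  false p = refl
      xor-not true  true  p = contradiction refl p

      xor-id : ∀ a → a xor false ≡ a
      xor-id false = refl
      xor-id true  = refl

      xor-invol : ∀ a b → a xor (a xor b) ≡ b
      xor-invol false b = refl
      xor-invol true false = refl
      xor-invol true true = refl

      layer₀ : (f : Auto (V × Bool) (Twice _∼_)) → ∀ x a → proj₂ (to f (x , a)) ≡ swaps f xor a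
      layer₀ f x false = trans (layer f false x) (sym (xor-id _))
      layer₀ f x true with proj₂ (to f (x₀ , true)) ≟ᵇ swaps f
      ... | no  p = trans (layer f true x) (xor-not _ _ p)
      ... | yes p = contradiction (trans (sym same) (trans (cong proj₂ (to-from f _)) refl)) (back (swaps f))
        where
        -- If both layers went to one layer, nothing would reach the other.
        hits : ∀ z → proj₂ (to f z) ≡ swaps f
        hits (y , false) = layer f false y
        hits (y , true)  = trans (layer f true y) p
        same : proj₂ (to f (from f (x₀ , not (swaps f)))) ≡ swaps f
        same = hits _
        back : ∀ b → ¬ (b ≡ not b)
        back false ()
        back true ()

      -- The index b is the copy of arrival, in agreement with `wact`; the copy of departure is
      -- `swaps f xor b`.
      part : (f : Auto (V × Bool) (Twice _∼_)) → Bool → Auto V _∼_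
      part f b = record
        { to = λ x → proj₁ (to f (x , a))
        ; from = λ x → proj₁ (from f (x , b))
        ; to-from = λ x → trans (cong (λ z → proj₁ (to f z)) (fromlayer x)) (cong proj₁ (to-from f (x , b)))
        ; from-to = λ x → trans (cong (λ z → proj₁ (from f z)) (tolayer x)) (cong proj₁ (from-to f (x , a)))
        ; to-adj = λ e → proj₁ (to-adj f (e , refl))
        ; from-adj = λ e → proj₁ (from-adj f (e , refl)) }
        where
        a = swaps f xor b
        tolayer : ∀ x → (proj₁ (to f (x , a)) , b) ≡ to f (x , a)
        tolayer x = cong (proj₁ (to f (x , a)) ,_)
          (sym (trans (layer₀ f x a) (xor-invol (swaps f) b)))
        fromlayer : ∀ x → (proj₁ (from f (x , b)) , a) ≡ from f (x , b)
        fromlayer x = cong (proj₁ (from f (x , b)) ,_)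
          (trans (cong (swaps f xor_) (sym (trans (sym (layer₀ f _ _)) (cong proj₂ (to-from f (x , b))))))
                 (xor-invol (swaps f) _))

    wreath : Represents (H ≀S₂) (V × Bool) (Twice _∼_)
    wreath = record
      { act = wact
      ; act-cong = λ { {_ , s} ((p , q) , refl) (x , a) → cong (_, s xor a) (pcong p q (s xor a) x) }
      ; faithful = λ { {g , s} {h , t} e → wfaithful g h s t e }
      ; act-∙ = λ { (gh , s) (gh′ , t) (x , a) → y∙ gh gh′ s t x a }
      ; act-ε = λ { (x , false) → cong (_, false) (act-ε x) ; (x , true) → cong (_, true) (act-ε x) }
      ; act-⁻¹ˡ = λ { (gh , s) (x , a) → winv gh s x a }
      ; act-⁻¹ʳ = λ { (gh , s) (x , a) → winvʳ gh s x a }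
      ; act-adj = λ { (gh , s) {x , a} {y , a} (e , refl) → act-adj (pick gh (s xor a)) e , refl }
      ; full = λ f → ((proj₁ (full (part f false)) , proj₁ (full (part f true))) , swaps f) ,
          λ { (x , a) → wfull f (swaps f) refl x a }
      }
      where
      pcong : ∀ {g g′ h h′} → g H.≈ g′ → h H.≈ h′ → ∀ b x → act (pick (g , h) b) x ≡ act (pick (g′ , h′) b) x
      pcong p q false x = act-cong p x
      pcong p q true  x = act-cong q x
      wfaithful : ∀ g h s t → (∀ z → wact (g , s) z ≡ wact (h , t) z) → (g , s) W.≈ (h , t)
      wfaithful g h s t e with trans (sym (xor-id s)) (trans (cong proj₂ (e (x₀ , false))) (xor-id t))
      wfaithful g h false _ e | refl =
        (faithful (λ x → cong proj₁ (e (x , false))) , faithful (λ x → cong proj₁ (e (x , true)))) , refl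
      wfaithful g h true  _ e | refl =
        (faithful (λ x → cong proj₁ (e (x , true))) , faithful (λ x → cong proj₁ (e (x , false)))) , refl
      y∙ : ∀ gh gh′ s t x a → wact ((gh , s) W.∙ (gh′ , t)) (x , a) ≡ wact (gh , s) (wact (gh′ , t) (x , a))
      y∙ gh gh′ false false x false = cong (_, false) (act-∙ _ _ x)
      y∙ gh gh′ false false x true  = cong (_, true)  (act-∙ _ _ x)
      y∙ gh gh′ false true  x false = cong (_, true)  (act-∙ _ _ x)
      y∙ gh gh′ false true  x true  = cong (_, false) (act-∙ _ _ x)
      y∙ gh gh′ true  false x false = cong (_, true)  (act-∙ _ _ x)
      y∙ gh gh′ true  false x true  = cong (_, false) (act-∙ _ _ x)
      y∙ gh gh′ true  true  x false = cong (_, false) (act-∙ _ _ x)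
      y∙ gh gh′ true  true  x true  = cong (_, true)  (act-∙ _ _ x)
      winv : ∀ gh s x a → wact ((gh , s) W.⁻¹) (wact (gh , s) (x , a)) ≡ (x , a)
      winv gh false x false = cong (_, false) (act-⁻¹ˡ _ x)
      winv gh false x true  = cong (_, true)  (act-⁻¹ˡ _ x)
      winv gh true  x false = cong (_, false) (act-⁻¹ˡ _ x)
      winv gh true  x true  = cong (_, true)  (act-⁻¹ˡ _ x)
      winvʳ : ∀ gh s x a → wact (gh , s) (wact ((gh , s) W.⁻¹) (x , a)) ≡ (x , a)
      winvʳ gh false x false = cong (_, false) (act-⁻¹ʳ _ x)
      winvʳ gh false x true  = cong (_, true)  (act-⁻¹ʳ _ x)
      winvʳ gh true  x false = cong (_, false) (act-⁻¹ʳ _ x)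
      winvʳ gh true  x true  = cong (_, true)  (act-⁻¹ʳ _ x)
      wfull : ∀ f s → s ≡ swaps f → ∀ x a →
        wact ((proj₁ (full (part f false)) , proj₁ (full (part f true))) , s) (x , a) ≡ to f (x , a)
      wfull f s e x a = cong₂ _,_
        (trans (parts (s xor a)) (cong (λ b → proj₁ (to f (x , b)))
          (trans (cong (λ t → t xor (s xor a)) (sym e)) (xor-invol s a))))
        (trans (cong (_xor a) e) (sym (layer₀ f x a)))
        where
        parts : ∀ b → act (pick (proj₁ (full (part f false)) , proj₁ (full (part f true))) b) x
                      ≡ proj₁ (to f (x , swaps f xor b))
        parts false = proj₂ (full (part f false)) x
        parts true  = proj₂ (full (part f true)) x

-- Calculation with words modulo relations.

module Words where

  open import Defs
  open Automorphisms
  open import Level using (0ℓ)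
  open import Data.Nat using (ℕ; zero; suc; _+_; _*_; _∸_)
  import Data.Nat.Properties as ℕ
  open import Data.Fin using (Fin; zero; suc)
  open import Data.Bool using (Bool; true; false; not)
  open import Data.Bool.Properties using (not-involutive)
  open import Data.Product using (∃; _×_; _,_; proj₁; proj₂)
  open import Data.List using (List; []; _∷_; _++_; map)
  open import Data.List.Properties using (++-assoc; ++-identityʳ; unfold-reverse)
  open import Data.List.Relation.Unary.All using (All; []; _∷_; lookup)
  open import Relation.Binary.PropositionalEquality using (_≡_; refl; sym; trans; cong; module ≡-Reasoning)
  open import Relation.Binary.Bundles using (Setoid)
  import Relation.Binary.Reasoning.Setoid as SetoidReasoning
  open import Relation.Nullary using (¬_; contradiction)
  open Auto

  module _ {g : ℕ} where

    ^w-+ : ∀ (w : Word g) a b → w ^w (a + b) ≡ (w ^w a) · (w ^w b)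
    ^w-+ w zero b = refl
    ^w-+ w (suc a) b = trans (cong (w ·_) (^w-+ w a b)) (sym (++-assoc w (w ^w a) (w ^w b)))

    ^w-swap : ∀ (w : Word g) a b → (w ^w a) · (w ^w b) ≡ (w ^w b) · (w ^w a)
    ^w-swap w a b = trans (sym (^w-+ w a b)) (trans (cong (w ^w_) (ℕ.+-comm a b)) (^w-+ w b a))

  module _ {g : ℕ} {R : List (Word g × Word g)} where

    private
      infix 4 _≈_
      _≈_ : Word g → Word g → Set
      _≈_ = Equiv R

    wordSetoid : Setoid 0ℓ 0ℓ
    wordSetoid = record { Carrier = Word g ; _≈_ = Equiv R
      ; isEquivalence = record { refl = e-refl ; sym = e-sym ; trans = e-trans } }

    open SetoidReasoning wordSetoid

    ≡⇒≈ : ∀ {a b} → a ≡ b → a ≈ b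
    ≡⇒≈ refl = e-refl

    ·-congˡ : ∀ a {b c} → b ≈ c → a · b ≈ a · c
    ·-congˡ a = e-cong (e-refl {w = a})

    ·-congʳ : ∀ a {b c} → b ≈ c → b · a ≈ c · a
    ·-congʳ a e = e-cong e (e-refl {w = a})

    prefix : ∀ a b c d w → a · b ≈ c · d → a · b · w ≈ c · d · w
    prefix a b c d w e = begin
      a · b · w   ≡⟨ ++-assoc a b w ⟨
      (a · b) · w ≈⟨ ·-congʳ w e ⟩
      (c · d) · w ≡⟨ ++-assoc c d w ⟩
      c · d · w   ∎

    prefix₁ : ∀ a b {c} w → a · b ≈ c → a · b · w ≈ c · w
    prefix₁ a b {c} w e = begin
      a · b · w   ≡⟨ ++-assoc a b w ⟨
      (a · b) · w ≈⟨ ·-congʳ w e ⟩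
      c · w ∎

    invW-cancelʳ : ∀ w → w · invW w ≈ []
    invW-cancelʳ [] = e-refl
    invW-cancelʳ ((x , s) ∷ w) = begin
      (x , s) ∷ (w · invW ((x , s) ∷ w))
        ≡⟨ cong (λ z → (x , s) ∷ (w · z)) (unfold-reverse (x , not s) (map (λ l → proj₁ l , not (proj₂ l)) w)) ⟩
      (x , s) ∷ (w · invW w · ((x , not s) ∷ []))
        ≈⟨ ·-congˡ ((x , s) ∷ []) (prefix₁ w (invW w) _ (invW-cancelʳ w)) ⟩
      (x , s) ∷ (x , not s) ∷ []
        ≈⟨ e-cancel x s ⟩
      [] ∎

    invW-cancelˡ : ∀ w → invW w · w ≈ []
    invW-cancelˡ [] = e-refl
    invW-cancelˡ ((x , s) ∷ w) = begin
      invW ((x , s) ∷ w) · ((x , s) ∷ w)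
        ≡⟨ cong (_· ((x , s) ∷ w)) (unfold-reverse (x , not s) (map (λ l → proj₁ l , not (proj₂ l)) w)) ⟩
      (invW w · ((x , not s) ∷ [])) · ((x , s) ∷ w)
        ≡⟨ ++-assoc (invW w) _ _ ⟩
      invW w · ((x , not s) ∷ (x , s) ∷ w)
        ≡⟨ cong (λ t → invW w · ((x , not s) ∷ (x , t) ∷ w)) (sym (not-involutive s)) ⟩
      invW w · ((x , not s) ∷ (x , not (not s)) ∷ w)
        ≈⟨ ·-congˡ (invW w) (·-congʳ w (e-cancel x (not s))) ⟩
      invW w · w ≈⟨ invW-cancelˡ w ⟩
      [] ∎

    ^w-order : ∀ {w : Word g} {N} → w ^w N ≈ [] → ∀ c → w ^w (c * N) ≈ []
    ^w-order e zero = e-refl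
    ^w-order {w} {N} e (suc c) = e-trans (≡⇒≈ (^w-+ w N (c * N))) (e-cong e (^w-order e c))

    pow-past : ∀ x r m → x · r ≈ (r ^w m) · x → ∀ i → x · (r ^w i) ≈ (r ^w (m * i)) · x
    pow-past x r m e zero = ≡⇒≈ (trans (++-identityʳ x) (cong (λ j → (r ^w j) · x) (sym (ℕ.*-zeroʳ m))))
    pow-past x r m e (suc i) = begin
      x · r · (r ^w i)            ≈⟨ prefix x r (r ^w m) x (r ^w i) e ⟩
      (r ^w m) · x · (r ^w i)     ≈⟨ ·-congˡ (r ^w m) (pow-past x r m e i) ⟩
      (r ^w m) · (r ^w (m * i)) · x ≡⟨ ++-assoc (r ^w m) _ x ⟨
      ((r ^w m) · (r ^w (m * i))) · x ≡⟨ cong (_· x) (^w-+ r m (m * i)) ⟨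
      (r ^w (m + m * i)) · x      ≡⟨ cong (λ j → (r ^w j) · x) (ℕ.*-suc m i) ⟨
      (r ^w (m * suc i)) · x      ∎

    -- A generator of finite order has a positive word as its inverse, so closure under inverse
    -- letters reduces to closure under the letters themselves.
    gen⁻¹-pow : ∀ x n → ¬ (n ≡ 0) → gen x ^w n ≈ [] → gen⁻¹ x ≈ gen x ^w (n ∸ 1)
    gen⁻¹-pow x zero n≢0 e = contradiction refl n≢0
    gen⁻¹-pow x (suc n) _ e = begin
      gen⁻¹ x                          ≈⟨ ·-congˡ (gen⁻¹ x) (e-sym e) ⟩
      gen⁻¹ x · gen x · (gen x ^w n)   ≈⟨ ·-congʳ (gen x ^w n) (e-cancel x true) ⟩
      gen x ^w n                       ∎

    involution-past : ∀ x y {z} → x · x ≈ [] → x · y · x ≈ z → x · y ≈ z · x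
    involution-past x y {z} xx e = begin
      x · y               ≡⟨ cong (x ·_) (++-identityʳ y) ⟨
      x · y · []          ≈⟨ ·-congˡ x (·-congˡ y (e-sym xx)) ⟩
      x · y · x · x       ≡⟨ cong (x ·_) (++-assoc y x x) ⟨
      x · (y · x) · x     ≡⟨ ++-assoc x (y · x) x ⟨
      (x · y · x) · x     ≈⟨ ·-congʳ x e ⟩
      z · x               ∎

    conj-past : ∀ x y {z} → gen⁻¹ x · y · gen x ≈ z → y · gen x ≈ gen x · z
    conj-past x y {z} e = begin
      y · gen x                         ≈⟨ ·-congʳ (y · gen x) (e-sym (e-cancel x false)) ⟩
      gen x · gen⁻¹ x · y · gen x       ≈⟨ ·-congˡ (gen x) e ⟩
      gen x · z                         ∎

    conj⁻¹-past : ∀ x y {z} → gen x · y · gen⁻¹ x ≈ z → gen x · y ≈ z · gen x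
    conj⁻¹-past x y {z} e = begin
      gen x · y                          ≡⟨ cong (gen x ·_) (++-identityʳ y) ⟨
      gen x · y · []                     ≈⟨ ·-congˡ (gen x) (·-congˡ y (e-sym (e-cancel x true))) ⟩
      gen x · y · gen⁻¹ x · gen x        ≡⟨ cong (gen x ·_) (++-assoc y (gen⁻¹ x) (gen x)) ⟨
      gen x · (y · gen⁻¹ x) · gen x      ≈⟨ ·-congʳ (gen x) e ⟩
      z · gen x                          ∎

    -- The groups L and M prescribe x⁻¹ y x, whereas normal forms move x to the right and so need x
    -- y x⁻¹. Writing x as x⁻¹ s with s = x² turns the second conjugate into the first one, of y
    -- conjugated by s.
    square-past : ∀ x y {y′ z s} → gen x · gen x ≈ s → s · y ≈ y′ · s →
                  gen⁻¹ x · y′ · gen x ≈ z → gen x · y ≈ z · gen x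
    square-past x y {y′} {z} {s} xx sy e = begin
      gen x · y                            ≈⟨ ·-congʳ (gen x · y) (e-sym (e-cancel x true)) ⟩
      gen⁻¹ x · gen x · gen x · y          ≈⟨ ·-congˡ (gen⁻¹ x) (·-congʳ y xx) ⟩
      gen⁻¹ x · s · y                      ≈⟨ ·-congˡ (gen⁻¹ x) sy ⟩
      gen⁻¹ x · y′ · s                     ≈⟨ ·-congˡ (gen⁻¹ x) (·-congˡ y′ (e-sym xx)) ⟩
      gen⁻¹ x · y′ · gen x · gen x         ≡⟨ cong (gen⁻¹ x ·_) (++-assoc y′ (gen x) (gen x)) ⟨
      gen⁻¹ x · (y′ · gen x) · gen x       ≈⟨ ·-congʳ (gen x) e ⟩
      z · gen x                            ∎

    -- A normal form is a power of the generator r followed by a representative indexed by T.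
    -- `Closed x` says that left multiplication by x preserves the existence of a normal form; once
    -- this is known for all letters, it holds for all words by induction.
    module Normal (r : Fin g) {T : Set} (rep : T → Word g) where

      private
        ρ : Word g
        ρ = gen r

      NF : Word g → Set
      NF w = ∃ λ i → ∃ λ t → w ≈ (ρ ^w i) · rep t

      Closed : Word g → Set
      Closed x = ∀ {w} → NF w → NF (x · w)

      NF-≈ : ∀ {a b} → a ≈ b → NF b → NF a
      NF-≈ e (i , t , p) = i , t , e-trans e p

      NF-rep : ∀ t → NF (rep t)
      NF-rep t = 0 , t , e-refl

      closed-≈ : ∀ {x y} → x ≈ y → Closed y → Closed x
      closed-≈ e cl {w} p = NF-≈ (·-congʳ w e) (cl p)

      closed-[] : Closed []
      closed-[] p = p

      closed-· : ∀ x {y} → Closed x → Closed y → Closed (x · y)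
      closed-· x {y} cx cy {w} p = NF-≈ (≡⇒≈ (++-assoc x y w)) (cx (cy p))

      closed-^ : ∀ x i → Closed x → Closed (x ^w i)
      closed-^ x zero    cl = closed-[]
      closed-^ x (suc i) cl = closed-· x cl (closed-^ x i cl)

      closed-ρ : Closed ρ
      closed-ρ (i , t , p) = suc i , t , ·-congˡ ρ p

      -- As soon as x passes powers of ρ at the price of a new exponent, only the products of x with
      -- the representatives are left to treat.
      closed : ∀ x m → x · ρ ≈ (ρ ^w m) · x → (∀ t → NF (x · rep t)) → Closed x
      closed x m e base {w} (i , t , p) = NF-≈ (begin
        x · w                             ≈⟨ ·-congˡ x p ⟩
        x · (ρ ^w i) · rep t              ≈⟨ prefix x (ρ ^w i) (ρ ^w (m * i)) x (rep t) (pow-past x ρ m e i) ⟩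
        (ρ ^w (m * i)) · x · rep t        ∎)
        (closed-^ ρ (m * i) closed-ρ (base t))

      closed⁻¹ : ∀ x n → ¬ (n ≡ 0) → gen x ^w n ≈ [] → Closed (gen x) → Closed (gen⁻¹ x)
      closed⁻¹ x n n≢0 e cl = closed-≈ (gen⁻¹-pow x n n≢0 e) (closed-^ (gen x) (n ∸ 1) cl)

      closed-all : NF [] → (∀ x → Closed (gen x) × Closed (gen⁻¹ x)) → ∀ w → NF w
      closed-all z cl [] = z
      closed-all z cl ((x , false) ∷ w) = proj₁ (cl x) (closed-all z cl w)
      closed-all z cl ((x , true) ∷ w)  = proj₂ (cl x) (closed-all z cl w)

  _^ᵇ_ : ∀ {g} → Word g → Bool → Word g
  w ^ᵇ false = []
  w ^ᵇ true  = w

  module WordAction {g : ℕ} (R : List (Word g × Word g)) {V : Set} {_∼_ : V → V → Set}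
                    (γ : Fin g → Auto V _∼_) where

    letter : Fin g × Bool → Auto V _∼_
    letter (x , false) = γ x
    letter (x , true)  = γ x ⁻¹ₐ

    word : Word g → Auto V _∼_
    word []      = idₐ
    word (l ∷ w) = letter l ∘ₐ word w

    word-++ : ∀ a b z → to (word (a ++ b)) z ≡ to (word a) (to (word b) z)
    word-++ [] b z = refl
    word-++ (l ∷ a) b z = cong (to (letter l)) (word-++ a b z)

    Valid : Word g × Word g → Set
    Valid (l , r) = ∀ z → to (word l) z ≡ to (word r) z

    module Sound (valid : All Valid R) where

      word-cong : ∀ {a b} → Equiv R a b → ∀ z → to (word a) z ≡ to (word b) z
      word-cong e-refl z = refl
      word-cong (e-sym e) z = sym (word-cong e z)
      word-cong (e-trans e f) z = trans (word-cong e z) (word-cong f z)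
      word-cong (e-cong {a} {a′} {b} {b′} e f) z = begin
        to (word (a ++ b)) z          ≡⟨ word-++ a b z ⟩
        to (word a) (to (word b) z)   ≡⟨ word-cong e _ ⟩
        to (word a′) (to (word b) z)  ≡⟨ cong (to (word a′)) (word-cong f z) ⟩
        to (word a′) (to (word b′) z) ≡⟨ word-++ a′ b′ z ⟨
        to (word (a′ ++ b′)) z        ∎
        where open ≡-Reasoning
      word-cong (e-cancel x false) z = to-from (γ x) z
      word-cong (e-cancel x true) z = from-to (γ x) z
      word-cong (e-rel m) z = lookup valid m z

      word-invˡ : ∀ w z → to (word (invW w)) (to (word w) z) ≡ z
      word-invˡ w z = trans (sym (word-++ (invW w) w z)) (word-cong (invW-cancelˡ w) z)

      word-invʳ : ∀ w z → to (word w) (to (word (invW w)) z) ≡ z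
      word-invʳ w z = trans (sym (word-++ w (invW w) z)) (word-cong (invW-cancelʳ w) z)

      -- Two words with the same action have a quotient acting trivially, so a trivial kernel
      -- already yields faithfulness.
      presented : (∀ w → (∀ z → to (word w) z ≡ z) → Equiv R w []) →
                  ((f : Auto V _∼_) → ∃ λ w → ∀ z → to (word w) z ≡ to f z) →
                  Represents (Presented g R) V _∼_
      presented kernel onto = record
        { act = λ w → to (word w)
        ; act-cong = word-cong
        ; faithful = λ {a} {b} e → begin
            a                   ≡⟨ ++-identityʳ a ⟨
            a · []              ≈⟨ ·-congˡ a (e-sym (invW-cancelˡ b)) ⟩
            a · invW b · b      ≈⟨ prefix₁ a (invW b) b (kernel (a · invW b) λ z →
              trans (word-++ a (invW b) z) (trans (e _) (word-invʳ b z))) ⟩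
            b                   ∎
        ; act-∙ = word-++
        ; act-ε = λ _ → refl
        ; act-⁻¹ˡ = word-invˡ
        ; act-⁻¹ʳ = word-invʳ
        ; act-adj = λ w → to-adj (word w)
        ; full = onto
        }
        where open SetoidReasoning wordSetoid

-- Normal forms in the groups F, H, J, K, L, M and N.

module NormalForms where

  open import Defs
  open Automorphisms
  open Words
  open import Algebra.Bundles.Raw using (RawGroup)
  open import Data.Nat using (ℕ; zero; suc; _+_; _*_; _∸_; ⌊_/2⌋)
  import Data.Nat.Properties as ℕ
  open import Data.Fin using (Fin; zero; suc)
  open import Data.Bool using (Bool; true; false)
  open import Data.Product using (∃; _×_; _,_)
  open import Data.List using (List; [])
  open import Data.List.Properties using (++-assoc; ++-identityʳ)
  open import Data.List.Relation.Unary.Any using (here; there)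
  open import Relation.Binary.PropositionalEquality using (_≡_; refl; sym; cong)
  import Relation.Binary.Reasoning.Setoid as SetoidReasoning
  open import Relation.Nullary using (¬_)

  pattern #0 = zero
  pattern #1 = suc zero
  pattern #2 = suc (suc zero)
  pattern #3 = suc (suc (suc zero))

  pattern 1st p = here p
  pattern 2nd p = there (here p)
  pattern 3rd p = there (there (here p))
  pattern 4th p = there (there (there (here p)))
  pattern 5th p = there (there (there (there (here p))))
  pattern 6th p = there (there (there (there (there (here p)))))
  pattern 7th p = there (there (there (there (there (there (here p))))))
  pattern 8th p = there (there (there (there (there (there (there (here p)))))))
  pattern 9th p = there (there (there (there (there (there (there (there (here p))))))))
  pattern 10th p = there (there (there (there (there (there (there (there (there (here p)))))))))
  pattern 11th p = there (there (there (there (there (there (there (there (there (there (here p))))))))))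

  module _ {g : ℕ} {R : List (Word (suc g) × Word (suc g))} where

    private
      infix 4 _≈_
      _≈_ : Word (suc g) → Word (suc g) → Set
      _≈_ = Equiv R
      ρ : Word (suc g)
      ρ = gen #0

    open SetoidReasoning (wordSetoid {R = R})

    reflection-past : ∀ {n} → ¬ (n ≡ 0) → (d : Fin (suc g)) → ρ ^w n ≈ [] → gen d ^w 2 ≈ [] →
                      gen d · ρ · gen d ≈ gen⁻¹ #0 → gen d · ρ ≈ (ρ ^w (n ∸ 1)) · gen d
    reflection-past {n} n≢0 d ρⁿ δ² e = e-trans (involution-past (gen d) ρ δ² e)
      (·-congʳ (gen d) (gen⁻¹-pow #0 n n≢0 ρⁿ))

  rep₄ : Bool × Bool × Bool → Word 4
  rep₄ (d , b , l) = (gen #1 ^ᵇ d) · (gen #2 ^ᵇ b) · (gen #3 ^ᵇ l)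

  -- Words ρⁱ δᵈ βᵇ λˡ, where δ inverts ρ, β centralises ⟨ρ, δ⟩ and λ normalises ⟨ρ, δ, β⟩.
  module Tower {R : List (Word 4 × Word 4)} where

    private
      infix 4 _≈_
      _≈_ : Word 4 → Word 4 → Set
      _≈_ = Equiv R
      ρ δ β ƛ : Word 4
      ρ = gen #0
      δ = gen #1
      β = gen #2
      ƛ = gen #3

    open Normal {R = R} #0 rep₄
    open SetoidReasoning (wordSetoid {R = R})

    -- The common shape of L, M and N. They differ in the exponents m and h that arise when ƛ passes
    -- ρ and β, in the order o of ƛ, and in the square of ƛ, which is ρᶜ, followed by δ if d holds.
    tower : ∀ {n h m c d} → ¬ (n ≡ 0) → ∀ {o} → ¬ (o ≡ 0) →
            ρ ^w n ≈ [] → δ ^w 2 ≈ [] → β ^w 2 ≈ [] → ƛ ^w o ≈ [] →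
            δ · ρ · δ ≈ gen⁻¹ #0 → β · ρ · β ≈ ρ → β · δ · β ≈ δ →
            ƛ · ρ ≈ (ρ ^w m) · ƛ → ƛ · δ ≈ δ · ƛ → ƛ · β ≈ ((ρ ^w h) · β) · ƛ →
            ƛ · ƛ ≈ (ρ ^w c) · (δ ^ᵇ d) →
            ∀ w → NF w
    tower {n} {h} {m} {c} {d} n≢0 {o} o≢0 ρⁿ δ² β² ƛᵒ δρδ βρβ βδβ ƛρ ƛδ ƛβ ƛƛ =
      closed-all (NF-rep (false , false , false)) λ where
        #0 → closed-ρ , closed⁻¹ #0 n n≢0 ρⁿ closed-ρ
        #1 → cδ , closed⁻¹ #1 2 (λ ()) δ² cδ
        #2 → cβ , closed⁻¹ #2 2 (λ ()) β² cβ
        #3 → cƛ , closed⁻¹ #3 o o≢0 ƛᵒ cƛ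
      where
      cδ : Closed δ
      cδ = closed δ (n ∸ 1) (reflection-past n≢0 #1 ρⁿ δ² δρδ) λ where
        (false , b , l) → NF-rep (true , b , l)
        (true  , b , l) → NF-≈ (·-congʳ ((β ^ᵇ b) · (ƛ ^ᵇ l)) δ²) (NF-rep (false , b , l))
      cβ : Closed β
      cβ = closed β 1 (involution-past β ρ β² βρβ) λ where
          (false , b , l) → base b l
          (true  , b , l) → NF-≈ (·-congʳ ((β ^ᵇ b) · (ƛ ^ᵇ l)) (involution-past β δ β² βδβ)) (cδ (base b l))
        where
        base : ∀ b l → NF (β · (β ^ᵇ b) · (ƛ ^ᵇ l))
        base false l = NF-rep (false , true , l)
        base true  l = NF-≈ (·-congʳ (ƛ ^ᵇ l) β²) (NF-rep (false , false , l))
      cρδ : ∀ d → NF ((ρ ^w c) · (δ ^ᵇ d))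
      cρδ false = closed-^ ρ c closed-ρ (NF-rep (false , false , false))
      cρδ true  = closed-^ ρ c closed-ρ (NF-rep (true , false , false))
      cƛ : Closed ƛ
      cƛ = closed ƛ m ƛρ λ where
          (false , b , l) → base b l
          (true  , b , l) → NF-≈ (·-congʳ ((β ^ᵇ b) · (ƛ ^ᵇ l)) ƛδ) (cδ (base b l))
        where
        base₀ : ∀ l → NF (ƛ · (ƛ ^ᵇ l))
        base₀ false = NF-rep (false , false , true)
        base₀ true  = NF-≈ ƛƛ (cρδ d)
        base : ∀ b l → NF (ƛ · (β ^ᵇ b) · (ƛ ^ᵇ l))
        base false l = base₀ l
        base true  l = NF-≈ (begin
          ƛ · β · (ƛ ^ᵇ l)                   ≈⟨ ·-congʳ (ƛ ^ᵇ l) ƛβ ⟩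
          (((ρ ^w h) · β) · ƛ) · (ƛ ^ᵇ l)    ≡⟨ ++-assoc ((ρ ^w h) · β) ƛ (ƛ ^ᵇ l) ⟩
          ((ρ ^w h) · β) · ƛ · (ƛ ^ᵇ l)      ∎)
          (closed-· (ρ ^w h) (closed-^ ρ h closed-ρ) cβ (base₀ l))

  rep₂ : Bool → Word 2
  rep₂ d = gen #1 ^ᵇ d

  -- The square of α in H plays the role of δ.
  repᴴ : Bool × Bool → Word 2
  repᴴ (d , a) = ((gen #1 · gen #1) ^ᵇ d) · (gen #1 ^ᵇ a)

  rep₃ : Bool × Bool → Word 3
  rep₃ (d , a) = (gen #1 ^ᵇ d) · (gen #2 ^ᵇ a)

  module _ {n : ℕ} (n≢0 : ¬ (n ≡ 0)) where

    normal-F : ∀ w → ∃ λ i → ∃ λ t → RawGroup._≈_ (F n) w ((gen #0 ^w i) · rep₂ t)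
    normal-F = closed-all (NF-rep false) λ where
        #0 → closed-ρ , closed⁻¹ #0 n n≢0 (e-rel (1st refl)) closed-ρ
        #1 → cδ , closed⁻¹ #1 2 (λ ()) δ² cδ
      where
      open Normal #0 rep₂
      δ² = e-rel (2nd refl)
      cδ : Closed (gen #1)
      cδ = closed (gen #1) (n ∸ 1) (reflection-past n≢0 #1 (e-rel (1st refl)) δ² (e-rel (3rd refl))) λ where
        false → NF-rep true
        true  → NF-≈ δ² (NF-rep false)

    normal-H : ∀ k w → ∃ λ i → ∃ λ t → RawGroup._≈_ (H n k) w ((gen #0 ^w i) · repᴴ t)
    normal-H k = closed-all (NF-rep (false , false)) λ where
        #0 → closed-ρ , closed⁻¹ #0 n n≢0 (e-rel (1st refl)) closed-ρ
        #1 → cα , closed⁻¹ #1 4 (λ ()) α⁴ cα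
      where
      open Normal #0 repᴴ
      α⁴ = e-rel (2nd refl)
      cα : Closed (gen #1)
      cα = closed (gen #1) k (conj⁻¹-past #1 (gen #0) (e-rel (3rd refl))) λ where
        (false , false) → NF-rep (false , true)
        (false , true)  → NF-rep (true , false)
        (true  , false) → NF-rep (true , true)
        (true  , true)  → NF-≈ α⁴ (NF-rep (false , false))

    module _ {R : List (Word 3 × Word 3)} (m : ℕ) where
      private
        infix 4 _≈_
        _≈_ : Word 3 → Word 3 → Set
        _≈_ = Equiv R
        ρ δ α : Word 3
        ρ = gen #0
        δ = gen #1
        α = gen #2
      open Normal {R = R} #0 rep₃

      normal-3 : ρ ^w n ≈ [] → δ ^w 2 ≈ [] → α ^w 2 ≈ [] → δ · ρ · δ ≈ gen⁻¹ #0 →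
                 α · ρ · α ≈ ρ ^w m → α · δ · α ≈ δ → ∀ w → NF w
      normal-3 ρⁿ δ² α² δρδ αρα αδα = closed-all (NF-rep (false , false)) λ where
          #0 → closed-ρ , closed⁻¹ #0 n n≢0 ρⁿ closed-ρ
          #1 → cδ , closed⁻¹ #1 2 (λ ()) δ² cδ
          #2 → cα , closed⁻¹ #2 2 (λ ()) α² cα
        where
        cδ : Closed δ
        cδ = closed δ (n ∸ 1) (reflection-past n≢0 #1 ρⁿ δ² δρδ) λ where
          (false , a) → NF-rep (true , a)
          (true  , a) → NF-≈ (·-congʳ (α ^ᵇ a) δ²) (NF-rep (false , a))
        cα : Closed α
        cα = closed α m (involution-past α ρ α² αρα) λ where
            (false , a) → base a
            (true  , a) → NF-≈ (·-congʳ (α ^ᵇ a) (involution-past α δ α² αδα)) (cδ (base a))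
          where
          base : ∀ a → NF (α · (α ^ᵇ a))
          base false = NF-rep (false , true)
          base true  = NF-≈ α² (NF-rep (false , false))

    normal-J : ∀ k w → ∃ λ i → ∃ λ t → RawGroup._≈_ (J n k) w ((gen #0 ^w i) · rep₃ t)
    normal-J k = normal-3 k (e-rel (1st refl)) (e-rel (2nd refl)) (e-rel (3rd refl))
      (e-rel (4th refl)) (e-rel (5th refl)) (e-rel (6th refl))

    normal-K : ∀ k w → ∃ λ i → ∃ λ t → RawGroup._≈_ (K n k) w ((gen #0 ^w i) · rep₃ t)
    normal-K k = normal-3 1 (e-rel (1st refl)) (e-rel (2nd refl)) (e-rel (3rd refl))
      (e-rel (4th refl)) (e-rel (5th refl)) (e-rel (6th refl))

    normal-N : ∀ k w → ∃ λ i → ∃ λ t → RawGroup._≈_ (N n k) w ((gen #0 ^w i) · rep₄ t)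
    normal-N k = Tower.tower {h = ⌊ n /2⌋} {m = 2 * k + 1} {c = 0} {d = false} n≢0 {2} (λ ())
      (e-rel (1st refl)) (e-rel (2nd refl)) (e-rel (3rd refl)) θ² (e-rel (5th refl)) (e-rel (6th refl)) (e-rel (7th refl))
      (involution-past (gen #3) (gen #0) θ² (e-rel (8th refl)))
      (involution-past (gen #3) (gen #1) θ² (e-rel (9th refl)))
      (involution-past (gen #3) (gen #2) θ² (e-rel (10th refl)))
      θ²
      where θ² = e-rel (4th refl)

    normal-L : ∀ k w → ∃ λ i → ∃ λ t → RawGroup._≈_ (L n k) w ((gen #0 ^w i) · rep₄ t)
    -- Here λ² is a power of ρ and commutes with ρ and β, so conjugating either of them by λ or by
    -- its inverse gives the same result.
    normal-L k = Tower.tower {h = h} {m = k * k + k ∸ 1} {c = h} {d = false} n≢0 {4} (λ ())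
      (e-rel (1st refl)) (e-rel (2nd refl)) β² (e-rel (4th refl)) (e-rel (5th refl)) βρβ (e-rel (7th refl))
      (square-past #3 (gen #0) λ² (≡⇒≈ (ρ-comm 1)) (e-rel (8th refl)))
      (e-sym (conj-past #3 (gen #1) (e-rel (9th refl))))
      (square-past #3 (gen #2) λ² (e-sym βρʰ) (e-rel (10th refl)))
      (e-trans λ² (≡⇒≈ (sym (++-identityʳ _))))
      where
      h = ⌊ n /2⌋
      λ² = e-rel (11th refl)
      β² = e-rel (3rd refl)
      βρβ = e-rel (6th refl)
      ρ-comm : ∀ j → (gen #0 ^w h) · (gen {4} #0 ^w j) ≡ (gen #0 ^w j) · (gen #0 ^w h)
      ρ-comm = ^w-swap (gen #0) h
      βρʰ : RawGroup._≈_ (L n k) (gen #2 · (gen #0 ^w h)) ((gen #0 ^w h) · gen #2)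
      βρʰ = e-trans (pow-past (gen #2) (gen #0) 1 (involution-past (gen #2) (gen #0) β² βρβ) h)
        (≡⇒≈ (cong (λ j → (gen #0 ^w j) · gen #2) (ℕ.*-identityˡ h)))

    normal-M : ∀ k w → ∃ λ i → ∃ λ t → RawGroup._≈_ (M n k) w ((gen #0 ^w i) · rep₄ t)
    -- Here τ² = ρʰδ inverts ρ, so conjugation by τ sends ρ to the inverse of the power prescribed
    -- for conjugation by τ⁻¹; the exponent -(h + k) is written as (h + k)(n - 1).
    normal-M k = Tower.tower {h = h} {m = m * (n ∸ 1)} {c = h} {d = true} n≢0 {4} (λ ())
      (e-rel (1st refl)) δ² β² (e-rel (4th refl)) (e-rel (5th refl)) βρβ βδβ
      (square-past #3 ρ τ² τ²ρ τρτ)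
      (e-sym (conj-past #3 δ (e-rel (9th refl))))
      (square-past #3 β {y′ = β} {s = (ρ ^w h) · δ} τ² (e-sym βτ²) (e-rel {r = (ρ ^w h) · β} (10th refl)))
      τ²
      where
      open SetoidReasoning (wordSetoid {R = _})
      h = ⌊ n /2⌋
      m = h + k
      ρ δ β τ : Word 4
      ρ = gen #0
      δ = gen #1
      β = gen #2
      τ = gen #3
      infix 4 _≈_
      _≈_ : Word 4 → Word 4 → Set
      _≈_ = RawGroup._≈_ (M n k)
      δ² : δ · δ ≈ []
      δ² = e-rel (2nd refl)
      τ² : τ · τ ≈ (ρ ^w h) · δ
      τ² = e-rel (11th refl)
      β² : β · β ≈ []
      β² = e-rel (3rd refl)
      βρβ : β · ρ · β ≈ ρ
      βρβ = e-rel (6th refl)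
      βδβ : β · δ · β ≈ δ
      βδβ = e-rel (7th refl)
      δρ : δ · ρ ≈ (ρ ^w (n ∸ 1)) · δ
      δρ = reflection-past n≢0 #1 (e-rel (1st refl)) δ² (e-rel (5th refl))
      τ²ρ : ((ρ ^w h) · δ) · ρ ≈ (ρ ^w (n ∸ 1)) · (ρ ^w h) · δ
      τ²ρ = begin
        ((ρ ^w h) · δ) · ρ                ≡⟨ ++-assoc (ρ ^w h) δ ρ ⟩
        (ρ ^w h) · δ · ρ                  ≈⟨ ·-congˡ (ρ ^w h) δρ ⟩
        (ρ ^w h) · (ρ ^w (n ∸ 1)) · δ     ≈⟨ prefix (ρ ^w h) _ (ρ ^w (n ∸ 1)) (ρ ^w h) δ (≡⇒≈ (^w-swap ρ h (n ∸ 1))) ⟩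
        (ρ ^w (n ∸ 1)) · (ρ ^w h) · δ     ∎
      ρτ : ∀ i → (ρ ^w i) · τ ≈ τ · (ρ ^w (m * i))
      ρτ zero = ≡⇒≈ (cong (λ j → τ · (ρ ^w j)) (sym (ℕ.*-zeroʳ m)))
      ρτ (suc i) = begin
        ρ · (ρ ^w i) · τ                  ≈⟨ ·-congˡ ρ (ρτ i) ⟩
        ρ · τ · (ρ ^w (m * i))            ≈⟨ prefix ρ τ τ (ρ ^w m) (ρ ^w (m * i)) (conj-past #3 ρ (e-rel (8th refl))) ⟩
        τ · (ρ ^w m) · (ρ ^w (m * i))     ≡⟨ cong (τ ·_) (^w-+ ρ m (m * i)) ⟨
        τ · (ρ ^w (m + m * i))            ≡⟨ cong (λ j → τ · (ρ ^w j)) (ℕ.*-suc m i) ⟨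
        τ · (ρ ^w (m * suc i))            ∎
      τρτ : gen⁻¹ #3 · (ρ ^w (n ∸ 1)) · τ ≈ ρ ^w (m * (n ∸ 1))
      τρτ = begin
        gen⁻¹ #3 · (ρ ^w (n ∸ 1)) · τ           ≈⟨ ·-congˡ (gen⁻¹ #3) (ρτ (n ∸ 1)) ⟩
        gen⁻¹ #3 · τ · (ρ ^w (m * (n ∸ 1)))     ≈⟨ ·-congʳ _ (e-cancel #3 true) ⟩
        ρ ^w (m * (n ∸ 1))                      ∎
      βτ² : β · (ρ ^w h) · δ ≈ ((ρ ^w h) · δ) · β
      βτ² = begin
        β · (ρ ^w h) · δ        ≈⟨ prefix β (ρ ^w h) (ρ ^w (1 * h)) β δ (pow-past β ρ 1 (involution-past β ρ β² βρβ) h) ⟩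
        (ρ ^w (1 * h)) · β · δ  ≡⟨ cong (λ j → (ρ ^w j) · β · δ) (ℕ.*-identityˡ h) ⟩
        (ρ ^w h) · β · δ        ≈⟨ ·-congˡ (ρ ^w h) (involution-past β δ β² βδβ) ⟩
        (ρ ^w h) · δ · β        ≡⟨ ++-assoc (ρ ^w h) δ β ⟨
        ((ρ ^w h) · δ) · β      ∎

-- The lattice of relations, residues and parities.

module Lattice where

  open import Defs
  open Automorphisms
  open import Data.Nat as ℕ using (ℕ; zero; suc; NonZero; z≤n; s≤s)
  import Data.Nat.Properties as ℕ
  import Data.Nat.Divisibility as ℕᵈ
  open import Data.Integer using (ℤ; +_; 0ℤ; 1ℤ; -1ℤ; _+_; _-_; _*_; -_; ∣_∣) renaming (_%ℕ_ to _mod_; _/ℕ_ to _div_)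
  import Data.Integer.Properties as ℤ
  open import Data.Integer.DivMod using (n%ℕd<d; a≡a%ℕn+[a/ℕn]*n)
  open import Data.Integer.Divisibility.Signed using (_∣_; divides; ∣⇒∣ᵤ; ∣m∣n⇒∣m+n; ∣n⇒∣m*n; _∣?_)
  open import Data.Integer.Tactic.RingSolver using (solve-∀)
  open import Data.Fin using (Fin; zero; suc; toℕ; fromℕ<)
  open import Data.Fin.Properties using (toℕ-fromℕ<; toℕ<n; toℕ-injective)
  open import Data.Bool using (Bool; true; false; not)
  open import Data.Product using (∃; _×_; _,_)
  open import Data.Sum using (inj₁; inj₂)
  open import Relation.Binary.PropositionalEquality using (_≡_; refl; sym; trans; cong; subst; module ≡-Reasoning)
  open import Relation.Nullary using (¬_; Dec; contradiction; _×-dec_)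
  open import Relation.Nullary.Decidable using (map′)

  data Slot : Set where
    fwd bwd spk : Slot

  P : Set
  P = Bool × ℤ × ℤ

  slide : ℤ → P → P
  slide e (false , p , q) = false , p + e , q
  slide e (true  , p , q) = true , p , q + e

  nb : Slot → P → P
  nb spk (t , p , q) = not t , p , q
  nb fwd a = slide 1ℤ a
  nb bwd a = slide -1ℤ a

  -- A divisibility is certified by two coefficients, and what remains is an identity for the ring
  -- solver. With a single premise, the second coefficient is 0.
  combine : ∀ {m x y z} a b → m ∣ x → m ∣ y → z ≡ a * x + b * y → m ∣ z
  combine a b x y refl = ∣m∣n⇒∣m+n (∣n⇒∣m*n a x) (∣n⇒∣m*n b y)

  ∣0 : ∀ {m} → m ∣ 0ℤ
  ∣0 = divides 0ℤ refl

  -- With a = (1 , 1) and b = (k , 1) in ℤ/n × ℤ/2, the relations p a + q b = 0.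
  record Λ (n k : ℕ) (p q : ℤ) : Set where
    constructor _&_
    field
      n∣ : + n ∣ p + q * + k
      2∣ : + 2 ∣ p + q
  open Λ

  module _ {n k : ℕ} where

    Λ? : ∀ p q → Dec (Λ n k p q)
    Λ? p q = map′ (λ (d , e) → d & e) (λ (d & e) → d , e) ((+ n ∣? p + q * + k) ×-dec (+ 2 ∣? p + q))

    Λ-comb : ∀ {p q p′ q′ x y} a b → Λ n k p q → Λ n k p′ q′ →
             x ≡ a * p + b * p′ → y ≡ a * q + b * q′ → Λ n k x y
    Λ-comb {p} {q} {p′} {q′} a b (d & e) (d′ & e′) refl refl =
      combine a b d d′ (i a b p q p′ q′ (+ k)) & combine a b e e′ (j a b p q p′ q′)
      where
      i : ∀ a b p q p′ q′ k → a * p + b * p′ + (a * q + b * q′) * k ≡ a * (p + q * k) + b * (p′ + q′ * k)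
      i = solve-∀
      j : ∀ a b p q p′ q′ → a * p + b * p′ + (a * q + b * q′) ≡ a * (p + q) + b * (p′ + q′)
      j = solve-∀

    Λ-0 : Λ n k 0ℤ 0ℤ
    Λ-0 = ∣0 & ∣0

  -- A graph presented as the quotient by Λ of the graph on P given by nb.
  record Cover (n k : ℕ) (V : Set) (_∼_ : V → V → Set) : Set where
    field
      pt     : P → V
      onto   : ∀ x → ∃ λ a → pt a ≡ x
      pt-≡   : ∀ {t p q p′ q′} → Λ n k (p - p′) (q - q′) → pt (t , p , q) ≡ pt (t , p′ , q′)
      pt-inj : ∀ {t p q t′ p′ q′} → pt (t , p , q) ≡ pt (t′ , p′ , q′) → t ≡ t′ × Λ n k (p - p′) (q - q′)
      nb-adj : ∀ s a → pt a ∼ pt (nb s a)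
      adj-nb : ∀ {a x} → pt a ∼ x → ∃ λ s → x ≡ pt (nb s a)

  module _ (m : ℕ) .{{_ : NonZero m}} where

    res : ℤ → Fin m
    res z = fromℕ< (n%ℕd<d z m)

    res-rem : ∀ z → + m ∣ z - + toℕ (res z)
    res-rem z = divides (z div m) (begin
      z - + toℕ (res z)                              ≡⟨ cong (λ r → z - + r) (toℕ-fromℕ< (n%ℕd<d z m)) ⟩
      z - + (z mod m)                                ≡⟨ cong (_- + (z mod m)) (a≡a%ℕn+[a/ℕn]*n z m) ⟩
      + (z mod m) + (z div m) * + m - + (z mod m)    ≡⟨ i (+ (z mod m)) _ ⟩
      (z div m) * + m                                ∎)
      where
      open ≡-Reasoning
      i : ∀ a b → a + b - a ≡ b
      i = solve-∀

    small-multiple₀ : ∀ {x} → m ℕᵈ.∣ x → x ℕ.< m → x ≡ 0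
    small-multiple₀ {zero} _ _ = refl
    small-multiple₀ {suc x} m∣x x<m = contradiction m∣x (ℕᵈ.>⇒∤ x<m)

    private
      ordered : ∀ {i j x} → i ℕ.≤ j → j ℕ.< m → x ≡ j ℕ.∸ i → m ℕᵈ.∣ x → i ≡ j
      ordered {i} {j} i≤j j<m refl d =
        ℕ.≤-antisym i≤j (ℕ.m∸n≡0⇒m≤n (small-multiple₀ d (ℕ.≤-<-trans (ℕ.m∸n≤m j i) j<m)))

    small-multiple : ∀ {i j} → i ℕ.< m → j ℕ.< m → + m ∣ + i - + j → i ≡ j
    small-multiple {i} {j} i<m j<m d with ℕ.≤-total i j
    ... | inj₁ i≤j = ordered i≤j j<m (trans (cong ∣_∣ (ℤ.m-n≡m⊖n i j)) (ℤ.∣⊖∣-≤ i≤j)) (∣⇒∣ᵤ d)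
    ... | inj₂ j≤i = sym (ordered j≤i i<m
      (trans (cong ∣_∣ (ℤ.m-n≡m⊖n i j)) (trans (ℤ.∣m⊖n∣≡∣n⊖m∣ i j) (ℤ.∣⊖∣-≤ j≤i))) (∣⇒∣ᵤ d))

    res-≡ : ∀ y z → + m ∣ y - z → res y ≡ res z
    res-≡ y z d = toℕ-injective (small-multiple (toℕ<n (res y)) (toℕ<n (res z))
      (combine 1ℤ 1ℤ (combine 1ℤ -1ℤ d (res-rem y) refl) (res-rem z)
        (i y z (+ toℕ (res y)) (+ toℕ (res z)))))
      where
      i : ∀ y z r s → r - s ≡ 1ℤ * (1ℤ * (y - z) + -1ℤ * (y - r)) + 1ℤ * (z - s)
      i = solve-∀

    res-inj : ∀ y z → res y ≡ res z → + m ∣ y - z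
    res-inj y z e = combine 1ℤ -1ℤ (res-rem y) (subst (λ r → + m ∣ z - + toℕ r) (sym e) (res-rem z))
      (i y z (+ toℕ (res y)))
      where
      i : ∀ y z r → y - z ≡ 1ℤ * (y - r) + -1ℤ * (z - r)
      i = solve-∀

    res-toℕ : ∀ i → res (+ toℕ i) ≡ i
    res-toℕ i = toℕ-injective (small-multiple (toℕ<n _) (toℕ<n i)
      (combine -1ℤ 0ℤ (res-rem (+ toℕ i)) (∣0 {+ m}) (j (+ toℕ i) (+ toℕ (res (+ toℕ i))))))
      where
      j : ∀ y r → r - y ≡ -1ℤ * (y - r) + 0ℤ * 0ℤ
      j = solve-∀

  shift-res : ∀ m .{{_ : NonZero m}} j z → shift {m} j (res m z) ≡ res m (z + + j)
  shift-res m@(suc _) j z = res-≡ m (+ (toℕ (res m z) ℕ.+ j)) (z + + j)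
    (combine -1ℤ 0ℤ (res-rem m z) (∣0 {+ m})
      (trans (cong (_- (z + + j)) (ℤ.pos-+ (toℕ (res m z)) j)) (i z (+ toℕ (res m z)) (+ j))))
    where
    i : ∀ z r j → r + j - (z + j) ≡ -1ℤ * (z - r) + 0ℤ * 0ℤ
    i = solve-∀

  odd? : ℤ → Bool
  odd? z with res 2 z
  ... | zero  = false
  ... | suc _ = true

  odd?-≡ : ∀ {y z} → + 2 ∣ y - z → odd? y ≡ odd? z
  odd?-≡ {y} {z} d with res 2 y | res 2 z | res-≡ 2 y z d
  ... | _ | _ | refl = refl

  odd?-inj : ∀ {y z} → odd? y ≡ odd? z → + 2 ∣ y - z
  odd?-inj {y} {z} e = res-inj 2 y z (go (res 2 y) (res 2 z) refl refl e)
    where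
    go : ∀ a b → res 2 y ≡ a → res 2 z ≡ b → odd? y ≡ odd? z → res 2 y ≡ res 2 z
    go a b p q e with res 2 y | res 2 z
    go _ _ _ _ _  | zero | zero = refl
    go _ _ _ _ _  | suc zero | suc zero = refl
    go _ _ _ _ () | zero | suc zero
    go _ _ _ _ () | suc zero | zero

  odd?-pred : ∀ z → odd? (z + -1ℤ) ≡ odd? (z + 1ℤ)
  odd?-pred z = odd?-≡ {z + -1ℤ} {z + 1ℤ} (divides -1ℤ (i z))
    where
    i : ∀ z → z + -1ℤ - (z + 1ℤ) ≡ -1ℤ * + 2
    i = solve-∀

  2∤1 : ∀ z → ¬ (+ 2 ∣ z + 1ℤ - z)
  2∤1 z d = contradiction (∣⇒∣ᵤ (subst (+ 2 ∣_) (i z) d)) (ℕᵈ.>⇒∤ (s≤s (s≤s z≤n)))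
    where
    i : ∀ z → z + 1ℤ - z ≡ 1ℤ
    i = solve-∀

  odd?-suc : ∀ z → odd? (z + 1ℤ) ≡ not (odd? z)
  odd?-suc z with odd? z in p | odd? (z + 1ℤ) in q
  ... | false | true  = refl
  ... | true  | false = refl
  ... | false | false = contradiction (odd?-inj {z + 1ℤ} {z} (trans q (sym p))) (2∤1 z)
  ... | true  | true  = contradiction (odd?-inj {z + 1ℤ} {z} (trans q (sym p))) (2∤1 z)

-- D(GP(n,k)) and GP(n,k) as quotients of the plane graph; splitting of bipartite double covers.

module Covers where

  open import Defs
  open Automorphisms
  import Data.Nat.Properties as ℕ
  import Data.Nat.Divisibility as ℕᵈ
  import Data.Integer.Properties as ℤ
  open import Data.Nat as ℕ using (ℕ; zero; suc; NonZero)
  open import Data.Integer using (ℤ; +_; -[1+_]; 0ℤ; 1ℤ; -1ℤ; _+_; _-_; _*_; -_; ∣_∣)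
  open import Data.Integer.Divisibility.Signed using (_∣_; divides; ∣⇒∣ᵤ; ∣n⇒∣m*n)
  open import Data.Integer.Tactic.RingSolver using (solve-∀)
  open import Data.Fin using (Fin; zero; suc; toℕ)
  open import Data.Bool using (Bool; true; false; not; _xor_)
  open import Data.Product using (∃; _×_; _,_; proj₁; proj₂)
  open import Data.Sum using (_⊎_; inj₁; inj₂)
  open import Relation.Binary.PropositionalEquality using (_≡_; _≢_; refl; sym; trans; cong; cong₂; subst; module ≡-Reasoning)
  open import Relation.Nullary using (¬_; yes; no; contradiction)
  open Lattice
  open import Data.Bool.Properties using (not-involutive; not-¬; ¬-not) renaming (_≟_ to _≟ᵇ_)
  open Auto

  ℤ-induction : (Q : ℤ → Set) → Q 0ℤ → (∀ z → Q z → Q (z + 1ℤ)) → (∀ z → Q z → Q (z + -1ℤ)) → ∀ z → Q z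
  ℤ-induction Q q0 up down (+ zero)  = q0
  ℤ-induction Q q0 up down (+ suc m) = subst Q (cong +_ (ℕ.+-comm m 1)) (up (+ m) (ℤ-induction Q q0 up down (+ m)))
  ℤ-induction Q q0 up down -[1+ zero ]  = down 0ℤ q0
  ℤ-induction Q q0 up down -[1+ suc m ] =
    subst Q (cong (λ z → -[1+ suc z ]) (ℕ.+-identityʳ m)) (down -[1+ m ] (ℤ-induction Q q0 up down -[1+ m ]))

  even-or-odd : ∀ n → (+ 2 ∣ + n) ⊎ (+ 2 ∣ + n - 1ℤ)
  even-or-odd zero = inj₁ ∣0
  even-or-odd (suc n) with even-or-odd n
  ... | inj₁ d = inj₂ (subst (+ 2 ∣_) (trans (i (+ n)) (cong (_- 1ℤ) (cong +_ (ℕ.+-comm n 1)))) d)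
    where
    i : ∀ n → n ≡ n + 1ℤ - 1ℤ
    i = solve-∀
  ... | inj₂ d = inj₁ (combine 1ℤ 1ℤ d (divides 1ℤ refl) (trans (cong +_ (ℕ.+-comm 1 n)) (i (+ n))))
    where
    i : ∀ n → n + 1ℤ ≡ 1ℤ * (n - 1ℤ) + 1ℤ * + 2
    i = solve-∀

  odd-ℤ : ∀ {n} → ¬ (2 ℕᵈ.∣ n) → + 2 ∣ + n - 1ℤ
  odd-ℤ {n} p with even-or-odd n
  ... | inj₁ d = contradiction (∣⇒∣ᵤ d) p
  ... | inj₂ d = d

  -- The ℤ₂-coordinate of the double cover, lifted to the plane: every step changes it.
  col : P → Bool
  col (s , p , q) = s xor odd? (p + q)

  not-xor : ∀ a b → not a xor b ≡ not (a xor b)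
  not-xor false b = refl
  not-xor true  b = sym (not-involutive b)

  xor-not : ∀ a b → a xor not b ≡ not (a xor b)
  xor-not false b = refl
  xor-not true  b = refl

  xor-cancel : ∀ a b → a xor (a xor b) ≡ b
  xor-cancel false b = refl
  xor-cancel true  b = not-involutive b

  col-nb : ∀ s a → col (nb s a) ≡ not (col a)
  col-nb spk (s , p , q) = not-xor s _
  col-nb fwd (false , p , q) = trans (cong odd? (i p q)) (odd?-suc (p + q))
    where
    i : ∀ p q → p + 1ℤ + q ≡ p + q + 1ℤ
    i = solve-∀
  col-nb fwd (true , p , q) = cong not (trans (cong odd? (i p q)) (odd?-suc (p + q)))
    where
    i : ∀ p q → p + (q + 1ℤ) ≡ p + q + 1ℤ
    i = solve-∀
  col-nb bwd (false , p , q) = trans (cong odd? (i p q)) (trans (odd?-pred (p + q)) (odd?-suc (p + q)))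
    where
    i : ∀ p q → p + -1ℤ + q ≡ p + q + -1ℤ
    i = solve-∀
  col-nb bwd (true , p , q) = cong not (trans (cong odd? (i p q)) (trans (odd?-pred (p + q)) (odd?-suc (p + q))))
    where
    i : ∀ p q → p + (q + -1ℤ) ≡ p + q + -1ℤ
    i = solve-∀

  module _ {V : Set} {_∼_ : V → V → Set} {n k : ℕ} (C : Cover n k V _∼_) where
    open Cover C

    private
      origin : V
      origin = pt (false , 0ℤ , 0ℤ)

      inner-path : ∀ q → Path _∼_ origin (pt (true , 0ℤ , q))
      inner-path = ℤ-induction _ (step here (inj₁ (nb-adj spk _)))
        (λ q r → step r (inj₁ (nb-adj fwd _))) (λ q r → step r (inj₁ (nb-adj bwd _)))

      outer-path : ∀ q p → Path _∼_ origin (pt (false , p , q))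
      outer-path q = ℤ-induction _ (step (inner-path q) (inj₁ (nb-adj spk _)))
        (λ q r → step r (inj₁ (nb-adj fwd _))) (λ q r → step r (inj₁ (nb-adj bwd _)))

    connected : ∀ x → Path _∼_ origin x
    connected x with onto x
    ... | (false , p , q) , refl = outer-path q p
    ... | (true  , p , q) , refl = step (outer-path q p) (inj₁ (nb-adj spk _))

  module GeneralizedPetersen (n k : ℕ) .{{_ : NonZero n}} where

    -- The coordinates p and q count steps of size 1 and of size k in the subscript, whichever side
    -- the point is on.
    gp : P → GPV n
    gp (false , p , q) = u (res n (p + q * + k))
    gp (true  , p , q) = v (res n (p + q * + k))

    private
      r : ℤ → Fin n
      r = res n

      out+ : ∀ p q k → p + q * k + 1ℤ ≡ p + 1ℤ + q * k
      out+ = solve-∀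
      out- : ∀ p q k → p + -1ℤ + q * k + 1ℤ ≡ p + q * k
      out- = solve-∀
      in+ : ∀ p q k → p + q * k + k ≡ p + (q + 1ℤ) * k
      in+ = solve-∀
      in- : ∀ p q k → p + (q + -1ℤ) * k + k ≡ p + q * k
      in- = solve-∀

      shifted : ∀ j y {z} → y + + j ≡ z → shift j (r y) ≡ r z
      shifted j y e = trans (shift-res n j y) (cong r e)

      unshifted : ∀ j i y {z} → shift j i ≡ r z → y + + j ≡ z → i ≡ r y
      unshifted j i y {z} e refl = trans (sym (res-toℕ n i)) (res-≡ n (+ toℕ i) y (subst (+ n ∣_) (eq (+ toℕ i) (+ j) y)
        (res-inj n (+ toℕ i + + j) z (trans (sym (shift-res n j (+ toℕ i))) (trans (cong (shift j) (res-toℕ n i)) e)))))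
        where
        eq : ∀ i j y → i + j - (y + j) ≡ i - y
        eq = solve-∀

      to-u : ∀ {x y j} → GPEdge n k x y → y ≡ u j → ∃ λ i → x ≡ u i × shift 1 i ≡ j
      to-u (outer i) refl = i , refl , refl
      to-v : ∀ {x y j} → GPEdge n k x y → y ≡ v j → x ≡ u j ⊎ ∃ λ i → x ≡ v i × shift k i ≡ j
      to-v (spoke i) refl = inj₁ refl
      to-v (inner i) refl = inj₂ (i , refl , refl)

    gp-adj : ∀ s a → GPAdj n k (gp a) (gp (nb s a))
    gp-adj spk (false , p , q) = inj₁ (spoke _)
    gp-adj spk (true  , p , q) = inj₂ (spoke _)
    gp-adj fwd (false , p , q) = inj₁ (subst (λ i → GPEdge n k (gp (false , p , q)) (u i)) (shifted 1 (p + q * + k) (out+ p q (+ k))) (outer _))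
    gp-adj bwd (false , p , q) = inj₂ (subst (λ i → GPEdge n k (gp (nb bwd (false , p , q))) (u i)) (shifted 1 (p + -1ℤ + q * + k) (out- p q (+ k))) (outer _))
    gp-adj fwd (true  , p , q) = inj₁ (subst (λ i → GPEdge n k (gp (true , p , q)) (v i)) (shifted k (p + q * + k) (in+ p q (+ k))) (inner _))
    gp-adj bwd (true  , p , q) = inj₂ (subst (λ i → GPEdge n k (gp (nb bwd (true , p , q))) (v i)) (shifted k (p + (q + -1ℤ) * + k) (in- p q (+ k))) (inner _))

    gp-nb : ∀ a {x} → GPAdj n k (gp a) x → ∃ λ s → x ≡ gp (nb s a)
    gp-nb (false , p , q) (inj₁ (outer _)) = fwd , cong u (shifted 1 (p + q * + k) (out+ p q (+ k)))
    gp-nb (false , p , q) (inj₁ (spoke _)) = spk , refl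
    gp-nb (false , p , q) (inj₂ e) with to-u e refl
    ... | i , refl , s = bwd , cong u (unshifted 1 i (p + -1ℤ + q * + k) s (out- p q (+ k)))
    gp-nb (true , p , q) (inj₁ (inner _)) = fwd , cong v (shifted k (p + q * + k) (in+ p q (+ k)))
    gp-nb (true , p , q) (inj₂ e) with to-v e refl
    ... | inj₁ refl = spk , refl
    ... | inj₂ (i , refl , s) = bwd , cong v (unshifted k i (p + (q + -1ℤ) * + k) s (in- p q (+ k)))

    private
      diff : ∀ p q p′ q′ k → (p + q * k) - (p′ + q′ * k) ≡ (p - p′) + (q - q′) * k
      diff = solve-∀
      diff₂ : ∀ p q p′ q′ → (p + q) - (p′ + q′) ≡ (p - p′) + (q - q′)
      diff₂ = solve-∀

    gp-≡ : ∀ {t p q p′ q′} → + n ∣ (p - p′) + (q - q′) * + k → gp (t , p , q) ≡ gp (t , p′ , q′)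
    gp-≡ {false} {p} {q} {p′} {q′} d = cong u (res-≡ n (p + q * + k) (p′ + q′ * + k) (subst (+ n ∣_) (sym (diff p q p′ q′ (+ k))) d))
    gp-≡ {true}  {p} {q} {p′} {q′} d = cong v (res-≡ n (p + q * + k) (p′ + q′ * + k) (subst (+ n ∣_) (sym (diff p q p′ q′ (+ k))) d))

    gp-inj : ∀ {t p q t′ p′ q′} → gp (t , p , q) ≡ gp (t′ , p′ , q′) → t ≡ t′ × + n ∣ (p - p′) + (q - q′) * + k
    gp-inj {false} {p} {q} {false} {p′} {q′} e =
      refl , subst (+ n ∣_) (diff p q p′ q′ (+ k)) (res-inj n (p + q * + k) (p′ + q′ * + k) (u-inj e))
      where
      u-inj : ∀ {i j : Fin n} → u i ≡ u j → i ≡ j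
      u-inj refl = refl
    gp-inj {true}  {p} {q} {true}  {p′} {q′} e =
      refl , subst (+ n ∣_) (diff p q p′ q′ (+ k)) (res-inj n (p + q * + k) (p′ + q′ * + k) (v-inj e))
      where
      v-inj : ∀ {i j : Fin n} → v i ≡ v j → i ≡ j
      v-inj refl = refl
    gp-inj {false} {t′ = true} ()
    gp-inj {true} {t′ = false} ()

    gp-onto : ∀ x → ∃ λ a → gp a ≡ x
    gp-onto (u i) = (false , + toℕ i , 0ℤ) , cong u (trans (cong r (ℤ.+-identityʳ (+ toℕ i))) (res-toℕ n i))
    gp-onto (v i) = (true  , + toℕ i , 0ℤ) , cong v (trans (cong r (ℤ.+-identityʳ (+ toℕ i))) (res-toℕ n i))

    col-≡ : ∀ {t p q p′ q′} → + 2 ∣ (p - p′) + (q - q′) → col (t , p , q) ≡ col (t , p′ , q′)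
    col-≡ {t} {p} {q} {p′} {q′} d = cong (t xor_) (odd?-≡ {p + q} {p′ + q′} (subst (+ 2 ∣_) (sym (diff₂ p q p′ q′)) d))

    col-inj : ∀ {t p q p′ q′} → col (t , p , q) ≡ col (t , p′ , q′) → + 2 ∣ (p - p′) + (q - q′)
    col-inj {t} {p} {q} {p′} {q′} e = subst (+ 2 ∣_) (diff₂ p q p′ q′) (odd?-inj {p + q} {p′ + q′}
      (trans (sym (xor-cancel t _)) (trans (cong (t xor_) e) (xor-cancel t _))))

    -- The extra hypothesis says that (1 , 1) and (k , 1) generate ℤ/n × ℤ/2.
    double-cover : ∀ c d → + n ∣ c + d * + k → + 2 ∣ c + d - 1ℤ → Cover n k (DV n) (DAdj n k)
    double-cover c d n∣ 2∣ = record
      { pt     = λ a → gp a , col a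
      ; onto   = onto′
      ; pt-≡   = λ { {t} {p} {q} {p′} {q′} (d & e) → cong₂ _,_ (gp-≡ {t} {p} {q} {p′} {q′} d) (col-≡ {t} {p} {q} {p′} {q′} e) }
      ; pt-inj = inj
      ; nb-adj = λ s a → gp-adj s a , λ e → not-¬ (sym e) (col-nb s a)
      ; adj-nb = λ { {a} (e , ne) → let s , p = gp-nb a e in
          s , cong₂ _,_ p (trans (¬-not (λ e → ne (sym e))) (sym (col-nb s a))) }
      }
      where
      inj : ∀ {t p q t′ p′ q′} → (gp (t , p , q) , col (t , p , q)) ≡ (gp (t′ , p′ , q′) , col (t′ , p′ , q′)) →
            t ≡ t′ × Λ n k (p - p′) (q - q′)
      inj {t} {p} {q} {t′} {p′} {q′} e with gp-inj {t} {p} {q} {t′} {p′} {q′} (cong proj₁ e)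
      ... | refl , d = refl , d & col-inj {t} {p} {q} {p′} {q′} (cong proj₂ e)
      fix : ∀ {a b c : Bool} → a ≢ b → c ≡ not a → c ≡ b
      fix {false} {false} p _ = contradiction refl p
      fix {false} {true}  p e = e
      fix {true}  {false} p e = e
      fix {true}  {true}  p _ = contradiction refl p
      e₁ : ∀ p q c d → p + c + (q + d) - (p + q + 1ℤ) ≡ c + d - 1ℤ
      e₁ = solve-∀
      e₂ : ∀ p q c d k → c + d * k ≡ p + c - p + (q + d - q) * k
      e₂ = solve-∀
      onto′ : ∀ x → ∃ λ a → (gp a , col a) ≡ x
      onto′ (x , b) with gp-onto x
      ... | (t , p , q) , refl with col (t , p , q) ≟ᵇ b
      ...   | yes refl = (t , p , q) , refl
      -- Adding (c , d) keeps the vertex of GP(n,k) and reverses the colour.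
      ...   | no  ne   = (t , p + c , q + d) , cong₂ _,_
          (gp-≡ {t} {p + c} {q + d} {p} {q} (subst (+ n ∣_) (e₂ p q c d (+ k)) n∣))
          (fix ne (trans (cong (t xor_) (trans (odd?-≡ {p + c + (q + d)} {p + q + 1ℤ} (subst (+ 2 ∣_) (sym (e₁ p q c d)) 2∣))
            (odd?-suc (p + q)))) (xor-not t _)))

    -- For even n and odd k the congruence modulo n in Λ implies the one modulo 2, so that GP(n,k)
    -- itself is already the quotient by Λ.
    module Bipartite (2∣n : + 2 ∣ + n) (2∣k-1 : + 2 ∣ + k - 1ℤ) where

      private
        2∣n∣ : ∀ {z} → + n ∣ z → + 2 ∣ z
        2∣n∣ (divides c refl) = ∣n⇒∣m*n c 2∣n

        e₁ : ∀ p q k → p + q ≡ 1ℤ * (p + q * k) + - q * (k - 1ℤ)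
        e₁ = solve-∀

      petersen-cover : Cover n k (GPV n) (GPAdj n k)
      petersen-cover = record
        { pt     = gp
        ; onto   = gp-onto
        ; pt-≡   = λ { {t} {p} {q} {p′} {q′} (d & _) → gp-≡ {t} {p} {q} {p′} {q′} d }
        ; pt-inj = λ {t} {p} {q} {t′} {p′} {q′} e → let s , d = gp-inj {t} {p} {q} {t′} {p′} {q′} e in
            s , d & combine 1ℤ (- (q - q′)) (2∣n∣ d) 2∣k-1 (e₁ (p - p′) (q - q′) (+ k))
        ; nb-adj = gp-adj
        ; adj-nb = λ {a} → gp-nb a
        }

      color : GPV n → Bool
      color (u i) = odd? (+ toℕ i)
      color (v i) = not (odd? (+ toℕ i))

      color-gp : ∀ a → color (gp a) ≡ col a
      color-gp (t , p , q) = trans (split t) (cong (t xor_) (sym (odd?-≡ {p + q} {+ toℕ (r (p + q * + k))}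
        (combine 1ℤ (- q) (2∣n∣ (res-rem n (p + q * + k))) 2∣k-1 (e₂ p q (+ k) _)))))
        where
        split : ∀ t → color (gp (t , p , q)) ≡ t xor odd? (+ toℕ (r (p + q * + k)))
        split false = refl
        split true  = refl
        e₂ : ∀ p q k r → p + q - r ≡ 1ℤ * (p + q * k - r) + - q * (k - 1ℤ)
        e₂ = solve-∀

      color-adj : ∀ {x y} → GPAdj n k x y → color y ≡ not (color x)
      color-adj {x} e with gp-onto x
      ... | a , refl with gp-nb a e
      ...   | s , refl = trans (color-gp (nb s a)) (trans (col-nb s a) (cong not (sym (color-gp a))))

      -- Along an edge of the double cover both the ℤ₂-coordinate and the bipartite colour change.
      -- Their sum is therefore constant along edges and separates two copies of GP(n,k). The map is
      -- its own inverse.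
      untwist : GraphIso (GPV n × Bool) (Twice (GPAdj n k)) (DV n) (DAdj n k)
      untwist = record
        { f = tw ; g = tw
        ; fg = λ { (x , b) → cong (x ,_) (xor-cancel (color x) b) }
        ; gf = λ { (x , b) → cong (x ,_) (xor-cancel (color x) b) }
        ; f-adj = λ { {x , a} {y , b} (e , refl) → e , λ eq → not-¬ (sym eq)
            (trans (cong (_xor a) (color-adj e)) (not-xor (color x) a)) }
        ; g-adj = λ { {x , a} {y , b} (e , ne) → e , (begin
            color x xor a             ≡⟨ not-involutive _ ⟨
            not (not (color x xor a)) ≡⟨ cong not (not-xor (color x) a) ⟨
            not (not (color x) xor a) ≡⟨ xor-not (not (color x)) a ⟨
            not (color x) xor not a   ≡⟨ cong₂ _xor_ (color-adj e) (¬-not (λ e → ne (sym e))) ⟨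
            color y xor b             ∎) }
        }
        where
        open ≡-Reasoning
        tw : DV n → DV n
        tw (x , b) = x , color x xor b

-- Darts, non-backtracking walks and their images under automorphisms.

module Darts where

  open import Defs
  open Automorphisms
  open import Data.Nat as ℕ using (ℕ; zero; suc)
  import Data.Nat.Properties as ℕ
  open import Data.Integer using (ℤ; +_; 0ℤ; 1ℤ; -1ℤ; _+_; _-_; -_)
  import Data.Integer.Properties as ℤ
  open import Data.Integer.Tactic.RingSolver using (solve-∀)
  open import Data.Fin using (zero; suc)
  open import Data.Bool using (Bool; true; false; not)
  open import Data.Product using (∃; _×_; _,_; proj₂)
  open import Data.Sum using (_⊎_; inj₁; inj₂)
  open import Relation.Binary.PropositionalEquality using (_≡_; _≢_; refl; sym; trans; cong; cong₂; subst; subst₂)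
  open import Relation.Nullary using (¬_; Dec; yes; no; contradiction; _×-dec_)
  open Lattice
  open Covers
  open import Data.Bool using (_∧_; if_then_else_)
  open import Data.Bool.Properties using (not-involutive) renaming (_≟_ to _≟ᵇ_)
  open import Data.Nat using () renaming (_+_ to _+ⁿ_)
  open import Relation.Nullary using (does)
  open import Relation.Nullary.Decidable using (does-⇔; map′)
  open import Function.Bundles using (mk⇔)
  open Auto

  _≟ˢ_ : (s t : Slot) → Dec (s ≡ t)
  fwd ≟ˢ fwd = yes refl
  fwd ≟ˢ bwd = no λ ()
  fwd ≟ˢ spk = no λ ()
  bwd ≟ˢ fwd = no λ ()
  bwd ≟ˢ bwd = yes refl
  bwd ≟ˢ spk = no λ ()
  spk ≟ˢ fwd = no λ ()
  spk ≟ˢ bwd = no λ ()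
  spk ≟ˢ spk = yes refl

  -- The three slots at the end of a dart: `back` retraces it, the other two continue it. After a
  -- rim dart `turn₁` goes straight on and `turn₂` takes the spoke.
  back turn₁ turn₂ : Slot → Slot
  back fwd = bwd
  back bwd = fwd
  back spk = spk
  turn₁ fwd = fwd
  turn₁ bwd = bwd
  turn₁ spk = fwd
  turn₂ fwd = spk
  turn₂ bwd = spk
  turn₂ spk = bwd

  turns : ∀ r x → x ≢ back r → x ≡ turn₁ r ⊎ x ≡ turn₂ r
  turns fwd fwd ne = inj₁ refl
  turns fwd bwd ne = contradiction refl ne
  turns fwd spk ne = inj₂ refl
  turns bwd fwd ne = contradiction refl ne
  turns bwd bwd ne = inj₁ refl
  turns bwd spk ne = inj₂ refl
  turns spk fwd ne = inj₁ refl
  turns spk bwd ne = inj₂ refl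
  turns spk spk ne = contradiction refl ne

  turn₁≢back : ∀ s → turn₁ s ≢ back s
  turn₁≢back fwd ()
  turn₁≢back bwd ()
  turn₁≢back spk ()

  turn₂≢back : ∀ s → turn₂ s ≢ back s
  turn₂≢back fwd ()
  turn₂≢back bwd ()
  turn₂≢back spk ()

  turn₁≢turn₂ : ∀ s → turn₁ s ≢ turn₂ s
  turn₁≢turn₂ fwd ()
  turn₁≢turn₂ bwd ()
  turn₁≢turn₂ spk ()

  nb-back : ∀ s a → nb (back s) (nb s a) ≡ a
  nb-back spk (t , p , q) = cong (_, p , q) (not-involutive t)
  nb-back fwd (false , p , q) = cong (λ z → false , z , q) (i p)
    where
    i : ∀ p → p + 1ℤ + -1ℤ ≡ p
    i = solve-∀
  nb-back fwd (true , p , q) = cong (λ z → true , p , z) (i q)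
    where
    i : ∀ p → p + 1ℤ + -1ℤ ≡ p
    i = solve-∀
  nb-back bwd (false , p , q) = cong (λ z → false , z , q) (i p)
    where
    i : ∀ p → p + -1ℤ + 1ℤ ≡ p
    i = solve-∀
  nb-back bwd (true , p , q) = cong (λ z → true , p , z) (i q)
    where
    i : ∀ p → p + -1ℤ + 1ℤ ≡ p
    i = solve-∀

  count : (P → Slot → ℕ) → ℕ → P → Slot → ℕ
  count hit zero    a s = hit a s
  count hit (suc ℓ) a s = count hit ℓ (nb s a) (turn₁ s) +ⁿ count hit ℓ (nb s a) (turn₂ s)

  indicator : Bool → ℕ
  indicator b = if b then 1 else 0

  -- The lattice enters only through its indicator χ, which can thus be replaced by the indicator of
  -- the multiples of a single vector.
  returns : (ℤ → ℤ → Bool) → Bool → Slot → P → Slot → ℕ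
  returns χ t₀ s₀ (t , p , q) s = indicator (does (t ≟ᵇ t₀) ∧ does (s ≟ˢ s₀) ∧ χ p q)

  -- The number of closed non-backtracking walks of length ℓ through a dart.
  closedWalks : (ℤ → ℤ → Bool) → ℕ → Bool → Slot → ℕ
  closedWalks χ ℓ t s = count (returns χ t s) ℓ (t , 0ℤ , 0ℤ) s

  χ : ℕ → ℕ → ℤ → ℤ → Bool
  χ n k p q = does (Λ? {n} {k} p q)

  translate : ℤ → ℤ → P → P
  translate x y (t , p , q) = t , p + x , q + y

  nb-translate : ∀ s x y a → nb s (translate x y a) ≡ translate x y (nb s a)
  nb-translate spk x y (t , p , q) = refl
  nb-translate fwd x y (false , p , q) = cong (λ z → false , z , q + y) (i p x 1ℤ)
    where
    i : ∀ p x e → p + x + e ≡ p + e + x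
    i = solve-∀
  nb-translate fwd x y (true , p , q) = cong (λ z → true , p + x , z) (i q y 1ℤ)
    where
    i : ∀ p x e → p + x + e ≡ p + e + x
    i = solve-∀
  nb-translate bwd x y (false , p , q) = cong (λ z → false , z , q + y) (i p x -1ℤ)
    where
    i : ∀ p x e → p + x + e ≡ p + e + x
    i = solve-∀
  nb-translate bwd x y (true , p , q) = cong (λ z → true , p + x , z) (i q y -1ℤ)
    where
    i : ∀ p x e → p + x + e ≡ p + e + x
    i = solve-∀

  count-translate : ∀ {hit hit′} x y → (∀ a s → hit (translate x y a) s ≡ hit′ a s) →
                    ∀ ℓ a s → count hit ℓ (translate x y a) s ≡ count hit′ ℓ a s
  count-translate x y e zero a s = e a s
  count-translate x y e (suc ℓ) a s rewrite nb-translate s x y a =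
    cong₂ _+ⁿ_ (count-translate x y e ℓ (nb s a) (turn₁ s)) (count-translate x y e ℓ (nb s a) (turn₂ s))

  dir : Bool → Slot
  dir false = fwd
  dir true  = bwd

  val : Bool → ℤ
  val false = 1ℤ
  val true  = -1ℤ

  nb-dir : ∀ d a → nb (dir d) a ≡ slide (val d) a
  nb-dir false a = refl
  nb-dir true  a = refl

  -- The first argument is the coordinate along side t and the second the one along the other side,
  -- which lets both sides be treated at once.
  Relation : ℕ → ℕ → Bool → ℤ → ℤ → Set
  Relation n k false x y = Λ n k x y
  Relation n k true  x y = Λ n k y x

  -- The two hypotheses keep the forward and the backward neighbour of a vertex distinct, so that
  -- slots at a point correspond one to one to neighbours of its vertex.
  module Local {n k : ℕ} {V : Set} {_∼_ : V → V → Set} (C : Cover n k V _∼_)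
               (Λ20 : ¬ Λ n k (+ 2) 0ℤ) (Λ02 : ¬ Λ n k 0ℤ (+ 2)) where

    open Cover C

    pt-slide : ∀ e t {p q p′ q′} → pt (t , p , q) ≡ pt (t , p′ , q′) →
               pt (slide e (t , p , q)) ≡ pt (slide e (t , p′ , q′))
    pt-slide e false {p} {q} {p′} {q′} eq = pt-≡ (subst (λ z → Λ n k z (q - q′)) (i p p′ e) (proj₂ (pt-inj eq)))
      where
      i : ∀ p p′ e → p - p′ ≡ p + e - (p′ + e)
      i = solve-∀
    pt-slide e true {p} {q} {p′} {q′} eq = pt-≡ (subst (Λ n k (p - p′)) (i q q′ e) (proj₂ (pt-inj eq)))
      where
      i : ∀ p p′ e → p - p′ ≡ p + e - (p′ + e)
      i = solve-∀

    pt-nb : ∀ s {a b} → pt a ≡ pt b → pt (nb s a) ≡ pt (nb s b)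
    pt-nb s {t , p , q} {t′ , p′ , q′} e with pt-inj e
    pt-nb fwd {t , p , q} e | refl , l = pt-slide 1ℤ t e
    pt-nb bwd {t , p , q} e | refl , l = pt-slide -1ℤ t e
    pt-nb spk {t , p , q} e | refl , l = pt-≡ l

    private
      opposite : ∀ a → pt (slide 1ℤ a) ≢ pt (slide -1ℤ a)
      opposite (false , p , q) e = Λ20 (subst₂ (Λ n k) (i p) (j q) (proj₂ (pt-inj e)))
        where
        i : ∀ p → p + 1ℤ - (p + -1ℤ) ≡ + 2
        i = solve-∀
        j : ∀ q → q - q ≡ 0ℤ
        j = solve-∀
      opposite (true , p , q) e = Λ02 (subst₂ (Λ n k) (j p) (i q) (proj₂ (pt-inj e)))
        where
        i : ∀ p → p + 1ℤ - (p + -1ℤ) ≡ + 2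
        i = solve-∀
        j : ∀ q → q - q ≡ 0ℤ
        j = solve-∀

      sides : ∀ e a → pt (slide e a) ≢ pt (nb spk a)
      sides e (false , p , q) eq with pt-inj eq
      ... | () , _
      sides e (true , p , q) eq with pt-inj eq
      ... | () , _

    nb-inj : ∀ s t {a} → pt (nb s a) ≡ pt (nb t a) → s ≡ t
    nb-inj fwd fwd e = refl
    nb-inj bwd bwd e = refl
    nb-inj spk spk e = refl
    nb-inj fwd bwd {a} e = contradiction e (opposite a)
    nb-inj bwd fwd {a} e = contradiction (sym e) (opposite a)
    nb-inj fwd spk {a} e = contradiction e (sides 1ℤ a)
    nb-inj bwd spk {a} e = contradiction e (sides -1ℤ a)
    nb-inj spk fwd {a} e = contradiction (sym e) (sides 1ℤ a)
    nb-inj spk bwd {a} e = contradiction (sym e) (sides -1ℤ a)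

    module Image (f : Auto V _∼_) where

      infix 4 _↦_
      _↦_ : P → P → Set
      a ↦ b = to f (pt a) ≡ pt b

      -- The automorphism acts on vertices, but slots belong to points of the plane; a dart and its
      -- image are therefore given by chosen lifts.
      record Dart (a : P) (s : Slot) (b : P) (r : Slot) : Set where
        constructor _,ᵈ_
        field
          src : a ↦ b
          tgt : nb s a ↦ nb r b
      open Dart

      image : ∀ {a b} → a ↦ b → ∀ s → ∃ λ r → Dart a s b r
      image {a} {b} e s with adj-nb (subst (_∼ to f (pt (nb s a))) e (to-adj f (nb-adj s a)))
      ... | r , e′ = r , (e ,ᵈ e′)

      Dart-inj : ∀ {a b s t r} → Dart a s b r → Dart a t b r → s ≡ t
      Dart-inj {s = s} {t} d d′ = nb-inj s t (to-injective f (trans (tgt d) (sym (tgt d′))))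

      Dart-fun : ∀ {a b s r r′} → Dart a s b r → Dart a s b r′ → r ≡ r′
      Dart-fun {r = r} {r′} d d′ = nb-inj r r′ (trans (sym (tgt d)) (tgt d′))

      reverse-dart : ∀ {a b s r} → Dart a s b r → Dart (nb s a) (back s) (nb r b) (back r)
      reverse-dart {a} {b} {s} {r} d = tgt d ,ᵈ (subst₂ _↦_ (sym (nb-back s a)) (sym (nb-back r b)) (src d))

      -- The reversed image dart is already the image of the reversed dart, so the two continuations
      -- can only go to the two continuations, in one order or the other.
      continue : ∀ {a b s r} → Dart a s b r →
        (Dart (nb s a) (turn₁ s) (nb r b) (turn₁ r) × Dart (nb s a) (turn₂ s) (nb r b) (turn₂ r)) ⊎
        (Dart (nb s a) (turn₁ s) (nb r b) (turn₂ r) × Dart (nb s a) (turn₂ s) (nb r b) (turn₁ r))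
      continue {a} {b} {s} {r} d with image (tgt d) (turn₁ s) | image (tgt d) (turn₂ s)
      ... | x , dx | y , dy
        with turns r x (λ { refl → turn₁≢back s (Dart-inj dx (reverse-dart d)) })
           | turns r y (λ { refl → turn₂≢back s (Dart-inj dy (reverse-dart d)) })
      ... | inj₁ refl | inj₂ refl = inj₁ (dx , dy)
      ... | inj₂ refl | inj₁ refl = inj₂ (dx , dy)
      ... | inj₁ refl | inj₁ refl = contradiction (Dart-inj dx dy) (turn₁≢turn₂ s)
      ... | inj₂ refl | inj₂ refl = contradiction (Dart-inj dx dy) (turn₁≢turn₂ s)

      count-invariant : ∀ {hit hit′} → (∀ {a s b r} → Dart a s b r → hit a s ≡ hit′ b r) →
                        ∀ ℓ {a s b r} → Dart a s b r → count hit ℓ a s ≡ count hit′ ℓ b r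
      count-invariant e zero d = e d
      count-invariant {hit} {hit′} e (suc ℓ) {a} {s} {b} {r} d with continue d
      ... | inj₁ (d₁ , d₂) = cong₂ _+ⁿ_ (count-invariant e ℓ d₁) (count-invariant e ℓ d₂)
      ... | inj₂ (d₁ , d₂) = trans (cong₂ _+ⁿ_ (count-invariant e ℓ d₁) (count-invariant e ℓ d₂))
        (ℕ.+-comm (count hit′ ℓ (nb r b) (turn₂ r)) (count hit′ ℓ (nb r b) (turn₁ r)))

      Same : P → Slot → P → Slot → Set
      Same a s b r = pt a ≡ pt b × s ≡ r

      private
        Same? : ∀ a₀ s₀ a s → Dec (Same a s a₀ s₀)
        Same? (t₀ , p₀ , q₀) s₀ (t , p , q) s = map′ fwd⇒ ⇒fwd
          ((t ≟ᵇ t₀) ×-dec (s ≟ˢ s₀) ×-dec Λ? {n} {k} (p - p₀) (q - q₀))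
          where
          fwd⇒ : t ≡ t₀ × s ≡ s₀ × Λ n k (p - p₀) (q - q₀) → Same (t , p , q) s (t₀ , p₀ , q₀) s₀
          fwd⇒ (refl , e , l) = pt-≡ l , e
          ⇒fwd : Same (t , p , q) s (t₀ , p₀ , q₀) s₀ → t ≡ t₀ × s ≡ s₀ × Λ n k (p - p₀) (q - q₀)
          ⇒fwd (eq , e) = let t≡ , l = pt-inj eq in t≡ , e , l

        hitAt : P → Slot → P → Slot → ℕ
        hitAt a₀ s₀ a s = indicator (does (Same? a₀ s₀ a s))

        -- Translating the start to the origin leaves a number depending on the side and the slot
        -- alone.
        hitAt-closed : ∀ ℓ t p q s → count (hitAt (t , p , q) s) ℓ (t , p , q) s ≡ closedWalks (χ n k) ℓ t s
        hitAt-closed ℓ t p q s = trans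
          (cong (λ a → count (hitAt (t , p , q) s) ℓ a s) (sym (cong₂ (λ x y → t , x , y) (ℤ.+-identityˡ p) (ℤ.+-identityˡ q))))
          (count-translate {hit = hitAt (t , p , q) s} {hit′ = returns (χ n k) t s} p q
            (λ { (t′ , p′ , q′) s′ → cong₂ (λ x y → indicator (does (t′ ≟ᵇ t) ∧ does (s′ ≟ˢ s) ∧ χ n k x y)) (i p′ p) (i q′ q) })
            ℓ (t , 0ℤ , 0ℤ) s)
          where
          i : ∀ p x → p + x - x ≡ p
          i = solve-∀

        hitAt-image : ∀ {a₀ s₀ b₀ r₀ a s b r} → Dart a₀ s₀ b₀ r₀ → Dart a s b r → hitAt a₀ s₀ a s ≡ hitAt b₀ r₀ b r
        hitAt-image {a₀} {s₀} {b₀} {r₀} {a} {s} {b} {r} d₀ d =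
          cong indicator (does-⇔ (mk⇔ there there⁻¹) (Same? a₀ s₀ a s) (Same? b₀ r₀ b r))
          where
          there : Same a s a₀ s₀ → Same b r b₀ r₀
          there (e , refl) = b≡ , nb-inj r r₀ {b} (trans (sym (tgt d)) (trans (cong (to f) (pt-nb s {a} {a₀} e))
              (trans (tgt d₀) (sym (pt-nb r₀ {b} {b₀} b≡)))))
            where
            b≡ : pt b ≡ pt b₀
            b≡ = trans (sym (src d)) (trans (cong (to f) e) (src d₀))
          there⁻¹ : Same b r b₀ r₀ → Same a s a₀ s₀
          there⁻¹ (e , refl) = a≡ , nb-inj s s₀ {a} (trans (to-injective f (trans (tgt d)
              (trans (pt-nb r {b} {b₀} e) (sym (tgt d₀))))) (sym (pt-nb s₀ {a} {a₀} a≡)))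
            where
            a≡ : pt a ≡ pt a₀
            a≡ = to-injective f (trans (src d) (trans e (sym (src d₀))))

      closedWalks-invariant : ∀ ℓ {t p q s t′ p′ q′ r} → Dart (t , p , q) s (t′ , p′ , q′) r →
                              closedWalks (χ n k) ℓ t s ≡ closedWalks (χ n k) ℓ t′ r
      closedWalks-invariant ℓ {t} {p} {q} {s} {t′} {p′} {q′} {r} d =
        trans (sym (hitAt-closed ℓ t p q s)) (trans
          (count-invariant {hit = hitAt _ s} {hit′ = hitAt _ r} (hitAt-image d) ℓ d) (hitAt-closed ℓ t′ p′ q′ r))

      Spokes : Set
      Spokes = ∀ {a b r} → Dart a spk b r → r ≡ spk

      private
        flip : ∀ {x y} → x ≢ y → not x ≡ y
        flip {false} {false} ne = contradiction refl ne
        flip {false} {true}  ne = refl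
        flip {true}  {false} ne = refl
        flip {true}  {true}  ne = contradiction refl ne

        back-spk : ∀ {r} → back r ≡ spk → r ≡ spk
        back-spk {spk} e = refl

        third : ∀ {a b r s t} → Dart a fwd b s → Dart a bwd b t → s ≢ spk → t ≢ spk → Dart a spk b r → r ≡ spk
        third {r = spk} F B ns nt D = refl
        third {s = spk} F B ns nt D = contradiction refl ns
        third {t = spk} F B ns nt D = contradiction refl nt
        third {s = fwd} {t = fwd} F B ns nt D = contradiction (Dart-inj F B) λ ()
        third {s = bwd} {t = bwd} F B ns nt D = contradiction (Dart-inj F B) λ ()
        third {r = fwd} {s = fwd} {t = bwd} F B ns nt D = contradiction (Dart-inj D F) λ ()
        third {r = bwd} {s = fwd} {t = bwd} F B ns nt D = contradiction (Dart-inj D B) λ ()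
        third {r = fwd} {s = bwd} {t = fwd} F B ns nt D = contradiction (Dart-inj D B) λ ()
        third {r = bwd} {s = bwd} {t = fwd} F B ns nt D = contradiction (Dart-inj D F) λ ()

        on-side-of : ∀ {t p q b r} → (∀ {b} d → ¬ Dart (t , p , q) (dir d) b spk) → Dart (t , p , q) spk b r → r ≡ spk
        on-side-of rim D = third (proj₂ (image (src D) fwd)) (proj₂ (image (src D) bwd))
          (λ e → rim false (subst (Dart _ fwd _) e (proj₂ (image (src D) fwd))))
          (λ e → rim true (subst (Dart _ bwd _) e (proj₂ (image (src D) bwd)))) D

      -- If the rim edges on one side never become spokes, the third edge at their ends must.
      spokes-from-side : ∀ t → (∀ {p q b} d → ¬ Dart (t , p , q) (dir d) b spk) → Spokes
      spokes-from-side t rim {a = t′ , p , q} {b} {r} D with t′ ≟ᵇ t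
      ... | yes refl = on-side-of rim D
      ... | no ne = back-spk (on-side-of rim D′)
        where
        D′ : Dart (t , p , q) spk (nb r b) (back r)
        D′ = subst (λ t″ → Dart (t″ , p , q) spk (nb r b) (back r)) (flip ne) (reverse-dart D)

-- Automorphisms that preserve the spokes are affine.

module Frames where

  open import Defs
  open Automorphisms
  open import Data.Nat as ℕ using (ℕ)
  import Data.Nat.Properties as ℕ
  open import Data.Integer using (ℤ; +_; 0ℤ; 1ℤ; -1ℤ; _+_; _-_; _*_; -_)
  import Data.Integer.Properties as ℤ
  open import Data.Integer.Tactic.RingSolver using (solve-∀)
  open import Data.Bool using (Bool; true; false; not; _xor_)
  open import Data.Product using (∃; _×_; _,_; proj₁; proj₂)
  open import Data.Sum using (inj₁; inj₂)
  open import Relation.Binary.PropositionalEquality using (_≡_; _≢_; refl; sym; trans; cong; subst; subst₂; module ≡-Reasoning)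
  open import Relation.Nullary using (¬_; contradiction)
  open Lattice
  open Covers
  open import Data.Bool.Properties using (not-involutive)
  open Darts
  open Auto

  sg : Bool → ℤ → ℤ
  sg false z = z
  sg true  z = - z

  -- The maps x ↦ x₀ + φ x with φ a signed permutation of the two coordinates, exchanging the sides when it exchanges the coordinates.
  record Affine : Set where
    constructor affine
    field
      swap sgn₁ sgn₂ : Bool
      p₀ q₀ : ℤ

  applyA : Affine → P → P
  applyA (affine false r r′ x y) (t , p , q) = t , x + sg r p , y + sg r′ q
  applyA (affine true  r r′ x y) (t , p , q) = not t , x + sg r′ q , y + sg r p

  -- The three shapes of the relations among 2(1 , 1) and 2(k , 1) for which the local argument is made.
  data Shape (n k : ℕ) : Set where
    generic : ¬ Λ n k (+ 2) (+ 2) → ¬ Λ n k (+ 2) (- + 2) → Shape n k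
    prism   : Λ n k 1ℤ -1ℤ → ¬ Λ n k 1ℤ 1ℤ → Shape n k
    twisted : Λ n k (+ 2) (+ 2) → ¬ Λ n k (+ 2) (- + 2) → Shape n k

  module _ {n k : ℕ} where

    Rel-comb : ∀ t {p q p′ q′ x y} a b → Relation n k t p q → Relation n k t p′ q′ →
               x ≡ a * p + b * p′ → y ≡ a * q + b * q′ → Relation n k t x y
    Rel-comb false a b l l′ e e′ = Λ-comb a b l l′ e e′
    Rel-comb true  a b l l′ e e′ = Λ-comb a b l l′ e′ e

    Rel-neg : ∀ t {p q x y} → Relation n k t p q → x ≡ - p → y ≡ - q → Relation n k t x y
    Rel-neg t {p} {q} l e e′ = Rel-comb t -1ℤ 0ℤ l l (trans e (i p)) (trans e′ (i q))
      where
      i : ∀ p → - p ≡ -1ℤ * p + 0ℤ * p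
      i = solve-∀

    Rel-both : ∀ {x y} → ¬ Λ n k x y → ¬ Λ n k y x → ∀ t → ¬ Relation n k t x y
    Rel-both p q false = p
    Rel-both p q true  = q

    module _ (Λ20 : ¬ Λ n k (+ 2) 0ℤ) (Λ02 : ¬ Λ n k 0ℤ (+ 2)) (t : Bool) where
      private
        R = Relation n k t
        R20 : ¬ R (+ 2) 0ℤ
        R20 = Rel-both Λ20 Λ02 t
        R02 : ¬ R 0ℤ (+ 2)
        R02 = Rel-both Λ02 Λ20 t
        R-20 : ¬ R (- + 2) 0ℤ
        R-20 l = R20 (Rel-neg t l refl refl)
        R0-2 : ¬ R 0ℤ (- + 2)
        R0-2 l = R02 (Rel-neg t l refl refl)

      -- Different γ and ε would make a vector (0 , ±2) or (±2 , ±2) a relation.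
      signs-generic : ¬ R (+ 2) (+ 2) → ¬ R (+ 2) (- + 2) → ∀ α β γ ε →
                      R (val α - val β) (val γ - val ε) → γ ≡ ε
      signs-generic n1 n2 α β false false l = refl
      signs-generic n1 n2 α β true  true  l = refl
      signs-generic n1 n2 false false false true  l = contradiction l R02
      signs-generic n1 n2 false false true  false l = contradiction l R0-2
      signs-generic n1 n2 true  true  false true  l = contradiction l R02
      signs-generic n1 n2 true  true  true  false l = contradiction l R0-2
      signs-generic n1 n2 false true  false true  l = contradiction l n1
      signs-generic n1 n2 false true  true  false l = contradiction l n2
      signs-generic n1 n2 true  false false true  l = contradiction (Rel-neg t l refl refl) n2
      signs-generic n1 n2 true  false true  false l = contradiction (Rel-neg t l refl refl) n1

      signs-prism : ¬ R 1ℤ 1ℤ → ∀ α β → R (val α) (- val β) → α ≡ β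
      signs-prism n1 false false l = refl
      signs-prism n1 true  true  l = refl
      signs-prism n1 false true  l = contradiction l n1
      signs-prism n1 true  false l = contradiction (Rel-neg t l refl refl) n1

      -- If α and γ differ, one of the two relations is (2 , 0), (0 , 2) or (2 , -2) up to sign, and
      -- none of these lies in the lattice.
      signs-twisted : ¬ R (+ 2) (- + 2) → ∀ α β γ ε →
                      R (val α - val β) (val γ - val ε) → R (val α + val β) (val γ + val ε) → α ≡ γ
      signs-twisted n1 false β false ε l m = refl
      signs-twisted n1 true  β true  ε l m = refl
      signs-twisted n1 false false true  false l m = contradiction l R0-2
      signs-twisted n1 false false true  true  l m = contradiction m n1
      signs-twisted n1 false true  true  false l m = contradiction l n1
      signs-twisted n1 false true  true  true  l m = contradiction l R20
      signs-twisted n1 true  false false true  l m = contradiction (Rel-neg t l refl refl) n1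
      signs-twisted n1 true  false false false l m = contradiction l R-20
      signs-twisted n1 true  true  false true  l m = contradiction l R02
      signs-twisted n1 true  true  false false l m = contradiction (Rel-neg t m refl refl) n1

  val-not : ∀ d → val (not d) ≡ - val d
  val-not false = refl
  val-not true  = refl

  module Frames {n k : ℕ} {V : Set} {_∼_ : V → V → Set} (C : Cover n k V _∼_)
                (Λ20 : ¬ Λ n k (+ 2) 0ℤ) (Λ02 : ¬ Λ n k 0ℤ (+ 2)) (shape : Shape n k)
                (f : Auto V _∼_) (spokes : Local.Image.Spokes C Λ20 Λ02 f) where

    open Cover C
    open Local C Λ20 Λ02
    open Image f
    open Dart

    Line : P → P → Bool → Set
    Line a b r = ∀ d → Dart a (dir d) b (dir (d xor r))

    -- Around a, f multiplies the step along the side of a by r and the step along the other side by r′.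
    Frame : P → P → Bool → Bool → Set
    Frame a b r r′ = Line a b r × Line (nb spk a) (nb spk b) r′

    spoke-to-spoke : ∀ {a b} → a ↦ b → Dart a spk b spk
    spoke-to-spoke e with image e spk
    ... | r , D with spokes D
    ... | refl = D

    private
      dir-onto : ∀ s → s ≢ spk → ∃ λ d → s ≡ dir d
      dir-onto fwd _ = false , refl
      dir-onto bwd _ = true , refl
      dir-onto spk p = contradiction refl p

      dir≢spk : ∀ d → dir d ≢ spk
      dir≢spk false ()
      dir≢spk true ()

      dir-inj : ∀ {d e} → dir d ≡ dir e → d ≡ e
      dir-inj {false} {false} _ = refl
      dir-inj {true}  {true}  _ = refl

      turn₁-dir : ∀ d → turn₁ (dir d) ≡ dir d
      turn₁-dir false = refl
      turn₁-dir true  = refl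

      turn₂-dir : ∀ d → turn₂ (dir d) ≡ spk
      turn₂-dir false = refl
      turn₂-dir true  = refl

      ≢⇒not : ∀ {x y : Bool} → x ≢ y → x ≡ not y
      ≢⇒not {false} {false} p = contradiction refl p
      ≢⇒not {false} {true}  p = refl
      ≢⇒not {true}  {false} p = refl
      ≢⇒not {true}  {true}  p = contradiction refl p

    rim : ∀ {a b} → a ↦ b → ∀ d → ∃ λ r → Dart a (dir d) b (dir r)
    rim e d with image e (dir d)
    ... | s , D with dir-onto s (λ { refl → dir≢spk d (Dart-inj D (spoke-to-spoke e)) })
    ... | r , refl = r , D

    line : ∀ {a b} → a ↦ b → ∃ (Line a b)
    line {a} {b} e with rim e false | rim e true
    ... | r , D | r′ , D′ = r , λ where
        false → D
        true  → subst (λ x → Dart a bwd b (dir x)) (≢⇒not λ { refl → contradiction (Dart-inj D D′) λ () }) D′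

    -- The other continuation of a rim dart is a spoke and has a spoke as its image, which leaves
    -- the straight continuation of the image to the straight one.
    straight : ∀ {a b d r} → Dart a (dir d) b (dir r) → Dart (nb (dir d) a) (dir d) (nb (dir r) b) (dir r)
    straight {a} {b} {d} {r} D with continue D
    ... | inj₁ (D₁ , _) = subst₂ (λ x y → Dart (nb (dir d) a) x (nb (dir r) b) y) (turn₁-dir d) (turn₁-dir r) D₁
    ... | inj₂ (_ , D₂) = contradiction (trans (sym (turn₁-dir r))
        (spokes (subst (λ x → Dart (nb (dir d) a) x _ _) (turn₂-dir d) D₂))) (dir≢spk r)

    Line-fun : ∀ {a b r r′} → Line a b r → Line a b r′ → r ≡ r′
    Line-fun L L′ = dir-inj (Dart-fun (L false) (L′ false))

    -- Going straight is preserved, so the sign is constant along a whole rim line.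
    Line-step : ∀ {a b r} d → Line a b r → Line (nb (dir d) a) (nb (dir (d xor r)) b) r
    Line-step {a} {b} {r} d L with line (tgt (L d))
    ... | s , L′ = subst (Line _ _) s≡r L′
      where
      s≡r : s ≡ r
      s≡r = trans (sym (xor-cancel d s)) (trans (cong (d xor_) (dir-inj (Dart-fun (L′ d) (straight (L d))))) (xor-cancel d r))

    frame : ∀ {a b r} → Line a b r → ∃ λ r′ → Frame a b r r′
    frame L with line (tgt (spoke-to-spoke (src (L false))))
    ... | r′ , L′ = r′ , L , L′

    private
      go : ∀ {a b r} → Line a b r → ∀ d → slide (val d) a ↦ slide (val (d xor r)) b
      go {a} {b} {r} L d = subst₂ _↦_ (nb-dir d a) (nb-dir (d xor r) b) (tgt (L d))

      Line-slide : ∀ {a b r} d → Line a b r → Line (slide (val d) a) (slide (val (d xor r)) b) r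
      Line-slide {a} {b} {r} d L = subst₂ (λ x y → Line x y r) (nb-dir d a) (nb-dir (d xor r) b) (Line-step d L)

      across : ∀ {a b} → a ↦ b → nb spk a ↦ nb spk b
      across e = tgt (spoke-to-spoke e)

      ↦-fun : ∀ {a b b′} → a ↦ b → a ↦ b′ → pt b ≡ pt b′
      ↦-fun e e′ = trans (sym e) e′

      own : ∀ t {x y α γ α′ γ′} →
        pt (nb spk (slide γ (nb spk (slide α (t , x , y))))) ≡ pt (slide α′ (nb spk (slide γ′ (nb spk (t , x , y))))) →
        Relation n k t (α - α′) (γ - γ′)
      own false {x} {y} {α} {γ} {α′} {γ′} e = subst₂ (Λ n k) (i x α α′) (i y γ γ′) (proj₂ (pt-inj e))
        where
        i : ∀ x α β → x + α - (x + β) ≡ α - β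
        i = solve-∀
      own true {x} {y} {α} {γ} {α′} {γ′} e = subst₂ (Λ n k) (i x γ γ′) (i y α α′) (proj₂ (pt-inj e))
        where
        i : ∀ x α β → x + α - (x + β) ≡ α - β
        i = solve-∀

    -- A step along either side keeps the sign of the line it follows. The unknowns are the signs on
    -- the two far edges of the 8-cycle: `r″` on the other side after a step on the own side, and
    -- `r₃` on the own side after a step on the other.
    module Corner {a b r r′} (F : Frame a b r r′) (d : Bool) where

      a₁ b₁ : P
      a₁ = slide (val d) a
      b₁ = slide (val (d xor r)) b

      F₁ : ∃ λ r″ → Frame a₁ b₁ r r″
      F₁ = frame (Line-slide d (proj₁ F))

      r″ : Bool
      r″ = proj₁ F₁

      c e : P
      c = slide (val d) (nb spk a)
      e = slide (val (d xor r′)) (nb spk b)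

      Lc : Line c e r′
      Lc = Line-slide d (proj₂ F)

      F₃ : ∃ λ r₃ → Line (nb spk c) (nb spk e) r₃
      F₃ = line (across (src (Lc false)))

      r₃ : Bool
      r₃ = proj₁ F₃

      opposite-corners : (nb spk (slide (val d) (nb spk a₁))) ≡ slide (val d) (nb spk c)
      opposite-corners = corner a
        where
        corner : ∀ a → nb spk (slide (val d) (nb spk (slide (val d) a))) ≡ slide (val d) (nb spk (slide (val d) (nb spk a)))
        corner (false , _ , _) = refl
        corner (true  , _ , _) = refl

      -- The 8-cycle through a in the directions (d , d).
      square : Relation n k (proj₁ b) (val (d xor r) - val (d xor r₃)) (val (d xor r″) - val (d xor r′))
      square = own (proj₁ b) (↦-fun (across (go (proj₂ (proj₂ F₁)) d))
        (subst (_↦ slide (val (d xor r₃)) (nb spk e)) (sym opposite-corners) (go (proj₂ F₃) d)))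

    private
      Move : Set
      Move = ∀ {a b r r′} d → Frame a b r r′ → Frame (slide (val d) a) (slide (val (d xor r)) b) r r′

      conclude : ∀ {a b r r′ s} → Frame a b r s → s ≡ r′ → Frame a b r r′
      conclude F refl = F

    -- The sign of the own line survives the step; if the two signs of every frame agree, the other
    -- sign survives with it.
    move-equal : (∀ {a b r r′} → Frame a b r r′ → r ≡ r′) → Move
    move-equal equal d F = conclude (proj₂ F₁) (trans (sym (equal (proj₂ F₁))) (equal F))
      where open Corner F d

    move-generic : ¬ Λ n k (+ 2) (+ 2) → ¬ Λ n k (+ 2) (- + 2) → Move
    move-generic n1 n2 {a} {b} {r} {r′} d F = conclude (proj₂ F₁)
      (trans (sym (xor-cancel d r″)) (trans (cong (d xor_)
        (signs-generic Λ20 Λ02 (proj₁ b) (Rel-both n1 n1 (proj₁ b)) (Rel-both n2 n2′ (proj₁ b))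
          (d xor r) (d xor r₃) (d xor r″) (d xor r′) square)) (xor-cancel d r′)))
      where
      open Corner F d
      n2′ : ¬ Λ n k (- + 2) (+ 2)
      n2′ l = n2 (Rel-neg false l refl refl)

    module _ (Λ1-1 : Λ n k 1ℤ -1ℤ) (n1 : ¬ Λ n k 1ℤ 1ℤ) where
      private
        a~ : ∀ t p q → pt (nb spk (slide 1ℤ (t , p , q))) ≡ pt (slide 1ℤ (nb spk (t , p , q)))
        a~ false p q = pt-≡ (Λ-comb 1ℤ 0ℤ Λ1-1 Λ1-1 (i p) (j q))
          where
          i : ∀ p → p + 1ℤ - p ≡ 1ℤ * 1ℤ + 0ℤ * 1ℤ
          i = solve-∀
          j : ∀ q → q - (q + 1ℤ) ≡ 1ℤ * -1ℤ + 0ℤ * -1ℤ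
          j = solve-∀
        a~ true p q = pt-≡ (Λ-comb -1ℤ 0ℤ Λ1-1 Λ1-1 (j p) (i q))
          where
          i : ∀ p → p + 1ℤ - p ≡ -1ℤ * -1ℤ + 0ℤ * -1ℤ
          i = solve-∀
          j : ∀ q → q - (q + 1ℤ) ≡ -1ℤ * 1ℤ + 0ℤ * 1ℤ
          j = solve-∀

        b~ : ∀ t {p q α β} → pt (nb spk (slide α (t , p , q))) ≡ pt (slide β (nb spk (t , p , q))) → Relation n k t α (- β)
        b~ false {p} {q} {α} {β} e = subst₂ (Λ n k) (i p α) (j q β) (proj₂ (pt-inj e))
          where
          i : ∀ p α → p + α - p ≡ α
          i = solve-∀
          j : ∀ q β → q - (q + β) ≡ - β
          j = solve-∀
        b~ true {p} {q} {α} {β} e = subst₂ (Λ n k) (j p β) (i q α) (proj₂ (pt-inj e))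
          where
          i : ∀ p α → p + α - p ≡ α
          i = solve-∀
          j : ∀ q β → q - (q + β) ≡ - β
          j = solve-∀

      -- The relation (1 , -1) makes two spokes and two parallel rim edges into a 4-cycle. Its image
      -- closes up as well, which forces the two rim edges to be followed in matching directions.
      equal-signs : ∀ {a b r r′} → Frame a b r r′ → r ≡ r′
      equal-signs {t , p , q} {b} {r} {r′} (L , L′) = signs-prism Λ20 Λ02 (proj₁ b) (Rel-both n1 n1 (proj₁ b)) r r′
        (b~ (proj₁ b) (trans (sym (across (go L false))) (trans (cong (to f) (a~ t p q)) (go L′ false))))

    module _ (Λ22 : Λ n k (+ 2) (+ 2)) (n1 : ¬ Λ n k (+ 2) (- + 2)) where
      private
        n1′ : ¬ Λ n k (- + 2) (+ 2)
        n1′ l = n1 (Rel-neg false l refl refl)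

        vv : ∀ d → Λ n k (val d + val d) (val d + val d)
        vv false = Λ22
        vv true  = Rel-neg false Λ22 refl refl

        -- The relation (2 , 2) closes the walk of four steps in direction d that alternates between
        -- the sides. Its fourth step is traversed here backwards, from the starting point.
        last : ∀ t p q d → pt (slide (val (not d)) (nb spk (t , p , q))) ≡
                           pt (nb spk (slide (val d) (nb spk (slide (val d) (nb spk (slide (val d) (t , p , q)))))))
        last false p q d = pt-≡ (Rel-comb false -1ℤ 0ℤ (vv d) (vv d) (i p (val d)) (trans (cong (λ z → q + z - (q + val d)) (val-not d)) (j q (val d))))
          where
          i : ∀ p v → p - (p + v + v) ≡ -1ℤ * (v + v) + 0ℤ * (v + v)
          i = solve-∀
          j : ∀ q v → q + - v - (q + v) ≡ -1ℤ * (v + v) + 0ℤ * (v + v)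
          j = solve-∀
        last true p q d = pt-≡ (Rel-comb false -1ℤ 0ℤ (vv d) (vv d) (trans (cong (λ z → p + z - (p + val d)) (val-not d)) (j p (val d))) (i q (val d)))
          where
          i : ∀ p v → p - (p + v + v) ≡ -1ℤ * (v + v) + 0ℤ * (v + v)
          i = solve-∀
          j : ∀ q v → q + - v - (q + v) ≡ -1ℤ * (v + v) + 0ℤ * (v + v)
          j = solve-∀

        last-image : ∀ t {x y α β γ ε} → pt (slide (- ε) (nb spk (t , x , y))) ≡
            pt (nb spk (slide β (nb spk (slide γ (nb spk (slide α (t , x , y))))))) →
            Relation n k t (α + β) (γ + ε)
        last-image false {x} {y} {α} {β} {γ} {ε} e = Rel-neg false (proj₂ (pt-inj e)) (i x α β) (j y γ ε)
          where
          i : ∀ x α β → α + β ≡ - (x - (x + α + β))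
          i = solve-∀
          j : ∀ y γ ε → γ + ε ≡ - (y + - ε - (y + γ))
          j = solve-∀
        last-image true {x} {y} {α} {β} {γ} {ε} e = Rel-neg false (proj₂ (pt-inj e)) (j x γ ε) (i y α β)
          where
          i : ∀ x α β → α + β ≡ - (x - (x + α + β))
          i = solve-∀
          j : ∀ y γ ε → γ + ε ≡ - (y + - ε - (y + γ))
          j = solve-∀

      module _ {a b r r′} (F : Frame a b r r′) (d : Bool) where
        open Corner F d

        -- The closed walk (d , d , d , d) coming from the relation (2 , 2).
        closing : Relation n k (proj₁ b) (val (d xor r) + val (d xor r₃)) (val (d xor r″) + val (d xor r′))
        closing = last-image (proj₁ b) {proj₁ (proj₂ b)} {proj₂ (proj₂ b)}
          {val (d xor r)} {val (d xor r₃)} {val (d xor r″)} {val (d xor r′)} (begin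
            pt (slide (- val (d xor r′)) (nb spk b))       ≡⟨ first-step ⟨
            to f (pt (slide (val (not d)) (nb spk a)))     ≡⟨ cong (to f) (last (proj₁ a) (proj₁ (proj₂ a)) (proj₂ (proj₂ a)) d) ⟩
            to f (pt (nb spk (slide (val d) X)))           ≡⟨ across {slide (val d) X} {slide (val (d xor r₃)) Y} (go far d) ⟩
            pt (nb spk (slide (val (d xor r₃)) Y))         ∎)
          where
          open ≡-Reasoning
          X Y Y′ : P
          X = nb spk (slide (val d) (nb spk a₁))
          Y = nb spk (slide (val (d xor r″)) (nb spk b₁))
          Y′ = slide (val (d xor r₃)) (nb spk e)
          first-step : slide (val (not d)) (nb spk a) ↦ slide (- val (d xor r′)) (nb spk b)
          first-step = subst (λ z → slide (val (not d)) (nb spk a) ↦ slide z (nb spk b))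
            (trans (cong val (not-xor d r′)) (val-not (d xor r′))) (go {nb spk a} {nb spk b} {r′} (proj₂ F) (not d))
          X↦Y : X ↦ Y
          X↦Y = across {slide (val d) (nb spk a₁)} {slide (val (d xor r″)) (nb spk b₁)}
            (go {nb spk a₁} {nb spk b₁} {r″} (proj₂ (proj₂ F₁)) d)
          X↦Y′ : X ↦ Y′
          X↦Y′ = subst (_↦ Y′) (sym opposite-corners) (go {nb spk c} {nb spk e} {r₃} (proj₂ F₃) d)
          Line-at : ∀ {s} → Line X Y s → Line X Y′ r₃ → s ≡ r₃
          Line-at {s} L L′ = trans (sym (xor-cancel d s)) (trans (cong (d xor_) (dir-inj
            (nb-inj (dir (d xor s)) (dir (d xor r₃)) {Y} (trans (sym (tgt (L d))) (trans (tgt (L′ d))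
              (pt-nb (dir (d xor r₃)) {Y′} {Y} (trans (sym X↦Y′) X↦Y))))))) (xor-cancel d r₃))
          -- The line through the far corner, seen from both of its ends.
          far : Line X Y r₃
          far = subst (Line X Y) (Line-at (proj₂ (line X↦Y))
            (subst (λ z → Line z Y′ r₃) (sym opposite-corners) (Line-slide {nb spk c} {nb spk e} {r₃} d (proj₂ F₃))))
            (proj₂ (line X↦Y))

        next-equal : r ≡ r″
        next-equal = trans (sym (xor-cancel d r)) (trans (cong (d xor_)
          (signs-twisted Λ20 Λ02 (proj₁ b) (Rel-both n1 n1′ (proj₁ b))
            (d xor r) (d xor r₃) (d xor r″) (d xor r′) square closing)) (xor-cancel d r″))

      private
        slide-inv : ∀ x y a → x + y ≡ 0ℤ → slide x (slide y a) ≡ a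
        slide-inv x y (false , p , q) e = cong (λ z → false , z , q)
          (trans (i p x y) (trans (cong (λ z → p + z) e) (ℤ.+-identityʳ p)))
          where
          i : ∀ p x y → p + y + x ≡ p + (x + y)
          i = solve-∀
        slide-inv x y (true , p , q) e = cong (λ z → true , p , z)
          (trans (i q x y) (trans (cong (λ z → q + z) e) (ℤ.+-identityʳ q)))
          where
          i : ∀ p x y → p + y + x ≡ p + (x + y)
          i = solve-∀

        val-cancel : ∀ r → val r + val (not r) ≡ 0ℤ
        val-cancel false = refl
        val-cancel true  = refl

      -- Every frame is next to the one behind it.
      equal-signs′ : ∀ {a b r r′} → Frame a b r r′ → r ≡ r′
      equal-signs′ {a} {b} {r} {r′} F = trans (next-equal F⁻ false) (Line-fun
        (subst₂ (λ x y → Line (nb spk x) (nb spk y) r″) (slide-inv 1ℤ -1ℤ a refl)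
          (slide-inv (val r) (val (not r)) b (val-cancel r)) (proj₂ (proj₂ F₁))) (proj₂ F))
        where
        F⁻ = proj₂ (frame (Line-slide true (proj₁ F)))
        open Corner F⁻ false

    move : Move
    move = by shape
      where
      by : Shape n k → Move
      by (generic n1 n2) = move-generic n1 n2
      by (prism l n1)    = move-equal (equal-signs l n1)
      by (twisted l n1)  = move-equal (equal-signs′ l n1)

    private
      turn-side : ∀ {t p q x y s r r′} → Frame (t , p , q) (s , x , y) r r′ → Frame (not t , p , q) (not s , x , y) r′ r
      turn-side {t} {p} {q} {x} {y} {s} {r} (L , L′) = L′ ,
        subst₂ (λ t s → Line (t , p , q) (s , x , y) r) (sym (not-involutive t)) (sym (not-involutive s)) L

      sg-0 : ∀ r → sg r 0ℤ ≡ 0ℤ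
      sg-0 false = refl
      sg-0 true  = refl

      slide-0 : ∀ a → slide 0ℤ a ≡ a
      slide-0 (false , p , q) = cong (λ z → false , z , q) (ℤ.+-identityʳ p)
      slide-0 (true  , p , q) = cong (λ z → true , p , z) (ℤ.+-identityʳ q)

      slide-+ : ∀ x y a → slide x (slide y a) ≡ slide (y + x) a
      slide-+ x y (false , p , q) = cong (λ z → false , z , q) (ℤ.+-assoc p y x)
      slide-+ x y (true  , p , q) = cong (λ z → true , p , z) (ℤ.+-assoc q y x)

      sg-val : ∀ p d r → sg r p + val (d xor r) ≡ sg r (p + val d)
      sg-val p false false = refl
      sg-val p true  false = refl
      sg-val p false true  = sym (ℤ.neg-distrib-+ p 1ℤ)
      sg-val p true  true  = sym (ℤ.neg-distrib-+ p -1ℤ)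

      frame-slide : ∀ {a b r r′} → Frame a b r r′ → ∀ p → Frame (slide p a) (slide (sg r p) b) r r′
      frame-slide {a} {b} {r} {r′} F = ℤ-induction _
        (subst₂ (λ a b → Frame a b r r′) (sym (slide-0 a)) (sym (trans (cong (λ z → slide z b) (sg-0 r)) (slide-0 b))) F)
        (λ p → next p false) (λ p → next p true)
        where
        next : ∀ p d → Frame (slide p a) (slide (sg r p) b) r r′ →
               Frame (slide (p + val d) a) (slide (sg r (p + val d)) b) r r′
        next p d G = subst₂ (λ a b → Frame a b r r′) (slide-+ (val d) p a)
          (trans (slide-+ (val (d xor r)) (sg r p) b) (cong (λ z → slide z b) (sg-val p d r))) (move d G)

    -- The images of the origin and of the lines on its two sides fix the translation part and both
    -- signs. The frame is then carried to any (p , q), first q steps along the inner and then p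
    -- steps along the outer rim.
    affine-image : ∃ λ α → ∀ a → a ↦ applyA α a
    affine-image with onto (to f (pt (false , 0ℤ , 0ℤ)))
    ... | (s , x , y) , e with line {false , 0ℤ , 0ℤ} {s , x , y} (sym e)
    ... | r , L with frame L
    ... | r′ , F = affine s r r′ x y , λ where
        (false , p , q) → src (proj₁ (at s F p q) false)
        (true  , p , q) → true-side s (src (proj₂ (at s F p q) false))
      where
      true-side : ∀ s {p q} → (true , p , q) ↦ nb spk (applyA (affine s r r′ x y) (false , p , q)) →
                  (true , p , q) ↦ applyA (affine s r r′ x y) (true , p , q)
      true-side false e = e
      true-side true  e = e
      at : ∀ s {x y} → Frame (false , 0ℤ , 0ℤ) (s , x , y) r r′ → ∀ p q →
           Frame (false , p , q) (applyA (affine s r r′ x y) (false , p , q)) r r′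
      at false {x} {y} F p q = subst₂ (λ p′ q′ → Frame (false , p′ , q′) (false , x + sg r p , y + sg r′ q) r r′) (ℤ.+-identityˡ p) (ℤ.+-identityˡ q)
        (frame-slide (turn-side (frame-slide (turn-side F) q)) p)
      at true {x} {y} F p q = subst₂ (λ p′ q′ → Frame (false , p′ , q′) (true , x + sg r′ q , y + sg r p) r r′) (ℤ.+-identityˡ p) (ℤ.+-identityˡ q)
        (frame-slide (turn-side (frame-slide (turn-side F) q)) p)

-- Telling spokes from rim edges by counting walks.

module ClosedWalks where

  open import Defs
  open Automorphisms
  open import Data.Nat as ℕ using (ℕ; zero; suc; z≤n; s≤s)
  import Data.Nat.Properties as ℕ
  import Data.Bool
  import Data.List.Relation.Unary.All
  open import Data.Integer using (ℤ; +_; 0ℤ; 1ℤ; _+_; _-_; _*_; -_; ∣_∣)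
  import Data.Integer.Properties as ℤ
  open import Data.Integer.Divisibility.Signed using (_∣_; ∣⇒∣ᵤ)
  open import Data.Integer.Tactic.RingSolver using (solve-∀)
  open import Data.Fin using (zero; suc)
  open import Data.Bool using (Bool; true; false; not)
  open import Data.Product using (∃; _×_; _,_; proj₁; proj₂)
  open import Data.Sum using (_⊎_; inj₁; inj₂; [_,_]′)
  open import Relation.Binary.PropositionalEquality using (_≡_; _≢_; refl; sym; trans; cong; cong₂; subst)
  open import Relation.Nullary using (¬_; Dec; yes; no; contradiction)
  open import Data.Bool using (_∧_; if_then_else_)
  open import Data.Bool.Properties using () renaming (_≟_ to _≟ᵇ_)
  open import Data.Nat using () renaming (_+_ to _+ⁿ_)
  open import Relation.Nullary using (does)
  open Lattice
  open Covers
  open Darts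
  open import Data.Bool using (_∨_)
  open import Data.List using (List; []; _∷_; _++_; map; concatMap)
  open import Data.Bool.ListAction using (all; any)
  open import Data.List.Relation.Unary.All using (All; []; _∷_; lookup)
  open import Data.List.Relation.Unary.All.Properties using (++⁻ˡ; ++⁻ʳ)
  open import Data.List.Membership.Propositional using (_∈_)
  open import Data.List.Relation.Unary.Any using (here; there)
  open import Data.Unit using (tt)
  open import Relation.Nullary.Decidable using (dec-true)

  differ : ℕ → ℕ → Bool
  differ a b = not (a ℕ.≡ᵇ b)

  differ₄ : ℕ → ℕ → ℕ → ℕ → Bool
  differ₄ a b c d = differ a c ∧ differ a d ∧ differ b c ∧ differ b d

  -- Rim edges on side t lie in a different number of closed walks than spokes.
  separates : (ℤ → ℤ → Bool) → ℕ → Bool → Bool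
  separates χ ℓ t = differ₄ (w t fwd) (w t bwd) (w false spk) (w true spk)
    where w = closedWalks χ ℓ

  -- One side suffices: at a vertex on which both rim edges stay rim edges, the spoke has only the
  -- spoke left.
  separated : (ℤ → ℤ → Bool) → ℕ → Bool
  separated χ ℓ = separates χ ℓ false ∨ separates χ ℓ true

  allBelow : ℕ → (ℕ → Bool) → Bool
  allBelow zero    f = true
  allBelow (suc m) f = f m ∧ allBelow m f

  -- The seven edge-transitive generalised Petersen graphs, where no count can distinguish a spoke
  -- from a rim edge.
  exceptions : List (ℕ × ℕ)
  exceptions = (5 , 2) ∷ (4 , 1) ∷ (8 , 3) ∷ (10 , 3) ∷ (12 , 5) ∷ (24 , 5) ∷ (10 , 2) ∷ []

  exceptional : ℕ → ℕ → Bool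
  exceptional n k = any (λ (a , b) → (n ℕ.≡ᵇ a) ∧ (k ℕ.≡ᵇ b)) exceptions

  -- The first two alternatives discard the pairs violating 1 ≤ k and 2k < n; length 10 is evaluated
  -- only where length 8 fails.
  small-ok : ℕ → ℕ → Bool
  small-ok n k = (k ℕ.≤ᵇ 0) ∨ (n ℕ.≤ᵇ 2 ℕ.* k) ∨ exceptional n k ∨ separated (χ n k) 8 ∨ separated (χ n k) 10

  -- From n < 65 and 2k < n follows k < 33, so the table is complete.
  small-check : allBelow 65 (λ n → allBelow 33 (small-ok n)) ≡ true
  small-check = refl

  ∧-true : ∀ {a b} → a ∧ b ≡ true → a ≡ true × b ≡ true
  ∧-true {true} {true} _ = refl , refl

  ∨-true : ∀ {a b} → a ∨ b ≡ true → a ≡ true ⊎ b ≡ true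
  ∨-true {true}  e = inj₁ refl
  ∨-true {false} e = inj₂ e

  allBelow-sound : ∀ m {f} → allBelow m f ≡ true → ∀ {i} → i ℕ.< m → f i ≡ true
  allBelow-sound (suc m) {f} e {i} (s≤s i≤m) with ∧-true e | ℕ.m≤n⇒m<n∨m≡n i≤m
  ... | a , b | inj₂ refl = a
  ... | a , b | inj₁ i<m  = allBelow-sound m b i<m

  all-sound : ∀ {X : Set} {f : X → Bool} {xs} → all f xs ≡ true → All (λ x → f x ≡ true) xs
  all-sound {xs = []} e = []
  all-sound {xs = x ∷ xs} e with ∧-true e
  ... | a , b = a ∷ all-sound b

  any-sound : ∀ {X : Set} {f : X → Bool} {xs} → any f xs ≡ true → ∃ λ x → x ∈ xs × f x ≡ true
  any-sound {f = f} {x ∷ xs} e with f x in fx | any-sound {f = f} {xs}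
  ... | true  | _ = x , here refl , fx
  ... | false | r with r e
  ...   | y , y∈ , fy = y , there y∈ , fy

  T≡ : ∀ {b} → b ≡ true → Data.Bool.T b
  T≡ refl = tt

  differ-sound : ∀ a b → differ a b ≡ true → a ≢ b
  differ-sound a .a e refl with a ℕ.≡ᵇ a in eq
  ... | false = subst Data.Bool.T eq (ℕ.≡⇒≡ᵇ a a refl)

  differ₄-sound : ∀ {a b c d} → differ₄ a b c d ≡ true → (a ≢ c × a ≢ d) × (b ≢ c × b ≢ d)
  differ₄-sound {a} {b} {c} {d} e with ∧-true {differ a c} e
  ... | e₁ , e₂₃₄ with ∧-true {differ a d} e₂₃₄
  ...   | e₂ , e₃₄ with ∧-true {differ b c} e₃₄
  ...     | e₃ , e₄ = (differ-sound a c e₁ , differ-sound a d e₂) , (differ-sound b c e₃ , differ-sound b d e₄)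

  cong₄ : ∀ {X Y : Set} (h : X → X → X → X → Y) {a a′ b b′ c c′ d d′} →
          a ≡ a′ → b ≡ b′ → c ≡ c′ → d ≡ d′ → h a b c d ≡ h a′ b′ c′ d′
  cong₄ h refl refl refl refl = refl

  -- The displacements of the walks of length ℓ ending in a translate of their first dart.
  ends : Bool → Slot → ℕ → P → Slot → List (ℤ × ℤ)
  ends t₀ s₀ zero (t , p , q) s = if does (t ≟ᵇ t₀) ∧ does (s ≟ˢ s₀) then (p , q) ∷ [] else []
  ends t₀ s₀ (suc ℓ) a s = ends t₀ s₀ ℓ (nb s a) (turn₁ s) ++ ends t₀ s₀ ℓ (nb s a) (turn₂ s)

  Agree : (χ χ′ : ℤ → ℤ → Bool) → ℤ × ℤ → Set
  Agree χ χ′ (p , q) = χ p q ≡ χ′ p q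

  count-agree : ∀ {χ χ′} t₀ s₀ ℓ a s → All (Agree χ χ′) (ends t₀ s₀ ℓ a s) →
                count (returns χ t₀ s₀) ℓ a s ≡ count (returns χ′ t₀ s₀) ℓ a s
  count-agree t₀ s₀ zero (t , p , q) s ag with does (t ≟ᵇ t₀) | does (s ≟ˢ s₀)
  ... | false | _     = refl
  ... | true  | false = refl
  count-agree t₀ s₀ zero (t , p , q) s (e ∷ []) | true | true = cong indicator e
  count-agree t₀ s₀ (suc ℓ) a s ag = cong₂ _+ⁿ_
    (count-agree t₀ s₀ ℓ (nb s a) (turn₁ s) (++⁻ˡ _ ag))
    (count-agree t₀ s₀ ℓ (nb s a) (turn₂ s) (++⁻ʳ (ends t₀ s₀ ℓ (nb s a) (turn₁ s)) ag))

  _≡ᶻ_ : ℤ → ℤ → Bool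
  a ≡ᶻ b = does (a ℤ.≟ b)

  _≡²_ : ℤ × ℤ → ℤ × ℤ → Bool
  (a , b) ≡² (c , d) = (a ≡ᶻ c) ∧ (b ≡ᶻ d)

  ≡²-sound : ∀ {x y} → x ≡² y ≡ true → x ≡ y
  ≡²-sound {a , b} {c , d} e with a ℤ.≟ c | b ℤ.≟ d
  ... | yes refl | yes refl = refl
  ≡²-sound {a , b} {c , d} () | yes _ | no _
  ≡²-sound {a , b} {c , d} () | no _ | _

  ≡²-refl : ∀ x → x ≡² x ≡ true
  ≡²-refl (a , b) with a ℤ.≟ a | b ℤ.≟ b
  ... | yes _ | yes _ = refl
  ... | yes _ | no n  = contradiction refl n
  ... | no n  | _     = contradiction refl n

  kinds : List (Bool × Slot)
  kinds = (false , fwd) ∷ (false , bwd) ∷ (false , spk) ∷ (true , fwd) ∷ (true , bwd) ∷ (true , spk) ∷ []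

  allEnds : List (ℤ × ℤ)
  allEnds = concatMap (λ (t , s) → ends t s 8 (t , 0ℤ , 0ℤ) s) kinds

  -- All nonzero displacements occurring in allEnds, in order of increasing norm;
  -- (1 , 1) and (1 , -1) are added so that differences of multiples of a shorter element are again listed.
  ball : List (ℤ × ℤ)
  ball = concatMap (λ (p , q) → (p , q) ∷ (- p , - q) ∷ [])
    ( (+ 2 , 0ℤ) ∷ (0ℤ , + 2) ∷ (+ 1 , + 1) ∷ (+ 1 , - + 1)
    ∷ (+ 2 , + 2) ∷ (+ 2 , - + 2)
    ∷ (+ 5 , + 1) ∷ (+ 5 , - + 1) ∷ (+ 4 , + 2) ∷ (+ 4 , - + 2) ∷ (+ 3 , + 3) ∷ (+ 3 , - + 3)
    ∷ (+ 2 , + 4) ∷ (+ 2 , - + 4) ∷ (+ 1 , + 5) ∷ (+ 1 , - + 5)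
    ∷ (+ 8 , 0ℤ) ∷ (0ℤ , + 8) ∷ [])

  zero² : ℤ × ℤ
  zero² = 0ℤ , 0ℤ

  ball-covers : all (λ z → (z ≡² zero²) ∨ any (z ≡²_) ball) allEnds ≡ true
  ball-covers = refl

  -- No listed vector is more than four times another one; the extreme case is (8 , 0) = 4 (2 , 0).
  factors : List ℤ
  factors = - + 4 ∷ - + 3 ∷ - + 2 ∷ - + 1 ∷ 0ℤ ∷ + 1 ∷ + 2 ∷ + 3 ∷ + 4 ∷ []

  scale : ℤ → ℤ × ℤ → ℤ × ℤ
  scale m (p , q) = m * p , m * q

  multiple : ℤ × ℤ → ℤ → ℤ → Bool
  multiple d p q = any (λ m → (p , q) ≡² scale m d) factors

  det : ℤ × ℤ → ℤ × ℤ → ℤ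
  det (p , q) (p′ , q′) = p * q′ - p′ * q

  minus : ℤ × ℤ → ℤ → ℤ × ℤ → ℤ × ℤ
  minus (p , q) m (p′ , q′) = p - m * p′ , q - m * q′

  -- Given that no element of pre is a relation, either z is a multiple of d, or not both d and z are relations when 64 < n.
  excluded : List (ℤ × ℤ) → ℤ × ℤ → ℤ × ℤ → Bool
  excluded pre d z = multiple d (proj₁ z) (proj₂ z)
    ∨ (differ 0 ∣ det d z ∣ ∧ (∣ det d z ∣ ℕ.≤ᵇ 64))
    ∨ any (λ m → any (minus z m d ≡²_) pre) factors

  excluded-all : List (ℤ × ℤ) → List (ℤ × ℤ) → Bool
  excluded-all pre []         = true
  excluded-all pre (d ∷ post) = all (excluded pre d) ball ∧ excluded-all (d ∷ pre) post

  excluded-check : excluded-all [] ball ≡ true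
  excluded-check = refl

  -- For large n the relations in `ball` are the multiples of one of its vectors, or there are none.
  -- Each of these finitely many patterns is evaluated.
  pattern-check : all (λ d → separated (multiple d) 8) (zero² ∷ ball) ≡ true
  pattern-check = refl

  does-true : ∀ {X : Set} (x? : Dec X) → does x? ≡ true → X
  does-true (yes x) _ = x

  -- The bound 64 is the largest absolute determinant of two vectors of `ball`, attained by (8 , 0)
  -- and (0 , 8). As n divides the determinant of any two relations, relations in `ball` are
  -- collinear beyond this bound.
  module LargeOrder {n k : ℕ} (64<n : 64 ℕ.< n) where

    private
      Rel : ℤ × ℤ → Set
      Rel (p , q) = Λ n k p q

      χ′ : ℤ × ℤ → Bool
      χ′ (p , q) = χ n k p q

      χ-true : ∀ {z} → χ′ z ≡ true → Rel z
      χ-true {p , q} = does-true (Λ? p q)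

      true-χ : ∀ {z} → Rel z → χ′ z ≡ true
      true-χ {p , q} = dec-true (Λ? p q)

      None : List (ℤ × ℤ) → Set
      None = All (λ z → χ′ z ≡ false)

      det-Λ : ∀ {d z} → Rel d → Rel z → + n ∣ det d z
      det-Λ {p , q} {p′ , q′} l l′ = combine q′ (- q) (Λ.n∣ l) (Λ.n∣ l′) (i p q p′ q′ (+ k))
        where
        i : ∀ p q p′ q′ k → p * q′ - p′ * q ≡ q′ * (p + q * k) + - q * (p′ + q′ * k)
        i = solve-∀

      scale-Λ : ∀ m {d} → Rel d → Rel (scale m d)
      scale-Λ m {p , q} l = Λ-comb m 0ℤ l l (i m p) (i m q)
        where
        i : ∀ m p → m * p ≡ m * p + 0ℤ * p
        i = solve-∀

      minus-Λ : ∀ {z} m {d} → Rel z → Rel d → Rel (minus z m d)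
      minus-Λ {p , q} m {p′ , q′} l l′ = Λ-comb 1ℤ (- m) l l′ (i p m p′) (i q m q′)
        where
        i : ∀ p m p′ → p - m * p′ ≡ 1ℤ * p + - m * p′
        i = solve-∀

      multiple-χ : ∀ {d} → Rel d → ∀ {z} → multiple d (proj₁ z) (proj₂ z) ≡ true → χ′ z ≡ true
      multiple-χ {d} l {z} e with any-sound {f = λ m → z ≡² scale m d} {factors} e
      ... | m , _ , eq = true-χ {z} (subst Rel (sym (≡²-sound {z} {scale m d} eq)) (scale-Λ m {d} l))

      excluded-sound : ∀ {pre d z} → None pre → Rel d → Rel z → excluded pre d z ≡ true →
                       multiple d (proj₁ z) (proj₂ z) ≡ true
      excluded-sound {pre} {d} {z} none l l′ e with ∨-true {multiple d (proj₁ z) (proj₂ z)} e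
      ... | inj₁ m = m
      ... | inj₂ e′ with ∨-true {differ 0 ∣ det d z ∣ ∧ (∣ det d z ∣ ℕ.≤ᵇ 64)} e′
      ...   | inj₂ a with any-sound {f = λ m → any (minus z m d ≡²_) pre} {factors} a
      ...     | m , _ , a′ with any-sound {f = minus z m d ≡²_} {pre} a′
      ...       | y , y∈ , eq = contradiction (trans (sym (lookup none y∈))
                    (trans (cong χ′ (sym (≡²-sound {minus z m d} {y} eq))) (true-χ {minus z m d} (minus-Λ {z} m {d} l′ l)))) λ ()
      excluded-sound {pre} {d} {z} none l l′ e | inj₂ e′ | inj₁ b with ∧-true b
      ... | nz , le = contradiction (small-multiple₀ n {{ℕ.>-nonZero 64<n′}} (∣⇒∣ᵤ (det-Λ {d} {z} l l′)) (ℕ.≤-<-trans (ℕ.≤ᵇ⇒≤ _ 64 (T≡ le)) 64<n))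
                       λ eq → differ-sound 0 _ nz (sym eq)
        where
        64<n′ : 0 ℕ.< n
        64<n′ = ℕ.≤-<-trans z≤n 64<n

      -- The list runs by increasing norm, and `pre` holds the vectors already known not to be
      -- relations. The first relation met has all others as multiples: a collinear vector that is
      -- not a multiple would differ from one by an element of `pre`.
      search : ∀ pre post → None pre → excluded-all pre post ≡ true →
        None post ⊎ ∃ λ d → d ∈ post × Rel d × All (λ z → χ′ z ≡ true → multiple d (proj₁ z) (proj₂ z) ≡ true) ball
      search pre [] none e = inj₁ []
      search pre (d ∷ post) none e with ∧-true e | χ′ d in eq
      ... | a , b | true = inj₂ (d , here refl , χ-true {d} eq ,
              Data.List.Relation.Unary.All.map (λ {z} ex c → excluded-sound {pre} {d} {z} none (χ-true {d} eq) (χ-true {z} c) ex) (all-sound a))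
      ... | a , b | false with search (d ∷ pre) post (eq ∷ none) b
      ...   | inj₁ none′ = inj₁ (eq ∷ none′)
      ...   | inj₂ (d′ , d∈ , rest) = inj₂ (d′ , there d∈ , rest)

      agree : ∀ d → Rel d → (∀ {z} → z ∈ ball → χ′ z ≡ true → multiple d (proj₁ z) (proj₂ z) ≡ true) →
              All (Agree (χ n k) (multiple d)) allEnds
      agree d l on-ball = Data.List.Relation.Unary.All.map (λ {z} → one z) (all-sound ball-covers)
        where
        same : ∀ {a b} → (a ≡ true → b ≡ true) → (b ≡ true → a ≡ true) → a ≡ b
        same {true}  {b} f g = sym (f refl)
        same {false} {true}  f g = g refl
        same {false} {false} f g = refl
        zero-multiple : multiple d 0ℤ 0ℤ ≡ true
        zero-multiple = any-∈ factors 0ℤ (there (there (there (there (here refl))))) (≡²-refl (0ℤ , 0ℤ))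
          where
          any-∈ : ∀ ms m → m ∈ ms → zero² ≡² scale m d ≡ true → any (λ m → zero² ≡² scale m d) ms ≡ true
          any-∈ (x ∷ ms) m (here refl) e rewrite e = refl
          any-∈ (x ∷ ms) m (there m∈) e with zero² ≡² scale x d
          ... | true  = refl
          ... | false = any-∈ ms m m∈ e
        one : ∀ z → (z ≡² zero²) ∨ any (z ≡²_) ball ≡ true → Agree (χ n k) (multiple d) z
        one z e with ∨-true {z ≡² zero²} e
        ... | inj₁ e₀ with ≡²-sound {z} {zero²} e₀
        ...   | refl = trans (true-χ {zero²} Λ-0) (sym zero-multiple)
        one z e | inj₂ e₁ with any-sound {f = z ≡²_} {ball} e₁
        ... | y , y∈ , eq with ≡²-sound {z} {y} eq
        ...   | refl = same (on-ball y∈) (multiple-χ {d} l {z})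

      agreement : ∃ λ d → d ∈ (zero² ∷ ball) × All (Agree (χ n k) (multiple d)) allEnds
      agreement with search [] ball [] excluded-check
      ... | inj₁ none = zero² , here refl , agree zero² Λ-0 λ {z} z∈ c → contradiction (trans (sym (lookup none z∈)) c) λ ()
      ... | inj₂ (d , d∈ , l , al) = d , there d∈ , agree d l λ z∈ → lookup al z∈

      part : ∀ {Q : ℤ × ℤ → Set} ks {t s} → (t , s) ∈ ks →
             All Q (concatMap (λ (t , s) → ends t s 8 (t , 0ℤ , 0ℤ) s) ks) → All Q (ends t s 8 (t , 0ℤ , 0ℤ) s)
      part (_ ∷ ks) (here refl) al = ++⁻ˡ _ al
      part ((t , s) ∷ ks) (there m) al = part ks m (++⁻ʳ (ends t s 8 (t , 0ℤ , 0ℤ) s) al)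

      kind∈ : ∀ t s → (t , s) ∈ kinds
      kind∈ false fwd = here refl
      kind∈ false bwd = there (here refl)
      kind∈ false spk = there (there (here refl))
      kind∈ true  fwd = there (there (there (here refl)))
      kind∈ true  bwd = there (there (there (there (here refl))))
      kind∈ true  spk = there (there (there (there (there (here refl)))))

    large-separated : separated (χ n k) 8 ≡ true
    large-separated = trans (cong₂ _∨_ (same false) (same true)) (lookup (all-sound {f = λ d → separated (multiple d) 8} {zero² ∷ ball} pattern-check) (proj₁ (proj₂ agreement)))
      where
      d : ℤ × ℤ
      d = proj₁ agreement
      w≡ : ∀ t s → closedWalks (χ n k) 8 t s ≡ closedWalks (multiple d) 8 t s
      w≡ t s = count-agree t s 8 (t , 0ℤ , 0ℤ) s (part kinds (kind∈ t s) (proj₂ (proj₂ agreement)))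
      same : ∀ t → separates (χ n k) 8 t ≡ separates (multiple d) 8 t
      same t = cong₄ differ₄ (w≡ t fwd) (w≡ t bwd) (w≡ false spk) (w≡ true spk)

  private
    first-true : ∀ {le ex s t : Bool} → le ∨ ex ∨ s ∨ t ≡ true → le ≡ false → ex ≡ false → s ≡ true ⊎ t ≡ true
    first-true {false} {false} {true}  e _ _ = inj₁ refl
    first-true {false} {false} {false} e _ _ = inj₂ e

    ≰ᵇ : ∀ {a b} → b ℕ.< a → (a ℕ.≤ᵇ b) ≡ false
    ≰ᵇ {a} {b} b<a with a ℕ.≤ᵇ b in eq
    ... | false = refl
    ... | true  = contradiction (ℕ.≤ᵇ⇒≤ a b (T≡ eq)) (ℕ.<⇒≱ b<a)

  separated-length : ∀ {n k} → 1 ℕ.≤ k → 2 ℕ.* k ℕ.< n → exceptional n k ≡ false →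
                     separated (χ n k) 8 ≡ true ⊎ separated (χ n k) 10 ≡ true
  separated-length {n} {suc k} 1≤k 2k<n exc with n ℕ.<? 65
  ... | no n≥65 = inj₁ (LargeOrder.large-separated {n} {suc k} (ℕ.≮⇒≥ n≥65))
  ... | yes n<65 = first-true {n ℕ.≤ᵇ 2 ℕ.* suc k} {exceptional n (suc k)} {separated (χ n (suc k)) 8} {separated (χ n (suc k)) 10}
      (allBelow-sound 33 {small-ok n} (allBelow-sound 65 {λ n → allBelow 33 (small-ok n)} small-check n<65) k<33) (≰ᵇ 2k<n) exc
    where
    k<33 : suc k ℕ.< 33
    k<33 = ℕ.*-cancelˡ-< 2 (suc k) 33 (ℕ.<-trans 2k<n (ℕ.<-≤-trans n<65 (ℕ.n≤1+n 65)))

  module _ {n k : ℕ} {V : Set} {_∼_ : V → V → Set} (C : Cover n k V _∼_)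
           (Λ20 : ¬ Λ n k (+ 2) 0ℤ) (Λ02 : ¬ Λ n k 0ℤ (+ 2)) (f : Auto V _∼_) where

    open Local C Λ20 Λ02
    open Image f

    private
      w : ℕ → Bool → Slot → ℕ
      w = closedWalks (χ n k)

      counts : ∀ ℓ t → separates (χ n k) ℓ t ≡ true →
               (w ℓ t fwd ≢ w ℓ false spk × w ℓ t fwd ≢ w ℓ true spk) ×
               (w ℓ t bwd ≢ w ℓ false spk × w ℓ t bwd ≢ w ℓ true spk)
      counts ℓ t = differ₄-sound {w ℓ t fwd} {w ℓ t bwd} {w ℓ false spk} {w ℓ true spk}

      never : ∀ ℓ t → separates (χ n k) ℓ t ≡ true → ∀ {p q b} d → ¬ Dart (t , p , q) (dir d) b spk
      never ℓ t e {b = false , _ , _} false D = proj₁ (proj₁ (counts ℓ t e)) (closedWalks-invariant ℓ D)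
      never ℓ t e {b = true  , _ , _} false D = proj₂ (proj₁ (counts ℓ t e)) (closedWalks-invariant ℓ D)
      never ℓ t e {b = false , _ , _} true  D = proj₁ (proj₂ (counts ℓ t e)) (closedWalks-invariant ℓ D)
      never ℓ t e {b = true  , _ , _} true  D = proj₂ (proj₂ (counts ℓ t e)) (closedWalks-invariant ℓ D)

    separated⇒spokes : ∀ ℓ → separated (χ n k) ℓ ≡ true → Spokes
    separated⇒spokes ℓ e = [ (λ s → spokes-from-side false (never ℓ false s)) , (λ s → spokes-from-side true (never ℓ true s)) ]′
      (∨-true {separates (χ n k) ℓ false} e)

    preserves-spokes : 1 ℕ.≤ k → 2 ℕ.* k ℕ.< n → exceptional n k ≡ false → Spokes
    preserves-spokes 1≤k 2k<n exc = [ separated⇒spokes 8 , separated⇒spokes 10 ]′ (separated-length 1≤k 2k<n exc)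

-- Affine maps as automorphisms, and words evaluated to affine maps.

module AffineMaps where

  open import Defs
  open Automorphisms
  open import Data.Nat as ℕ using (ℕ; zero; suc)
  import Data.Nat.Properties as ℕ
  open import Data.Integer using (ℤ; +_; 0ℤ; 1ℤ; -1ℤ; _+_; _-_; _*_; -_)
  import Data.Integer.Properties as ℤ
  open import Data.Integer.Tactic.RingSolver using (solve-∀)
  open import Data.Fin using (Fin; zero; suc)
  open import Data.Bool using (Bool; true; false; not; _xor_)
  open import Data.Product using (∃; _×_; _,_; proj₁; proj₂)
  open import Relation.Binary.PropositionalEquality using (_≡_; refl; sym; trans; cong; cong₂; subst; subst₂; module ≡-Reasoning)
  open Lattice
  open Covers
  open import Data.Bool.Properties using (not-involutive)
  open Darts
  open Words
  open Frames
  open import Data.List using (List; []; _∷_)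
  open Auto

  sg-+ : ∀ r x y → sg r (x + y) ≡ sg r x + sg r y
  sg-+ false x y = refl
  sg-+ true  x y = ℤ.neg-distrib-+ x y

  sg-sg : ∀ r s z → sg r (sg s z) ≡ sg (r xor s) z
  sg-sg false s z = refl
  sg-sg true false z = refl
  sg-sg true true  z = ℤ.neg-involutive z

  sg-invol : ∀ r z → sg r (sg r z) ≡ z
  sg-invol false z = refl
  sg-invol true  z = ℤ.neg-involutive z

  sg-neg : ∀ r z → sg r (- z) ≡ - sg r z
  sg-neg false z = refl
  sg-neg true  z = refl

  infixr 9 _∘ᴬ_
  _∘ᴬ_ : Affine → Affine → Affine
  affine false r r′ x y ∘ᴬ affine false s s′ x₂ y₂ = affine false (r xor s) (r′ xor s′) (x + sg r x₂) (y + sg r′ y₂)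
  affine false r r′ x y ∘ᴬ affine true  s s′ x₂ y₂ = affine true (r′ xor s) (r xor s′) (x + sg r x₂) (y + sg r′ y₂)
  affine true  r r′ x y ∘ᴬ affine false s s′ x₂ y₂ = affine true (r xor s) (r′ xor s′) (x + sg r′ y₂) (y + sg r x₂)
  affine true  r r′ x y ∘ᴬ affine true  s s′ x₂ y₂ = affine false (r′ xor s) (r xor s′) (x + sg r′ y₂) (y + sg r x₂)

  private
    chain : ∀ x r x₂ s z → x + sg r (x₂ + sg s z) ≡ x + sg r x₂ + sg (r xor s) z
    chain x r x₂ s z = begin
      x + sg r (x₂ + sg s z)             ≡⟨ cong (λ w → x + w) (sg-+ r x₂ (sg s z)) ⟩
      x + (sg r x₂ + sg r (sg s z))      ≡⟨ cong (λ w → x + (sg r x₂ + w)) (sg-sg r s z) ⟩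
      x + (sg r x₂ + sg (r xor s) z)     ≡⟨ ℤ.+-assoc x (sg r x₂) (sg (r xor s) z) ⟨
      x + sg r x₂ + sg (r xor s) z       ∎
      where open ≡-Reasoning

  ∘ᴬ-apply : ∀ α β a → applyA (α ∘ᴬ β) a ≡ applyA α (applyA β a)
  ∘ᴬ-apply (affine false r r′ x y) (affine false s s′ x₂ y₂) (t , p , q) =
    cong₂ (λ p q → t , p , q) (sym (chain x r x₂ s p)) (sym (chain y r′ y₂ s′ q))
  ∘ᴬ-apply (affine false r r′ x y) (affine true  s s′ x₂ y₂) (t , p , q) =
    cong₂ (λ p q → not t , p , q) (sym (chain x r x₂ s′ q)) (sym (chain y r′ y₂ s p))
  ∘ᴬ-apply (affine true  r r′ x y) (affine false s s′ x₂ y₂) (t , p , q) =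
    cong₂ (λ p q → not t , p , q) (sym (chain x r′ y₂ s′ q)) (sym (chain y r x₂ s p))
  ∘ᴬ-apply (affine true  r r′ x y) (affine true  s s′ x₂ y₂) (t , p , q) =
    cong₂ _,_ (sym (not-involutive t)) (cong₂ _,_ (sym (chain x r′ y₂ s p)) (sym (chain y r x₂ s′ q)))

  _⁻¹ᴬ : Affine → Affine
  affine false r r′ x y ⁻¹ᴬ = affine false r r′ (- sg r x) (- sg r′ y)
  affine true  r r′ x y ⁻¹ᴬ = affine true r′ r (- sg r y) (- sg r′ x)

  private
    undo : ∀ r x z → x + sg r (- sg r x + sg r z) ≡ z
    undo r x z = begin
      x + sg r (- sg r x + sg r z)             ≡⟨ cong (λ w → x + w) (sg-+ r (- sg r x) (sg r z)) ⟩
      x + (sg r (- sg r x) + sg r (sg r z))    ≡⟨ cong₂ (λ w z → x + (w + z)) (trans (sg-neg r (sg r x)) (cong -_ (sg-invol r x))) (sg-invol r z) ⟩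
      x + (- x + z)                            ≡⟨ i x z ⟩
      z ∎
      where
      open ≡-Reasoning
      i : ∀ x z → x + (- x + z) ≡ z
      i = solve-∀

    undo′ : ∀ r x z → - sg r x + sg r (x + sg r z) ≡ z
    undo′ r x z = begin
      - sg r x + sg r (x + sg r z)         ≡⟨ cong (λ w → - sg r x + w) (sg-+ r x (sg r z)) ⟩
      - sg r x + (sg r x + sg r (sg r z))  ≡⟨ cong (λ w → - sg r x + (sg r x + w)) (sg-invol r z) ⟩
      - sg r x + (sg r x + z)              ≡⟨ i (sg r x) z ⟩
      z ∎
      where
      open ≡-Reasoning
      i : ∀ x z → - x + (x + z) ≡ z
      i = solve-∀

  ⁻¹ᴬ-right : ∀ α a → applyA α (applyA (α ⁻¹ᴬ) a) ≡ a
  ⁻¹ᴬ-right (affine false r r′ x y) (t , p , q) = cong₂ (λ p q → t , p , q) (undo r x p) (undo r′ y q)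
  ⁻¹ᴬ-right (affine true  r r′ x y) (t , p , q) = cong₂ _,_ (not-involutive t) (cong₂ _,_ (undo r′ x p) (undo r y q))

  ⁻¹ᴬ-left : ∀ α a → applyA (α ⁻¹ᴬ) (applyA α a) ≡ a
  ⁻¹ᴬ-left (affine false r r′ x y) (t , p , q) = cong₂ (λ p q → t , p , q) (undo′ r x p) (undo′ r′ y q)
  ⁻¹ᴬ-left (affine true  r r′ x y) (t , p , q) = cong₂ _,_ (not-involutive t) (cong₂ _,_ (undo′ r y p) (undo′ r′ x q))

  Preserves : ℕ → ℕ → Bool → Bool → Bool → Set
  Preserves n k false r r′ = ∀ {p q} → Λ n k p q → Λ n k (sg r p) (sg r′ q)
  Preserves n k true  r r′ = ∀ {p q} → Λ n k p q → Λ n k (sg r′ q) (sg r p)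

  Linear : ℕ → ℕ → Affine → Set
  Linear n k (affine s r r′ x y) = Preserves n k s r r′

  translation : ℤ → ℤ → Affine
  translation = affine false false false

  negation : Affine
  negation = affine false true true 0ℤ 0ℤ

  module _ {n k : ℕ} where

    Λ-neg : ∀ {p q} → Λ n k p q → Λ n k (- p) (- q)
    Λ-neg l = Rel-neg false l refl refl

    Λ-sg : ∀ r {p q} → Λ n k p q → Λ n k (sg r p) (sg r q)
    Λ-sg false l = l
    Λ-sg true  l = Λ-neg l

    Λ-swap-sign : ∀ {p q} → Λ n k (- p) q → Λ n k p (- q)
    Λ-swap-sign {p} l = Rel-neg false l (sym (ℤ.neg-involutive p)) refl

    -- A signed permutation of two coordinates is its own inverse up to sign, and Λ is closed under
    -- negation.
    Linear-⁻¹ : ∀ α → Linear n k α → Linear n k (α ⁻¹ᴬ)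
    Linear-⁻¹ (affine false r r′ x y) L = L
    Linear-⁻¹ (affine true false false x y) L = L
    Linear-⁻¹ (affine true true  true  x y) L = L
    Linear-⁻¹ (affine true false true  x y) L l = Rel-neg false (L l) (sym (ℤ.neg-involutive _)) refl
    Linear-⁻¹ (affine true true  false x y) L l = Rel-neg false (L l) refl (sym (ℤ.neg-involutive _))

  module Affines {n k : ℕ} {V : Set} {_∼_ : V → V → Set} (C : Cover n k V _∼_) where

    open Cover C

    private
      rep : V → P
      rep z = proj₁ (onto z)
      pt-rep : ∀ z → pt (rep z) ≡ z
      pt-rep z = proj₂ (onto z)

      diff : ∀ x r p p′ → sg r (p - p′) ≡ x + sg r p - (x + sg r p′)
      diff x r p p′ = trans (sg-+ r p (- p′)) (trans (cong (λ w → sg r p + w) (sg-neg r p′)) (i x (sg r p) (sg r p′)))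
        where
        i : ∀ x p q → p + - q ≡ x + p - (x + q)
        i = solve-∀

    respects : ∀ α → Linear n k α → ∀ {a b} → pt a ≡ pt b → pt (applyA α a) ≡ pt (applyA α b)
    respects (affine s r r′ x y) L {t , p , q} {t′ , p′ , q′} e with pt-inj e
    respects (affine false r r′ x y) L {t , p , q} {t′ , p′ , q′} e | refl , l =
      pt-≡ (subst₂ (Λ n k) (diff x r p p′) (diff y r′ q q′) (L l))
    respects (affine true r r′ x y) L {t , p , q} {t′ , p′ , q′} e | refl , l =
      pt-≡ (subst₂ (Λ n k) (diff x r′ q q′) (diff y r p p′) (L l))

    private
      i+ : ∀ x p → x + p + 1ℤ ≡ x + (p + 1ℤ)
      i+ x p = ℤ.+-assoc x p 1ℤ
      i- : ∀ x p → x + p + -1ℤ ≡ x + (p + -1ℤ)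
      i- x p = ℤ.+-assoc x p -1ℤ
      j+ : ∀ x p → x + - p + -1ℤ ≡ x + - (p + 1ℤ)
      j+ = solve-∀
      j- : ∀ x p → x + - p + 1ℤ ≡ x + - (p + -1ℤ)
      j- = solve-∀

      slot-f : ∀ r x p → ∃ λ e → dir e ≡ dir r × x + sg r p + val e ≡ x + sg r (p + 1ℤ)
      slot-f false x p = false , refl , i+ x p
      slot-f true  x p = true , refl , j+ x p
      slot-b : ∀ r x p → ∃ λ e → dir e ≡ dir (not r) × x + sg r p + val e ≡ x + sg r (p + -1ℤ)
      slot-b false x p = true , refl , i- x p
      slot-b true  x p = false , refl , j- x p

    slot-image : ∀ α s a → ∃ λ s′ → nb s′ (applyA α a) ≡ applyA α (nb s a)
    slot-image (affine false r r′ x y) spk a = spk , refl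
    slot-image (affine true  r r′ x y) spk a = spk , refl
    slot-image (affine false r r′ x y) fwd (false , p , q) = let e , _ , eq = slot-f r x p in
      dir e , trans (nb-dir e _) (cong (λ z → false , z , y + sg r′ q) eq)
    slot-image (affine false r r′ x y) fwd (true , p , q) = let e , _ , eq = slot-f r′ y q in
      dir e , trans (nb-dir e _) (cong (λ z → true , x + sg r p , z) eq)
    slot-image (affine true r r′ x y) fwd (false , p , q) = let e , _ , eq = slot-f r y p in
      dir e , trans (nb-dir e _) (cong (λ z → true , x + sg r′ q , z) eq)
    slot-image (affine true r r′ x y) fwd (true , p , q) = let e , _ , eq = slot-f r′ x q in
      dir e , trans (nb-dir e _) (cong (λ z → false , z , y + sg r p) eq)
    slot-image (affine false r r′ x y) bwd (false , p , q) = let e , _ , eq = slot-b r x p in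
      dir e , trans (nb-dir e _) (cong (λ z → false , z , y + sg r′ q) eq)
    slot-image (affine false r r′ x y) bwd (true , p , q) = let e , _ , eq = slot-b r′ y q in
      dir e , trans (nb-dir e _) (cong (λ z → true , x + sg r p , z) eq)
    slot-image (affine true r r′ x y) bwd (false , p , q) = let e , _ , eq = slot-b r y p in
      dir e , trans (nb-dir e _) (cong (λ z → true , x + sg r′ q , z) eq)
    slot-image (affine true r r′ x y) bwd (true , p , q) = let e , _ , eq = slot-b r′ x q in
      dir e , trans (nb-dir e _) (cong (λ z → false , z , y + sg r p) eq)

    private
      on : Affine → V → V
      on α z = pt (applyA α (rep z))

      on-pt : ∀ α → Linear n k α → ∀ a → on α (pt a) ≡ pt (applyA α a)
      on-pt α L a = respects α L (pt-rep (pt a))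

      on-adj : ∀ α → Linear n k α → ∀ {x y} → x ∼ y → on α x ∼ on α y
      on-adj α L {x} {y} e with adj-nb (subst (_∼ y) (sym (pt-rep x)) e)
      ... | s , refl with slot-image α s (rep x)
      ...   | s′ , eq = subst (on α x ∼_) (trans (cong pt eq) (sym (on-pt α L (nb s (rep x))))) (nb-adj s′ (applyA α (rep x)))

    affine-auto : ∀ α → Linear n k α → Auto V _∼_
    affine-auto α L = record
      { to = on α ; from = on (α ⁻¹ᴬ)
      ; to-from = λ z → trans (on-pt α L _) (trans (cong pt (⁻¹ᴬ-right α (rep z))) (pt-rep z))
      ; from-to = λ z → trans (on-pt (α ⁻¹ᴬ) L⁻ _) (trans (cong pt (⁻¹ᴬ-left α (rep z))) (pt-rep z))
      ; to-adj = on-adj α L ; from-adj = on-adj (α ⁻¹ᴬ) L⁻ }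
      where
      L⁻ : Linear n k (α ⁻¹ᴬ)
      L⁻ = Linear-⁻¹ α L

    module Generated {g : ℕ} (R : List (Word g × Word g)) (γ : Fin g → Affine) (lin : ∀ x → Linear n k (γ x)) where

      open WordAction R (λ x → affine-auto (γ x) (lin x)) public

      -- Translation parts stay integral here. A relation of a presentation is then verified by
      -- comparing the linear parts and testing one difference for membership in Λ.
      eval : Word g → Affine
      eval []                = translation 0ℤ 0ℤ
      eval ((x , false) ∷ w) = γ x ∘ᴬ eval w
      eval ((x , true) ∷ w)  = (γ x ⁻¹ᴬ) ∘ᴬ eval w

      private
        id-apply : ∀ a → applyA (translation 0ℤ 0ℤ) a ≡ a
        id-apply (t , p , q) = cong₂ (λ p q → t , p , q) (ℤ.+-identityˡ p) (ℤ.+-identityˡ q)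

      word-pt : ∀ w a → to (word w) (pt a) ≡ pt (applyA (eval w) a)
      word-pt [] a = cong pt (sym (id-apply a))
      word-pt ((x , false) ∷ w) a = trans (cong (on (γ x)) (word-pt w a))
        (trans (on-pt (γ x) (lin x) _) (cong pt (sym (∘ᴬ-apply (γ x) (eval w) a))))
      word-pt ((x , true) ∷ w) a = trans (cong (on (γ x ⁻¹ᴬ)) (word-pt w a))
        (trans (on-pt (γ x ⁻¹ᴬ) (Linear-⁻¹ (γ x) (lin x)) _) (cong pt (sym (∘ᴬ-apply (γ x ⁻¹ᴬ) (eval w) a))))

      data _≃_ : Affine → Affine → Set where
        agree : ∀ {s r r′ x y x′ y′} → Λ n k (x - x′) (y - y′) → affine s r r′ x y ≃ affine s r r′ x′ y′

      ≃-apply : ∀ {α β} → α ≃ β → ∀ a → pt (applyA α a) ≡ pt (applyA β a)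
      ≃-apply (agree {false} {r} {r′} {x} {y} {x′} {y′} l) (t , p , q) =
        pt-≡ (subst₂ (Λ n k) (i x x′ (sg r p)) (i y y′ (sg r′ q)) l)
        where
        i : ∀ x y p → x - y ≡ x + p - (y + p)
        i = solve-∀
      ≃-apply (agree {true} {r} {r′} {x} {y} {x′} {y′} l) (t , p , q) =
        pt-≡ (subst₂ (Λ n k) (i x x′ (sg r′ q)) (i y y′ (sg r p)) l)
        where
        i : ∀ x y p → x - y ≡ x + p - (y + p)
        i = solve-∀

      same-action : ∀ w α → eval w ≃ α → (f : Auto V _∼_) → (∀ a → to f (pt a) ≡ pt (applyA α a)) →
                    ∀ z → to (word w) z ≡ to f z
      same-action w α e f h z with onto z
      ... | a , refl = trans (word-pt w a) (trans (≃-apply e a) (sym (h a)))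

      Holds : Word g × Word g → Set
      Holds (l , r) = eval l ≃ eval r

      valid : ∀ {lr} → Holds lr → Valid lr
      valid {l , r} e = same-action l (eval r) e (word r) (word-pt r)

      shiftA : ℤ → ℤ → Affine → Affine
      shiftA x y (affine s r r′ x′ y′) = affine s r r′ (x + x′) (y + y′)

      eval-pow : ∀ x {a b} → γ x ≡ translation a b → ∀ m w → eval ((gen x ^w m) · w) ≡ shiftA (+ m * a) (+ m * b) (eval w)
      eval-pow x {a} {b} e zero w with eval w
      ... | affine s r r′ x′ y′ = cong₂ (affine s r r′) (i a x′) (i b y′)
        where
        i : ∀ a x → x ≡ 0ℤ * a + x
        i = solve-∀
      eval-pow x {a} {b} e (suc m) w = trans (cong (_∘ᴬ eval ((gen x ^w m) · w)) e)
        (trans (cong (translation a b ∘ᴬ_) (eval-pow x e m w)) (one (eval w)))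
        where
        i : ∀ a m x → a + (m * a + x) ≡ (1ℤ + m) * a + x
        i = solve-∀
        one : ∀ α → translation a b ∘ᴬ shiftA (+ m * a) (+ m * b) α ≡ shiftA (+ suc m * a) (+ suc m * b) α
        one (affine false r r′ x′ y′) = cong₂ (affine false r r′) (i a (+ m) x′) (i b (+ m) y′)
        one (affine true  r r′ x′ y′) = cong₂ (affine true r r′) (i a (+ m) x′) (i b (+ m) y′)

      ≡⇒≃ : ∀ {α β} → α ≡ β → α ≃ β
      ≡⇒≃ {affine s r r′ x y} refl = agree (subst₂ (Λ n k) (i x) (i y) Λ-0)
        where
        i : ∀ x → 0ℤ ≡ x - x
        i = solve-∀

      ≃-shift : ∀ x y {α β} → α ≃ β → shiftA x y α ≃ shiftA x y β
      ≃-shift x y (agree {x = x₁} {y₁} {x₂} {y₂} l) = agree (subst₂ (Λ n k) (i x x₁ x₂) (i y y₁ y₂) l)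
        where
        i : ∀ x x₁ x₂ → x₁ - x₂ ≡ x + x₁ - (x + x₂)
        i = solve-∀

      ≃-trans : ∀ {α β ζ} → α ≃ β → β ≃ ζ → α ≃ ζ
      ≃-trans (agree {x = x₁} {y₁} {x₂} {y₂} l) (agree {x′ = x₃} {y₃} l′) =
        agree (Λ-comb 1ℤ 1ℤ l l′ (i x₁ x₂ x₃) (i y₁ y₂ y₃))
        where
        i : ∀ x y z → x - z ≡ 1ℤ * (x - y) + 1ℤ * (y - z)
        i = solve-∀

      -- A map exchanging the sides fixes no vertex, since the side of a point can be read off from
      -- its vertex.
      trivial-action : ∀ w {s r r′ x y} → eval w ≃ affine s r r′ x y → (∀ z → to (word w) z ≡ z) →
                       s ≡ false × (∀ p q → Λ n k (x + sg r p - p) (y + sg r′ q - q))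
      trivial-action w {false} e h = refl , λ p q →
        proj₂ (pt-inj (trans (sym (≃-apply e (false , p , q))) (trans (sym (word-pt w (false , p , q))) (h _))))
      trivial-action w {true} e h with
        pt-inj (trans (sym (≃-apply e (false , 0ℤ , 0ℤ))) (trans (sym (word-pt w (false , 0ℤ , 0ℤ))) (h _)))
      ... | () , _

    -- Points that differ by a relation lie over one vertex and so have images over one vertex.
    -- Comparing a relation with the origin isolates the linear part.
    image-linear : (f : Auto V _∼_) → ∀ α → (∀ a → to f (pt a) ≡ pt (applyA α a)) → Linear n k α
    image-linear f (affine false r r′ x y) h {p} {q} l = subst₂ (Λ n k)
        (trans (sym (diff x r p 0ℤ)) (cong (sg r) (ℤ.+-identityʳ p))) (trans (sym (diff y r′ q 0ℤ)) (cong (sg r′) (ℤ.+-identityʳ q)))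
        (proj₂ (pt-inj (trans (sym (h (false , p , q))) (trans (cong (to f) (pt-≡ l₀)) (h (false , 0ℤ , 0ℤ))))))
      where
      l₀ : Λ n k (p - 0ℤ) (q - 0ℤ)
      l₀ = subst₂ (Λ n k) (sym (ℤ.+-identityʳ p)) (sym (ℤ.+-identityʳ q)) l
    image-linear f (affine true r r′ x y) h {p} {q} l = subst₂ (Λ n k)
        (trans (sym (diff x r′ q 0ℤ)) (cong (sg r′) (ℤ.+-identityʳ q))) (trans (sym (diff y r p 0ℤ)) (cong (sg r) (ℤ.+-identityʳ p)))
        (proj₂ (pt-inj (trans (sym (h (false , p , q))) (trans (cong (to f) (pt-≡ l₀)) (h (false , 0ℤ , 0ℤ))))))
      where
      l₀ : Λ n k (p - 0ℤ) (q - 0ℤ)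
      l₀ = subst₂ (Λ n k) (sym (ℤ.+-identityʳ p)) (sym (ℤ.+-identityʳ q)) l

-- Cyclic translation group: the groups F, J and H.

module CyclicGroups where

  open import Defs
  open Automorphisms
  open import Data.Nat as ℕ using (ℕ; suc; NonZero)
  import Data.Nat.Properties as ℕ
  import Data.Nat.Divisibility as ℕᵈ
  import Data.List.Relation.Unary.All
  open import Data.Integer using (ℤ; +_; 0ℤ; 1ℤ; -1ℤ; _+_; _-_; _*_; -_; ∣_∣) renaming (_%ℕ_ to _mod_; _/ℕ_ to _div_)
  import Data.Integer.Properties as ℤ
  open import Data.Integer.DivMod using (a≡a%ℕn+[a/ℕn]*n)
  open import Data.Integer.Divisibility.Signed using (_∣_; divides)
  open import Data.Integer.Tactic.RingSolver using (solve-∀)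
  open import Data.Fin using (Fin; suc)
  open import Data.Bool using (Bool; true; false; not; _xor_)
  open import Data.Product using (∃; _×_; _,_)
  open import Relation.Binary.PropositionalEquality using (_≡_; refl; sym; trans; cong; subst; subst₂)
  open import Relation.Nullary using (¬_; contradiction)
  open Lattice
  open Covers
  open Darts
  open Words
  open Frames
  open import Data.List using (List; []; _∷_)
  open NormalForms
  open AffineMaps
  open import Data.List.Relation.Unary.All using (All; []; _∷_)
  open import Data.List.Properties using (++-identityʳ)
  open Auto

  Rigid : ∀ {n k V _∼_} → Cover n k V _∼_ → Set
  Rigid {V = V} {_∼_} C = (f : Auto V _∼_) → ∃ λ α → ∀ a → to f (Cover.pt C a) ≡ Cover.pt C (applyA α a)

  -- diag, swap and rot stand for (p , q) ↦ (p , - q), (q , p) and (- q , p).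
  Diag Swap Rot : ℕ → ℕ → Set
  Diag n k = Preserves n k false false true
  Swap n k = Preserves n k true false false
  Rot  n k = Preserves n k true false true

  affineOf : Bool × Bool × Bool → ℤ → ℤ → Affine
  affineOf (s , r , r′) = affine s r r′

  module _ {n k : ℕ} where

    -- The eight signed permutation matrices fall into four classes modulo -1, which always
    -- preserves Λ.
    data Linearly : Bool → Bool → Bool → Set where
      scalar  : ∀ r → Linearly false r r
      diag    : ∀ {r} → Diag n k → Linearly false r (not r)
      swapped : ∀ {r} → Swap n k → Linearly true r r
      rotated : ∀ {r} → Rot n k → Linearly true r (not r)

    linearly : ∀ s r r′ → Preserves n k s r r′ → Linearly s r r′
    linearly false false false L = scalar false
    linearly false true  true  L = scalar true
    linearly false false true  L = diag L
    linearly false true  false L = diag (λ l → Rel-neg false (L l) (sym (ℤ.neg-involutive _)) refl)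
    linearly true  false false L = swapped L
    linearly true  true  true  L = swapped (λ l → Rel-neg false (L l) (sym (ℤ.neg-involutive _)) (sym (ℤ.neg-involutive _)))
    linearly true  false true  L = rotated L
    linearly true  true  false L = rotated (λ l → Rel-neg false (L l) refl (sym (ℤ.neg-involutive _)))

    swap-rot⇒diag : Swap n k → Rot n k → Diag n k
    swap-rot⇒diag S R l = Rel-neg false (R (S l)) (sym (ℤ.neg-involutive _)) refl

    scalar-preserves : ∀ r → Preserves n k false r r
    scalar-preserves r = Λ-sg r

  -- A map that fixes the origin and a unit vector modulo Λ cannot reverse this vector, whose double
  -- is not a relation.
  module FixedBasis {n k : ℕ} (Λ20 : ¬ Λ n k (+ 2) 0ℤ) (Λ02 : ¬ Λ n k 0ℤ (+ 2)) where

    fixes-first : ∀ r {x y} → Λ n k (x + sg r 0ℤ - 0ℤ) y → Λ n k (x + sg r 1ℤ - 1ℤ) y → r ≡ false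
    fixes-first false l₀ l₁ = refl
    fixes-first true {x} {y} l₀ l₁ = contradiction (Λ-comb 1ℤ -1ℤ l₀ l₁ (e x) (e′ y)) Λ20
      where
      e : ∀ x → + 2 ≡ 1ℤ * (x + 0ℤ - 0ℤ) + -1ℤ * (x + -1ℤ - 1ℤ)
      e = solve-∀
      e′ : ∀ y → 0ℤ ≡ 1ℤ * y + -1ℤ * y
      e′ = solve-∀

    fixes-second : ∀ r {x y} → Λ n k x (y + sg r 0ℤ - 0ℤ) → Λ n k x (y + sg r 1ℤ - 1ℤ) → r ≡ false
    fixes-second false l₀ l₁ = refl
    fixes-second true {x} {y} l₀ l₁ = contradiction (Λ-comb 1ℤ -1ℤ l₀ l₁ (e′ x) (e y)) Λ02
      where
      e : ∀ x → + 2 ≡ 1ℤ * (x + 0ℤ - 0ℤ) + -1ℤ * (x + -1ℤ - 1ℤ)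
      e = solve-∀
      e′ : ∀ y → 0ℤ ≡ 1ℤ * y + -1ℤ * y
      e′ = solve-∀

  -- The translations form the cyclic group ℤ²/Λ of order N generated by (1 , 0), and `k-rel` makes
  -- (0 , 1) the multiple k of the generator. With reflections of one coordinate ruled out, the
  -- linear parts are ±1, possibly joined by the exchanges or by the quarter turns.
  module Cyclic {n k : ℕ} {V : Set} {_∼_ : V → V → Set} (C : Cover n k V _∼_)
    (Λ20 : ¬ Λ n k (+ 2) 0ℤ) (Λ02 : ¬ Λ n k 0ℤ (+ 2))
    (N : ℕ) (N≢0 : ¬ (N ≡ 0)) (N-rel : Λ n k (+ N) 0ℤ) (order : ∀ i → Λ n k (+ i) 0ℤ → N ℕᵈ.∣ i)
    (k-rel : Λ n k (+ k) -1ℤ) (no-diag : ¬ Diag n k) (rigid : Rigid C) where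

    open Affines C
    open FixedBasis {n} {k} Λ20 Λ02

    private
      residue : ∀ x y → ∃ λ i → Λ n k (+ i * 1ℤ + 0ℤ - x) (+ i * 0ℤ + 0ℤ - y)
      residue x y = i , Λ-comb y (- c) k-rel N-rel
        (trans (e₁ (+ i) x) (trans (cong (_- x) (e₃ (x + + k * y) (+ i) (c * + N) (a≡a%ℕn+[a/ℕn]*n (x + + k * y) N))) (e₄ x (+ k) y c (+ N))))
        (e₂ (+ i) y c)
        where
        instance
          N≢0ⁱ : NonZero N
          N≢0ⁱ = ℕ.≢-nonZero N≢0
        i = (x + + k * y) mod N
        c = (x + + k * y) div N
        e₁ : ∀ i x → i * 1ℤ + 0ℤ - x ≡ i - x
        e₁ = solve-∀
        e₂ : ∀ i y c → i * 0ℤ + 0ℤ - y ≡ y * -1ℤ + - c * 0ℤ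
        e₂ = solve-∀
        e₃ : ∀ z i c → z ≡ i + c → i ≡ z - c
        e₃ z i c refl = e i c
          where
          e : ∀ i c → i ≡ i + c - c
          e = solve-∀
        e₄ : ∀ x k y c N → x + k * y - c * N - x ≡ y * k + - c * N
        e₄ = solve-∀

    module Presentation {g : ℕ} (R : List (Word (suc g) × Word (suc g))) (γ : Fin (suc g) → Affine)
      (lin : ∀ x → Linear n k (γ x)) (γ0 : γ #0 ≡ translation 1ℤ 0ℤ) where

      open Generated R γ lin public

      eval-ρ : ∀ i w → eval ((gen #0 ^w i) · w) ≡ shiftA (+ i * 1ℤ) (+ i * 0ℤ) (eval w)
      eval-ρ = eval-pow #0 γ0

      ρ-power : ∀ i → eval (gen #0 ^w i) ≡ translation (+ i * 1ℤ + 0ℤ) (+ i * 0ℤ + 0ℤ)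
      ρ-power i = trans (cong eval (sym (++-identityʳ (gen #0 ^w i)))) (eval-ρ i [])

      ρᴺ-holds : Holds ((gen #0 ^w N) , [])
      ρᴺ-holds = subst (_≃ translation 0ℤ 0ℤ) (sym (ρ-power N))
        (agree (Λ-comb 1ℤ 0ℤ N-rel N-rel (e (+ N)) (e′ (+ N))))
        where
        e : ∀ N → N * 1ℤ + 0ℤ - 0ℤ ≡ 1ℤ * N + 0ℤ * N
        e = solve-∀
        e′ : ∀ N → N * 0ℤ + 0ℤ - 0ℤ ≡ 1ℤ * 0ℤ + 0ℤ * 0ℤ
        e′ = solve-∀

      -- ρᵏ is the translation by b.
      ρᵏ-holds : ∀ w → eval w ≡ translation 0ℤ 1ℤ → Holds (w , (gen #0 ^w k))
      ρᵏ-holds w e = subst₂ _≃_ (sym e) (sym (ρ-power k))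
        (agree (Λ-comb -1ℤ 0ℤ k-rel k-rel (e₁ (+ k)) (e₂ (+ k))))
        where
        e₁ : ∀ k → 0ℤ - (k * 1ℤ + 0ℤ) ≡ -1ℤ * k + 0ℤ * k
        e₁ = solve-∀
        e₂ : ∀ k → 1ℤ - (k * 0ℤ + 0ℤ) ≡ -1ℤ * -1ℤ + 0ℤ * -1ℤ
        e₂ = solve-∀

      module _ {T : Set} (rep : T → Word (suc g)) (linear : T → Bool × Bool × Bool)
        (eval-rep : ∀ t → eval (rep t) ≡ affineOf (linear t) 0ℤ 0ℤ)
        (rep-trivial : ∀ t → linear t ≡ (false , false , false) → rep t ≡ [])
        (normal : ∀ w → ∃ λ i → ∃ λ t → Equiv R w ((gen #0 ^w i) · rep t))
        (reach : ∀ s r r′ → Linearly {n} {k} s r r′ → ∃ λ t → linear t ≡ (s , r , r′))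
        (relations : All Holds R) (ρᴺ : Equiv R (gen #0 ^w N) []) where

        open Sound (Data.List.Relation.Unary.All.map (λ {lr} → valid {lr}) relations)

        private
          eval-normal : ∀ i t {s r r′} → linear t ≡ (s , r , r′) →
            eval ((gen #0 ^w i) · rep t) ≡ affine s r r′ (+ i * 1ℤ + 0ℤ) (+ i * 0ℤ + 0ℤ)
          eval-normal i t refl = trans (eval-ρ i (rep t)) (cong (shiftA (+ i * 1ℤ) (+ i * 0ℤ)) (eval-rep t))

          -- A trivial action fixes both unit vectors, which makes the linear part trivial and
          -- leaves i as a multiple of the order N.
          fixed : ∀ i t {s r r′} → linear t ≡ (s , r , r′) → (∀ z → to (word ((gen #0 ^w i) · rep t)) z ≡ z) →
                  rep t ≡ [] × N ℕᵈ.∣ i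
          fixed i t {s} {r} {r′} eq h with trivial-action ((gen #0 ^w i) · rep t) (≡⇒≃ (eval-normal i t eq)) h
          ... | refl , triv with fixes-first r {+ i * 1ℤ + 0ℤ} {+ i * 0ℤ + 0ℤ + sg r′ 0ℤ - 0ℤ} (triv 0ℤ 0ℤ) (triv 1ℤ 0ℤ)
                          | fixes-second r′ {+ i * 1ℤ + 0ℤ + sg r 0ℤ - 0ℤ} {+ i * 0ℤ + 0ℤ} (triv 0ℤ 0ℤ) (triv 0ℤ 1ℤ)
          ...   | refl | refl = rep-trivial t eq , order i (subst₂ (Λ n k) (x₀ (+ i)) (y₀ (+ i)) (triv 0ℤ 0ℤ))
            where
            x₀ : ∀ i → i * 1ℤ + 0ℤ + 0ℤ - 0ℤ ≡ i
            x₀ = solve-∀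
            y₀ : ∀ i → i * 0ℤ + 0ℤ + 0ℤ - 0ℤ ≡ 0ℤ
            y₀ = solve-∀

          kernel : ∀ w → (∀ z → to (word w) z ≡ z) → Equiv R w []
          kernel w h = let i , t , e = normal w
                           t≡ , N∣i = fixed i t refl (λ z → trans (sym (word-cong e z)) (h z))
            in e-trans e (e-trans (≡⇒≈ (trans (cong ((gen #0 ^w i) ·_) t≡) (++-identityʳ _))) (multiple-of-order N∣i))
            where
            multiple-of-order : ∀ {i} → N ℕᵈ.∣ i → Equiv R (gen #0 ^w i) []
            multiple-of-order (ℕᵈ.divides c refl) = ^w-order ρᴺ c

          onto′ : (f : Auto V _∼_) → ∃ λ w → ∀ z → to (word w) z ≡ to f z
          onto′ f with rigid f
          ... | α@(affine s r r′ x y) , h with reach s r r′ (linearly s r r′ (image-linear f α h)) | residue x y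
          ...   | t , eq | i , l = (gen #0 ^w i) · rep t ,
            same-action ((gen #0 ^w i) · rep t) α (subst (_≃ α) (sym (eval-normal i t eq)) (agree l)) f h

        represents : Represents (Presented (suc g) R) V _∼_
        represents = presented kernel onto′

    representsF : ¬ Swap n k → ¬ Rot n k → Represents (F N) V _∼_
    representsF ¬S ¬R = represents rep₂ (λ d → false , d , d) (λ { false → refl ; true → refl })
      (λ { false e → refl ; true () }) (normal-F N≢0)
      (λ { _ _ _ (scalar r) → r , refl ; _ _ _ (diag D) → contradiction (λ {p} {q} → D {p} {q}) no-diag
         ; _ _ _ (swapped S) → contradiction (λ {p} {q} → S {p} {q}) ¬S ; _ _ _ (rotated R) → contradiction (λ {p} {q} → R {p} {q}) ¬R })
      (ρᴺ-holds ∷ agree Λ-0 ∷ agree Λ-0 ∷ []) (e-rel (1st refl))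
      where
      γ : Fin 2 → Affine
      γ #0 = translation 1ℤ 0ℤ
      γ #1 = negation
      lin : ∀ x → Linear n k (γ x)
      lin #0 = scalar-preserves false
      lin #1 = scalar-preserves true
      open Presentation _ γ lin refl

    -- The generator α is the exchange of the coordinates, which takes (1 , 0) to (0 , 1) and hence
    -- ρ to ρᵏ. A quarter turn is excluded, as its product with α would be a reflection of one
    -- coordinate.
    representsJ : Swap n k → Represents (J N k) V _∼_
    representsJ S = represents rep₃ (λ (d , a) → a , d , d)
      (λ { (false , false) → refl ; (true , false) → refl ; (false , true) → refl ; (true , true) → refl })
      (λ { (false , false) e → refl ; (true , _) () ; (false , true) () }) (normal-J N≢0 k)
      (λ { _ _ _ (scalar r) → (r , false) , refl ; _ _ _ (diag D) → contradiction (λ {p} {q} → D {p} {q}) no-diag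
         ; _ _ _ (swapped {r} _) → (r , true) , refl
         ; _ _ _ (rotated R) → contradiction (λ {p} {q} → swap-rot⇒diag S R {p} {q}) no-diag })
      (ρᴺ-holds ∷ agree Λ-0 ∷ agree Λ-0 ∷ agree Λ-0 ∷ ρᵏ-holds (gen #2 · gen #0 · gen #2) refl ∷ agree Λ-0 ∷ [])
      (e-rel (1st refl))
      where
      γ : Fin 3 → Affine
      γ #0 = translation 1ℤ 0ℤ
      γ #1 = negation
      γ #2 = affine true false false 0ℤ 0ℤ
      lin : ∀ x → Linear n k (γ x)
      lin #0 = scalar-preserves false
      lin #1 = scalar-preserves true
      lin #2 = S
      open Presentation _ γ lin refl

    -- The generator α is the quarter turn (p , q) ↦ (- q , p). Its square is the inversion, which
    -- therefore needs no generator of its own.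
    representsH : Rot n k → Represents (H N k) V _∼_
    representsH R = represents repᴴ (λ (d , a) → a , d , d xor a)
      (λ { (false , false) → refl ; (true , false) → refl ; (false , true) → refl ; (true , true) → refl })
      (λ { (false , false) e → refl ; (true , _) () ; (false , true) () }) (normal-H N≢0 k)
      (λ { _ _ _ (scalar false) → (false , false) , refl ; _ _ _ (scalar true) → (true , false) , refl
         ; _ _ _ (diag D) → contradiction (λ {p} {q} → D {p} {q}) no-diag
         ; _ _ _ (swapped S) → contradiction (λ {p} {q} → swap-rot⇒diag S R {p} {q}) no-diag
         ; _ _ _ (rotated {false} _) → (false , true) , refl ; _ _ _ (rotated {true} _) → (true , true) , refl })
      (ρᴺ-holds ∷ agree Λ-0 ∷ ρᵏ-holds (gen #1 · gen #0 · gen⁻¹ #1) refl ∷ [])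
      (e-rel (1st refl))
      where
      γ : Fin 2 → Affine
      γ #0 = translation 1ℤ 0ℤ
      γ #1 = affine true false true 0ℤ 0ℤ
      lin : ∀ x → Linear n k (γ x)
      lin #0 = scalar-preserves false
      lin #1 = R
      open Presentation _ γ lin refl

-- Translation group ℤ/n × ℤ/2: the groups K, N, L and M.

module BicyclicGroups where

  open import Defs
  open Automorphisms
  open import Data.Nat as ℕ using (ℕ; ⌊_/2⌋; suc; NonZero; s≤s)
  import Data.Nat.Properties as ℕ
  import Data.Nat.Divisibility as ℕᵈ
  import Data.List.Relation.Unary.All
  open import Data.Integer using (ℤ; +_; 0ℤ; 1ℤ; -1ℤ; _+_; _-_; _*_; -_; ∣_∣) renaming (_%ℕ_ to _mod_; _/ℕ_ to _div_)
  import Data.Integer.Properties as ℤ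
  open import Data.Integer.DivMod using (n%ℕd<d; a≡a%ℕn+[a/ℕn]*n)
  open import Data.Integer.Divisibility.Signed using (_∣_; divides; ∣⇒∣ᵤ)
  open import Data.Integer.Tactic.RingSolver using (solve-∀)
  open import Data.Fin using (Fin; suc)
  open import Data.Bool using (Bool; true; false; not; _xor_)
  open import Data.Product using (∃; _×_; _,_; proj₁; proj₂)
  open import Relation.Binary.PropositionalEquality using (_≡_; refl; sym; trans; cong; cong₂; subst)
  open import Relation.Nullary using (¬_; contradiction)
  open Lattice
  open Covers
  open Darts
  open Words
  open Frames
  open import Data.List using (List; []; _∷_)
  open NormalForms
  open AffineMaps
  open import Data.List.Relation.Unary.All using (All; []; _∷_)
  open import Data.List.Properties using (++-identityʳ)
  open CyclicGroups
  open Auto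

  bit : Bool → ℤ
  bit false = 0ℤ
  bit true  = 1ℤ

  -- Here ρ and β are the translations by (1 , 0) and (0 , 1) in ℤ/n × ℤ/2, where a = (1 , 1) and b = (k , 1).
  module Bicyclic {n k : ℕ} {V : Set} {_∼_ : V → V → Set} (C : Cover n k V _∼_)
    (Λ20 : ¬ Λ n k (+ 2) 0ℤ) (Λ02 : ¬ Λ n k 0ℤ (+ 2))
    (n≢0 : ¬ (n ≡ 0)) (n≡ : + n ≡ + ⌊ n /2⌋ * + 2) (e : ℤ) (k≡ : + k ≡ e * + 2) (rigid : Rigid C) where

    open Affines C
    open FixedBasis {n} {k} Λ20 Λ02

    private
      κ N½ ν : ℤ
      κ = + k
      N½ = + ⌊ n /2⌋
      ν = + n

      ν-2N½ : ν - N½ * + 2 ≡ 0ℤ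
      ν-2N½ = ℤ.i≡j⇒i-j≡0 n≡

    ρ-step β-step : Affine
    ρ-step = translation (1ℤ - κ) 1ℤ
    β-step = translation (- κ) 1ℤ

    -- A relation is certified by writing it as a combination of n, of an expression z known to vanish, and of even numbers.
    certify : ∀ {z} → z ≡ 0ℤ → ∀ {x y} c m b l → x + y * κ ≡ c * ν + z → x + y ≡ m * + 2 + b * κ + l * ν → Λ n k x y
    certify refl c m b l p q = divides c (trans p (ℤ.+-identityʳ (c * ν))) & divides (m + b * e + l * N½)
      (trans q (trans (cong₂ (λ K N → m * + 2 + b * K + l * N) k≡ n≡) (i m b l e N½)))
      where
      i : ∀ m b l e h → m * + 2 + b * (e * + 2) + l * (h * + 2) ≡ (m + b * e + l * h) * + 2
      i = solve-∀

    private
      zero-relation : ∀ {x y} → x ≡ 0ℤ → y ≡ 0ℤ → Λ n k x y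
      zero-relation refl refl = Λ-0

      ρⁿ-relation : Λ n k (ν * (1ℤ - κ) + 0ℤ - 0ℤ) (ν * 1ℤ + 0ℤ - 0ℤ)
      ρⁿ-relation = certify refl 1ℤ 0ℤ 0ℤ (+ 2 - κ) (i ν κ) (j ν κ)
        where
        i : ∀ N K → N * (1ℤ - K) + 0ℤ - 0ℤ + (N * 1ℤ + 0ℤ - 0ℤ) * K ≡ 1ℤ * N + 0ℤ
        i = solve-∀
        j : ∀ N K → N * (1ℤ - K) + 0ℤ - 0ℤ + (N * 1ℤ + 0ℤ - 0ℤ) ≡ 0ℤ * + 2 + 0ℤ * K + (+ 2 - K) * N
        j = solve-∀

      β²-relation : ∀ {x} → x ≡ - + 2 * κ → Λ n k x (+ 2)
      β²-relation refl = certify refl 0ℤ 1ℤ (- + 2) 0ℤ (i κ ν) (j κ ν)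
        where
        i : ∀ K N → - + 2 * K + + 2 * K ≡ 0ℤ * N + 0ℤ
        i = solve-∀
        j : ∀ K N → - + 2 * K + + 2 ≡ 1ℤ * + 2 + - + 2 * K + 0ℤ * N
        j = solve-∀

      β-square : ∀ K → - K + (- K + 0ℤ) - 0ℤ ≡ - + 2 * K
      β-square = solve-∀
      δρδ-zero : ∀ K → 0ℤ + - (1ℤ - K + 0ℤ) - (- (1ℤ - K) + 0ℤ) ≡ 0ℤ
      δρδ-zero = solve-∀
      βρβ-square : ∀ K → - K + (1ℤ - K + (- K + 0ℤ)) - (1ℤ - K + 0ℤ) ≡ - + 2 * K
      βρβ-square = solve-∀
      βδβ-zero : ∀ K → - K + (0ℤ + - (- K + 0ℤ)) - 0ℤ ≡ 0ℤ
      βδβ-zero = solve-∀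

      -- The exponents are the images of (x , y) under (p , q) ↦ (p + qk , p + q) in ℤ/n × ℤ/2; as k
      -- is even, this map takes the two steps to the standard generators.
      coordinates : ∀ x y → ∃ λ i → ∃ λ d → Λ n k (+ i * (1ℤ - κ) + bit d * - κ - x) (+ i * 1ℤ + bit d - y)
      coordinates x y = i , d , certify₂
        where
        instance
          n≢0ⁱ : NonZero n
          n≢0ⁱ = ℕ.≢-nonZero n≢0
        i = (x + κ * y) mod n
        c = (x + κ * y) div n
        parity : ∀ z → ∃ λ d → ∃ λ m → bit d - z ≡ m * + 2
        parity z with z mod 2 | z div 2 | a≡a%ℕn+[a/ℕn]*n z 2 | n%ℕd<d z 2
        ... | 0 | m | refl | _ = false , - m , j m
          where
          j : ∀ m → 0ℤ - (0ℤ + m * + 2) ≡ - m * + 2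
          j = solve-∀
        ... | 1 | m | refl | _ = true , - m , j m
          where
          j : ∀ m → 1ℤ - (1ℤ + m * + 2) ≡ - m * + 2
          j = solve-∀
        ... | suc (suc _) | _ | _ | s≤s (s≤s ())
        d = proj₁ (parity (x + y))
        m = proj₁ (proj₂ (parity (x + y)))
        i≡ : x + κ * y - + i - c * ν ≡ 0ℤ
        i≡ = trans (cong (λ z → z - + i - c * ν) (a≡a%ℕn+[a/ℕn]*n (x + κ * y) n)) (e₀ (+ i) (c * ν))
          where
          e₀ : ∀ i c → i + c - i - c ≡ 0ℤ
          e₀ = solve-∀
        d≡ : bit d - (x + y) - m * + 2 ≡ 0ℤ
        d≡ = ℤ.i≡j⇒i-j≡0 (proj₂ (proj₂ (parity (x + y))))
        certify₂ : Λ n k (+ i * (1ℤ - κ) + bit d * - κ - x) (+ i * 1ℤ + bit d - y)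
        certify₂ = divides (- c) (trans (e₁ (+ i) κ (bit d) x y c ν) (trans (cong (λ z → - c * ν + - z) i≡) (ℤ.+-identityʳ (- c * ν)))) &
          divides (+ i + m + e * (- + i - bit d)) (trans (e₂ (+ i) κ (bit d) x y m)
            (trans (cong₂ (λ K z → + i * + 2 + K * (- + i - bit d) + m * + 2 + z) k≡ d≡) (e₃ (+ i) e (bit d) m)))
          where
          e₁ : ∀ i K d x y c N → i * (1ℤ - K) + d * - K - x + (i * 1ℤ + d - y) * K ≡ - c * N + - (x + K * y - i - c * N)
          e₁ = solve-∀
          e₂ : ∀ i K d x y m → i * (1ℤ - K) + d * - K - x + (i * 1ℤ + d - y) ≡ i * + 2 + K * (- i - d) + m * + 2 + (d - (x + y) - m * + 2)
          e₂ = solve-∀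
          e₃ : ∀ i e d m → i * + 2 + e * + 2 * (- i - d) + m * + 2 + 0ℤ ≡ (i + m + e * (- i - d)) * + 2
          e₃ = solve-∀

      independent : ∀ i d → Λ n k (+ i * (1ℤ - κ) + bit d * - κ + 0ℤ - 0ℤ) (+ i * 1ℤ + bit d + 0ℤ - 0ℤ) → d ≡ false × n ℕᵈ.∣ i
      independent i d (n∣ & 2∣) = even d (combine 1ℤ (- (- + i - bit d)) 2∣ (divides e k≡) (e₁ (+ i) κ (bit d))) ,
        ∣⇒∣ᵤ (combine 1ℤ 0ℤ n∣ n∣ (e₀ (+ i) κ (bit d)))
        where
        e₀ : ∀ i K d → i ≡ 1ℤ * (i * (1ℤ - K) + d * - K + 0ℤ - 0ℤ + (i * 1ℤ + d + 0ℤ - 0ℤ) * K) +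
                           0ℤ * (i * (1ℤ - K) + d * - K + 0ℤ - 0ℤ + (i * 1ℤ + d + 0ℤ - 0ℤ) * K)
        e₀ = solve-∀
        e₁ : ∀ i K d → + 2 * i + d ≡ 1ℤ * (i * (1ℤ - K) + d * - K + 0ℤ - 0ℤ + (i * 1ℤ + d + 0ℤ - 0ℤ)) + - (- i - d) * K
        e₁ = solve-∀
        even : ∀ d → + 2 ∣ + 2 * + i + bit d → d ≡ false
        even false _ = refl
        even true  l = contradiction (combine 1ℤ (- + i) l (divides 1ℤ refl) (j (+ i))) (2∤1 0ℤ)
          where
          j : ∀ i → 0ℤ + 1ℤ - 0ℤ ≡ 1ℤ * (+ 2 * i + 1ℤ) + - i * + 2
          j = solve-∀

    module Presentation {g : ℕ} (R : List (Word (suc g) × Word (suc g))) (γ : Fin (suc g) → Affine)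
      (lin : ∀ x → Linear n k (γ x)) (γ0 : γ #0 ≡ ρ-step) where

      open Generated R γ lin public

      eval-ρ : ∀ i w → eval ((gen #0 ^w i) · w) ≡ shiftA (+ i * (1ℤ - κ)) (+ i * 1ℤ) (eval w)
      eval-ρ = eval-pow #0 γ0

      ρ-power : ∀ i → eval (gen #0 ^w i) ≡ translation (+ i * (1ℤ - κ) + 0ℤ) (+ i * 1ℤ + 0ℤ)
      ρ-power i = trans (cong eval (sym (++-identityʳ (gen #0 ^w i)))) (eval-ρ i [])

      holds-ρ : ∀ {l} i → eval l ≃ translation (+ i * (1ℤ - κ) + 0ℤ) (+ i * 1ℤ + 0ℤ) → Holds (l , (gen #0 ^w i))
      holds-ρ i = subst (_ ≃_) (sym (ρ-power i))

      holds-ρ· : ∀ {l} i w → eval l ≃ shiftA (+ i * (1ℤ - κ)) (+ i * 1ℤ) (eval w) → Holds (l , ((gen #0 ^w i) · w))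
      holds-ρ· i w = subst (_ ≃_) (sym (eval-ρ i w))

      ρⁿ-holds : Holds ((gen #0 ^w n) , [])
      ρⁿ-holds = subst (_≃ translation 0ℤ 0ℤ) (sym (ρ-power n)) (agree ρⁿ-relation)

      -- `level` is the exponent of β in the translation part of a representative. It can differ
      -- from the exponent in the word, because the fourth generators of L and M contain a β.
      -- Evaluation holds only modulo Λ, since δ turns the step of β into its negative.
      module _ {T : Set} (rep : T → Word (suc g)) (linear : T → Bool × Bool × Bool) (level : T → Bool)
        (eval-rep : ∀ t → eval (rep t) ≃ affineOf (linear t) (bit (level t) * - κ) (bit (level t)))
        (rep-trivial : ∀ t → linear t ≡ (false , false , false) → level t ≡ false → rep t ≡ [])
        (normal : ∀ w → ∃ λ i → ∃ λ t → Equiv R w ((gen #0 ^w i) · rep t))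
        (reach : ∀ s r r′ d → Linearly {n} {k} s r r′ → ∃ λ t → linear t ≡ (s , r , r′) × level t ≡ d)
        (relations : All Holds R) (ρⁿ : Equiv R (gen #0 ^w n) []) where

        open Sound (Data.List.Relation.Unary.All.map (λ {lr} → valid {lr}) relations)

        private
          eval-normal : ∀ i t {s r r′ d} → linear t ≡ (s , r , r′) → level t ≡ d →
            eval ((gen #0 ^w i) · rep t) ≃ affine s r r′ (+ i * (1ℤ - κ) + bit d * - κ) (+ i * 1ℤ + bit d)
          eval-normal i t refl refl = ≃-trans (≡⇒≃ (eval-ρ i (rep t))) (≃-shift (+ i * (1ℤ - κ)) (+ i * 1ℤ) (eval-rep t))

          fixed : ∀ i t {s r r′ d} → linear t ≡ (s , r , r′) → level t ≡ d → (∀ z → to (word ((gen #0 ^w i) · rep t)) z ≡ z) →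
                  rep t ≡ [] × n ℕᵈ.∣ i
          fixed i t {s} {r} {r′} {d} eq eq′ h with trivial-action ((gen #0 ^w i) · rep t) (eval-normal i t eq eq′) h
          ... | refl , triv
            with fixes-first r {+ i * (1ℤ - κ) + bit d * - κ} {+ i * 1ℤ + bit d + sg r′ 0ℤ - 0ℤ} (triv 0ℤ 0ℤ) (triv 1ℤ 0ℤ)
               | fixes-second r′ {+ i * (1ℤ - κ) + bit d * - κ + sg r 0ℤ - 0ℤ} {+ i * 1ℤ + bit d} (triv 0ℤ 0ℤ) (triv 0ℤ 1ℤ)
          ...   | refl | refl = let d≡ , n∣i = independent i d (triv 0ℤ 0ℤ) in rep-trivial t eq (trans eq′ d≡) , n∣i

          kernel : ∀ w → (∀ z → to (word w) z ≡ z) → Equiv R w []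
          kernel w h = let i , t , e = normal w
                           t≡ , n∣i = fixed i t refl refl (λ z → trans (sym (word-cong e z)) (h z))
            in e-trans e (e-trans (≡⇒≈ (trans (cong ((gen #0 ^w i) ·_) t≡) (++-identityʳ _))) (multiple-of-order n∣i))
            where
            multiple-of-order : ∀ {i} → n ℕᵈ.∣ i → Equiv R (gen #0 ^w i) []
            multiple-of-order (ℕᵈ.divides c refl) = ^w-order ρⁿ c

          onto′ : (f : Auto V _∼_) → ∃ λ w → ∀ z → to (word w) z ≡ to f z
          onto′ f with rigid f
          ... | α@(affine s r r′ x y) , h with coordinates x y
          ...   | i , d , l with reach s r r′ d (linearly s r r′ (image-linear f α h))
          ...     | t , eq , eq′ = (gen #0 ^w i) · rep t ,
            same-action ((gen #0 ^w i) · rep t) α (≃-trans (eval-normal i t eq eq′) (agree l)) f h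

        represents : Represents (Presented (suc g) R) V _∼_
        represents = presented kernel onto′

    private
      β-bit : ∀ κ → - κ + 0ℤ - 1ℤ * - κ ≡ 0ℤ
      β-bit = solve-∀
      ββ-bit : ∀ κ → - κ + (- κ + 0ℤ) - 0ℤ ≡ - + 2 * κ
      ββ-bit = solve-∀
      δβ-bit : ∀ κ → 0ℤ + - (- κ + 0ℤ) - 1ℤ * - κ ≡ + 2 * κ
      δβ-bit = solve-∀
      δββ-bit : ∀ κ → 0ℤ + - (- κ + (- κ + 0ℤ)) - 0ℤ ≡ + 2 * κ
      δββ-bit = solve-∀

      β⁻²-relation : ∀ {x} → x ≡ + 2 * κ → Λ n k x (- + 2)
      β⁻²-relation refl = Λ-swap-sign (β²-relation (i κ))
        where
        i : ∀ κ → - (+ 2 * κ) ≡ - + 2 * κ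
        i = solve-∀

      not-xor-true : ∀ d → not d xor true ≡ d
      not-xor-true false = refl
      not-xor-true true  = refl

      xor-true : ∀ d → d xor true ≡ not d
      xor-true false = refl
      xor-true true  = refl

      xor-false : ∀ d → d xor false ≡ d
      xor-false false = refl
      xor-false true  = refl

    representsK : ¬ Diag n k → ¬ Swap n k → ¬ Rot n k → Represents (K n k) V _∼_
    representsK ¬D ¬S ¬R = represents rep₃ (λ (d , b) → false , d , d) (λ (d , b) → b)
      (λ { (false , false) → agree Λ-0 ; (true , false) → agree Λ-0
         ; (false , true) → agree (zero-relation (β-bit κ) refl) ; (true , true) → agree (β⁻²-relation (δβ-bit κ)) })
      (λ { (false , false) _ _ → refl ; (false , true) _ () ; (true , _) () })
      (normal-K n≢0 k)
      (λ { _ _ _ d (scalar r) → (r , d) , refl , refl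
         ; _ _ _ _ (diag D) → contradiction (λ {p} {q} → D {p} {q}) ¬D
         ; _ _ _ _ (swapped S) → contradiction (λ {p} {q} → S {p} {q}) ¬S
         ; _ _ _ _ (rotated R) → contradiction (λ {p} {q} → R {p} {q}) ¬R })
      (ρⁿ-holds ∷ agree Λ-0 ∷ agree (β²-relation (β-square κ)) ∷ agree (zero-relation (δρδ-zero κ) refl)
        ∷ agree (β²-relation (βρβ-square κ)) ∷ agree (zero-relation (βδβ-zero κ) refl) ∷ [])
      (e-rel (1st refl))
      where
      γ : Fin 3 → Affine
      γ #0 = ρ-step
      γ #1 = negation
      γ #2 = β-step
      lin : ∀ x → Linear n k (γ x)
      lin #0 = scalar-preserves false
      lin #1 = scalar-preserves true
      lin #2 = scalar-preserves false
      open Presentation _ γ lin refl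

    -- The generator θ is the reflection (p , q) ↦ (p , - q). It takes the step (1 - k , 1) of ρ to
    -- (1 - k , - 1), which is the element 1 - 2k of ℤ/n, equal to 2k + 1 because n = 4k.
    representsN : n ≡ 4 ℕ.* k → Diag n k → ¬ Swap n k → Represents (N n k) V _∼_
    representsN n≡4k D ¬S = represents rep₄ (λ (d , b , l) → false , d , d xor l) (λ (d , b , l) → b)
      (λ { (false , false , false) → agree Λ-0 ; (true , false , false) → agree Λ-0
         ; (false , true , false) → agree (zero-relation (β-bit κ) refl) ; (true , true , false) → agree (β⁻²-relation (δβ-bit κ))
         ; (false , false , true) → agree Λ-0 ; (true , false , true) → agree Λ-0
         ; (false , true , true) → agree (zero-relation (β-bit κ) refl) ; (true , true , true) → agree (β⁻²-relation (δβ-bit κ)) })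
      (λ { (false , false , false) _ _ → refl ; (false , true , _) _ () ; (true , _ , _) () ; (false , false , true) () })
      (normal-N n≢0 k)
      (λ { _ _ _ d (scalar r) → (r , d , false) , cong (λ x → false , r , x) (xor-false r) , refl
         ; _ _ _ d (diag {r} _) → (r , d , true) , cong (λ x → false , r , x) (xor-true r) , refl
         ; _ _ _ _ (swapped S) → contradiction (λ {p} {q} → S {p} {q}) ¬S
         ; _ _ _ _ (rotated R) → contradiction (λ {p} {q} l → subst (λ z → Λ n k z p) (ℤ.neg-involutive q) (R (D l))) ¬S })
      (ρⁿ-holds ∷ agree Λ-0 ∷ agree (β²-relation (β-square κ)) ∷ agree Λ-0 ∷ agree (zero-relation (δρδ-zero κ) refl)
        ∷ agree (β²-relation (βρβ-square κ)) ∷ agree (zero-relation (βδβ-zero κ) refl)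
        ∷ holds-ρ {gen #3 · gen #0 · gen #3} (2 ℕ.* k ℕ.+ 1) (agree θρθ)
        ∷ agree Λ-0
        ∷ holds-ρ· {gen #3 · gen #2 · gen #3} ⌊ n /2⌋ (gen #2) (agree θβθ) ∷ [])
      (e-rel (1st refl))
      where
      γ : Fin 4 → Affine
      γ #0 = ρ-step
      γ #1 = negation
      γ #2 = β-step
      γ #3 = affine false false true 0ℤ 0ℤ
      lin : ∀ x → Linear n k (γ x)
      lin #0 = scalar-preserves false
      lin #1 = scalar-preserves true
      lin #2 = scalar-preserves false
      lin #3 = D
      open Presentation _ γ lin refl
      m : ℤ
      m = + (2 ℕ.* k ℕ.+ 1)
      m≡ : m ≡ + 2 * κ + 1ℤ
      m≡ = trans (ℤ.pos-+ (2 ℕ.* k) 1) (cong (_+ 1ℤ) (ℤ.pos-* 2 k))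
      z≡ : ν - + 4 * κ + - (m - (+ 2 * κ + 1ℤ)) ≡ 0ℤ
      z≡ = cong₂ (λ x y → x + - y) (ℤ.i≡j⇒i-j≡0 (trans (cong +_ n≡4k) (ℤ.pos-* 4 k))) (ℤ.i≡j⇒i-j≡0 m≡)
      θρθ : Λ n k (0ℤ + (1ℤ - κ + 0ℤ) - (m * (1ℤ - κ) + 0ℤ)) (-1ℤ - (m * 1ℤ + 0ℤ))
      θρθ = certify z≡ -1ℤ (- m) (m - 1ℤ) 0ℤ (i m κ ν) (j m κ ν)
        where
        i : ∀ m κ ν → 0ℤ + (1ℤ - κ + 0ℤ) - (m * (1ℤ - κ) + 0ℤ) + (-1ℤ - (m * 1ℤ + 0ℤ)) * κ
                      ≡ -1ℤ * ν + (ν - + 4 * κ + - (m - (+ 2 * κ + 1ℤ)))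
        i = solve-∀
        j : ∀ m κ ν → 0ℤ + (1ℤ - κ + 0ℤ) - (m * (1ℤ - κ) + 0ℤ) + (-1ℤ - (m * 1ℤ + 0ℤ)) ≡ - m * + 2 + (m - 1ℤ) * κ + 0ℤ * ν
        j = solve-∀
      N½≡ : N½ ≡ + 2 * κ
      N½≡ = ℤ.*-cancelʳ-≡ N½ (+ 2 * κ) (+ 2) (trans (sym n≡) (trans (cong +_ n≡4k) (trans (ℤ.pos-* 4 k) (i κ))))
        where
        i : ∀ κ → + 4 * κ ≡ + 2 * κ * + 2
        i = solve-∀
      z≡′ : - (N½ - + 2 * κ) + (ν - N½ * + 2) + (N½ - + 2 * κ) + (N½ - + 2 * κ) ≡ 0ℤ
      z≡′ = cong₂ (λ x y → - x + y + x + x) (ℤ.i≡j⇒i-j≡0 N½≡) ν-2N½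
      θβθ : Λ n k (0ℤ + (- κ + 0ℤ) - (N½ * (1ℤ - κ) + (- κ + 0ℤ))) (-1ℤ - (N½ * 1ℤ + 1ℤ))
      θβθ = certify z≡′ -1ℤ (- N½ - 1ℤ) N½ 0ℤ (i N½ κ ν) (j N½ κ ν)
        where
        i : ∀ H κ ν → 0ℤ + (- κ + 0ℤ) - (H * (1ℤ - κ) + (- κ + 0ℤ)) + (-1ℤ - (H * 1ℤ + 1ℤ)) * κ
                      ≡ -1ℤ * ν + (- (H - + 2 * κ) + (ν - H * + 2) + (H - + 2 * κ) + (H - + 2 * κ))
        i = solve-∀
        j : ∀ H κ ν → 0ℤ + (- κ + 0ℤ) - (H * (1ℤ - κ) + (- κ + 0ℤ)) + (-1ℤ - (H * 1ℤ + 1ℤ)) ≡ (- H - 1ℤ) * + 2 + H * κ + 0ℤ * ν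
        j = solve-∀

    module _ (c : ℤ) where
      private
        -- For relations into which k² enters once, next to a further n/2: the two halves add up to
        -- n.
        half-relation : ∀ {x y z} → z ≡ 0ℤ → ∀ m b →
          x + y * κ ≡ - (N½ + (N½ + c * ν)) + z → x + y ≡ m * + 2 + b * κ → Λ n k x y
        half-relation {x} {y} {z} z≡ m b p q = certify {z + (ν - N½ * + 2)} (cong₂ _+_ z≡ ν-2N½) (- (1ℤ + c)) m b 0ℤ
          (trans p (i N½ ν c z)) (trans q (j ν (m * + 2 + b * κ)))
          where
          i : ∀ H ν c z → - (H + (H + c * ν)) + z ≡ - (1ℤ + c) * ν + (z + (ν - H * + 2))
          i = solve-∀
          j : ∀ ν a → a ≡ a + 0ℤ * ν
          j = solve-∀

        -- For relations into which k² enters twice: the half n/2 is doubled to n.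
        double-relation : ∀ {x y z} → z ≡ 0ℤ → ∀ m b →
          x + y * κ ≡ + 2 * (N½ + c * ν) + z → x + y ≡ m * + 2 + b * κ → Λ n k x y
        double-relation {x} {y} {z} z≡ m b p q = certify {z + - (ν - N½ * + 2)} (cong₂ (λ x y → x + - y) z≡ ν-2N½) (1ℤ + + 2 * c) m b 0ℤ
          (trans p (i N½ ν c z)) (trans q (j ν (m * + 2 + b * κ)))
          where
          i : ∀ H ν c z → + 2 * (H + c * ν) + z ≡ (1ℤ + + 2 * c) * ν + (z + - (ν - H * + 2))
          i = solve-∀
          j : ∀ ν a → a ≡ a + 0ℤ * ν
          j = solve-∀

      -- The generator λ is the exchange of the coordinates followed by β. Its square is the
      -- translation by (1 - k , 1 - k), the element 1 - k² = n/2 of ℤ/n.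
      representsL : κ * κ ≡ 1ℤ + (N½ + c * ν) → 1 ℕ.≤ k → Swap n k → ¬ Diag n k → Represents (L n k) V _∼_
      representsL κ²≡ 1≤k S ¬D = represents rep₄ (λ (d , b , l) → l , d , d) (λ (d , b , l) → b xor l)
        (λ { (false , false , false) → agree Λ-0 ; (true , false , false) → agree Λ-0
           ; (false , true , false) → agree (zero-relation (β-bit κ) refl) ; (true , true , false) → agree (β⁻²-relation (δβ-bit κ))
           ; (false , false , true) → agree (zero-relation (β-bit κ) refl) ; (true , false , true) → agree (β⁻²-relation (δβ-bit κ))
           ; (false , true , true) → agree (β²-relation (ββ-bit κ)) ; (true , true , true) → agree (β⁻²-relation (δββ-bit κ)) })
        (λ { (false , false , false) _ _ → refl ; (false , true , false) _ () ; (true , _ , false) () ; (_ , _ , true) () })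
        (normal-L n≢0 k)
        (λ { _ _ _ d (scalar r) → (r , d , false) , refl , xor-false d
           ; _ _ _ d (diag D) → contradiction (λ {p} {q} → D {p} {q}) ¬D
           ; _ _ _ d (swapped {r} _) → (r , not d , true) , refl , not-xor-true d
           ; _ _ _ _ (rotated R) → contradiction (λ {p} {q} → swap-rot⇒diag S R {p} {q}) ¬D })
        (ρⁿ-holds ∷ agree Λ-0 ∷ agree (β²-relation (β-square κ)) ∷ agree λ⁴ ∷ agree (zero-relation (δρδ-zero κ) refl)
          ∷ agree (β²-relation (βρβ-square κ)) ∷ agree (zero-relation (βδβ-zero κ) refl)
          ∷ holds-ρ {gen⁻¹ #3 · gen #0 · gen #3} (k ℕ.* k ℕ.+ k ℕ.∸ 1) (agree λρλ)
          ∷ agree λδλ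
          ∷ holds-ρ· {gen⁻¹ #3 · gen #2 · gen #3} ⌊ n /2⌋ (gen #2) (agree λβλ)
          ∷ holds-ρ {gen #3 ^w 2} ⌊ n /2⌋ (agree λ²) ∷ [])
        (e-rel (1st refl))
        where
        γ : Fin 4 → Affine
        γ #0 = ρ-step
        γ #1 = negation
        γ #2 = β-step
        γ #3 = affine true false false (- κ) 1ℤ
        lin : ∀ x → Linear n k (γ x)
        lin #0 = scalar-preserves false
        lin #1 = scalar-preserves true
        lin #2 = scalar-preserves false
        lin #3 = S
        open Presentation _ γ lin refl
        Q : ℤ
        Q = κ * κ - (1ℤ + (N½ + c * ν))
        Q≡0 : Q ≡ 0ℤ
        Q≡0 = ℤ.i≡j⇒i-j≡0 κ²≡
        m : ℤ
        m = + (k ℕ.* k ℕ.+ k ℕ.∸ 1)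
        m≡ : m - (κ * κ + κ - 1ℤ) ≡ 0ℤ
        m≡ = ℤ.i≡j⇒i-j≡0 (predecessor (k ℕ.* k ℕ.+ k) (ℕ.≤-trans 1≤k (ℕ.m≤n+m k (k ℕ.* k)))
          (trans (ℤ.pos-+ (k ℕ.* k) k) (cong (_+ κ) (ℤ.pos-* k k))))
          where
          predecessor : ∀ a → 1 ℕ.≤ a → ∀ {z} → + a ≡ z → + (a ℕ.∸ 1) ≡ z - 1ℤ
          predecessor (suc a) _ refl = refl
        λ⁴ : Λ n k (- κ + (1ℤ + (- κ + 1ℤ)) - 0ℤ) (1ℤ + (- κ + (1ℤ + (- κ + 0ℤ))) - 0ℤ)
        λ⁴ = Λ-neg′ (double-relation (cong (+ 2 *_) Q≡0) (- + 2) (+ 4) (i κ N½ ν c) (j κ))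
          where
          Λ-neg′ : Λ n k (- + 2 + + 2 * κ) (- + 2 + + 2 * κ) → Λ n k (- κ + (1ℤ + (- κ + 1ℤ)) - 0ℤ) (1ℤ + (- κ + (1ℤ + (- κ + 0ℤ))) - 0ℤ)
          Λ-neg′ l = Rel-neg false l (e₁ κ) (e₂ κ)
            where
            e₁ : ∀ κ → - κ + (1ℤ + (- κ + 1ℤ)) - 0ℤ ≡ - (- + 2 + + 2 * κ)
            e₁ = solve-∀
            e₂ : ∀ κ → 1ℤ + (- κ + (1ℤ + (- κ + 0ℤ))) - 0ℤ ≡ - (- + 2 + + 2 * κ)
            e₂ = solve-∀
          i : ∀ κ H ν c → - + 2 + + 2 * κ + (- + 2 + + 2 * κ) * κ ≡ + 2 * (H + c * ν) + + 2 * (κ * κ - (1ℤ + (H + c * ν)))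
          i = solve-∀
          j : ∀ κ → - + 2 + + 2 * κ + (- + 2 + + 2 * κ) ≡ - + 2 * + 2 + + 4 * κ
          j = solve-∀
        λρλ : Λ n k (1ℤ - (m * (1ℤ - κ) + 0ℤ)) (- (- κ) + (1ℤ - κ + (- κ + 0ℤ)) - (m * 1ℤ + 0ℤ))
        λρλ = Rel-neg false (double-relation (cong₂ (λ x y → + 2 * x + y) Q≡0 m≡) (m - 1ℤ) (1ℤ - m) (i m κ N½ ν c) (j m κ)) (e₁ m κ) (e₂ m κ)
          where
          e₁ : ∀ m κ → 1ℤ - (m * (1ℤ - κ) + 0ℤ) ≡ - (m * (1ℤ - κ) - 1ℤ)
          e₁ = solve-∀
          e₂ : ∀ m κ → - (- κ) + (1ℤ - κ + (- κ + 0ℤ)) - (m * 1ℤ + 0ℤ) ≡ - (m - 1ℤ + κ)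
          e₂ = solve-∀
          i : ∀ m κ H ν c → m * (1ℤ - κ) - 1ℤ + (m - 1ℤ + κ) * κ
                ≡ + 2 * (H + c * ν) + (+ 2 * (κ * κ - (1ℤ + (H + c * ν))) + (m - (κ * κ + κ - 1ℤ)))
          i = solve-∀
          j : ∀ m κ → m * (1ℤ - κ) - 1ℤ + (m - 1ℤ + κ) ≡ (m - 1ℤ) * + 2 + (1ℤ - m) * κ
          j = solve-∀
        λδλ : Λ n k (- + 2) (- (- κ) + (0ℤ + - (- κ + 0ℤ)) - 0ℤ)
        λδλ = double-relation (cong (+ 2 *_) Q≡0) -1ℤ (+ 2) (i κ N½ ν c) (j κ)
          where
          i : ∀ κ H ν c → - + 2 + (- (- κ) + (0ℤ + - (- κ + 0ℤ)) - 0ℤ) * κ ≡ + 2 * (H + c * ν) + + 2 * (κ * κ - (1ℤ + (H + c * ν)))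
          i = solve-∀
          j : ∀ κ → - + 2 + (- (- κ) + (0ℤ + - (- κ + 0ℤ)) - 0ℤ) ≡ -1ℤ * + 2 + + 2 * κ
          j = solve-∀
        λβλ : Λ n k (1ℤ - (N½ * (1ℤ - κ) + (- κ + 0ℤ))) (- (- κ) + (- κ + (- κ + 0ℤ)) - (N½ * 1ℤ + 1ℤ))
        λβλ = half-relation (cong -_ Q≡0) (- N½) N½ (i κ N½ ν c) (j κ N½)
          where
          i : ∀ κ H ν c → 1ℤ - (H * (1ℤ - κ) + (- κ + 0ℤ)) + (- (- κ) + (- κ + (- κ + 0ℤ)) - (H * 1ℤ + 1ℤ)) * κ
                ≡ - (H + (H + c * ν)) + - (κ * κ - (1ℤ + (H + c * ν)))
          i = solve-∀
          j : ∀ κ H → 1ℤ - (H * (1ℤ - κ) + (- κ + 0ℤ)) + (- (- κ) + (- κ + (- κ + 0ℤ)) - (H * 1ℤ + 1ℤ)) ≡ - H * + 2 + H * κ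
          j = solve-∀
        λ² : Λ n k (- κ + 1ℤ - (N½ * (1ℤ - κ) + 0ℤ)) (1ℤ + (- κ + 0ℤ) - (N½ * 1ℤ + 0ℤ))
        λ² = half-relation (cong -_ Q≡0) (1ℤ - N½) (N½ - + 2) (i κ N½ ν c) (j κ N½)
          where
          i : ∀ κ H ν c → - κ + 1ℤ - (H * (1ℤ - κ) + 0ℤ) + (1ℤ + (- κ + 0ℤ) - (H * 1ℤ + 0ℤ)) * κ
                ≡ - (H + (H + c * ν)) + - (κ * κ - (1ℤ + (H + c * ν)))
          i = solve-∀
          j : ∀ κ H → - κ + 1ℤ - (H * (1ℤ - κ) + 0ℤ) + (1ℤ + (- κ + 0ℤ) - (H * 1ℤ + 0ℤ)) ≡ (1ℤ - H) * + 2 + (H - + 2) * κ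
          j = solve-∀

      -- The generator τ is the quarter turn (p , q) ↦ (q , - p) followed by β. Its square is the
      -- inversion followed by the translation by (1 - k , 1 + k), the element 1 + k² = n/2 of ℤ/n.
      representsM : κ * κ + 1ℤ ≡ N½ + c * ν → Rot n k → ¬ Diag n k → Represents (M n k) V _∼_
      representsM κ²≡ R ¬D = represents rep₄ (λ (d , b , l) → l , d xor l , d) (λ (d , b , l) → b xor l)
        (λ { (false , false , false) → agree Λ-0 ; (true , false , false) → agree Λ-0
           ; (false , true , false) → agree (zero-relation (β-bit κ) refl) ; (true , true , false) → agree (β⁻²-relation (δβ-bit κ))
           ; (false , false , true) → agree (zero-relation (β-bit κ) refl) ; (true , false , true) → agree (β⁻²-relation (δβ-bit κ))
           ; (false , true , true) → agree (β²-relation (ββ-bit κ)) ; (true , true , true) → agree (β⁻²-relation (δββ-bit κ)) })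
        (λ { (false , false , false) _ _ → refl ; (false , true , false) _ () ; (true , _ , false) () ; (_ , _ , true) () })
        (normal-M n≢0 k)
        (λ { _ _ _ d (scalar r) → (r , d , false) , cong (λ x → false , x , r) (xor-false r) , xor-false d
           ; _ _ _ d (diag D) → contradiction (λ {p} {q} → D {p} {q}) ¬D
           ; _ _ _ d (swapped S) → contradiction (λ {p} {q} → swap-rot⇒diag S R {p} {q}) ¬D
           ; _ _ _ d (rotated {r} _) → (not r , not d , true) , cong (λ x → true , x , not r) (not-xor-true r) , not-xor-true d })
        (ρⁿ-holds ∷ agree Λ-0 ∷ agree (β²-relation (β-square κ)) ∷ agree τ⁴ ∷ agree (zero-relation (δρδ-zero κ) refl)
          ∷ agree (β²-relation (βρβ-square κ)) ∷ agree (zero-relation (βδβ-zero κ) refl)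
          ∷ holds-ρ {gen⁻¹ #3 · gen #0 · gen #3} (⌊ n /2⌋ ℕ.+ k) (agree τρτ)
          ∷ agree τδτ
          ∷ holds-ρ· {gen⁻¹ #3 · gen #2 · gen #3} ⌊ n /2⌋ (gen #2) (agree τβτ)
          ∷ holds-ρ· {gen #3 ^w 2} ⌊ n /2⌋ (gen #1) (agree τ²) ∷ [])
        (e-rel (1st refl))
        where
        γ : Fin 4 → Affine
        γ #0 = ρ-step
        γ #1 = negation
        γ #2 = β-step
        γ #3 = affine true true false (- κ) 1ℤ
        lin : ∀ x → Linear n k (γ x)
        lin #0 = scalar-preserves false
        lin #1 = scalar-preserves true
        lin #2 = scalar-preserves false
        lin #3 = λ l → Rel-neg false (R l) (sym (ℤ.neg-involutive _)) refl
        open Presentation _ γ lin refl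
        Q : ℤ
        Q = κ * κ + 1ℤ - (N½ + c * ν)
        Q≡0 : Q ≡ 0ℤ
        Q≡0 = ℤ.i≡j⇒i-j≡0 κ²≡
        m : ℤ
        m = + (⌊ n /2⌋ ℕ.+ k)
        m≡ : m - (N½ + κ) ≡ 0ℤ
        m≡ = ℤ.i≡j⇒i-j≡0 (ℤ.pos-+ ⌊ n /2⌋ k)
        τ⁴ : Λ n k (- κ + (1ℤ + - (- κ + 1ℤ)) - 0ℤ) (1ℤ + - (- κ + (1ℤ + - (- κ + 0ℤ))) - 0ℤ)
        τ⁴ = zero-relation (i κ) (j κ)
          where
          i : ∀ κ → - κ + (1ℤ + - (- κ + 1ℤ)) - 0ℤ ≡ 0ℤ
          i = solve-∀
          j : ∀ κ → 1ℤ + - (- κ + (1ℤ + - (- κ + 0ℤ))) - 0ℤ ≡ 0ℤ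
          j = solve-∀
        τρτ : Λ n k (-1ℤ - (m * (1ℤ - κ) + 0ℤ)) (- (- κ) + (1ℤ - κ + (- κ + 0ℤ)) - (m * 1ℤ + 0ℤ))
        τρτ = half-relation (cong₂ (λ x y → - x + - y) Q≡0 m≡) (- m) (m - 1ℤ) (i m κ N½ ν c) (j m κ)
          where
          i : ∀ m κ H ν c → -1ℤ - (m * (1ℤ - κ) + 0ℤ) + (- (- κ) + (1ℤ - κ + (- κ + 0ℤ)) - (m * 1ℤ + 0ℤ)) * κ
                ≡ - (H + (H + c * ν)) + (- (κ * κ + 1ℤ - (H + c * ν)) + - (m - (H + κ)))
          i = solve-∀
          j : ∀ m κ → -1ℤ - (m * (1ℤ - κ) + 0ℤ) + (- (- κ) + (1ℤ - κ + (- κ + 0ℤ)) - (m * 1ℤ + 0ℤ)) ≡ - m * + 2 + (m - 1ℤ) * κ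
          j = solve-∀
        τδτ : Λ n k (+ 2) (- (- κ) + (0ℤ + - (- κ + 0ℤ)) - 0ℤ)
        τδτ = double-relation (cong (+ 2 *_) Q≡0) 1ℤ (+ 2) (i κ N½ ν c) (j κ)
          where
          i : ∀ κ H ν c → + 2 + (- (- κ) + (0ℤ + - (- κ + 0ℤ)) - 0ℤ) * κ ≡ + 2 * (H + c * ν) + + 2 * (κ * κ + 1ℤ - (H + c * ν))
          i = solve-∀
          j : ∀ κ → + 2 + (- (- κ) + (0ℤ + - (- κ + 0ℤ)) - 0ℤ) ≡ 1ℤ * + 2 + + 2 * κ
          j = solve-∀
        τβτ : Λ n k (-1ℤ - (N½ * (1ℤ - κ) + (- κ + 0ℤ))) (- (- κ) + (- κ + (- κ + 0ℤ)) - (N½ * 1ℤ + 1ℤ))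
        τβτ = half-relation (cong -_ Q≡0) (- N½ - 1ℤ) N½ (i κ N½ ν c) (j κ N½)
          where
          i : ∀ κ H ν c → -1ℤ - (H * (1ℤ - κ) + (- κ + 0ℤ)) + (- (- κ) + (- κ + (- κ + 0ℤ)) - (H * 1ℤ + 1ℤ)) * κ
                ≡ - (H + (H + c * ν)) + - (κ * κ + 1ℤ - (H + c * ν))
          i = solve-∀
          j : ∀ κ H → -1ℤ - (H * (1ℤ - κ) + (- κ + 0ℤ)) + (- (- κ) + (- κ + (- κ + 0ℤ)) - (H * 1ℤ + 1ℤ)) ≡ (- H - 1ℤ) * + 2 + H * κ
          j = solve-∀
        τ² : Λ n k (- κ + 1ℤ - (N½ * (1ℤ - κ) + 0ℤ)) (1ℤ + - (- κ + 0ℤ) - (N½ * 1ℤ + 0ℤ))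
        τ² = certify Q≡0 c (1ℤ - N½) N½ 0ℤ (i κ N½ ν c) (j κ N½ ν)
          where
          i : ∀ κ H ν c → - κ + 1ℤ - (H * (1ℤ - κ) + 0ℤ) + (1ℤ + - (- κ + 0ℤ) - (H * 1ℤ + 0ℤ)) * κ
                ≡ c * ν + (κ * κ + 1ℤ - (H + c * ν))
          i = solve-∀
          j : ∀ κ H ν → - κ + 1ℤ - (H * (1ℤ - κ) + 0ℤ) + (1ℤ + - (- κ + 0ℤ) - (H * 1ℤ + 0ℤ)) ≡ (1ℤ - H) * + 2 + H * κ + 0ℤ * ν
          j = solve-∀

-- From congruences on n and k to the shape and the symmetries of Λ.

module Arithmetic where

  open import Defs
  open Automorphisms
  open import Data.Nat as ℕ using (ℕ; suc; z≤n; s≤s)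
  import Data.Nat.Properties as ℕ
  open import Data.Integer using (ℤ; +_; -[1+_]; 0ℤ; 1ℤ; -1ℤ; _+_; _-_; _*_; -_; ∣_∣)
  import Data.Integer.Properties as ℤ
  open import Data.Integer.Divisibility.Signed using (_∣_; divides; ∣⇒∣ᵤ; ∣ᵤ⇒∣)
  open import Data.Integer.Tactic.RingSolver using (solve-∀)
  open import Data.Fin using (suc)
  open import Data.Product using (_,_; proj₁)
  open import Relation.Binary.PropositionalEquality using (_≡_; _≢_; refl; sym; trans; cong; cong₂; subst)
  open import Relation.Nullary using (¬_; yes; no; contradiction)
  open Lattice
  open Covers
  open Darts
  open Frames
  open AffineMaps
  open CyclicGroups
  open import Data.List.Membership.Propositional using (_∈_)
  open import Data.Empty using (⊥)
  open import Data.Bool using (Bool; true; false; not; _∧_)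
  open import Data.Sum using ([_,_]′)
  open ClosedWalks
  open BicyclicGroups
  open Auto

  rigid : ∀ {n k V _∼_} (C : Cover n k V _∼_) → ¬ Λ n k (+ 2) 0ℤ → ¬ Λ n k 0ℤ (+ 2) → Shape n k →
          1 ℕ.≤ k → 2 ℕ.* k ℕ.< n → exceptional n k ≡ false → Rigid C
  rigid C Λ20 Λ02 shape 1≤k 2k<n exc f =
    Frames.affine-image C Λ20 Λ02 shape f (preserves-spokes C Λ20 Λ02 f 1≤k 2k<n exc)

  ¬T-false : ∀ {b} → (b ≡ true → b ≡ false) → b ≡ false
  ¬T-false {false} f = refl
  ¬T-false {true}  f = f refl

  not-exceptional : ∀ {n k} → (∀ {a b} → (a , b) ∈ exceptions → n ≡ a → k ≢ b) → exceptional n k ≡ false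
  not-exceptional {n} {k} none = ¬T-false λ e →
    let (a , b) , m , eq = any-sound {f = λ (a , b) → (n ℕ.≡ᵇ a) ∧ (k ℕ.≡ᵇ b)} {exceptions} e
        e₁ , e₂ = ∧-true {n ℕ.≡ᵇ a} eq
    in contradiction (ℕ.≡ᵇ⇒≡ k b (T≡ e₂)) (none m (ℕ.≡ᵇ⇒≡ n a (T≡ e₁)))

  no-small-multiple : ∀ {n z} j → + n ∣ z → ∣ z ∣ ≡ j → 0 ℕ.< j → j ℕ.< n → ⊥
  no-small-multiple {n} j d refl 0<j j<n = ℕ.<-irrefl (sym (small-multiple₀ n {{ℕ.>-nonZero (ℕ.<-trans 0<j j<n)}} (∣⇒∣ᵤ d) j<n)) 0<j

  module Bounds {n k : ℕ} (1≤k : 1 ℕ.≤ k) (2k<n : 2 ℕ.* k ℕ.< n) where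

    private
      κ : ℤ
      κ = + k

    2<n : 2 ℕ.< n
    2<n = ℕ.≤-<-trans (ℕ.*-monoʳ-≤ 2 1≤k) 2k<n

    0<2k : 0 ℕ.< 2 ℕ.* k
    0<2k = ℕ.<-≤-trans (s≤s z≤n) (ℕ.*-monoʳ-≤ 2 1≤k)

    n≢0 : ¬ (n ≡ 0)
    n≢0 refl with 2<n
    ... | ()

    Λ20 : ¬ Λ n k (+ 2) 0ℤ
    Λ20 (d & _) = no-small-multiple 2 d refl (s≤s z≤n) 2<n

    n∤2k : ¬ (+ n ∣ + 2 * κ)
    n∤2k d = no-small-multiple (2 ℕ.* k) d (ℤ.abs-* (+ 2) κ) 0<2k 2k<n

    Λ02 : ¬ Λ n k 0ℤ (+ 2)
    Λ02 (d & _) = n∤2k (subst (+ n ∣_) (ℤ.+-identityˡ (+ 2 * κ)) d)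

    -- For k > 1 the vector (2 , -2) is no relation because 0 < 2(k - 1) < n; whether (2 , 2) is one
    -- decides between the two remaining shapes.
    shape : Shape n k
    shape with k ℕ.≟ 1
    ... | yes refl = prism (divides 0ℤ refl & divides 0ℤ refl) λ (d & _) → no-small-multiple 2 d refl (s≤s z≤n) 2<n
    ... | no k≢1 with Λ? {n} {k} (+ 2) (+ 2)
    ...   | yes l = twisted l 2-2
      where
      2-2 : ¬ Λ n k (+ 2) (- + 2)
      2-2 (d & _) = no-small-multiple (2 ℕ.* (k ℕ.∸ 1)) (combine -1ℤ 0ℤ d d (e k 1≤k)) refl
        (ℕ.<-≤-trans (s≤s z≤n) (ℕ.*-monoʳ-≤ 2 (ℕ.∸-monoˡ-≤ 1 (ℕ.≤∧≢⇒< 1≤k (λ e → k≢1 (sym e))))))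
        (ℕ.≤-<-trans (ℕ.*-monoʳ-≤ 2 (ℕ.m∸n≤m k 1)) 2k<n)
        where
        e : ∀ k → 1 ℕ.≤ k → + (2 ℕ.* (k ℕ.∸ 1)) ≡ -1ℤ * (+ 2 + - + 2 * + k) + 0ℤ * (+ 2 + - + 2 * + k)
        e (suc k) _ = trans (ℤ.pos-* 2 k) (i (+ k))
          where
          i : ∀ k → + 2 * k ≡ -1ℤ * (+ 2 + - + 2 * (1ℤ + k)) + 0ℤ * (+ 2 + - + 2 * (1ℤ + k))
          i = solve-∀
    ...   | no ¬l = generic ¬l 2-2
      where
      2-2 : ¬ Λ n k (+ 2) (- + 2)
      2-2 (d & _) = no-small-multiple (2 ℕ.* (k ℕ.∸ 1)) (combine -1ℤ 0ℤ d d (e k 1≤k)) refl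
        (ℕ.<-≤-trans (s≤s z≤n) (ℕ.*-monoʳ-≤ 2 (ℕ.∸-monoˡ-≤ 1 (ℕ.≤∧≢⇒< 1≤k (λ e → k≢1 (sym e))))))
        (ℕ.≤-<-trans (ℕ.*-monoʳ-≤ 2 (ℕ.m∸n≤m k 1)) 2k<n)
        where
        e : ∀ k → 1 ℕ.≤ k → + (2 ℕ.* (k ℕ.∸ 1)) ≡ -1ℤ * (+ 2 + - + 2 * + k) + 0ℤ * (+ 2 + - + 2 * + k)
        e (suc k) _ = trans (ℤ.pos-* 2 k) (i (+ k))
          where
          i : ∀ k → + 2 * k ≡ -1ℤ * (+ 2 + - + 2 * (1ℤ + k)) + 0ℤ * (+ 2 + - + 2 * (1ℤ + k))
          i = solve-∀

    +[k²-1] : + (k ℕ.* k ℕ.∸ 1) ≡ κ * κ - 1ℤ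
    +[k²-1] = predecessor (k ℕ.* k) (ℕ.*-mono-≤ 1≤k 1≤k) (ℤ.pos-* k k)
      where
      predecessor : ∀ a → 1 ℕ.≤ a → ∀ {z} → + a ≡ z → + (a ℕ.∸ 1) ≡ z - 1ℤ
      predecessor (suc a) _ refl = refl

    +[k²+1] : + (k ℕ.* k ℕ.+ 1) ≡ κ * κ + 1ℤ
    +[k²+1] = trans (ℤ.pos-+ (k ℕ.* k) 1) (cong (_+ 1ℤ) (ℤ.pos-* k k))

    square≡1 : ∀ {m} → k ²≡1[mod m ] → + m ∣ κ * κ - 1ℤ
    square≡1 d = subst (_ ∣_) +[k²-1] (∣ᵤ⇒∣ d)

    square≡1⁻ : ∀ {m} → + m ∣ κ * κ - 1ℤ → k ²≡1[mod m ]
    square≡1⁻ d = ∣⇒∣ᵤ (subst (_ ∣_) (sym +[k²-1]) d)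

    square≡-1 : ∀ {m} → k ²≡-1[mod m ] → + m ∣ κ * κ + 1ℤ
    square≡-1 d = subst (_ ∣_) +[k²+1] (∣ᵤ⇒∣ d)

    square≡-1⁻ : ∀ {m} → + m ∣ κ * κ + 1ℤ → k ²≡-1[mod m ]
    square≡-1⁻ d = ∣⇒∣ᵤ (subst (_ ∣_) (sym +[k²+1]) d)

  -- For odd k the lattice of relations contains (- k , 1).
  module OddStep {n k : ℕ} (odd : + 2 ∣ + k - 1ℤ) where

    private
      κ ν : ℤ
      κ = + k
      ν = + n

    k-relation : Λ n k κ -1ℤ
    k-relation = divides 0ℤ (i κ ν) & combine 1ℤ 0ℤ odd odd (j κ)
      where
      i : ∀ κ ν → κ + -1ℤ * κ ≡ 0ℤ * ν
      i = solve-∀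
      j : ∀ κ → κ + -1ℤ ≡ 1ℤ * (κ - 1ℤ) + 0ℤ * (κ - 1ℤ)
      j = solve-∀

    no-diag : ¬ (ν ∣ + 2 * κ) → ¬ Diag n k
    no-diag n∤2k D with D k-relation
    ... | d & _ = n∤2k (combine 1ℤ 0ℤ d d (i κ))
      where
      i : ∀ κ → + 2 * κ ≡ 1ℤ * (κ + - -1ℤ * κ) + 0ℤ * (κ + - -1ℤ * κ)
      i = solve-∀

    swap⇒square : Swap n k → ν ∣ κ * κ - 1ℤ
    swap⇒square S with S k-relation
    ... | d & _ = combine 1ℤ 0ℤ d d (i κ)
      where
      i : ∀ κ → κ * κ - 1ℤ ≡ 1ℤ * (-1ℤ + κ * κ) + 0ℤ * (-1ℤ + κ * κ)
      i = solve-∀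

    rot⇒square : Rot n k → ν ∣ κ * κ + 1ℤ
    rot⇒square R with R k-relation
    ... | d & _ = combine 1ℤ 0ℤ d d (i κ)
      where
      i : ∀ κ → κ * κ + 1ℤ ≡ 1ℤ * (- -1ℤ + κ * κ) + 0ℤ * (- -1ℤ + κ * κ)
      i = solve-∀

  module _ {n k : ℕ} where
    private
      κ ν : ℤ
      κ = + k
      ν = + n

    -- The hypothesis speaks of q(k² - 1) rather than of k² - 1, because for even n and k the entry
    -- q is even and contributes the factor 2 missing from n/2.
    square⇒swap : (∀ {p q} → Λ n k p q → ν ∣ q * (κ * κ - 1ℤ)) → Swap n k
    square⇒swap sq {p} {q} l@(d & e) = combine κ -1ℤ d (sq l) (i p q κ) & combine 1ℤ 0ℤ e e (j p q)
      where
      i : ∀ p q κ → q + p * κ ≡ κ * (p + q * κ) + -1ℤ * (q * (κ * κ - 1ℤ))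
      i = solve-∀
      j : ∀ p q → q + p ≡ 1ℤ * (p + q) + 0ℤ * (p + q)
      j = solve-∀

    square⇒rot : (∀ {p q} → Λ n k p q → ν ∣ q * (κ * κ + 1ℤ)) → Rot n k
    square⇒rot sq {p} {q} l@(d & e) = combine κ -1ℤ d (sq l) (i p q κ) & combine 1ℤ (- q) e (divides 1ℤ refl) (j p q)
      where
      i : ∀ p q κ → - q + p * κ ≡ κ * (p + q * κ) + -1ℤ * (q * (κ * κ + 1ℤ))
      i = solve-∀
      j : ∀ p q → - q + p ≡ 1ℤ * (p + q) + - q * + 2
      j = solve-∀

  reflect : P → P
  reflect (t , p , q) = t , p , - q

  -- Reversing the inner rim replaces k by n - k.
  module Reflected {n k k′ : ℕ} (k′≡ : + k′ ≡ + n - + k) {V : Set} {_∼_ : V → V → Set} (C : Cover n k V _∼_) where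

    open Cover C

    private
      ν κ : ℤ
      ν = + n
      κ = + k

      Λ-reflect : ∀ {p q q′} → q′ ≡ - q → Λ n k′ p q → Λ n k p q′
      Λ-reflect {p} {q} refl (d & e) =
        combine 1ℤ (- q) (subst (λ κ′ → ν ∣ p + q * κ′) k′≡ d) (divides 1ℤ refl) (i p q κ ν) & combine 1ℤ (- q) e (divides 1ℤ refl) (j p q)
        where
        i : ∀ p q κ ν → p + - q * κ ≡ 1ℤ * (p + q * (ν - κ)) + - q * (1ℤ * ν)
        i = solve-∀
        j : ∀ p q → p + - q ≡ 1ℤ * (p + q) + - q * + 2
        j = solve-∀

      Λ-unreflect : ∀ {p q q′} → q ≡ - q′ → Λ n k p q′ → Λ n k′ p q
      Λ-unreflect {p} {_} {q} refl (d & e) =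
        subst (λ κ′ → ν ∣ p + - q * κ′) (sym k′≡) (combine 1ℤ (- q) d (divides 1ℤ refl) (i p q κ ν)) & combine 1ℤ (- q) e (divides 1ℤ refl) (j p q)
        where
        i : ∀ p q κ ν → p + - q * (ν - κ) ≡ 1ℤ * (p + q * κ) + - q * (1ℤ * ν)
        i = solve-∀
        j : ∀ p q → p + - q ≡ 1ℤ * (p + q) + - q * + 2
        j = solve-∀

      mirror : Slot → Bool → Slot
      mirror s   false = s
      mirror fwd true  = bwd
      mirror bwd true  = fwd
      mirror spk true  = spk

      mirror-invol : ∀ s t → mirror (mirror s t) t ≡ s
      mirror-invol s   false = refl
      mirror-invol fwd true  = refl
      mirror-invol bwd true  = refl
      mirror-invol spk true  = refl

      reflect-nb : ∀ s a → reflect (nb s a) ≡ nb (mirror s (proj₁ a)) (reflect a)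
      reflect-nb fwd (false , p , q) = refl
      reflect-nb bwd (false , p , q) = refl
      reflect-nb spk (false , p , q) = refl
      reflect-nb spk (true  , p , q) = refl
      reflect-nb fwd (true  , p , q) = cong (λ z → true , p , z) (ℤ.neg-distrib-+ q 1ℤ)
      reflect-nb bwd (true  , p , q) = cong (λ z → true , p , z) (ℤ.neg-distrib-+ q -1ℤ)

      reflect-invol : ∀ a → reflect (reflect a) ≡ a
      reflect-invol (t , p , q) = cong (λ z → t , p , z) (ℤ.neg-involutive q)

    reflected : Cover n k′ V _∼_
    reflected = record
      { pt = λ a → pt (reflect a)
      ; onto = λ x → let a , e = onto x in reflect a , trans (cong pt (reflect-invol a)) e
      ; pt-≡ = λ {t} {p} {q} {p′} {q′} l → pt-≡ (Λ-reflect (i q q′) l)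
      ; pt-inj = λ {t} {p} {q} {t′} {p′} {q′} e → let t≡ , l = pt-inj e in t≡ , Λ-unreflect (j q q′) l
      ; nb-adj = λ s a → subst (λ b → pt (reflect a) ∼ pt b) (sym (reflect-nb s a)) (nb-adj (mirror s (proj₁ a)) (reflect a))
      ; adj-nb = λ {a} e → let s , eq = adj-nb e in mirror s (proj₁ a) ,
          trans eq (cong pt (trans (cong (λ r → nb r (reflect a)) (sym (mirror-invol s (proj₁ a)))) (sym (reflect-nb (mirror s (proj₁ a)) a))))
      }
      where
      i : ∀ q q′ → - q - - q′ ≡ - (q - q′)
      i = solve-∀
      j : ∀ q q′ → q - q′ ≡ - (- q - - q′)
      j = solve-∀

    private
      i₁ : ∀ y q → y + - q ≡ - (- y + q)
      i₁ = solve-∀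
      i₂ : ∀ y q → y + - - q ≡ - (- y + - q)
      i₂ = solve-∀

    -- Affine maps are conjugated by the reflection, which reverses both signs exactly when the
    -- coordinates are exchanged.
    reflected-rigid : Rigid C → Rigid reflected
    reflected-rigid R f with R f
    ... | affine false r r′ x y , h = affine false r r′ x (- y) , λ { (t , p , q) →
          trans (h (t , p , - q)) (cong (λ z → pt (t , x + sg r p , z)) (e r′ y q)) }
      where
      e : ∀ r y q → y + sg r (- q) ≡ - (- y + sg r q)
      e false = i₁
      e true  = i₂
    ... | affine true r r′ x y , h = affine true (not r) (not r′) x (- y) , λ { (t , p , q) →
          trans (h (t , p , - q)) (cong₂ (λ w z → pt (not t , x + w , z)) (e₁ r′ q) (e₂ r y p)) }
      where
      e₁ : ∀ r q → sg r (- q) ≡ sg (not r) q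
      e₁ false q = refl
      e₁ true  q = ℤ.neg-involutive q
      e₂ : ∀ r y p → y + sg r p ≡ - (- y + sg (not r) p)
      e₂ false y p = trans (cong (λ z → y + z) (sym (ℤ.neg-involutive p))) (i₁ y (- p))
      e₂ true  y p = i₁ y p

-- The four parity cases outside the exceptional graphs.

module Families where

  open import Defs
  open Automorphisms
  open import Data.Nat as ℕ using (ℕ; ⌊_/2⌋; zero; suc; NonZero; z≤n; s≤s)
  import Data.Nat.Properties as ℕ
  import Data.Nat.Divisibility as ℕᵈ
  open import Data.Integer using (ℤ; +_; -[1+_]; 0ℤ; 1ℤ; -1ℤ; _+_; _-_; _*_; -_; ∣_∣) renaming (_%ℕ_ to _mod_; _/ℕ_ to _div_)
  import Data.Integer.Properties as ℤ
  open import Data.Integer.DivMod using (n%ℕd<d; a≡a%ℕn+[a/ℕn]*n)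
  open import Data.Integer.Divisibility.Signed using (_∣_; divides; ∣⇒∣ᵤ; ∣ᵤ⇒∣; ∣n⇒∣m*n; *-cancelʳ-∣)
  open import Data.Integer.Tactic.RingSolver using (solve-∀)
  open import Data.Fin using (zero; suc)
  open import Data.Product using (∃; _×_; _,_)
  open import Relation.Binary.PropositionalEquality using (_≡_; _≢_; refl; sym; trans; cong; cong₂; subst; module ≡-Reasoning)
  open import Relation.Nullary using (¬_; contradiction)
  open Lattice
  open Covers
  open Darts
  open Frames
  open NormalForms
  open AffineMaps
  open CyclicGroups
  open import Data.List.Membership.Propositional using (_∈_)
  open import Data.Empty using (⊥)
  open import Data.Sum using ([_,_]′)
  open ClosedWalks
  open BicyclicGroups
  open Arithmetic
  open Auto

  private
    even-n : ∀ {n} → 2 ℕᵈ.∣ n → + 2 ∣ + n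
    even-n = ∣ᵤ⇒∣

    odd-pred : ∀ {n} → ¬ (2 ℕᵈ.∣ n) → + 2 ∣ + n - 1ℤ
    odd-pred = odd-ℤ

    half-double : ∀ q → ⌊ q ℕ.* 2 /2⌋ ≡ q
    half-double zero    = refl
    half-double (suc q) = cong suc (half-double q)

    2∤n : ∀ {z} → + 2 ∣ z → + 2 ∣ z - 1ℤ → ⊥
    2∤n {z} d d′ = 2∤1 0ℤ (combine 1ℤ -1ℤ d d′ (i z))
      where
      i : ∀ z → 0ℤ + 1ℤ - 0ℤ ≡ 1ℤ * z + -1ℤ * (z - 1ℤ)
      i = solve-∀

  bipartite-double : ∀ {n k G} .{{_ : NonZero n}} → 2 ℕᵈ.∣ n → ¬ (2 ℕᵈ.∣ k) →
                     Represents G (GPV n) (GPAdj n k) → A n k ≅ G ≀S₂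
  bipartite-double {n} {k} n-even k-odd R = A≅ (transport untwist (Wreath.wreath R _ (connected petersen-cover)))
    where
    open GeneralizedPetersen n k
    open Bipartite (even-n n-even) (odd-pred k-odd)

  -- For odd n the element (1 , 0) of the lattice has order 2n modulo the relations.
  module OddOrder {n k : ℕ} (n-odd : + 2 ∣ + n - 1ℤ) where

    order-relation : Λ n k (+ (2 ℕ.* n)) 0ℤ
    order-relation = divides (+ 2) (trans (cong (_+ 0ℤ * + k) (ℤ.pos-* 2 n)) (i (+ n) (+ k))) &
      divides (+ n) (trans (cong (_+ 0ℤ) (ℤ.pos-* 2 n)) (j (+ n)))
      where
      i : ∀ n k → + 2 * n + 0ℤ * k ≡ + 2 * n
      i = solve-∀
      j : ∀ n → + 2 * n + 0ℤ ≡ n * + 2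
      j = solve-∀

    order : ∀ i → Λ n k (+ i) 0ℤ → 2 ℕ.* n ℕᵈ.∣ i
    order i (d & divides j i≡) = ∣⇒∣ᵤ (lift (combine 1ℤ 0ℤ d d (e₀ (+ i) (+ k))) n-odd)
      where
      e₀ : ∀ i k → i ≡ 1ℤ * (i + 0ℤ * k) + 0ℤ * (i + 0ℤ * k)
      e₀ = solve-∀
      -- Since 1 = n - 2e with e = (n - 1)/2, divisibility by 2 and by n combines to divisibility by
      -- 2n.
      lift : + n ∣ + i → + 2 ∣ + n - 1ℤ → + (2 ℕ.* n) ∣ + i
      lift (divides c i≡cn) (divides e n≡) = divides (j - e * c) (begin
        + i                                     ≡⟨ ℤ.*-identityʳ (+ i) ⟨
        + i * 1ℤ                                ≡⟨ cong (+ i *_) (trans (e₁ (+ n)) (cong (λ z → + n - z) n≡)) ⟩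
        + i * (+ n - e * + 2)                   ≡⟨ e₂ (+ i) (+ n) e ⟩
        + i * + n - e * + 2 * + i               ≡⟨ cong₂ (λ x y → x * + n - e * + 2 * y) (trans (sym (ℤ.+-identityʳ (+ i))) i≡) i≡cn ⟩
        j * + 2 * + n - e * + 2 * (c * + n)     ≡⟨ e₃ j (+ n) e c ⟩
        (j - e * c) * (+ 2 * + n)               ≡⟨ cong ((j - e * c) *_) (sym (ℤ.pos-* 2 n)) ⟩
        (j - e * c) * + (2 ℕ.* n)               ∎)
        where
        open ≡-Reasoning
        e₁ : ∀ n → 1ℤ ≡ n - (n - 1ℤ)
        e₁ = solve-∀
        e₂ : ∀ i n e → i * (n - e * + 2) ≡ i * n - e * + 2 * i
        e₂ = solve-∀
        e₃ : ∀ j n e c → j * + 2 * n - e * + 2 * (c * n) ≡ (j - e * c) * (+ 2 * n)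
        e₃ = solve-∀

  module _ {n k : ℕ} (1≤k : 1 ℕ.≤ k) (2k<n : 2 ℕ.* k ℕ.< n) where

    open Bounds 1≤k 2k<n

    private
      κ ν : ℤ
      κ = + k
      ν = + n

      0<2n : ¬ (2 ℕ.* n ≡ 0)
      0<2n e with n≢0 (ℕ.m+n≡0⇒m≡0 n e)
      ... | ()

    theorem-i : ¬ (2 ℕᵈ.∣ n) → ¬ (2 ℕᵈ.∣ k) →
      (¬ (k ²≡1[mod n ]) × ¬ (k ²≡-1[mod n ]) → A n k ≅ F (2 ℕ.* n))
      × (k ²≡1[mod n ] → A n k ≅ J (2 ℕ.* n) k)
      × (k ²≡-1[mod n ] → A n k ≅ H (2 ℕ.* n) k)
    theorem-i n-odd k-odd =
        (λ (¬1 , ¬-1) → A≅ (representsF (λ S → ¬1 (square≡1⁻ (swap⇒square S))) (λ R → ¬-1 (square≡-1⁻ (rot⇒square R)))))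
      , (λ e → A≅ (representsJ (square⇒swap λ {p} {q} _ → ∣n⇒∣m*n q (square≡1 e))))
      , (λ e → A≅ (representsH (square⇒rot λ {p} {q} _ → ∣n⇒∣m*n q (square≡-1 e))))
      where
      instance
        n≢0ⁱ : NonZero n
        n≢0ⁱ = ℕ.≢-nonZero n≢0
      not-exc : ∀ {a b} → (a , b) ∈ exceptions → n ≡ a → k ≢ b
      not-exc (1st refl) refl refl = k-odd (ℕᵈ.divides 1 refl)
      not-exc (2nd refl) refl refl = n-odd (ℕᵈ.divides 2 refl)
      not-exc (3rd refl) refl refl = n-odd (ℕᵈ.divides 4 refl)
      not-exc (4th refl) refl refl = n-odd (ℕᵈ.divides 5 refl)
      not-exc (5th refl) refl refl = n-odd (ℕᵈ.divides 6 refl)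
      not-exc (6th refl) refl refl = n-odd (ℕᵈ.divides 12 refl)
      not-exc (7th refl) refl refl = n-odd (ℕᵈ.divides 5 refl)
      C : Cover n k (DV n) (DAdj n k)
      -- The vector (n , 0) returns to the same vertex and reverses the colour because n is odd.
      C = GeneralizedPetersen.double-cover n k ν 0ℤ (combine 1ℤ 0ℤ (divides 1ℤ refl) ∣0 (i ν κ)) (combine 1ℤ 0ℤ (odd-pred n-odd) ∣0 (j ν))
        where
        i : ∀ ν κ → ν + 0ℤ * κ ≡ 1ℤ * (1ℤ * ν) + 0ℤ * 0ℤ
        i = solve-∀
        j : ∀ ν → ν + 0ℤ - 1ℤ ≡ 1ℤ * (ν - 1ℤ) + 0ℤ * 0ℤ
        j = solve-∀
      open OddStep {n} {k} (odd-pred k-odd)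
      open OddOrder {n} {k} (odd-pred n-odd)
      open Cyclic C Λ20 Λ02 (2 ℕ.* n) 0<2n order-relation order k-relation (no-diag n∤2k)
        (rigid C Λ20 Λ02 shape 1≤k 2k<n (not-exceptional not-exc))

    theorem-ii : ¬ (2 ℕᵈ.∣ n) → 2 ℕᵈ.∣ k → ¬ (n ≡ 5 × k ≡ 2) →
      (¬ (k ²≡1[mod n ]) × ¬ (k ²≡-1[mod n ]) → A n k ≅ F (2 ℕ.* n))
      × (k ²≡1[mod n ] → A n k ≅ J (2 ℕ.* n) (n ℕ.∸ k))
      × (k ²≡-1[mod n ] → A n k ≅ H (2 ℕ.* n) (n ℕ.∸ k))
    theorem-ii n-odd k-even ≢52 =
        (λ (¬1 , ¬-1) → A≅ (representsF (λ S → ¬1 (square≡1⁻ (square₁⁻ (swap⇒square S)))) (λ R → ¬-1 (square≡-1⁻ (square₋₁⁻ (rot⇒square R))))))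
      , (λ e → A≅ (representsJ (square⇒swap λ {p} {q} _ → ∣n⇒∣m*n q (square₁ (square≡1 e)))))
      , (λ e → A≅ (representsH (square⇒rot λ {p} {q} _ → ∣n⇒∣m*n q (square₋₁ (square≡-1 e)))))
      where
      instance
        n≢0ⁱ : NonZero n
        n≢0ⁱ = ℕ.≢-nonZero n≢0
      k-odd : ∀ {j} → k ≡ j → ¬ (+ 2 ∣ + j - 1ℤ)
      k-odd refl d = 2∤n {κ} (even-n k-even) d
      not-exc : ∀ {a b} → (a , b) ∈ exceptions → n ≡ a → k ≢ b
      not-exc (1st refl) refl refl = ≢52 (refl , refl)
      not-exc (2nd refl) refl refl = n-odd (ℕᵈ.divides 2 refl)
      not-exc (3rd refl) refl refl = n-odd (ℕᵈ.divides 4 refl)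
      not-exc (4th refl) refl refl = n-odd (ℕᵈ.divides 5 refl)
      not-exc (5th refl) refl refl = n-odd (ℕᵈ.divides 6 refl)
      not-exc (6th refl) refl refl = n-odd (ℕᵈ.divides 12 refl)
      not-exc (7th refl) refl refl = n-odd (ℕᵈ.divides 5 refl)
      C₀ : Cover n k (DV n) (DAdj n k)
      C₀ = GeneralizedPetersen.double-cover n k ν 0ℤ (combine 1ℤ 0ℤ (divides 1ℤ refl) ∣0 (i ν κ)) (combine 1ℤ 0ℤ (odd-pred n-odd) ∣0 (j ν))
        where
        i : ∀ ν κ → ν + 0ℤ * κ ≡ 1ℤ * (1ℤ * ν) + 0ℤ * 0ℤ
        i = solve-∀
        j : ∀ ν → ν + 0ℤ - 1ℤ ≡ 1ℤ * (ν - 1ℤ) + 0ℤ * 0ℤ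
        j = solve-∀
      k≤n : k ℕ.≤ n
      k≤n = ℕ.≤-trans (ℕ.m≤m+n k (k ℕ.+ 0)) (ℕ.<⇒≤ 2k<n)
      k′ : ℕ
      k′ = n ℕ.∸ k
      κ′ : ℤ
      κ′ = + k′
      κ′≡ : κ′ ≡ ν - κ
      κ′≡ = trans (sym (ℤ.⊖-≥ k≤n)) (sym (ℤ.m-n≡m⊖n n k))
      z≡ : κ′ - (ν - κ) ≡ 0ℤ
      z≡ = ℤ.i≡j⇒i-j≡0 κ′≡
      open Reflected {n} {k} {k′} κ′≡ C₀
      C : Cover n k′ (DV n) (DAdj n k)
      C = reflected
      Λ20′ : ¬ Λ n k′ (+ 2) 0ℤ
      Λ20′ (d & _) = no-small-multiple 2 d refl (s≤s z≤n) 2<n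
      n∤2k′ : ¬ (ν ∣ + 2 * κ′)
      n∤2k′ d = n∤2k (combine -1ℤ (+ 2) (subst (λ z → ν ∣ + 2 * z) κ′≡ d) (divides 1ℤ refl) (i ν κ))
        where
        i : ∀ ν κ → + 2 * κ ≡ -1ℤ * (+ 2 * (ν - κ)) + + 2 * (1ℤ * ν)
        i = solve-∀
      Λ02′ : ¬ Λ n k′ 0ℤ (+ 2)
      Λ02′ (d & _) = n∤2k′ (subst (ν ∣_) (ℤ.+-identityˡ (+ 2 * κ′)) d)
      k′-odd : + 2 ∣ κ′ - 1ℤ
      k′-odd = subst (λ z → + 2 ∣ z - 1ℤ) (sym κ′≡) (combine 1ℤ -1ℤ (odd-pred n-odd) (even-n k-even) (i ν κ))
        where
        i : ∀ ν κ → ν - κ - 1ℤ ≡ 1ℤ * (ν - 1ℤ) + -1ℤ * κ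
        i = solve-∀
      same-square : ∀ s → ν ∣ κ * κ + s → ν ∣ κ′ * κ′ + s
      same-square s d = subst (λ z → ν ∣ z * z + s) (sym κ′≡) (combine 1ℤ (ν - + 2 * κ) d (divides 1ℤ refl) (i ν κ s))
        where
        i : ∀ ν κ s → (ν - κ) * (ν - κ) + s ≡ 1ℤ * (κ * κ + s) + (ν - + 2 * κ) * (1ℤ * ν)
        i = solve-∀
      same-square⁻ : ∀ s → ν ∣ κ′ * κ′ + s → ν ∣ κ * κ + s
      same-square⁻ s d = combine 1ℤ (- (ν - + 2 * κ)) (subst (λ z → ν ∣ z * z + s) κ′≡ d) (divides 1ℤ refl) (i ν κ s)
        where
        i : ∀ ν κ s → κ * κ + s ≡ 1ℤ * ((ν - κ) * (ν - κ) + s) + - (ν - + 2 * κ) * (1ℤ * ν)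
        i = solve-∀
      square₁   = same-square -1ℤ
      square₁⁻  = same-square⁻ -1ℤ
      square₋₁  = same-square 1ℤ
      square₋₁⁻ = same-square⁻ 1ℤ
      open OddStep {n} {k′} k′-odd
      open OddOrder {n} {k′} (odd-pred n-odd)
      -- As n - k exceeds n/2, rigidity is proved for k and then carried over by the reflection.
      open Cyclic C Λ20′ Λ02′ (2 ℕ.* n) 0<2n order-relation order k-relation (no-diag n∤2k′)
        (reflected-rigid (rigid C₀ Λ20 Λ02 shape 1≤k 2k<n (not-exceptional not-exc)))

    theorem-iii : 2 ℕᵈ.∣ n → ¬ (2 ℕᵈ.∣ k) →
      ¬ (n ≡ 4 × k ≡ 1) → ¬ (n ≡ 8 × k ≡ 3) → ¬ (n ≡ 10 × k ≡ 3) → ¬ (n ≡ 12 × k ≡ 5) → ¬ (n ≡ 24 × k ≡ 5) →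
      (¬ (k ²≡1[mod n ]) × ¬ (k ²≡-1[mod n ]) → A n k ≅ F n ≀S₂)
      × (k ²≡1[mod n ] → A n k ≅ J n k ≀S₂)
      × (k ²≡-1[mod n ] → A n k ≅ H n k ≀S₂)
    theorem-iii n-even k-odd ≢41 ≢83 ≢103 ≢125 ≢245 =
        (λ (¬1 , ¬-1) → doubled (representsF (λ S → ¬1 (square≡1⁻ (swap⇒square S))) (λ R → ¬-1 (square≡-1⁻ (rot⇒square R)))))
      , (λ e → doubled (representsJ (square⇒swap λ {p} {q} _ → ∣n⇒∣m*n q (square≡1 e))))
      , (λ e → doubled (representsH (square⇒rot λ {p} {q} _ → ∣n⇒∣m*n q (square≡-1 e))))
      where
      instance
        n≢0ⁱ : NonZero n
        n≢0ⁱ = ℕ.≢-nonZero n≢0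
      n-odd : ∀ {j} → n ≡ j → ¬ (+ 2 ∣ + j - 1ℤ)
      n-odd refl d = 2∤n {ν} (even-n n-even) d
      not-exc : ∀ {a b} → (a , b) ∈ exceptions → n ≡ a → k ≢ b
      not-exc (1st refl) e    refl = n-odd e (divides (+ 2) refl)
      not-exc (2nd refl) refl refl = ≢41 (refl , refl)
      not-exc (3rd refl) refl refl = ≢83 (refl , refl)
      not-exc (4th refl) refl refl = ≢103 (refl , refl)
      not-exc (5th refl) refl refl = ≢125 (refl , refl)
      not-exc (6th refl) refl refl = ≢245 (refl , refl)
      not-exc (7th refl) refl refl = k-odd (ℕᵈ.divides 1 refl)
      open GeneralizedPetersen n k
      open Bipartite (even-n n-even) (odd-pred k-odd)
      C : Cover n k (GPV n) (GPAdj n k)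
      C = petersen-cover
      doubled : ∀ {G} → Represents G (GPV n) (GPAdj n k) → A n k ≅ G ≀S₂
      doubled = bipartite-double n-even k-odd
      order-relation : Λ n k ν 0ℤ
      order-relation = combine 1ℤ 0ℤ (divides 1ℤ refl) ∣0 (i ν κ) & combine 1ℤ 0ℤ (even-n n-even) ∣0 (j ν)
        where
        i : ∀ ν κ → ν + 0ℤ * κ ≡ 1ℤ * (1ℤ * ν) + 0ℤ * 0ℤ
        i = solve-∀
        j : ∀ ν → ν + 0ℤ ≡ 1ℤ * ν + 0ℤ * 0ℤ
        j = solve-∀
      order : ∀ i → Λ n k (+ i) 0ℤ → n ℕᵈ.∣ i
      order i (d & _) = ∣⇒∣ᵤ (combine 1ℤ 0ℤ d d (e (+ i) κ))
        where
        e : ∀ i k → i ≡ 1ℤ * (i + 0ℤ * k) + 0ℤ * (i + 0ℤ * k)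
        e = solve-∀
      open OddStep {n} {k} (odd-pred k-odd)
      open Cyclic C Λ20 Λ02 n n≢0 order-relation order k-relation (no-diag n∤2k)
        (rigid C Λ20 Λ02 shape 1≤k 2k<n (not-exceptional not-exc))

    theorem-iv : 2 ℕᵈ.∣ n → 2 ℕᵈ.∣ k → ¬ (n ≡ 10 × k ≡ 2) →
      (k ²≡1[mod ⌊ n /2⌋ ] → A n k ≅ L n k)
      × (k ²≡-1[mod ⌊ n /2⌋ ] → A n k ≅ M n k)
      × (n ≡ 4 ℕ.* k → A n k ≅ N n k)
      × (¬ (k ²≡1[mod ⌊ n /2⌋ ]) × ¬ (k ²≡-1[mod ⌊ n /2⌋ ]) × ¬ (n ≡ 4 ℕ.* k) → A n k ≅ K n k)
    theorem-iv n-even k-even ≢102 =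
        (λ e → let c , κ²≡ = odd-quotient -1ℤ (divides -1ℤ refl) (square≡1 e) in
           A≅ (representsL c (from-square -1ℤ c κ²≡) 1≤k (square⇒swap (λ {p} {q} l → even-multiple -1ℤ (square≡1 e) (even-q l)))
                (λ D → square-order -1ℤ (divides -1ℤ refl) (square≡1 e) (diag⇒4k D))))
      , (λ e → let c , κ²≡ = odd-quotient 1ℤ (divides 0ℤ refl) (square≡-1 e) in
           A≅ (representsM c κ²≡ (square⇒rot (λ {p} {q} l → even-multiple 1ℤ (square≡-1 e) (even-q l)))
                (λ D → square-order 1ℤ (divides 0ℤ refl) (square≡-1 e) (diag⇒4k D))))
      , (λ e → A≅ (representsN e (4k⇒diag e) (λ S → square-order -1ℤ (divides -1ℤ refl) (swap⇒square S) e)))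
      , (λ (¬1 , ¬-1 , ≢4k) → A≅ (representsK (λ D → ≢4k (diag⇒4k D)) (λ S → ¬1 (square≡1⁻ (swap⇒square S)))
           (λ R → ¬-1 (square≡-1⁻ (rot⇒square R)))))
      where
      instance
        n≢0ⁱ : NonZero n
        n≢0ⁱ = ℕ.≢-nonZero n≢0
      odd : ∀ {i j} → 2 ℕᵈ.∣ i → i ≡ j → ¬ (+ 2 ∣ + j - 1ℤ)
      odd {i} d refl d′ = 2∤n {+ i} (even-n d) d′
      not-exc : ∀ {a b} → (a , b) ∈ exceptions → n ≡ a → k ≢ b
      not-exc (1st refl) e _ = odd n-even e (divides (+ 2) refl)
      not-exc (2nd refl) _ e = odd k-even e (divides 0ℤ refl)
      not-exc (3rd refl) _ e = odd k-even e (divides (+ 1) refl)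
      not-exc (4th refl) _ e = odd k-even e (divides (+ 1) refl)
      not-exc (5th refl) _ e = odd k-even e (divides (+ 2) refl)
      not-exc (6th refl) _ e = odd k-even e (divides (+ 2) refl)
      not-exc (7th refl) e e′ = ≢102 (e , e′)
      C : Cover n k (DV n) (DAdj n k)
      -- The vector (- k , 1) returns to the same vertex and reverses the colour because 1 - k is
      -- odd.
      C = GeneralizedPetersen.double-cover n k (- κ) 1ℤ (divides 0ℤ (i κ ν)) (combine -1ℤ 0ℤ (even-n k-even) ∣0 (j κ))
        where
        i : ∀ κ ν → - κ + 1ℤ * κ ≡ 0ℤ * ν
        i = solve-∀
        j : ∀ κ → - κ + 1ℤ - 1ℤ ≡ -1ℤ * κ + 0ℤ * 0ℤ
        j = solve-∀
      h : ℤ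
      h = + ⌊ n /2⌋
      n≡ : ν ≡ h * + 2
      n≡ = halve n-even
        where
        halve : ∀ {n} → 2 ℕᵈ.∣ n → + n ≡ + ⌊ n /2⌋ * + 2
        halve (ℕᵈ.divides q refl) = trans (ℤ.pos-* q 2) (cong (λ z → + z * + 2) (sym (half-double q)))
      e : ℤ
      e = _∣_.quotient (even-n k-even)
      k≡ : κ ≡ e * + 2
      k≡ = _∣_.equality (even-n k-even)
      open Bicyclic C Λ20 Λ02 n≢0 n≡ e k≡ (rigid C Λ20 Λ02 shape 1≤k 2k<n (not-exceptional not-exc))

      -- For even k the vector (- k , 1) is not a relation, only its double is. Applying a linear
      -- part to this double therefore gives congruences modulo n/2 in place of n.
      β²-relation : Λ n k (- + 2 * κ) (+ 2)
      β²-relation = divides 0ℤ (i κ ν) & divides (1ℤ - κ) (j κ)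
        where
        i : ∀ κ ν → - + 2 * κ + + 2 * κ ≡ 0ℤ * ν
        i = solve-∀
        j : ∀ κ → - + 2 * κ + + 2 ≡ (1ℤ - κ) * + 2
        j = solve-∀

      -- As n and k are even, the congruence modulo n makes p even, and then the one modulo 2 makes
      -- q even.
      even-q : ∀ {p q} → Λ n k p q → + 2 ∣ q
      even-q {p} {q} (d & d′) = combine 1ℤ 1ℤ (combine 1ℤ -1ℤ d′ (∣-trans′ d) refl) (∣n⇒∣m*n q (even-n k-even)) (i p q κ)
        where
        ∣-trans′ : ∀ {z} → ν ∣ z → + 2 ∣ z
        ∣-trans′ (divides c refl) = ∣n⇒∣m*n c (even-n n-even)
        i : ∀ p q κ → q ≡ 1ℤ * (1ℤ * (p + q) + -1ℤ * (p + q * κ)) + 1ℤ * (q * κ)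
        i = solve-∀

      even-multiple : ∀ s → h ∣ κ * κ + s → ∀ {q} → + 2 ∣ q → ν ∣ q * (κ * κ + s)
      even-multiple s (divides m m≡) (divides q refl) = divides (q * m) (trans (cong (q * + 2 *_) m≡) (trans (i q m h) (cong (q * m *_) (sym n≡))))
        where
        i : ∀ q m h → q * + 2 * (m * h) ≡ q * m * (h * + 2)
        i = solve-∀

      halve-∣ : ∀ {z} → ν ∣ z * + 2 → h ∣ z
      halve-∣ {z} d = *-cancelʳ-∣ (+ 2) (subst (_∣ z * + 2) n≡ d)

      swap⇒square : Swap n k → h ∣ κ * κ - 1ℤ
      swap⇒square S with S β²-relation
      ... | d & _ = halve-∣ (combine -1ℤ 0ℤ d d (i κ))
        where
        i : ∀ κ → (κ * κ - 1ℤ) * + 2 ≡ -1ℤ * (+ 2 + - + 2 * κ * κ) + 0ℤ * (+ 2 + - + 2 * κ * κ)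
        i = solve-∀

      rot⇒square : Rot n k → h ∣ κ * κ + 1ℤ
      rot⇒square R with R β²-relation
      ... | d & _ = halve-∣ (combine -1ℤ 0ℤ d d (i κ))
        where
        i : ∀ κ → (κ * κ + 1ℤ) * + 2 ≡ -1ℤ * (- + 2 + - + 2 * κ * κ) + 0ℤ * (- + 2 + - + 2 * κ * κ)
        i = solve-∀

      -- The reflected relation shows that n divides 4k, and 0 < 4k < 2n leaves 1 as the only
      -- quotient.
      diag⇒4k : Diag n k → n ≡ 4 ℕ.* k
      diag⇒4k D with D β²-relation
      ... | d & _ = quotient-one (∣⇒∣ᵤ (combine -1ℤ 0ℤ d d (trans (ℤ.pos-* 4 k) (i κ))))
        where
        i : ∀ κ → + 4 * κ ≡ -1ℤ * (- + 2 * κ + - + 2 * κ) + 0ℤ * (- + 2 * κ + - + 2 * κ)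
        i = solve-∀
        4k≡ : 4 ℕ.* k ≡ 2 ℕ.* (2 ℕ.* k)
        4k≡ = ℕ.*-assoc 2 2 k
        quotient-one : n ℕᵈ.∣ 4 ℕ.* k → n ≡ 4 ℕ.* k
        quotient-one (ℕᵈ.divides 0 eq) = contradiction 0<2k (ℕ.≤⇒≯ (subst (2 ℕ.* k ℕ.≤_) eq (ℕ.*-monoˡ-≤ k {2} {4} (s≤s (s≤s z≤n)))))
        quotient-one (ℕᵈ.divides 1 eq) = sym (trans eq (ℕ.+-identityʳ n))
        quotient-one (ℕᵈ.divides (suc (suc q)) eq) = contradiction
          (ℕ.<-≤-trans (subst (ℕ._< 2 ℕ.* n) (sym 4k≡) (ℕ.*-monoʳ-< 2 2k<n)) (subst (2 ℕ.* n ℕ.≤_) (sym eq) (ℕ.*-monoˡ-≤ n {2} {suc (suc q)} (s≤s (s≤s z≤n)))))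
          (ℕ.<-irrefl refl)

      4k⇒diag : n ≡ 4 ℕ.* k → Diag n k
      4k⇒diag n≡4k {p} {q} l@(d & d′) with even-q l
      ... | divides q′ refl = combine 1ℤ (- q′) d (divides 1ℤ refl) (trans (i p q′ κ) (cong (λ z → 1ℤ * (p + q′ * + 2 * κ) + - q′ * (1ℤ * z)) (sym (trans (cong +_ n≡4k) (ℤ.pos-* 4 k))))) &
          combine 1ℤ (- + 2 * q′) d′ (divides 1ℤ refl) (j p q′)
        where
        i : ∀ p q κ → p + - (q * + 2) * κ ≡ 1ℤ * (p + q * + 2 * κ) + - q * (1ℤ * (+ 4 * κ))
        i = solve-∀
        j : ∀ p q → p + - (q * + 2) ≡ 1ℤ * (p + q * + 2) + - + 2 * q * + 2
        j = solve-∀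

      -- κ² ± 1 is odd, hence so is every divisor of it and the complementary quotient.
      square-odd : ∀ s → + 2 ∣ s - 1ℤ → ¬ (+ 2 ∣ κ * κ + s)
      square-odd s s-odd d = 2∤n {s} (combine 1ℤ -1ℤ d (∣n⇒∣m*n κ (even-n k-even)) (i κ s)) s-odd
        where
        i : ∀ κ s → s ≡ 1ℤ * (κ * κ + s) + -1ℤ * (κ * κ)
        i = solve-∀

      -- For n = 4k the half n/2 = 2k is even and cannot divide the odd number k² + s. Hence the
      -- cases of L and M exclude the reflection, and the case of N excludes the exchange.
      square-order : ∀ s → + 2 ∣ s - 1ℤ → h ∣ κ * κ + s → n ≢ 4 ℕ.* k
      square-order s s-odd (divides m m≡) n≡4k = square-odd s s-odd
        (subst (+ 2 ∣_) (sym m≡) (∣n⇒∣m*n m (divides κ (ℤ.*-cancelʳ-≡ h (κ * + 2) (+ 2) (trans (sym n≡) (trans (cong +_ n≡4k) (trans (ℤ.pos-* 4 k) (i κ))))))))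
        where
        i : ∀ κ → + 4 * κ ≡ κ * + 2 * + 2
        i = solve-∀

      -- The odd number k² + s is an odd multiple of n/2 and so is congruent to n/2 modulo n. This
      -- is the origin of the power n/2 of ρ in λ² and τ².
      odd-quotient : ∀ s → + 2 ∣ s - 1ℤ → h ∣ κ * κ + s → ∃ λ c → κ * κ + s ≡ h + c * ν
      odd-quotient s s-odd (divides m m≡) with m mod 2 | m div 2 | a≡a%ℕn+[a/ℕn]*n m 2 | n%ℕd<d m 2
      ... | 0 | c | refl | _ = contradiction (subst (+ 2 ∣_) (sym m≡) (divides (c * h) (i c h))) (square-odd s s-odd)
        where
        i : ∀ c h → (0ℤ + c * + 2) * h ≡ c * h * + 2
        i = solve-∀
      ... | 1 | c | refl | _ = c , trans m≡ (trans (i c h) (cong (λ z → h + c * z) (sym n≡)))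
        where
        i : ∀ c h → (1ℤ + c * + 2) * h ≡ h + c * (h * + 2)
        i = solve-∀
      ... | suc (suc _) | _ | _ | s≤s (s≤s ())

      from-square : ∀ s c → κ * κ + s ≡ h + c * ν → κ * κ ≡ - s + (h + c * ν)
      from-square s c eq = trans (i κ s) (cong (λ z → - s + z) eq)
        where
        i : ∀ κ s → κ * κ ≡ - s + (κ * κ + s)
        i = solve-∀

-- Evaluable graphs, and fullness of an action by a chain of stabilisers.

module FiniteGraphs where

  open import Defs
  open Automorphisms
  open ClosedWalks
  open import Level using (0ℓ)
  open import Data.Nat as ℕ using (ℕ; zero; suc)
  import Data.Nat.Properties as ℕ
  open import Data.Fin using (Fin; zero; suc; toℕ)
  open import Data.Fin.Properties using (toℕ-fromℕ<; toℕ-injective)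
  open import Data.Bool using (Bool; true; false; not; _∧_; _∨_; _xor_; if_then_else_)
  open import Data.Bool.ListAction using (all; any)
  open import Data.Product using (∃; _×_; _,_; proj₁; proj₂)
  open import Data.Sum using (inj₁; inj₂)
  open import Data.List using (List; []; _∷_; _++_; map; filterᵇ; foldr; allFin)
  open import Data.List.Membership.Propositional using (_∈_)
  open import Data.List.Membership.Propositional.Properties using (∈-++⁺ˡ; ∈-++⁺ʳ; ∈-map⁺; ∈-allFin; ∈-map⁻)
  open import Data.List.Relation.Unary.All as All using (All; []; _∷_)
  open import Data.List.Relation.Unary.Any using (here; there)
  open import Relation.Binary.PropositionalEquality using (_≡_; _≢_; refl; sym; trans; cong; cong₂; subst)
  open import Relation.Nullary using (contradiction)
  open import Algebra.Bundles.Raw using (RawGroup)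
  open Auto

  _≡ᵇ_ : Bool → Bool → Bool
  a ≡ᵇ b = not (a xor b)

  ≡ᵇ-refl : ∀ {a b} → a ≡ b → (a ≡ᵇ b) ≡ true
  ≡ᵇ-refl {false} refl = refl
  ≡ᵇ-refl {true}  refl = refl

  iff : ∀ {a b} → (a ≡ true → b ≡ true) → (b ≡ true → a ≡ true) → a ≡ b
  iff {true}  {b} f g = sym (f refl)
  iff {false} {true}  f g = g refl
  iff {false} {false} f g = refl

  all-complete : ∀ {X : Set} {f : X → Bool} xs → (∀ {x} → x ∈ xs → f x ≡ true) → all f xs ≡ true
  all-complete [] h = refl
  all-complete {f = f} (x ∷ xs) h rewrite h (here refl) = all-complete xs (λ m → h (there m))

  ∨-skip : ∀ {a b} → not a ∨ b ≡ true → a ≡ true → b ≡ true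
  ∨-skip {true} e refl = e

  record FiniteGraph (V : Set) (_∼_ : V → V → Set) : Set where
    field
      _≐_     : V → V → Bool
      ≐-sound : ∀ {x y} → x ≐ y ≡ true → x ≡ y
      ≐-refl  : ∀ x → x ≐ x ≡ true
      vs       : List V
      complete : ∀ x → x ∈ vs
      adj      : V → V → Bool
      adj⇒     : ∀ {x y} → adj x y ≡ true → x ∼ y
      ⇒adj     : ∀ {x y} → x ∼ y → adj x y ≡ true

  module _ {V : Set} {_∼_ : V → V → Set} (Γ : FiniteGraph V _∼_) where
    open FiniteGraph Γ

    consistent : List (V × V) → V → V → Bool
    consistent as x y = all (λ (x′ , y′) → ((x ≐ x′) ≡ᵇ (y ≐ y′)) ∧ (adj x x′ ≡ᵇ adj y y′)) as

    Extends : Auto V _∼_ → List (V × V) → Set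
    Extends f as = ∀ {x y} → (x , y) ∈ as → to f x ≡ y

    extends⇒consistent : ∀ f as → Extends f as → ∀ x → consistent as x (to f x) ≡ true
    extends⇒consistent f as e x = all-complete as λ {(x′ , y′)} m → cong₂ _∧_
      (≡ᵇ-refl (iff (λ q → same (trans (cong (to f) (≐-sound q)) (e m)))
                    (λ q → same (to-injective f (trans (≐-sound q) (sym (e m)))))))
      (≡ᵇ-refl (iff (λ q → ⇒adj (subst (to f x ∼_) (e m) (to-adj f (adj⇒ q))))
                    (λ q → ⇒adj (to-adj⁻ f (subst (to f x ∼_) (sym (e m)) (adj⇒ q))))))
      where
      same : ∀ {x y} → x ≡ y → x ≐ y ≡ true
      same refl = ≐-refl _

    -- Backtracking search: every way of extending the partial map to the given vertices is the identity.
    onlyIdentity : List (V × V) → List V → Bool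
    onlyIdentity as []       = all (λ (x , y) → x ≐ y) as
    onlyIdentity as (x ∷ xs) = all (λ y → not (consistent as x y) ∨ onlyIdentity ((x , y) ∷ as) xs) vs

    onlyIdentity-sound : ∀ f as xs → Extends f as → onlyIdentity as xs ≡ true →
                         (∀ {x} → x ∈ xs → to f x ≡ x) × (∀ {x y} → (x , y) ∈ as → x ≡ y)
    onlyIdentity-sound f as [] e ok = (λ ()) , λ m → ≐-sound (All.lookup (all-sound {f = λ (x , y) → x ≐ y} {as} ok) m)
    onlyIdentity-sound f as (x ∷ xs) e ok = (λ { (here refl) → sym (proj₂ rest (here refl)) ; (there m) → proj₁ rest m }) ,
        λ m → proj₂ rest (there m)
      where
      rest = onlyIdentity-sound f ((x , to f x) ∷ as) xs (λ { (here refl) → refl ; (there m) → e m })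
        (∨-skip (All.lookup (all-sound {f = λ y → not (consistent as x y) ∨ onlyIdentity ((x , y) ∷ as) xs} {vs} ok) (complete (to f x)))
                (extends⇒consistent f as e x))

    -- The vertices at distance at most ℓ from the given ones, those at smaller distance first.
    ballOrder : ℕ → List V → List V
    ballOrder zero    xs = xs
    ballOrder (suc ℓ) xs = ballOrder ℓ (xs ++ filterᵇ (λ y → not (any (y ≐_) xs) ∧ any (adj y) xs) vs)

    record Action (H : RawGroup 0ℓ 0ℓ) : Set where
      private module H = RawGroup H
      field
        act      : H.Carrier → V → V
        act-cong : ∀ {g h} → g H.≈ h → ∀ x → act g x ≡ act h x
        faithful : ∀ {g h} → (∀ x → act g x ≡ act h x) → g H.≈ h
        act-∙    : ∀ g h x → act (g H.∙ h) x ≡ act g (act h x)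
        act-ε    : ∀ x → act H.ε x ≡ x
        act-⁻¹ˡ  : ∀ g x → act (g H.⁻¹) (act g x) ≡ x
        act-⁻¹ʳ  : ∀ g x → act g (act (g H.⁻¹) x) ≡ x
        act-adj  : ∀ g {x y} → x ∼ y → act g x ∼ act g y

    module Transitivity {H : RawGroup 0ℓ 0ℓ} (α : Action H) where
      private module H = RawGroup H
      open Action α

      auto : H.Carrier → Auto V _∼_
      auto g = record
        { to = act g ; from = act (g H.⁻¹) ; to-from = act-⁻¹ʳ g ; from-to = act-⁻¹ˡ g
        ; to-adj = act-adj g ; from-adj = act-adj (g H.⁻¹) }

      -- Each vertex is stored with a group element that carries the base vertex to it.
      Orbit : Set
      Orbit = List (V × H.Carrier)

      insert : V × H.Carrier → Orbit → Orbit
      insert (x , h) o = if any (λ (y , _) → x ≐ y) o then o else (x , h) ∷ o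

      grow : List H.Carrier → Orbit → Orbit
      grow gs o = foldr (λ g o′ → foldr (λ (x , h) → insert (act g x , g H.∙ h)) o′ o) o gs

      orbit : ℕ → List H.Carrier → V → Orbit
      orbit zero    gs b = (b , H.ε) ∷ []
      orbit (suc ℓ) gs b = grow gs (orbit ℓ gs b)

      fixes : List V → H.Carrier → Bool
      fixes fixed g = all (λ x → act g x ≐ x) fixed

      module _ (fixed : List V) (b : V) where

        Good : V × H.Carrier → Set
        Good (x , h) = act h b ≡ x × (∀ {y} → y ∈ fixed → act h y ≡ y)

        insert-good : ∀ {p o} → Good p → All Good o → All Good (insert p o)
        insert-good {x , h} {o} p ps with any (λ (y , _) → x ≐ y) o
        ... | true  = ps
        ... | false = p ∷ ps

        grow-good : ∀ gs {o} → (∀ {g} → g ∈ gs → fixes fixed g ≡ true) → All Good o → All Good (grow gs o)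
        grow-good [] fix ps = ps
        grow-good (g ∷ gs) {o} fix ps = each o ps
          where
          fix-g : ∀ {y} → y ∈ fixed → act g y ≡ y
          fix-g m = ≐-sound (All.lookup (all-sound {f = λ x → act g x ≐ x} {fixed} (fix (here refl))) m)
          each : ∀ o′ → All Good o′ → All Good (foldr (λ (x , h) → insert (act g x , g H.∙ h)) (foldr (λ g o′ → foldr (λ (x , h) → insert (act g x , g H.∙ h)) o′ o) o gs) o′)
          each [] [] = grow-good gs (λ m → fix (there m)) ps
          each ((x , h) ∷ o′) ((e , fx) ∷ ps′) = insert-good
            (trans (act-∙ g h b) (cong (act g) e) , λ m → trans (act-∙ g h _) (trans (cong (act g) (fx m)) (fix-g m))) (each o′ ps′)

        orbit-good : ∀ ℓ gs → (∀ {g} → g ∈ gs → fixes fixed g ≡ true) → All Good (orbit ℓ gs b)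
        orbit-good zero gs fix = (act-ε b , λ _ → act-ε _) ∷ []
        orbit-good (suc ℓ) gs fix = grow-good gs fix (orbit-good ℓ gs fix)

      identities : List V → List (V × V)
      identities = map (λ x → x , x)

      -- The orbit and the order are arguments here so that evaluation shares them.
      covers : List V → V → Orbit → Bool
      covers fixed b o = all (λ y → not (consistent (identities fixed) b y) ∨ any (λ (z , _) → y ≐ z) o) vs

      rigid : List V → List V → Bool
      rigid fixed order = all (λ x → any (x ≐_) order) vs ∧ onlyIdentity (identities fixed) order

      -- Each stage moves the image of its vertex back by an element fixing the vertices of the previous stages.
      regular : ℕ → List V → List (V × List H.Carrier) → Bool
      regular ℓ fixed [] = rigid fixed (ballOrder ℓ fixed)
      regular ℓ fixed ((b , gs) ∷ stages) = all (fixes fixed) gs ∧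
        (covers fixed b (orbit ℓ gs b) ∧ regular ℓ (b ∷ fixed) stages)

      identities-extends : ∀ f {fixed} → (∀ {x} → x ∈ fixed → to f x ≡ x) → Extends f (identities fixed)
      identities-extends f {fixed} fx m with ∈-map⁻ (λ x → x , x) m
      ... | x , x∈ , refl = fx x∈

      -- The image of the base vertex is consistent with the vertices fixed so far, hence in the
      -- computed orbit. Composing f with the inverse of the stored element fixes one more vertex,
      -- and after the last stage only the identity remains.
      regular-full : ∀ ℓ fixed stages → regular ℓ fixed stages ≡ true → (f : Auto V _∼_) →
                     (∀ {x} → x ∈ fixed → to f x ≡ x) → ∃ λ h → ∀ x → act h x ≡ to f x
      regular-full ℓ fixed [] ok f fx = H.ε , λ x → trans (act-ε x) (sym (identity x))
        where
        order = ballOrder ℓ fixed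
        oks = ∧-true {all (λ x → any (x ≐_) order) vs} ok
        identity : ∀ x → to f x ≡ x
        identity x with any-sound {f = x ≐_} {order} (All.lookup (all-sound {f = λ x → any (x ≐_) order} {vs} (proj₁ oks)) (complete x))
        ... | y , y∈ , e = proj₁ (onlyIdentity-sound f (identities fixed) order (identities-extends f fx) (proj₂ oks))
                             (subst (_∈ order) (sym (≐-sound e)) y∈)
      regular-full ℓ fixed ((b , gs) ∷ stages) ok f fx with ∧-true {all (fixes fixed) gs} ok
      ... | ok₁ , ok₂₃ with ∧-true {covers fixed b (orbit ℓ gs b)} ok₂₃
      ...   | ok₂ , ok₃ with any-sound {f = λ (z , _) → to f b ≐ z} {orbit ℓ gs b}
                (∨-skip (All.lookup (all-sound {f = λ y → not (consistent (identities fixed) b y) ∨ any (λ (z , _) → y ≐ z) (orbit ℓ gs b)} {vs} ok₂)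
                                    (complete (to f b)))
                        (extends⇒consistent f (identities fixed) (identities-extends f fx) b))
      ...     | (z , h) , m , e = h H.∙ proj₁ rest , λ x →
                  trans (act-∙ h _ x) (trans (cong (act h) (proj₂ rest x)) (act-⁻¹ʳ h _))
        where
        good : Good fixed b (z , h)
        good = All.lookup (orbit-good fixed b ℓ gs (λ g∈ → All.lookup (all-sound {f = fixes fixed} {gs} ok₁) g∈)) m
        back : ∀ {x y} → act h x ≡ y → act (h H.⁻¹) y ≡ x
        back refl = act-⁻¹ˡ h _
        f′ : Auto V _∼_
        f′ = (auto h ⁻¹ₐ) ∘ₐ f
        rest = regular-full ℓ (b ∷ fixed) stages ok₃ f′ λ where
          (here refl) → back (trans (proj₁ good) (sym (≐-sound e)))
          (there y∈)  → trans (cong (act (h H.⁻¹)) (fx y∈)) (back (proj₂ good y∈))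

      represents : ∀ ℓ stages → regular ℓ [] stages ≡ true → Represents H V _∼_
      represents ℓ stages ok = record
        { act = act ; act-cong = act-cong ; faithful = faithful ; act-∙ = act-∙ ; act-ε = act-ε
        ; act-⁻¹ˡ = act-⁻¹ˡ ; act-⁻¹ʳ = act-⁻¹ʳ ; act-adj = act-adj
        ; full = λ f → regular-full ℓ [] stages ok f λ () }

  module _ (m k : ℕ) where

    private
      n : ℕ
      n = suc m

      sameIndex : Fin n → Fin n → Bool
      sameIndex i j = toℕ i ℕ.≡ᵇ toℕ j

      sameIndex-sound : ∀ {i j} → sameIndex i j ≡ true → i ≡ j
      sameIndex-sound {i} {j} e = toℕ-injective (ℕ.≡ᵇ⇒≡ (toℕ i) (toℕ j) (T≡ e))

      T⇒≡ : ∀ {b} → Data.Bool.T b → b ≡ true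
      T⇒≡ {true} _ = refl

      sameIndex-complete : ∀ {i j} → i ≡ j → sameIndex i j ≡ true
      sameIndex-complete {i} refl = T⇒≡ (ℕ.≡⇒≡ᵇ (toℕ i) (toℕ i) refl)

      steps : ℕ → Fin n → Fin n → Bool
      steps k i j = toℕ j ℕ.≡ᵇ ((toℕ i ℕ.+ k) ℕ.% n)

      steps-sound : ∀ k i j → steps k i j ≡ true → j ≡ shift k i
      steps-sound k i j e = toℕ-injective (trans (ℕ.≡ᵇ⇒≡ (toℕ j) _ (T≡ e)) (sym (toℕ-fromℕ< _)))

      steps-complete : ∀ k i → steps k i (shift k i) ≡ true
      steps-complete k i = T⇒≡ (ℕ.≡⇒≡ᵇ (toℕ (shift k i)) _ (toℕ-fromℕ< _))

    private
      samePetersen : GPV n → GPV n → Bool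
      samePetersen (u i) (u j) = sameIndex i j
      samePetersen (v i) (v j) = sameIndex i j
      samePetersen (u _) (v _) = false
      samePetersen (v _) (u _) = false

      adjPetersen : GPV n → GPV n → Bool
      adjPetersen (u i) (u j) = steps 1 i j ∨ steps 1 j i
      adjPetersen (u i) (v j) = sameIndex i j
      adjPetersen (v i) (u j) = sameIndex i j
      adjPetersen (v i) (v j) = steps k i j ∨ steps k j i

      ∨-left : ∀ {a b} → a ≡ true → a ∨ b ≡ true
      ∨-left refl = refl

      ∨-right : ∀ {a b} → b ≡ true → a ∨ b ≡ true
      ∨-right {false} refl = refl
      ∨-right {true}  refl = refl

    petersen : FiniteGraph (GPV n) (GPAdj n k)
    petersen = record
      { _≐_ = samePetersen
      ; ≐-sound = λ { {u i} {u j} e → cong u (sameIndex-sound e) ; {v i} {v j} e → cong v (sameIndex-sound e)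
                     ; {u _} {v _} () ; {v _} {u _} () }
      ; ≐-refl = λ { (u i) → sameIndex-complete {i} refl ; (v i) → sameIndex-complete {i} refl }
      ; vs = map u (allFin n) ++ map v (allFin n)
      ; complete = λ { (u i) → ∈-++⁺ˡ (∈-map⁺ u (∈-allFin i)) ; (v i) → ∈-++⁺ʳ (map u (allFin n)) (∈-map⁺ v (∈-allFin i)) }
      ; adj = adjPetersen
      ; adj⇒ = sound
      ; ⇒adj = λ { (inj₁ e) → edge e ; (inj₂ e) → edge⁻ e }
      }
      where
      sound : ∀ {x y} → adjPetersen x y ≡ true → GPAdj n k x y
      sound {u i} {u j} e with ∨-true {steps 1 i j} e
      ... | inj₁ s rewrite steps-sound 1 i j s = inj₁ (outer i)
      ... | inj₂ s rewrite steps-sound 1 j i s = inj₂ (outer j)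
      sound {v i} {v j} e with ∨-true {steps k i j} e
      ... | inj₁ s rewrite steps-sound k i j s = inj₁ (inner i)
      ... | inj₂ s rewrite steps-sound k j i s = inj₂ (inner j)
      sound {u i} {v j} e rewrite sameIndex-sound {i} {j} e = inj₁ (spoke j)
      sound {v i} {u j} e rewrite sameIndex-sound {i} {j} e = inj₂ (spoke j)
      edge : ∀ {x y} → GPEdge n k x y → adjPetersen x y ≡ true
      edge (outer i) = ∨-left (steps-complete 1 i)
      edge (spoke i) = sameIndex-complete {i} refl
      edge (inner i) = ∨-left (steps-complete k i)
      edge⁻ : ∀ {x y} → GPEdge n k y x → adjPetersen x y ≡ true
      edge⁻ (outer i) = ∨-right {steps 1 (shift 1 i) i} (steps-complete 1 i)
      edge⁻ (spoke i) = sameIndex-complete {i} refl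
      edge⁻ (inner i) = ∨-right {steps k (shift k i) i} (steps-complete k i)

    doubleCover : FiniteGraph (DV n) (DAdj n k)
    doubleCover = record
      { _≐_ = λ (x , a) (y , b) → (x P.≐ y) ∧ (a ≡ᵇ b)
      ; ≐-sound = λ {(x , a)} {(y , b)} e → let e₁ , e₂ = ∧-true {x P.≐ y} e in cong₂ _,_ (P.≐-sound e₁) (≡ᵇ-sound e₂)
      ; ≐-refl = λ (x , a) → cong₂ _∧_ (P.≐-refl x) (≡ᵇ-refl {a} refl)
      ; vs = map (_, false) P.vs ++ map (_, true) P.vs
      ; complete = λ { (x , false) → ∈-++⁺ˡ (∈-map⁺ (_, false) (P.complete x))
                     ; (x , true) → ∈-++⁺ʳ (map (_, false) P.vs) (∈-map⁺ (_, true) (P.complete x)) }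
      ; adj = λ (x , a) (y , b) → P.adj x y ∧ (a xor b)
      ; adj⇒ = λ {(x , a)} {(y , b)} e → let e₁ , e₂ = ∧-true {P.adj x y} e in P.adj⇒ e₁ , xor⇒≢ a b e₂
      ; ⇒adj = λ {(x , a)} {(y , b)} (e , ne) → cong₂ _∧_ (P.⇒adj e) (≢⇒xor a b ne)
      }
      where
      module P = FiniteGraph petersen
      ≡ᵇ-sound : ∀ {a b} → (a ≡ᵇ b) ≡ true → a ≡ b
      ≡ᵇ-sound {false} {false} _ = refl
      ≡ᵇ-sound {true}  {true}  _ = refl
      xor⇒≢ : ∀ a b → a xor b ≡ true → a ≢ b
      xor⇒≢ false true e ()
      xor⇒≢ true false e ()
      ≢⇒xor : ∀ a b → a ≢ b → a xor b ≡ true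
      ≢⇒xor false false p = contradiction refl p
      ≢⇒xor false true  p = refl
      ≢⇒xor true  false p = refl
      ≢⇒xor true  true  p = contradiction refl p

-- Actions on configurations, their products, extensions and cyclic powers.

module ConfigurationActions where

  open import Defs
  open Automorphisms
  open FiniteGraphs
  open import Level using (0ℓ)
  open import Data.Nat as ℕ using (ℕ; zero; suc; NonZero)
  import Data.Nat.Properties as ℕ
  import Data.Nat.DivMod as ℕ
  import Data.Fin
  open import Data.Fin using (Fin; zero; suc; toℕ)
  open import Data.Fin.Properties using (toℕ-fromℕ<; toℕ<n)
  open import Data.Bool using (true; false)
  open import Data.Product using (_,_)
  open import Relation.Binary.PropositionalEquality using (_≡_; refl; sym; trans; cong; subst₂; module ≡-Reasoning)
  open import Algebra.Bundles.Raw using (RawGroup)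

  -- Vertices described by configurations, of which only the valid ones matter.
  module Configurations {V : Set} {_∼_ : V → V → Set} {X : Set} (Valid : X → Set)
    (enc : X → V) (dec : V → X) (dec-valid : ∀ w → Valid (dec w)) (enc-dec : ∀ w → enc (dec w) ≡ w) where

    infix 4 _≈_
    _≈_ : X → X → Set
    x ≈ y = enc x ≡ enc y

    record Move : Set where
      field
        move   : X → X
        valid  : ∀ {x} → Valid x → Valid (move x)
        resp   : ∀ {x y} → Valid x → Valid y → x ≈ y → move x ≈ move y
        adj    : ∀ {x y} → Valid x → Valid y → enc x ∼ enc y → enc (move x) ∼ enc (move y)

    record XAct (H : RawGroup 0ℓ 0ℓ) : Set where
      private module H = RawGroup H
      field
        act    : H.Carrier → X → X
        valid  : ∀ h {x} → Valid x → Valid (act h x)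
        resp   : ∀ h {x y} → Valid x → Valid y → x ≈ y → act h x ≈ act h y
        adj    : ∀ h {x y} → Valid x → Valid y → enc x ∼ enc y → enc (act h x) ∼ enc (act h y)
        act-cong : ∀ {g h} → g H.≈ h → ∀ {x} → Valid x → act g x ≈ act h x
        act-∙  : ∀ g h {x} → Valid x → act (g H.∙ h) x ≈ act g (act h x)
        act-ε  : ∀ {x} → Valid x → act H.ε x ≈ x
        act-⁻¹ˡ : ∀ g {x} → Valid x → act (g H.⁻¹) (act g x) ≈ x
        act-⁻¹ʳ : ∀ g {x} → Valid x → act g (act (g H.⁻¹) x) ≈ x

    module _ {H : RawGroup 0ℓ 0ℓ} (α : XAct H) (Γ : FiniteGraph V _∼_) where
      private module H = RawGroup H
      open XAct α

      private
        enc-dec-enc : ∀ x → enc (dec (enc x)) ≡ enc x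
        enc-dec-enc x = enc-dec (enc x)

        via : ∀ h {x} → Valid x → act h (dec (enc x)) ≈ act h x
        via h {x} vx = resp h (dec-valid _) vx (enc-dec-enc x)

      -- A vertex is decoded, moved and encoded again; `resp` makes this independent of the
      -- configuration chosen for it.
      action : (∀ {g h} → (∀ {x} → Valid x → act g x ≈ act h x) → g H.≈ h) → Action Γ H
      action faithful = record
        { act      = λ h w → enc (act h (dec w))
        ; act-cong = λ e w → act-cong e (dec-valid w)
        ; faithful = λ {g} {h} e → faithful λ {x} vx → trans (sym (via g vx)) (trans (e (enc x)) (via h vx))
        ; act-∙    = λ g h w → trans (act-∙ g h (dec-valid w)) (sym (via g (valid h (dec-valid w))))
        ; act-ε    = λ w → trans (act-ε (dec-valid w)) (enc-dec w)
        ; act-⁻¹ˡ  = λ g w → trans (via (g H.⁻¹) (valid g (dec-valid w))) (trans (act-⁻¹ˡ g (dec-valid w)) (enc-dec w))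
        ; act-⁻¹ʳ  = λ g w → trans (via g (valid (g H.⁻¹) (dec-valid w))) (trans (act-⁻¹ʳ g (dec-valid w)) (enc-dec w))
        ; act-adj  = λ g {x} {y} e → adj g (dec-valid x) (dec-valid y) (subst₂ _∼_ (sym (enc-dec x)) (sym (enc-dec y)) e)
        }

    module _ {G K : RawGroup 0ℓ 0ℓ} (α : XAct G) (β : XAct K) where
      private
        module G = RawGroup G
        module K = RawGroup K
        module α = XAct α
        module β = XAct β

      product : (∀ g k {x} → Valid x → α.act g (β.act k x) ≈ β.act k (α.act g x)) → XAct (G ×G K)
      product comm = record
        { act   = λ (g , k) x → α.act g (β.act k x)
        ; valid = λ (g , k) vx → α.valid g (β.valid k vx)
        ; resp  = λ (g , k) vx vy e → α.resp g (β.valid k vx) (β.valid k vy) (β.resp k vx vy e)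
        ; adj   = λ (g , k) vx vy e → α.adj g (β.valid k vx) (β.valid k vy) (β.adj k vx vy e)
        ; act-cong = λ {(g , k)} {(g′ , k′)} (e , e′) vx → trans (α.resp g (β.valid k vx) (β.valid k′ vx) (β.act-cong e′ vx)) (α.act-cong e (β.valid k′ vx))
        ; act-∙ = λ (g , k) (g′ , k′) {x} vx → begin
            enc (α.act (g G.∙ g′) (β.act (k K.∙ k′) x))
              ≡⟨ α.resp (g G.∙ g′) (β.valid _ vx) (β.valid k (β.valid k′ vx)) (β.act-∙ k k′ vx) ⟩
            enc (α.act (g G.∙ g′) (β.act k (β.act k′ x)))
              ≡⟨ α.act-∙ g g′ (β.valid k (β.valid k′ vx)) ⟩
            enc (α.act g (α.act g′ (β.act k (β.act k′ x))))
              ≡⟨ α.resp g (α.valid g′ (β.valid k (β.valid k′ vx))) (β.valid k (α.valid g′ (β.valid k′ vx))) (comm g′ k (β.valid k′ vx)) ⟩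
            enc (α.act g (β.act k (α.act g′ (β.act k′ x)))) ∎
        ; act-ε = λ vx → trans (α.resp G.ε (β.valid K.ε vx) vx (β.act-ε vx)) (α.act-ε vx)
        ; act-⁻¹ˡ = λ (g , k) {x} vx → begin
            enc (α.act (g G.⁻¹) (β.act (k K.⁻¹) (α.act g (β.act k x))))
              ≡⟨ α.resp (g G.⁻¹) (β.valid _ (α.valid g (β.valid k vx))) (α.valid g (β.valid _ (β.valid k vx))) (sym (comm g (k K.⁻¹) (β.valid k vx))) ⟩
            enc (α.act (g G.⁻¹) (α.act g (β.act (k K.⁻¹) (β.act k x))))
              ≡⟨ α.act-⁻¹ˡ g (β.valid _ (β.valid k vx)) ⟩
            enc (β.act (k K.⁻¹) (β.act k x))
              ≡⟨ β.act-⁻¹ˡ k vx ⟩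
            enc x ∎
        ; act-⁻¹ʳ = λ (g , k) {x} vx → begin
            enc (α.act g (β.act k (α.act (g G.⁻¹) (β.act (k K.⁻¹) x))))
              ≡⟨ α.resp g (β.valid k (α.valid _ (β.valid _ vx))) (α.valid _ (β.valid k (β.valid _ vx))) (sym (comm (g G.⁻¹) k (β.valid _ vx))) ⟩
            enc (α.act g (α.act (g G.⁻¹) (β.act k (β.act (k K.⁻¹) x))))
              ≡⟨ α.act-⁻¹ʳ g (β.valid k (β.valid _ vx)) ⟩
            enc (β.act k (β.act (k K.⁻¹) x))
              ≡⟨ β.act-⁻¹ʳ k vx ⟩
            enc x ∎
        }
        where open ≡-Reasoning

    module _ {N : RawGroup 0ℓ 0ℓ} (σ : RawGroup.Carrier N → RawGroup.Carrier N) (α : XAct N) (T : Move) where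
      private
        module N = RawGroup N
        module S = RawGroup (SemiZ2 N σ)
        module α = XAct α
        module T = Move T
        t : X → X
        t = T.move

      -- The element (h , true) acts as the move t followed by h, and the second hypothesis is the
      -- rule t h = σ(h) t.
      semidirect : (∀ {x} → Valid x → t (t x) ≈ x) →
                   (∀ h {x} → Valid x → t (α.act h x) ≈ α.act (σ h) (t x)) → XAct (SemiZ2 N σ)
      semidirect invol comm = record
        { act      = sact
        ; valid    = λ { (h , false) vx → α.valid h vx ; (h , true) vx → α.valid h (T.valid vx) }
        ; resp     = λ { (h , false) vx vy e → α.resp h vx vy e
                       ; (h , true) vx vy e → α.resp h (T.valid vx) (T.valid vy) (T.resp vx vy e) }
        ; adj      = λ { (h , false) vx vy e → α.adj h vx vy e
                       ; (h , true) vx vy e → α.adj h (T.valid vx) (T.valid vy) (T.adj vx vy e) }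
        ; act-cong = λ { {_ , false} (e , refl) vx → α.act-cong e vx ; {_ , true} (e , refl) vx → α.act-cong e (T.valid vx) }
        ; act-∙    = s∙
        ; act-ε    = α.act-ε
        ; act-⁻¹ˡ  = λ { (g , false) vx → α.act-⁻¹ˡ g vx
                       ; (g , true) vx → trans (sym (comm (g N.⁻¹) (α.valid g (T.valid vx))))
                           (trans (T.resp (α.valid _ (α.valid g (T.valid vx))) (T.valid vx) (α.act-⁻¹ˡ g (T.valid vx))) (invol vx)) }
        ; act-⁻¹ʳ  = λ { (g , false) vx → α.act-⁻¹ʳ g vx
                       ; (g , true) vx → trans (α.resp g (T.valid (α.valid _ (T.valid vx))) (α.valid _ vx)
                             (trans (T.resp (α.valid _ (T.valid vx)) (T.valid (α.valid _ vx)) (sym (comm (g N.⁻¹) vx))) (invol (α.valid _ vx))))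
                           (α.act-⁻¹ʳ g vx) }
        }
        where
        sact : S.Carrier → X → X
        sact (h , false) x = α.act h x
        sact (h , true)  x = α.act h (t x)
        s∙ : ∀ g h {x} → Valid x → sact (g S.∙ h) x ≈ sact g (sact h x)
        s∙ (g , false) (h , false) vx = α.act-∙ g h vx
        s∙ (g , false) (h , true)  vx = α.act-∙ g h (T.valid vx)
        s∙ (g , true)  (h , false) vx = trans (α.act-∙ g (σ h) (T.valid vx))
          (α.resp g (α.valid (σ h) (T.valid vx)) (T.valid (α.valid h vx)) (sym (comm h vx)))
        s∙ (g , true)  (h , true)  vx = trans (α.act-∙ g (σ h) vx)
          (α.resp g (α.valid (σ h) vx) (T.valid (α.valid h (T.valid vx)))
            (trans (α.resp (σ h) vx (T.valid (T.valid vx)) (sym (invol vx))) (sym (comm h (T.valid vx)))))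

    module _ (R : Move) where
      private
        module R = Move R

      power : ℕ → X → X
      power zero    x = x
      power (suc i) x = R.move (power i x)

      power-valid : ∀ i {x} → Valid x → Valid (power i x)
      power-valid zero    vx = vx
      power-valid (suc i) vx = R.valid (power-valid i vx)

      power-resp : ∀ i {x y} → Valid x → Valid y → x ≈ y → power i x ≈ power i y
      power-resp zero    vx vy e = e
      power-resp (suc i) vx vy e = R.resp (power-valid i vx) (power-valid i vy) (power-resp i vx vy e)

      power-adj : ∀ i {x y} → Valid x → Valid y → enc x ∼ enc y → enc (power i x) ∼ enc (power i y)
      power-adj zero    vx vy e = e
      power-adj (suc i) vx vy e = R.adj (power-valid i vx) (power-valid i vy) (power-adj i vx vy e)

      power-+ : ∀ i j x → power (i ℕ.+ j) x ≡ power i (power j x)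
      power-+ zero    j x = refl
      power-+ (suc i) j x = cong R.move (power-+ i j x)

      module _ (m : ℕ) .{{_ : NonZero m}} (order : ∀ {x} → Valid x → power m x ≈ x) where

        private
          multiples : ∀ c {x} → Valid x → power (c ℕ.* m) x ≈ x
          multiples zero    vx = refl
          multiples (suc c) {x} vx = trans (cong enc (power-+ m (c ℕ.* m) x))
            (trans (order (power-valid (c ℕ.* m) vx)) (multiples c vx))

          power-% : ∀ i {x} → Valid x → power (i ℕ.% m) x ≈ power i x
          power-% i {x} vx = sym (trans (cong (λ j → enc (power j x)) (ℕ.m≡m%n+[m/n]*n i m))
            (trans (cong enc (power-+ (i ℕ.% m) (i ℕ./ m ℕ.* m) x))
              (power-resp (i ℕ.% m) (power-valid (i ℕ./ m ℕ.* m) vx) vx (multiples (i ℕ./ m) vx))))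

          power-fromℕ< : ∀ i {x} → Valid x → power (toℕ (Data.Fin.fromℕ< (ℕ.m%n<n i m))) x ≈ power i x
          power-fromℕ< i {x} vx = trans (cong (λ j → enc (power j x)) (toℕ-fromℕ< (ℕ.m%n<n i m))) (power-% i vx)

          negated : ∀ (a : Fin m) {x} → Valid x → power (m ℕ.∸ toℕ a ℕ.+ toℕ a) x ≈ x
          negated a {x} vx = trans (cong (λ j → enc (power j x)) (ℕ.m∸n+n≡m (ℕ.<⇒≤ (toℕ<n a)))) (order vx)

        cyclic : XAct (Z m)
        cyclic = record
          { act = λ a → power (toℕ a)
          ; valid = λ a → power-valid (toℕ a)
          ; resp = λ a → power-resp (toℕ a)
          ; adj = λ a → power-adj (toℕ a)
          ; act-cong = λ { refl _ → refl }
          ; act-∙ = λ a b {x} vx → trans (power-fromℕ< (toℕ a ℕ.+ toℕ b) vx) (cong enc (power-+ (toℕ a) (toℕ b) x))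
          ; act-ε = λ vx → power-fromℕ< 0 vx
          ; act-⁻¹ˡ = λ a {x} vx → trans (power-fromℕ< (m ℕ.∸ toℕ a) (power-valid (toℕ a) vx))
              (trans (cong enc (sym (power-+ (m ℕ.∸ toℕ a) (toℕ a) x))) (negated a vx))
          ; act-⁻¹ʳ = λ a {x} vx → trans (power-resp (toℕ a) (power-valid (toℕ (Data.Fin.fromℕ< (ℕ.m%n<n (m ℕ.∸ toℕ a) m))) vx) (power-valid (m ℕ.∸ toℕ a) vx) (power-fromℕ< (m ℕ.∸ toℕ a) vx))
              (trans (cong enc (sym (power-+ (toℕ a) (m ℕ.∸ toℕ a) x)))
                (trans (cong (λ j → enc (power j x)) (ℕ.+-comm (toℕ a) (m ℕ.∸ toℕ a))) (negated a vx)))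
          }

-- Finite models verified by evaluation, and the cube GP(4,1).

module Models where

  open import Defs
  open Automorphisms
  open NormalForms
  open ClosedWalks
  open FiniteGraphs
  open ConfigurationActions
  open import Data.Nat using (zero; suc)
  open import Data.Fin as Fin using (Fin; zero; suc)
  open import Data.Fin.Permutation using (transpose)
  open import Data.Bool using (Bool; true; false; not; _∧_; _∨_; _xor_; if_then_else_)
  open import Data.Bool.Properties using (not-involutive) renaming (_≟_ to _≟ᵇ_)
  open import Data.Bool.ListAction using (all; any)
  open import Data.Product using (∃; _×_; _,_; proj₁; proj₂)
  open import Data.Product.Properties using (≡-dec)
  open import Data.Unit using (tt)
  open import Data.List using (List; []; _∷_; allFin; cartesianProduct)
  open import Data.List.Membership.Propositional using (_∈_)
  open import Data.List.Membership.Propositional.Properties using (∈-allFin; ∈-cartesianProduct⁺)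
  open import Data.List.Relation.Unary.All as All using (All; []; _∷_)
  open import Data.List.Relation.Unary.Any using (here; there)
  open import Data.Vec using ([]; _∷_; lookup)
  open import Function.Bundles using (_↔_; Inverse)
  open import Relation.Binary.PropositionalEquality using (_≡_; refl; sym; trans; cong; cong₂; subst)
  open import Relation.Binary.Definitions using (DecidableEquality)
  open import Relation.Nullary using (Dec; does; contradiction)
  open import Relation.Nullary.Decidable using (dec-true)
  open import Algebra.Bundles.Raw using (RawGroup)
  open Inverse using (to; from; strictlyInverseˡ; strictlyInverseʳ)

  record Enum (X : Set) : Set where
    field
      elems    : List X
      complete : ∀ x → x ∈ elems
      _≟ᵉ_     : DecidableEquality X

    check : (f : X → Bool) → all f elems ≡ true → ∀ x → f x ≡ true
    check f e x = All.lookup (all-sound {f = f} {elems} e) (complete x)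

  finE : ∀ n → Enum (Fin n)
  finE n = record { elems = allFin n ; complete = ∈-allFin ; _≟ᵉ_ = Fin._≟_ }

  boolE : Enum Bool
  boolE = record { elems = false ∷ true ∷ [] ; complete = λ { false → here refl ; true → there (here refl) } ; _≟ᵉ_ = _≟ᵇ_ }

  infixr 6 _×E_
  _×E_ : ∀ {X Y} → Enum X → Enum Y → Enum (X × Y)
  A ×E B = record
    { elems = cartesianProduct (Enum.elems A) (Enum.elems B)
    ; complete = λ (x , y) → ∈-cartesianProduct⁺ (Enum.complete A x) (Enum.complete B y)
    ; _≟ᵉ_ = ≡-dec (Enum._≟ᵉ_ A) (Enum._≟ᵉ_ B) }

  does-true⁻ : ∀ {X : Set} (x? : Dec X) → X → does x? ≡ true
  does-true⁻ = dec-true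

  _⇒ᵇ_ : Bool → Bool → Bool
  a ⇒ᵇ b = not a ∨ b

  infixr 4 _⇒ᵇ_

  ≡ᵇ-sound : ∀ {a b} → (a ≡ᵇ b) ≡ true → a ≡ b
  ≡ᵇ-sound {false} {false} _ = refl
  ≡ᵇ-sound {true}  {true}  _ = refl

  any-complete : ∀ {I : Set} {f : I → Bool} is {j} → j ∈ is → f j ≡ true → any f is ≡ true
  any-complete (i ∷ is) (here refl) e rewrite e = refl
  any-complete {f = f} (i ∷ is) (there m) e with f i
  ... | true  = refl
  ... | false = any-complete is m e

  -- Vertices encode the valid elements of X up to the relation same.
  record Model {V : Set} (_∼_ : V → V → Set) {X : Set} (valid? : X → Bool) (same adjX : X → X → Bool) : Set where

    Valid : X → Set
    Valid x = valid? x ≡ true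

    field
      enc       : X → V
      dec       : V → X
      dec-valid : ∀ w → Valid (dec w)
      enc-dec   : ∀ w → enc (dec w) ≡ w
      enc⇒same  : ∀ {x y} → Valid x → Valid y → enc x ≡ enc y → same x y ≡ true
      same⇒enc  : ∀ {x y} → Valid x → Valid y → same x y ≡ true → enc x ≡ enc y
      adj⇒adjX  : ∀ {x y} → Valid x → Valid y → enc x ∼ enc y → adjX x y ≡ true
      adjX⇒adj  : ∀ {x y} → Valid x → Valid y → adjX x y ≡ true → enc x ∼ enc y

    module _ (φ : X → X) (vφ : ∀ {x} → Valid x → Valid (φ x)) where

      resp : (∀ x y → same x y ≡ true → same (φ x) (φ y) ≡ true) →
             ∀ {x y} → Valid x → Valid y → enc x ≡ enc y → enc (φ x) ≡ enc (φ y)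
      resp sφ {x} {y} vx vy e = same⇒enc (vφ vx) (vφ vy) (sφ x y (enc⇒same vx vy e))

      keeps : (∀ {x y} → Valid x → Valid y → adjX x y ≡ true → adjX (φ x) (φ y) ≡ true) →
              ∀ {x y} → Valid x → Valid y → enc x ∼ enc y → enc (φ x) ∼ enc (φ y)
      keeps aφ vx vy e = adjX⇒adj (vφ vx) (vφ vy) (aφ vx vy (adj⇒adjX vx vy e))

    module Exact (≡-same : ∀ {x y} → same x y ≡ true → x ≡ y) (same-refl : ∀ x → same x x ≡ true) where

      enc-inj : ∀ {x y} → Valid x → Valid y → enc x ≡ enc y → x ≡ y
      enc-inj vx vy e = ≡-same (enc⇒same vx vy e)

      resp-≡ : (φ : X → X) → ∀ {x y} → Valid x → Valid y → enc x ≡ enc y → enc (φ x) ≡ enc (φ y)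
      resp-≡ φ vx vy e = cong (λ x → enc (φ x)) (enc-inj vx vy e)

      keeps-neighbours : (nbr : Fin 3 → X → X) (adjX≡ : ∀ x y → adjX x y ≡ any (λ i → same (nbr i x) y) (allFin 3)) →
        (φ : X → X) → (∀ {x} → Valid x → Valid (φ x)) → (∀ i x → Valid x → ∃ λ j → φ (nbr i x) ≡ nbr j (φ x)) →
        ∀ {x y} → Valid x → Valid y → enc x ∼ enc y → enc (φ x) ∼ enc (φ y)
      keeps-neighbours nbr adjX≡ φ vφ nφ = keeps φ vφ λ {x} {y} vx vy e →
        let i , _ , e′ = any-sound {f = λ i → same (nbr i x) y} {allFin 3} (trans (sym (adjX≡ x y)) e)
            j , eq = nφ i x vx
        in trans (adjX≡ (φ x) (φ y)) (any-complete {f = λ j → same (nbr j (φ x)) (φ y)} (allFin 3) (∈-allFin j)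
             (subst (λ z → same (nbr j (φ x)) z ≡ true) (trans (sym eq) (cong φ (≡-same e′))) (same-refl (nbr j (φ x)))))

  module Encoding {V : Set} {_∼_ : V → V → Set} (Γ : FiniteGraph V _∼_) {X : Set} (E : Enum X)
    (valid? : X → Bool) (same : X → X → Bool) (dec : V → X) (default : V) where

    open FiniteGraph Γ
    open Enum E using (elems; check)

    Valid : X → Set
    Valid x = valid? x ≡ true

    encode : X → V
    encode x = find vs
      where
      find : List V → V
      find []       = default
      find (w ∷ ws) = if same (dec w) x then w else find ws

    decodes : Bool
    decodes = all (λ w → valid? (dec w) ∧ (encode (dec w) ≐ w)) vs

    module _ (ok : decodes ≡ true) where
      private
        both : ∀ w → valid? (dec w) ≡ true × (encode (dec w) ≐ w) ≡ true
        both w = ∧-true (All.lookup (all-sound {f = λ w → valid? (dec w) ∧ (encode (dec w) ≐ w)} {vs} ok) (complete w))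

      dec-valid : ∀ w → Valid (dec w)
      dec-valid w = proj₁ (both w)

      enc-dec : ∀ w → encode (dec w) ≡ w
      enc-dec w = ≐-sound (proj₂ (both w))

      exactModel : (∀ {x y} → same x y ≡ true → x ≡ y) → (∀ x → same x x ≡ true) → (adjX : X → X → Bool) →
        all (λ x → valid? x ⇒ᵇ same (dec (encode x)) x) elems ≡ true →
        all (λ w → all (λ w′ → adj w w′ ≡ᵇ adjX (dec w) (dec w′)) vs) vs ≡ true →
        Model _∼_ valid? same adjX
      exactModel ≡-same same-refl adjX ok₁ ok₂ = record
        { enc = encode ; dec = dec ; dec-valid = dec-valid ; enc-dec = enc-dec
        ; enc⇒same = λ {x} {y} vx vy e → subst (λ z → same x z ≡ true) (trans (sym (dec-enc x vx)) (trans (cong dec e) (dec-enc y vy))) (same-refl x)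
        ; same⇒enc = λ vx vy e → cong encode (≡-same e)
        ; adj⇒adjX = λ {x} {y} vx vy e → trans (sym (adj-adjX x y vx vy)) (⇒adj e)
        ; adjX⇒adj = λ {x} {y} vx vy e → adj⇒ (trans (adj-adjX x y vx vy) e)
        }
        where
        dec-enc : ∀ x → Valid x → dec (encode x) ≡ x
        dec-enc x vx = ≡-same (∨-skip (check (λ x → valid? x ⇒ᵇ same (dec (encode x)) x) ok₁ x) vx)
        adj-adjX : ∀ x y → Valid x → Valid y → adj (encode x) (encode y) ≡ adjX x y
        adj-adjX x y vx vy = trans (≡ᵇ-sound (All.lookup (all-sound {f = λ w′ → adj (encode x) w′ ≡ᵇ adjX (dec (encode x)) (dec w′)} {vs}
            (All.lookup (all-sound {f = λ w → all (λ w′ → adj w w′ ≡ᵇ adjX (dec w) (dec w′)) vs} {vs} ok₂) (complete (encode x)))) (complete (encode y))))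
          (cong₂ adjX (dec-enc x vx) (dec-enc y vy))

    table : List X → List (X × V)
    table []       = []
    table (x ∷ xs) = if valid? x then (x , encode x) ∷ table xs else table xs

    table-complete : ∀ xs {x} → x ∈ xs → Valid x → (x , encode x) ∈ table xs
    table-complete (x ∷ xs) (here refl) vx with valid? x | vx
    ... | true | _ = here refl
    table-complete (x ∷ xs) (there m) vx with valid? x
    ... | true  = there (table-complete xs m vx)
    ... | false = table-complete xs m vx

    -- The encodings are tabulated once, since recomputing them for every pair would dominate the check.
    pairwise : (X → X → Bool) → List (X × V) → Bool
    pairwise adjX t = all (λ (x , w) → all (λ (y , w′) → ((w ≐ w′) ≡ᵇ same x y) ∧ (adj w w′ ≡ᵇ adjX x y)) t) t

    -- When several configurations encode one vertex, equality and adjacency must be compared on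
    -- pairs of configurations and not just on pairs of vertices.
    pairedModel : decodes ≡ true → (adjX : X → X → Bool) → pairwise adjX (table elems) ≡ true → Model _∼_ valid? same adjX
    pairedModel ok adjX ok₂ = record
      { enc = encode ; dec = dec ; dec-valid = dec-valid ok ; enc-dec = enc-dec ok
      ; enc⇒same = λ {x} {y} vx vy e → trans (sym (proj₁ (pair x y vx vy))) (subst (λ w → (encode x ≐ w) ≡ true) e (≐-refl (encode x)))
      ; same⇒enc = λ {x} {y} vx vy e → ≐-sound (trans (proj₁ (pair x y vx vy)) e)
      ; adj⇒adjX = λ {x} {y} vx vy e → trans (sym (proj₂ (pair x y vx vy))) (⇒adj e)
      ; adjX⇒adj = λ {x} {y} vx vy e → adj⇒ (trans (proj₂ (pair x y vx vy)) e)
      }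
      where
      pair : ∀ x y → Valid x → Valid y → (encode x ≐ encode y) ≡ same x y × adj (encode x) (encode y) ≡ adjX x y
      pair x y vx vy = let e₁ , e₂ = ∧-true {(encode x ≐ encode y) ≡ᵇ same x y}
                             (All.lookup (all-sound {f = λ (y , w′) → ((encode x ≐ w′) ≡ᵇ same x y) ∧ (adj (encode x) w′ ≡ᵇ adjX x y)} {table elems}
                               (All.lookup (all-sound {f = λ (x , w) → all (λ (y , w′) → ((w ≐ w′) ≡ᵇ same x y) ∧ (adj w w′ ≡ᵇ adjX x y)) (table elems)} {table elems} ok₂)
                                 (table-complete elems (Enum.complete E x) vx))) (table-complete elems (Enum.complete E y) vy))
        in ≡ᵇ-sound e₁ , ≡ᵇ-sound e₂

  _=ᶠ_ : ∀ {n} → Fin n → Fin n → Bool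
  i =ᶠ j = does (i Fin.≟ j)

  =ᶠ-image : ∀ {n m} (f : Fin n ↔ Fin m) i j → (to f i =ᶠ to f j) ≡ (i =ᶠ j)
  =ᶠ-image f i j = iff
    (λ e → does-true⁻ (i Fin.≟ j) (trans (sym (strictlyInverseʳ f i)) (trans (cong (from f) (does-true (to f i Fin.≟ to f j) e)) (strictlyInverseʳ f j))))
    (λ e → does-true⁻ (to f i Fin.≟ to f j) (cong (to f) (does-true (i Fin.≟ j) e)))

  swap : ∀ {n} → Fin n → Fin n → RawGroup.Carrier (S n)
  swap i j = transpose i j , tt

  -- GP(4,1) is K₄ × K₂.
  module Cube where

    Γ : FiniteGraph (GPV 4) (GPAdj 4 1)
    Γ = petersen 3 1

    X : Set
    X = Fin 4 × Bool

    E : Enum X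
    E = finE 4 ×E boolE

    dec : GPV 4 → X
    dec (u i) = lookup ((#0 , false) ∷ (#1 , true) ∷ (#3 , false) ∷ (#2 , true) ∷ []) i
    dec (v i) = lookup ((#3 , true) ∷ (#2 , false) ∷ (#0 , true) ∷ (#1 , false) ∷ []) i

    adjX : X → X → Bool
    adjX (i , a) (j , b) = not (i =ᶠ j) ∧ (a xor b)

    same : X → X → Bool
    same x y = does (Enum._≟ᵉ_ E x y)

    open Encoding Γ E (λ _ → true) same dec (u #0) using (encode; exactModel)

    module Acting (𝓜 : Model (GPAdj 4 1) {X} (λ _ → true) same adjX) where
      open Model 𝓜 hiding (dec)
      open Exact (λ {x} {y} → does-true (Enum._≟ᵉ_ E x y)) (λ x → does-true⁻ (Enum._≟ᵉ_ E x x) refl)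
      open Configurations {_∼_ = GPAdj 4 1} Valid enc (Model.dec 𝓜) dec-valid enc-dec

      private
        permute : Fin 4 ↔ Fin 4 → X → X
        permute f (i , b) = to f i , b

        toggle : X → X
        toggle (i , b) = i , not b

      symmetric : XAct (S 4)
      symmetric = record
        { act = λ (f , _) → permute f
        ; valid = λ _ _ → refl
        ; resp = λ (f , _) {x} {y} → resp-≡ (permute f) {x} {y}
        ; adj = λ (f , _) {x} {y} → keeps (permute f) (λ _ → refl)
            (λ {(i , a)} {(j , b)} _ _ e → trans (cong (λ z → not z ∧ (a xor b)) (=ᶠ-image f i j)) e) {x} {y}
        ; act-cong = λ e {(i , b)} _ → cong (λ j → enc (j , b)) (e i)
        ; act-∙ = λ _ _ _ → refl
        ; act-ε = λ _ → refl
        ; act-⁻¹ˡ = λ (f , _) {(i , b)} _ → cong (λ j → enc (j , b)) (strictlyInverseʳ f i)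
        ; act-⁻¹ʳ = λ (f , _) {(i , b)} _ → cong (λ j → enc (j , b)) (strictlyInverseˡ f i)
        }

      flip : Move
      flip = record
        { move = toggle
        ; valid = λ _ → refl
        ; resp = λ {x} {y} → resp-≡ toggle {x} {y}
        ; adj = λ {x} {y} → keeps toggle (λ _ → refl) (λ {(i , a)} {(j , b)} _ _ e → trans (cong (not (i =ᶠ j) ∧_) (not-not a b)) e) {x} {y}
        }
        where
        not-not : ∀ a b → not a xor not b ≡ a xor b
        not-not false b = not-involutive b
        not-not true  b = refl

      both : XAct (S 4 ×G Z 2)
      both = product symmetric (cyclic flip 2 λ {(i , b)} _ → cong (λ c → enc (i , c)) (not-involutive b))
        λ { (f , _) zero {x} _ → refl ; (f , _) (suc zero) {x} _ → refl }

      private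
        inj : ∀ x y → enc x ≡ enc y → x ≡ y
        inj x y = enc-inj {x} {y} refl refl

        faithful : ∀ {g h} → (∀ {x} → Valid x → enc (XAct.act both g x) ≡ enc (XAct.act both h x)) →
                   RawGroup._≈_ (S 4 ×G Z 2) g h
        faithful {g@(_ , zero)}     {h@(_ , zero)}     e = (λ i → cong proj₁ (inj (XAct.act both g (i , false)) (XAct.act both h (i , false)) (e {i , false} refl))) , refl
        faithful {g@(_ , suc zero)} {h@(_ , suc zero)} e = (λ i → cong proj₁ (inj (XAct.act both g (i , false)) (XAct.act both h (i , false)) (e {i , false} refl))) , refl
        faithful {g@(_ , zero)}     {h@(_ , suc zero)} e = contradiction (cong proj₂ (inj (XAct.act both g (#0 , false)) (XAct.act both h (#0 , false)) (e {#0 , false} refl))) λ ()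
        faithful {g@(_ , suc zero)} {h@(_ , zero)}     e = contradiction (cong proj₂ (inj (XAct.act both g (#0 , false)) (XAct.act both h (#0 , false)) (e {#0 , false} refl))) λ ()

      acting : Action Γ (S 4 ×G Z 2)
      acting = action both Γ λ {g} {h} → faithful {g} {h}

    open Transitivity Γ (Acting.acting (exactModel refl (λ {x} {y} → does-true (Enum._≟ᵉ_ E x y)) (λ x → does-true⁻ (Enum._≟ᵉ_ E x x) refl) adjX refl refl))

    -- The chain is the usual one of the symmetric group: fixing 0 leaves the permutations of 1, 2,
    -- 3, and fixing 1 as well leaves the exchange of 2 and 3.
    cube : Represents (S 4 ×G Z 2) (GPV 4) (GPAdj 4 1)
    cube = represents 4 ((encode (#0 , false) , (swap #0 #1 , #0) ∷ (swap #1 #2 , #0) ∷ (swap #2 #3 , #0) ∷ (swap #0 #0 , #1) ∷ [])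
      ∷ (encode (#1 , true) , (swap #1 #2 , #0) ∷ (swap #2 #3 , #0) ∷ [])
      ∷ (encode (#2 , true) , (swap #2 #3 , #0) ∷ []) ∷ []) refl

-- D(GP(5,2)) and the 2-subsets of a set of five.

module DesarguesGraph where

  open import Defs
  open Automorphisms
  open NormalForms
  open ClosedWalks
  open FiniteGraphs
  open ConfigurationActions
  open import Data.Nat using (zero; suc)
  open import Data.Fin as Fin using (Fin; zero; suc)
  open import Data.Bool using (Bool; true; false; not; _∧_; _∨_; _xor_)
  open import Data.Bool.Properties using (not-involutive)
  open import Data.Product using (∃; _×_; _,_; proj₁; proj₂)
  open import Data.Unit using (tt)
  open import Data.Sum using (_⊎_; inj₁; inj₂)
  open import Data.List using ([]; _∷_)
  open import Data.List.Relation.Unary.All using ([]; _∷_)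
  open import Data.Vec using ([]; _∷_; lookup)
  open import Function.Bundles using (_↔_; Inverse)
  open import Relation.Binary.PropositionalEquality using (_≡_; refl; sym; trans; cong; cong₂)
  open import Relation.Nullary using (contradiction)
  open import Algebra.Bundles.Raw using (RawGroup)
  open Models
  open Inverse using (to; from; strictlyInverseˡ; strictlyInverseʳ)

  -- Vertices of the Petersen graph are the 2-subsets of Fin 5, given here by either of their orderings.
  module Kneser where

    Γ : FiniteGraph (DV 5) (DAdj 5 2)
    Γ = doubleCover 4 2

    X : Set
    X = Fin 5 × Fin 5 × Bool

    E : Enum X
    E = finE 5 ×E finE 5 ×E boolE

    valid? : X → Bool
    valid? (i , j , _) = not (i =ᶠ j)

    same : X → X → Bool
    same (i , j , a) (k , l , b) = (a ≡ᵇ b) ∧ (((i =ᶠ k) ∧ (j =ᶠ l)) ∨ ((i =ᶠ l) ∧ (j =ᶠ k)))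

    adjX : X → X → Bool
    adjX (i , j , a) (k , l , b) = (a xor b) ∧ (not (i =ᶠ k) ∧ not (i =ᶠ l) ∧ not (j =ᶠ k) ∧ not (j =ᶠ l))

    #4 : Fin 5
    #4 = suc #3

    pairs : GPV 5 → Fin 5 × Fin 5
    pairs (u i) = lookup ((#1 , #0) ∷ (#3 , #2) ∷ (#4 , #0) ∷ (#3 , #1) ∷ (#4 , #2) ∷ []) i
    pairs (v i) = lookup ((#4 , #3) ∷ (#4 , #1) ∷ (#2 , #1) ∷ (#2 , #0) ∷ (#3 , #0) ∷ []) i

    dec : DV 5 → X
    dec (w , b) = proj₁ (pairs w) , proj₂ (pairs w) , b

    open Encoding Γ E valid? same dec (u #0 , false) using (encode; pairedModel)

    module Acting (𝓜 : Model (DAdj 5 2) valid? same adjX) where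

      open Model 𝓜 hiding (dec)
      open Configurations {_∼_ = DAdj 5 2} Valid enc (Model.dec 𝓜) dec-valid enc-dec

      permute : Fin 5 ↔ Fin 5 → X → X
      permute f (i , j , b) = to f i , to f j , b

      toggle : X → X
      toggle (i , j , b) = i , j , not b

      permute-valid : ∀ f {x} → Valid x → Valid (permute f x)
      permute-valid f {i , j , b} vx = trans (cong not (=ᶠ-image f i j)) vx

      private
        not-not : ∀ a b → not a xor not b ≡ a xor b
        not-not false b = not-involutive b
        not-not true  b = refl

      symmetric : XAct (S 5)
      symmetric = record
        { act = λ (f , _) → permute f
        ; valid = λ (f , _) {x} → permute-valid f {x}
        ; resp = λ (f , _) {x} {y} → resp (permute f) (λ {x} → permute-valid f {x}) (λ (i , j , a) (k , l , b) → trans (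
            cong₄ (λ p q r s → (a ≡ᵇ b) ∧ ((p ∧ q) ∨ (r ∧ s))) (=ᶠ-image f i k) (=ᶠ-image f j l) (=ᶠ-image f i l) (=ᶠ-image f j k))) {x} {y}
        ; adj = λ (f , _) {x} {y} → keeps (permute f) (λ {x} → permute-valid f {x}) (λ {(i , j , a)} {(k , l , b)} _ _ → trans (
            cong₄ (λ p q r s → (a xor b) ∧ (not p ∧ not q ∧ not r ∧ not s)) (=ᶠ-image f i k) (=ᶠ-image f i l) (=ᶠ-image f j k) (=ᶠ-image f j l))) {x} {y}
        ; act-cong = λ e {(i , j , b)} _ → cong₂ (λ i j → enc (i , j , b)) (e i) (e j)
        ; act-∙ = λ _ _ _ → refl
        ; act-ε = λ _ → refl
        ; act-⁻¹ˡ = λ (f , _) {(i , j , b)} _ → cong₂ (λ i j → enc (i , j , b)) (strictlyInverseʳ f i) (strictlyInverseʳ f j)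
        ; act-⁻¹ʳ = λ (f , _) {(i , j , b)} _ → cong₂ (λ i j → enc (i , j , b)) (strictlyInverseˡ f i) (strictlyInverseˡ f j)
        }

      flip : Move
      flip = record
        { move = toggle
        ; valid = λ vx → vx
        ; resp = λ {x} {y} → resp toggle (λ vx → vx) (λ (i , j , a) (k , l , b) → trans (
            cong (λ z → not z ∧ (((i =ᶠ k) ∧ (j =ᶠ l)) ∨ ((i =ᶠ l) ∧ (j =ᶠ k)))) (not-not a b))) {x} {y}
        ; adj = λ {x} {y} → keeps toggle (λ vx → vx) (λ {(i , j , a)} {(k , l , b)} _ _ → trans (
            cong (_∧ (not (i =ᶠ k) ∧ not (i =ᶠ l) ∧ not (j =ᶠ k) ∧ not (j =ᶠ l))) (not-not a b))) {x} {y}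
        }

      both : XAct (S 5 ×G Z 2)
      both = product symmetric (cyclic flip 2 λ {(i , j , b)} _ → cong (λ c → enc (i , j , c)) (not-involutive b))
        λ { (f , _) zero {x} _ → refl ; (f , _) (suc zero) {x} _ → refl }

      private
        other₁ other₂ : Fin 5 → Fin 5
        other₁ #0 = #1
        other₁ (suc _) = #0
        other₂ #0 = #2
        other₂ #1 = #2
        other₂ (suc (suc _)) = #1

        distinct : ∀ i → not (i =ᶠ other₁ i) ≡ true × not (i =ᶠ other₂ i) ≡ true × not (other₁ i =ᶠ other₂ i) ≡ true
        distinct #0 = refl , refl , refl
        distinct #1 = refl , refl , refl
        distinct (suc (suc _)) = refl , refl , refl

        first-member : ∀ {a b} {i j k l : Fin 5} → (a ≡ᵇ b) ∧ (((i =ᶠ k) ∧ (j =ᶠ l)) ∨ ((i =ᶠ l) ∧ (j =ᶠ k))) ≡ true → i ≡ k ⊎ i ≡ l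
        first-member {a} {b} {i} {j} {k} {l} e with ∨-true {(i =ᶠ k) ∧ (j =ᶠ l)} (proj₂ (∧-true {a ≡ᵇ b} e))
        ... | inj₁ p = inj₁ (does-true (i Fin.≟ k) (proj₁ (∧-true {i =ᶠ k} p)))
        ... | inj₂ p = inj₂ (does-true (i Fin.≟ l) (proj₁ (∧-true {i =ᶠ l} p)))

        -- A point is the intersection of two of the 2-subsets containing it.
        point : ∀ (f g : Fin 5 ↔ Fin 5) i j k → not (j =ᶠ k) ≡ true →
                to f i ≡ to g i ⊎ to f i ≡ to g j → to f i ≡ to g i ⊎ to f i ≡ to g k → to f i ≡ to g i
        point f g i j k ne (inj₁ e) _ = e
        point f g i j k ne _ (inj₁ e) = e
        point f g i j k ne (inj₂ e) (inj₂ e′) = contradiction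
          (trans (sym ne) (cong not (does-true⁻ (j Fin.≟ k) (trans (sym (strictlyInverseʳ g j)) (trans (cong (from g) (trans (sym e) e′)) (strictlyInverseʳ g k)))))) λ ()

        shifted : Fin 2 → X → X
        shifted zero       x = x
        shifted (suc zero) x = toggle x

        act-both : ∀ f c x → XAct.act both ((f , tt) , c) x ≡ permute f (shifted c x)
        act-both f zero x = refl
        act-both f (suc zero) x = refl

        shifted-pair : ∀ c i j b → ∃ λ b′ → shifted c (i , j , b) ≡ (i , j , b′)
        shifted-pair zero i j b = b , refl
        shifted-pair (suc zero) i j b = not b , refl

        faithful : ∀ {g h} → (∀ {x} → Valid x → enc (XAct.act both g x) ≡ enc (XAct.act both h x)) → RawGroup._≈_ (S 5 ×G Z 2) g h
        faithful {(f , _) , c} {(g , _) , d} e =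
          (λ i → let n₁ , n₂ , n₃ = distinct i in
            point f g i (other₁ i) (other₂ i) n₃ (member i (other₁ i) n₁) (member i (other₂ i) n₂)) , level c d refl refl
          where
          compared : ∀ i j → not (i =ᶠ j) ≡ true → same (permute f (shifted c (i , j , false))) (permute g (shifted d (i , j , false))) ≡ true
          compared i j ne = enc⇒same {permute f (shifted c (i , j , false))} {permute g (shifted d (i , j , false))}
            (permute-valid f {shifted c (i , j , false)} (shifted-valid c)) (permute-valid g {shifted d (i , j , false)} (shifted-valid d))
            (trans (cong enc (sym (act-both f c (i , j , false)))) (trans (e {i , j , false} ne) (cong enc (act-both g d (i , j , false)))))
            where
            shifted-valid : ∀ c → Valid (shifted c (i , j , false))
            shifted-valid zero = ne
            shifted-valid (suc zero) = ne
          member : ∀ i j → not (i =ᶠ j) ≡ true → to f i ≡ to g i ⊎ to f i ≡ to g j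
          member i j ne with shifted c (i , j , false) | shifted d (i , j , false) | shifted-pair c i j false | shifted-pair d i j false | compared i j ne
          ... | _ | _ | a , refl | b , refl | s = first-member {a} {b} {to f i} {to f j} s
          level : ∀ c′ d′ → c ≡ c′ → d ≡ d′ → c ≡ d
          level zero zero refl refl = refl
          level (suc zero) (suc zero) refl refl = refl
          level zero (suc zero) refl refl = contradiction (compared #0 #1 refl) λ ()
          level (suc zero) zero refl refl = contradiction (compared #0 #1 refl) λ ()

      acting : Action Γ (S 5 ×G Z 2)
      acting = action both Γ λ {g} {h} → faithful {g} {h}

    open Transitivity Γ (Acting.acting (pairedModel refl adjX refl))

    -- The base vertices {0,1}, {2,3} and {2,4} leave only the exchange of 0 and 1, which moves the
    -- last base vertex {0,4}.
    desargues : Represents (S 5 ×G Z 2) (DV 5) (DAdj 5 2)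
    desargues = represents 7
      ( (encode (#0 , #1 , false) , (swap #0 #1 , #0) ∷ (swap #1 #2 , #0) ∷ (swap #2 #3 , #0) ∷ (swap #3 #4 , #0) ∷ (swap #0 #0 , #1) ∷ [])
      ∷ (encode (#2 , #3 , true) , (swap #2 #3 , #0) ∷ (swap #3 #4 , #0) ∷ [])
      ∷ (encode (#2 , #4 , true) , (swap #2 #3 , #0) ∷ [])
      ∷ (encode (#0 , #4 , false) , (swap #0 #1 , #0) ∷ []) ∷ []) refl

-- GP(12,5) and the arrangements of four symbols.

module NauruGraph where

  open import Defs
  open Automorphisms
  open NormalForms
  open ClosedWalks
  open FiniteGraphs
  open ConfigurationActions
  open import Data.Nat using (suc)
  open import Data.Fin as Fin using (Fin; suc)
  open import Data.Bool using (Bool; true; false; not; _∧_; if_then_else_)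
  open import Data.Bool.ListAction using (all; any)
  open import Data.Product using (_×_; _,_; proj₁; proj₂)
  open import Data.List using ([]; _∷_; allFin)
  open import Data.List.Membership.Propositional.Properties using (∈-allFin)
  open import Data.List.Relation.Unary.All as All using (All; []; _∷_)
  open import Data.Vec using ([]; _∷_; lookup)
  open import Function.Bundles using (_↔_; Inverse)
  open import Relation.Binary.PropositionalEquality using (_≡_; _≢_; refl; sym; trans; cong; cong₂; subst; module ≡-Reasoning)
  open import Relation.Nullary using (yes; no; does; contradiction)
  open import Algebra.Bundles.Raw using (RawGroup)
  open Models
  open Inverse using (to; from; strictlyInverseˡ; strictlyInverseʳ)

  -- GP(12,5) is the star graph on the arrangements (a , b₀ , b₁ , b₂) of Fin 4, in which a is exchanged with some bᵢ.
  module Star where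

    Γ : FiniteGraph (GPV 12) (GPAdj 12 5)
    Γ = petersen 11 5

    T : Set
    T = Fin 4 × Fin 4 × Fin 4

    X : Set
    X = Fin 4 × T

    E : Enum X
    E = finE 4 ×E finE 4 ×E finE 4 ×E finE 4

    at : T → Fin 3 → Fin 4
    at (b , _ , _) #0 = b
    at (_ , b , _) #1 = b
    at (_ , _ , b) #2 = b

    tab : (Fin 3 → Fin 4) → T
    tab h = h #0 , h #1 , h #2

    at-tab : ∀ h i → at (tab h) i ≡ h i
    at-tab h #0 = refl
    at-tab h #1 = refl
    at-tab h #2 = refl

    tab-cong : ∀ {h h′} → (∀ i → h i ≡ h′ i) → tab h ≡ tab h′
    tab-cong e = cong₂ _,_ (e #0) (cong₂ _,_ (e #1) (e #2))

    valid? : X → Bool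
    valid? (a , t) = all (λ i → not (at t i =ᶠ a)) (allFin 3) ∧
                     all (λ i → all (λ j → (i =ᶠ j) ≡ᵇ (at t i =ᶠ at t j)) (allFin 3)) (allFin 3)

    same : X → X → Bool
    same x y = does (Enum._≟ᵉ_ E x y)

    nbr : Fin 3 → X → X
    nbr i (a , t) = at t i , tab λ j → if j =ᶠ i then a else at t j

    adjX : X → X → Bool
    adjX x y = any (λ i → same (nbr i x) y) (allFin 3)

    dec : GPV 12 → X
    dec (u i) = lookup
      ( (#0 , #1 , #2 , #3) ∷ (#1 , #0 , #2 , #3) ∷ (#3 , #0 , #2 , #1) ∷ (#2 , #0 , #3 , #1)
      ∷ (#0 , #2 , #3 , #1) ∷ (#1 , #2 , #3 , #0) ∷ (#3 , #2 , #1 , #0) ∷ (#2 , #3 , #1 , #0)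
      ∷ (#0 , #3 , #1 , #2) ∷ (#1 , #3 , #0 , #2) ∷ (#3 , #1 , #0 , #2) ∷ (#2 , #1 , #0 , #3) ∷ []) i
    dec (v i) = lookup
      ( (#3 , #1 , #2 , #0) ∷ (#2 , #0 , #1 , #3) ∷ (#0 , #3 , #2 , #1) ∷ (#1 , #0 , #3 , #2)
      ∷ (#3 , #2 , #0 , #1) ∷ (#2 , #1 , #3 , #0) ∷ (#0 , #2 , #1 , #3) ∷ (#1 , #3 , #2 , #0)
      ∷ (#3 , #0 , #1 , #2) ∷ (#2 , #3 , #0 , #1) ∷ (#0 , #1 , #3 , #2) ∷ (#1 , #2 , #0 , #3) ∷ []) i

    open Encoding Γ E valid? same dec (u #0) using (encode; exactModel)

    module Acting (𝓜 : Model (GPAdj 12 5) valid? same adjX) where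

      open Model 𝓜 hiding (dec)
      open Exact (λ {x} {y} → does-true (Enum._≟ᵉ_ E x y)) (λ x → does-true⁻ (Enum._≟ᵉ_ E x x) refl)
      open Configurations {_∼_ = GPAdj 12 5} Valid enc (Model.dec 𝓜) dec-valid enc-dec

      private
        Arrangement : X → Set
        Arrangement (a , t) = (∀ i → at t i ≢ a) × (∀ i j → at t i ≡ at t j → i ≡ j)

        arrangement : ∀ {x} → Valid x → Arrangement x
        arrangement {a , t} vx with ∧-true {all (λ i → not (at t i =ᶠ a)) (allFin 3)} vx
        ... | e₁ , e₂ = (λ i eq → contradiction (trans (sym (All.lookup (all-sound {f = λ i → not (at t i =ᶠ a)} e₁) (∈-allFin i)))
                          (cong not (does-true⁻ (at t i Fin.≟ a) eq))) λ ()) ,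
            λ i j eq → does-true (i Fin.≟ j) (trans (≡ᵇ-sound (All.lookup (all-sound {f = λ j → (i =ᶠ j) ≡ᵇ (at t i =ᶠ at t j)}
              (All.lookup (all-sound {f = λ i → all (λ j → (i =ᶠ j) ≡ᵇ (at t i =ᶠ at t j)) (allFin 3)} e₂) (∈-allFin i))) (∈-allFin j)))
              (does-true⁻ (at t i Fin.≟ at t j) eq))

        ≢⇒false : ∀ {n} {i j : Fin n} → i ≢ j → not (i =ᶠ j) ≡ true
        ≢⇒false {i = i} {j} ne with i Fin.≟ j
        ... | yes e = contradiction e ne
        ... | no _  = refl

        arrangement⁻ : ∀ {x} → Arrangement x → Valid x
        arrangement⁻ {a , t} (d₁ , d₂) = cong₂ _∧_ (all-complete (allFin 3) λ {i} _ → ≢⇒false (d₁ i))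
          (all-complete (allFin 3) λ {i} _ → all-complete (allFin 3) λ {j} _ → ≡ᵇ-refl (iff
            (λ e → does-true⁻ (at t i Fin.≟ at t j) (cong (at t) (does-true (i Fin.≟ j) e)))
            (λ e → does-true⁻ (i Fin.≟ j) (d₂ i j (does-true (at t i Fin.≟ at t j) e)))))

      values : Fin 4 ↔ Fin 4 → X → X
      values f (a , t) = to f a , tab λ j → to f (at t j)

      -- The inverse turns the permutation of the places into a left action.
      places : Fin 3 ↔ Fin 3 → X → X
      places g (a , t) = a , tab λ j → at t (from g j)

      private
        at-values : ∀ (f : Fin 4 ↔ Fin 4) t i → at (tab λ j → to f (at t j)) i ≡ to f (at t i)
        at-values f t = at-tab (λ j → to f (at t j))

        at-places : ∀ (g : Fin 3 ↔ Fin 3) t i → at (tab λ j → at t (from g j)) i ≡ at t (from g i)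
        at-places g t = at-tab (λ j → at t (from g j))

        at-nbr : ∀ i a t j → at (tab λ j → if j =ᶠ i then a else at t j) j ≡ (if j =ᶠ i then a else at t j)
        at-nbr i a t = at-tab (λ j → if j =ᶠ i then a else at t j)

        ↔-inj : ∀ {n} (f : Fin n ↔ Fin n) {i j} → to f i ≡ to f j → i ≡ j
        ↔-inj f e = trans (sym (strictlyInverseʳ f _)) (trans (cong (from f) e) (strictlyInverseʳ f _))

        ↔-inj⁻ : ∀ {n} (f : Fin n ↔ Fin n) {i j} → from f i ≡ from f j → i ≡ j
        ↔-inj⁻ f e = trans (sym (strictlyInverseˡ f _)) (trans (cong (to f) e) (strictlyInverseˡ f _))

        values-valid : ∀ f {x} → Valid x → Valid (values f x)
        values-valid f {a , t} vx = let d₁ , d₂ = arrangement {a , t} vx in arrangement⁻ {values f (a , t)}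
          ( (λ i e → d₁ i (↔-inj f (trans (sym (at-values f t i)) e)))
          , λ i j e → d₂ i j (↔-inj f (trans (sym (at-values f t i)) (trans e (at-values f t j)))))

        places-valid : ∀ g {x} → Valid x → Valid (places g x)
        places-valid g {a , t} vx = let d₁ , d₂ = arrangement {a , t} vx in arrangement⁻ {places g (a , t)}
          ( (λ i e → d₁ (from g i) (trans (sym (at-places g t i)) e))
          , λ i j e → ↔-inj⁻ g (d₂ (from g i) (from g j) (trans (sym (at-places g t i)) (trans e (at-places g t j)))))

        if-to : ∀ (h : Fin 4 → Fin 4) b {x y} → h (if b then x else y) ≡ (if b then h x else h y)
        if-to h true  = refl
        if-to h false = refl

        values-nbr : ∀ f i x → values f (nbr i x) ≡ nbr i (values f x)
        values-nbr f i (a , t) = cong₂ _,_ (sym (at-values f t i)) (tab-cong λ j → trans (cong (to f) (at-nbr i a t j))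
          (trans (if-to (to f) (j =ᶠ i)) (cong (λ z → if j =ᶠ i then to f a else z) (sym (at-values f t j)))))

        places-nbr : ∀ g i x → places g (nbr i x) ≡ nbr (to g i) (places g x)
        places-nbr g i (a , t) = cong₂ _,_ (sym (trans (at-places g t (to g i)) (cong (at t) (strictlyInverseʳ g i))))
          (tab-cong λ j → trans (at-nbr i a t (from g j)) (cong₂ (λ b z → if b then a else z) (flip j) (sym (at-places g t j))))
          where
          flip : ∀ j → (from g j =ᶠ i) ≡ (j =ᶠ to g i)
          flip j = iff
            (λ e → does-true⁻ (j Fin.≟ to g i) (trans (sym (strictlyInverseˡ g j)) (cong (to g) (does-true (from g j Fin.≟ i) e))))
            (λ e → does-true⁻ (from g j Fin.≟ i) (trans (cong (from g) (does-true (j Fin.≟ to g i) e)) (strictlyInverseʳ g i)))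

      on-values : XAct (S 4)
      on-values = record
        { act = λ (f , _) → values f
        ; valid = λ (f , _) {x} → values-valid f {x}
        ; resp = λ (f , _) {x} {y} → resp-≡ (values f) {x} {y}
        ; adj = λ (f , _) {x} {y} → keeps-neighbours nbr (λ _ _ → refl) (values f) (λ {x} → values-valid f {x}) (λ i x _ → i , values-nbr f i x) {x} {y}
        ; act-cong = λ e {(a , t)} _ → cong enc (cong₂ _,_ (e a) (tab-cong λ j → e (at t j)))
        ; act-∙ = λ (f , _) (g , _) {(a , t)} _ → cong (λ t′ → enc (to f (to g a) , t′)) (tab-cong λ j → cong (to f) (sym (at-values g t j)))
        ; act-ε = λ {(a , t)} _ → refl
        ; act-⁻¹ˡ = λ (f , _) {(a , t)} _ → cong enc (cong₂ _,_ (strictlyInverseʳ f a) (tab-cong λ j → trans (cong (from f) (at-values f t j)) (strictlyInverseʳ f (at t j))))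
        ; act-⁻¹ʳ = λ (f , _) {(a , t)} _ → cong enc (cong₂ _,_ (strictlyInverseˡ f a) (tab-cong λ j → trans (cong (to f) (at-tab (λ j → from f (at t j)) j)) (strictlyInverseˡ f (at t j))))
        }

      on-places : XAct (S 3)
      on-places = record
        { act = λ (g , _) → places g
        ; valid = λ (g , _) {x} → places-valid g {x}
        ; resp = λ (g , _) {x} {y} → resp-≡ (places g) {x} {y}
        ; adj = λ (g , _) {x} {y} → keeps-neighbours nbr (λ _ _ → refl) (places g) (λ {x} → places-valid g {x}) (λ i x _ → to g i , places-nbr g i x) {x} {y}
        ; act-cong = λ {g} {h} e {(a , t)} _ → cong (λ t′ → enc (a , t′)) (tab-cong λ j → cong (at t) (from-cong (proj₁ g) (proj₁ h) e j))
        ; act-∙ = λ (g , _) (h , _) {(a , t)} _ → cong (λ t′ → enc (a , t′)) (tab-cong λ j → sym (at-places h t (from g j)))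
        ; act-ε = λ {(a , t)} _ → refl
        ; act-⁻¹ˡ = λ (g , _) {(a , t)} _ → cong (λ t′ → enc (a , t′)) (tab-cong λ j → trans (at-places g t (to g j)) (cong (at t) (strictlyInverseʳ g j)))
        ; act-⁻¹ʳ = λ (g , _) {(a , t)} _ → cong (λ t′ → enc (a , t′)) (tab-cong λ j → trans (at-tab (λ j → at t (to g j)) (from g j)) (cong (at t) (strictlyInverseˡ g j)))
        }
        where
        from-cong : ∀ (g h : Fin 3 ↔ Fin 3) → (∀ i → to g i ≡ to h i) → ∀ j → from g j ≡ from h j
        from-cong g h e j = ↔-inj h (trans (sym (e (from g j))) (trans (strictlyInverseˡ g j) (sym (strictlyInverseˡ h j))))

      both : XAct (S 4 ×G S 3)
      both = product on-values on-places λ (f , _) (g , _) {(a , t)} _ → cong (λ t′ → enc (to f a , t′))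
        (tab-cong λ j → trans (cong (to f) (at-places g t j)) (sym (at-values f t (from g j))))

      private
        starting : Fin 4 → X
        starting #0 = #0 , #1 , #2 , #3
        starting #1 = #1 , #0 , #2 , #3
        starting #2 = #2 , #0 , #1 , #3
        starting #3 = #3 , #0 , #1 , #2

        starting-valid : ∀ a → Valid (starting a)
        starting-valid #0 = refl
        starting-valid #1 = refl
        starting-valid #2 = refl
        starting-valid #3 = refl

        starting-first : ∀ a → proj₁ (starting a) ≡ a
        starting-first #0 = refl
        starting-first #1 = refl
        starting-first #2 = refl
        starting-first #3 = refl

        at-starting : ∀ i → at (proj₂ (starting #0)) i ≡ suc i
        at-starting #0 = refl
        at-starting #1 = refl
        at-starting #2 = refl

        suc-inj : ∀ {i j : Fin 3} → Fin.suc i ≡ suc j → i ≡ j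
        suc-inj refl = refl

        faithful : ∀ {g h} → (∀ {x} → Valid x → enc (XAct.act both g x) ≡ enc (XAct.act both h x)) → RawGroup._≈_ (S 4 ×G S 3) g h
        faithful {(f , _) , (g , _)} {(f′ , _) , (g′ , _)} e = f≡ , g≡
          where
          moved : ∀ a → values f (places g (starting a)) ≡ values f′ (places g′ (starting a))
          moved a = enc-inj {values f (places g (starting a))} {values f′ (places g′ (starting a))}
            (values-valid f {places g (starting a)} (places-valid g {starting a} (starting-valid a)))
            (values-valid f′ {places g′ (starting a)} (places-valid g′ {starting a} (starting-valid a))) (e {starting a} (starting-valid a))
          f≡ : ∀ a → to f a ≡ to f′ a
          f≡ a = subst (λ b → to f b ≡ to f′ b) (starting-first a) (cong proj₁ (moved a))
          from≡ : ∀ j → from g j ≡ from g′ j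
          from≡ j = suc-inj (trans (sym (at-starting (from g j))) (trans (↔-inj f (begin
            to f (at t₀ (from g j))              ≡⟨ cong (to f) (at-places g t₀ j) ⟨
            to f (at (proj₂ (places g (starting #0))) j)    ≡⟨ at-values f (proj₂ (places g (starting #0))) j ⟨
            at (proj₂ (values f (places g (starting #0)))) j   ≡⟨ cong (λ x → at (proj₂ x) j) (moved #0) ⟩
            at (proj₂ (values f′ (places g′ (starting #0)))) j ≡⟨ at-values f′ (proj₂ (places g′ (starting #0))) j ⟩
            to f′ (at (proj₂ (places g′ (starting #0))) j)  ≡⟨ cong (to f′) (at-places g′ t₀ j) ⟩
            to f′ (at t₀ (from g′ j))            ≡⟨ f≡ _ ⟨
            to f (at t₀ (from g′ j))             ∎)) (at-starting (from g′ j))))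
            where
            open ≡-Reasoning
            t₀ = proj₂ (starting #0)
          g≡ : ∀ i → to g i ≡ to g′ i
          g≡ i = ↔-inj⁻ g′ (trans (sym (from≡ (to g i))) (trans (strictlyInverseʳ g i) (sym (strictlyInverseʳ g′ i))))

      acting : Action Γ (S 4 ×G S 3)
      acting = action both Γ λ {g} {h} → faithful {g} {h}

    open Transitivity Γ (Acting.acting
      (exactModel refl (λ {x} {y} → does-true (Enum._≟ᵉ_ E x y)) (λ x → does-true⁻ (Enum._≟ᵉ_ E x x) refl) adjX refl refl))

    nauru : Represents (S 4 ×G S 3) (GPV 12) (GPAdj 12 5)
    nauru = represents 7
      ( (encode (#0 , #1 , #2 , #3) , (swap #0 #1 , one) ∷ (swap #1 #2 , one) ∷ (swap #2 #3 , one) ∷ [])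
      -- A permutation of the values 1, 2, 3 is undone by the same permutation of the places holding
      -- them, so these elements fix the first arrangement.
      ∷ (encode (#1 , #0 , #2 , #3) , (swap #1 #2 , swap #0 #1) ∷ (swap #2 #3 , swap #1 #2) ∷ [])
      ∷ (encode (#2 , #1 , #0 , #3) , (swap #2 #3 , swap #1 #2) ∷ []) ∷ []) refl
      where one = RawGroup.ε (S 3)

-- GL(2,3), its determinant and an outer involution.

module GeneralLinear where

  open import Defs
  open Automorphisms
  open NormalForms
  open ClosedWalks using (all-sound; any-sound; ∧-true; ∨-true; does-true; T≡)
  open FiniteGraphs
  open ConfigurationActions
  open import Level using (0ℓ)
  open import Data.Fin as Fin using (Fin)
  open import Data.Bool using (Bool; true; not; _∨_)
  open import Data.Bool.ListAction using (all)
  open import Data.Product using (_,_; proj₁; proj₂)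
  open import Function.Bundles using (Inverse)
  open import Relation.Binary.PropositionalEquality using (_≡_; refl; sym; trans; cong; cong₂; subst; module ≡-Reasoning)
  open import Relation.Nullary using (does)
  open import Algebra.Bundles.Raw using (RawGroup)
  open Models
  open import Function.Bundles using (mk↔ₛ′)
  open Inverse using (to; from; strictlyInverseˡ; strictlyInverseʳ)

  module InvolutiveAutomorphism (N : RawGroup 0ℓ 0ℓ) (σ : RawGroup.Carrier N → RawGroup.Carrier N) where
    open RawGroup N

    isInvolAut : (∀ {x y} → x ≈ y → y ≈ x) → (∀ {x y z} → x ≈ y → y ≈ z → x ≈ z) →
      (∀ {x y} → x ≈ y → σ x ≈ σ y) → (∀ x y → σ (x ∙ y) ≈ (σ x ∙ σ y)) → σ ε ≈ ε → (∀ x → σ (x ⁻¹) ≈ ((σ x) ⁻¹)) →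
      (∀ x → σ (σ x) ≈ x) → IsInvolAut N σ
    isInvolAut ≈-sym ≈-trans σ-cong σ-∙ σ-ε σ-⁻¹ invol = record
      { isGroupMonomorphism = record
        { isGroupHomomorphism = record
          { isMonoidHomomorphism = record
            { isMagmaHomomorphism = record { isRelHomomorphism = record { cong = σ-cong } ; homo = σ-∙ }
            ; ε-homo = σ-ε }
          ; ⁻¹-homo = σ-⁻¹ }
        ; injective = λ {x} {y} e → ≈-trans (≈-sym (invol x)) (≈-trans (σ-cong e) (invol y)) }
      ; surjective = λ y → σ y , λ e → ≈-trans (σ-cong e) (invol y) } , invol

  F₃² : Enum 𝔽₃²
  F₃² = finE 3 ×E finE 3

  identity-by : ∀ {X Y} (A : Enum X) (B : Enum Y) (f g : X → Y) →
                all (λ x → does (Enum._≟ᵉ_ B (f x) (g x))) (Enum.elems A) ≡ true → ∀ x → f x ≡ g x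
  identity-by A B f g ok x = does-true (Enum._≟ᵉ_ B (f x) (g x)) (Enum.check A (λ x → does (Enum._≟ᵉ_ B (f x) (g x))) ok x)

  e₁ e₂ : 𝔽₃²
  e₁ = #1 , #0
  e₂ = #0 , #1

  -- The scalar 2 is -1 in 𝔽₃, so this is ad - bc; likewise `D` below is the diagonal matrix with
  -- entries 1 and -1.
  det : 𝔽₃² → 𝔽₃² → 𝔽₃
  det (a , b) (c , d) = (a *₃ d) +₃ (#2 *₃ (b *₃ c))

  D : 𝔽₃² → 𝔽₃²
  D (a , b) = a , #2 *₃ b

  columns : 𝔽₃² → 𝔽₃² → 𝔽₃² → 𝔽₃²
  columns p q (a , b) = (a ⊙ p) ⊕ (b ⊙ q)

  columns-basis : ∀ x → columns e₁ e₂ x ≡ x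
  columns-basis = identity-by F₃² F₃² (columns e₁ e₂) (λ x → x) refl

  det-columns : ∀ p q x y → det (columns p q x) (columns p q y) ≡ det p q *₃ det x y
  det-columns p q x y = identity-by (F₃² ×E F₃² ×E F₃² ×E F₃²) (finE 3) (λ (p , q , x , y) → det (columns p q x) (columns p q y))
    (λ (p , q , x , y) → det p q *₃ det x y) refl (p , q , x , y)

  det-⊙ : ∀ c d x y → det (c ⊙ x) (d ⊙ y) ≡ (c *₃ d) *₃ det x y
  det-⊙ c d x y = identity-by (finE 3 ×E finE 3 ×E F₃² ×E F₃²) (finE 3) (λ (c , d , x , y) → det (c ⊙ x) (d ⊙ y))
    (λ (c , d , x , y) → (c *₃ d) *₃ det x y) refl (c , d , x , y)

  det-D : ∀ x y → det (D x) (D y) ≡ #2 *₃ det x y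
  det-D x y = identity-by (F₃² ×E F₃²) (finE 3) (λ (x , y) → det (D x) (D y)) (λ (x , y) → #2 *₃ det x y) refl (x , y)

  D-D : ∀ x → D (D x) ≡ x
  D-D = identity-by F₃² F₃² (λ x → D (D x)) (λ x → x) refl

  D-⊕ : ∀ x y → D (x ⊕ y) ≡ D x ⊕ D y
  D-⊕ x y = identity-by (F₃² ×E F₃²) F₃² (λ (x , y) → D (x ⊕ y)) (λ (x , y) → D x ⊕ D y) refl (x , y)

  D-⊙ : ∀ c x → D (c ⊙ x) ≡ c ⊙ D x
  D-⊙ c x = identity-by (finE 3 ×E F₃²) F₃² (λ (c , x) → D (c ⊙ x)) (λ (c , x) → c ⊙ D x) refl (c , x)

  ⊙-⊕ : ∀ c x y → c ⊙ (x ⊕ y) ≡ (c ⊙ x) ⊕ (c ⊙ y)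
  ⊙-⊕ c x y = identity-by (finE 3 ×E F₃² ×E F₃²) F₃² (λ (c , x , y) → c ⊙ (x ⊕ y)) (λ (c , x , y) → (c ⊙ x) ⊕ (c ⊙ y)) refl (c , x , y)

  ⊙-⊙ : ∀ c d x → c ⊙ (d ⊙ x) ≡ (c *₃ d) ⊙ x
  ⊙-⊙ c d x = identity-by (finE 3 ×E finE 3 ×E F₃²) F₃² (λ (c , d , x) → c ⊙ (d ⊙ x)) (λ (c , d , x) → (c *₃ d) ⊙ x) refl (c , d , x)

  1-⊙ : ∀ x → #1 ⊙ x ≡ x
  1-⊙ = identity-by F₃² F₃² (#1 ⊙_) (λ x → x) refl

  *₃-assoc : ∀ a b c → (a *₃ b) *₃ c ≡ a *₃ (b *₃ c)
  *₃-assoc a b c = identity-by (finE 3 ×E finE 3 ×E finE 3) (finE 3) (λ (a , b , c) → (a *₃ b) *₃ c) (λ (a , b , c) → a *₃ (b *₃ c)) refl (a , b , c)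

  *₃-comm : ∀ a b → a *₃ b ≡ b *₃ a
  *₃-comm a b = identity-by (finE 3 ×E finE 3) (finE 3) (λ (a , b) → a *₃ b) (λ (a , b) → b *₃ a) refl (a , b)

  1-*₃ : ∀ a → #1 *₃ a ≡ a
  1-*₃ = identity-by (finE 3) (finE 3) (#1 *₃_) (λ x → x) refl

  unit-inverse : ∀ a b → a *₃ b ≡ #1 → a ≡ b
  unit-inverse #1 #1 e = refl
  unit-inverse #2 #2 e = refl
  unit-inverse #0 #0 ()
  unit-inverse #0 #1 ()
  unit-inverse #0 #2 ()
  unit-inverse #1 #0 ()
  unit-inverse #1 #2 ()
  unit-inverse #2 #0 ()
  unit-inverse #2 #1 ()

  G : Set
  G = RawGroup.Carrier GL₂₃

  module GL = RawGroup GL₂₃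

  infixr 9 _•_
  _•_ : G → 𝔽₃² → 𝔽₃²
  g • x = to (proj₁ g) x

  •-⊕ : ∀ (g : G) x y → g • (x ⊕ y) ≡ (g • x) ⊕ (g • y)
  •-⊕ g = proj₁ (proj₂ g)

  •-⊙ : ∀ (g : G) c x → g • (c ⊙ x) ≡ c ⊙ (g • x)
  •-⊙ g = proj₂ (proj₂ g)

  Δ : G → 𝔽₃
  Δ g = det (g • e₁) (g • e₂)

  •-columns : ∀ g x → g • x ≡ columns (g • e₁) (g • e₂) x
  •-columns g x = begin
    g • x                                              ≡⟨ cong (g •_) (columns-basis x) ⟨
    g • columns e₁ e₂ x                                ≡⟨ •-⊕ g (proj₁ x ⊙ e₁) (proj₂ x ⊙ e₂) ⟩
    (g • (proj₁ x ⊙ e₁)) ⊕ (g • (proj₂ x ⊙ e₂))        ≡⟨ cong₂ _⊕_ (•-⊙ g (proj₁ x) e₁) (•-⊙ g (proj₂ x) e₂) ⟩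
    columns (g • e₁) (g • e₂) x                        ∎
    where open ≡-Reasoning

  det-• : ∀ g x y → det (g • x) (g • y) ≡ Δ g *₃ det x y
  det-• g x y = trans (cong₂ det (•-columns g x) (•-columns g y)) (det-columns (g • e₁) (g • e₂) x y)

  Δ-∙ : ∀ g h → Δ (g GL.∙ h) ≡ Δ g *₃ Δ h
  Δ-∙ g h = det-• g (h • e₁) (h • e₂)

  Δ-cong : ∀ {g h} → g GL.≈ h → Δ g ≡ Δ h
  Δ-cong e = cong₂ det (e e₁) (e e₂)

  Δ-inverse : ∀ g → Δ g *₃ Δ (g GL.⁻¹) ≡ #1
  Δ-inverse g = trans (sym (Δ-∙ g (g GL.⁻¹))) (cong₂ det (strictlyInverseˡ (proj₁ g) e₁) (strictlyInverseˡ (proj₁ g) e₂))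

  Δ-⁻¹ : ∀ g → Δ (g GL.⁻¹) ≡ Δ g
  Δ-⁻¹ g = sym (unit-inverse (Δ g) (Δ (g GL.⁻¹)) (Δ-inverse g))

  Δ² : ∀ g → Δ g *₃ Δ g ≡ #1
  Δ² g = trans (cong (Δ g *₃_) (sym (Δ-⁻¹ g))) (Δ-inverse g)

  twisted : 𝔽₃ → (𝔽₃² → 𝔽₃²) → 𝔽₃² → 𝔽₃²
  twisted c φ x = c ⊙ D (φ (D x))

  twisted-twisted : ∀ c d (φ ψ : 𝔽₃² → 𝔽₃²) → (∀ a x → φ (a ⊙ x) ≡ a ⊙ φ x) →
                    ∀ x → twisted c φ (twisted d ψ x) ≡ twisted (c *₃ d) (λ x → φ (ψ x)) x
  twisted-twisted c d φ ψ φ-⊙ x = begin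
    c ⊙ D (φ (D (d ⊙ D (ψ (D x)))))     ≡⟨ cong (λ z → c ⊙ D (φ z)) (trans (D-⊙ d (D (ψ (D x)))) (cong (d ⊙_) (D-D (ψ (D x))))) ⟩
    c ⊙ D (φ (d ⊙ ψ (D x)))             ≡⟨ cong (λ z → c ⊙ D z) (φ-⊙ d (ψ (D x))) ⟩
    c ⊙ D (d ⊙ φ (ψ (D x)))             ≡⟨ cong (c ⊙_) (D-⊙ d (φ (ψ (D x)))) ⟩
    c ⊙ (d ⊙ D (φ (ψ (D x))))           ≡⟨ ⊙-⊙ c d (D (φ (ψ (D x)))) ⟩
    (c *₃ d) ⊙ D (φ (ψ (D x)))          ∎
    where open ≡-Reasoning

  twisted-id : ∀ c (φ : 𝔽₃² → 𝔽₃²) → c ≡ #1 → (∀ x → φ x ≡ x) → ∀ x → twisted c φ x ≡ x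
  twisted-id c φ refl e x = trans (1-⊙ (D (φ (D x)))) (trans (cong D (e (D x))) (D-D x))

  -- The outer automorphism g ↦ det(g) D g D.
  σ : G → G
  σ g = mk↔ₛ′ (twisted (Δ g) (g •_)) (twisted (Δ g) (from (proj₁ g)))
      (λ x → trans (twisted-twisted (Δ g) (Δ g) (g •_) (from (proj₁ g)) (•-⊙ g) x)
        (twisted-id _ _ (Δ² g) (strictlyInverseˡ (proj₁ g)) x))
      (λ x → trans (twisted-twisted (Δ g) (Δ g) (from (proj₁ g)) (g •_) (•-⊙ (g GL.⁻¹)) x)
        (twisted-id _ _ (Δ² g) (strictlyInverseʳ (proj₁ g)) x))
    , (λ x y → trans (cong (λ z → Δ g ⊙ D (g • z)) (D-⊕ x y)) (trans (cong (λ z → Δ g ⊙ D z) (•-⊕ g (D x) (D y)))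
        (trans (cong (Δ g ⊙_) (D-⊕ (g • D x) (g • D y))) (⊙-⊕ (Δ g) (D (g • D x)) (D (g • D y))))))
    , (λ c x → trans (cong (λ z → Δ g ⊙ D (g • z)) (D-⊙ c x)) (trans (cong (λ z → Δ g ⊙ D z) (•-⊙ g c (D x)))
        (trans (cong (Δ g ⊙_) (D-⊙ c (g • D x))) (trans (⊙-⊙ (Δ g) c (D (g • D x))) (trans (cong (_⊙ D (g • D x)) (*₃-comm (Δ g) c)) (sym (⊙-⊙ c (Δ g) (D (g • D x)))))))))

  Δ-σ : ∀ g → Δ (σ g) ≡ Δ g
  Δ-σ g = begin
    det (Δ g ⊙ D (g • D e₁)) (Δ g ⊙ D (g • D e₂))    ≡⟨ det-⊙ (Δ g) (Δ g) (D (g • D e₁)) (D (g • D e₂)) ⟩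
    (Δ g *₃ Δ g) *₃ det (D (g • D e₁)) (D (g • D e₂)) ≡⟨ cong₂ _*₃_ (Δ² g) (det-D (g • D e₁) (g • D e₂)) ⟩
    #1 *₃ (#2 *₃ det (g • D e₁) (g • D e₂))           ≡⟨ cong (λ z → #1 *₃ (#2 *₃ z)) (det-• g (D e₁) (D e₂)) ⟩
    #1 *₃ (#2 *₃ (Δ g *₃ #2))                         ≡⟨ cancel (Δ g) ⟩
    Δ g                                               ∎
    where
    open ≡-Reasoning
    cancel : ∀ d → #1 *₃ (#2 *₃ (d *₃ #2)) ≡ d
    cancel = identity-by (finE 3) (finE 3) (λ d → #1 *₃ (#2 *₃ (d *₃ #2))) (λ d → d) refl

  σ-invol : ∀ g → σ (σ g) GL.≈ g
  σ-invol g x = begin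
    Δ (σ g) ⊙ D (Δ g ⊙ D (g • D (D x)))  ≡⟨ cong₂ (λ c z → c ⊙ D (Δ g ⊙ D (g • z))) (Δ-σ g) (D-D x) ⟩
    Δ g ⊙ D (Δ g ⊙ D (g • x))            ≡⟨ cong (Δ g ⊙_) (trans (D-⊙ (Δ g) (D (g • x))) (cong (Δ g ⊙_) (D-D (g • x)))) ⟩
    Δ g ⊙ (Δ g ⊙ (g • x))                ≡⟨ ⊙-⊙ (Δ g) (Δ g) (g • x) ⟩
    (Δ g *₃ Δ g) ⊙ (g • x)               ≡⟨ cong (_⊙ (g • x)) (Δ² g) ⟩
    #1 ⊙ (g • x)                         ≡⟨ 1-⊙ (g • x) ⟩
    g • x                                ∎
    where open ≡-Reasoning

  σ-cong : ∀ {g h} → g GL.≈ h → σ g GL.≈ σ h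
  σ-cong {g} {h} e x = cong₂ (λ c z → c ⊙ D z) (Δ-cong {g} {h} e) (e (D x))

  σ-∙ : ∀ g h → σ (g GL.∙ h) GL.≈ (σ g GL.∙ σ h)
  σ-∙ g h x = trans (cong (_⊙ D (g • h • D x)) (Δ-∙ g h)) (sym (twisted-twisted (Δ g) (Δ h) (g •_) (h •_) (•-⊙ g) x))

  σ-⁻¹ : ∀ g → σ (g GL.⁻¹) GL.≈ (σ g GL.⁻¹)
  σ-⁻¹ g x = cong (_⊙ D (from (proj₁ g) (D x))) (Δ-⁻¹ g)

  σ-ε : σ GL.ε GL.≈ GL.ε
  σ-ε x = trans (1-⊙ (D (D x))) (D-D x)

  σ-isInvolAut : IsInvolAut GL₂₃ σ
  σ-isInvolAut = InvolutiveAutomorphism.isInvolAut GL₂₃ σ (λ e x → sym (e x)) (λ e e′ x → trans (e x) (e′ x))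
    (λ {g} {h} → σ-cong {g} {h}) σ-∙ σ-ε σ-⁻¹ σ-invol

  unipotent transposition : G
  unipotent = mk↔ₛ′ (columns e₁ (#1 , #1)) (columns e₁ (#2 , #1))
      (identity-by F₃² F₃² (λ x → columns e₁ (#1 , #1) (columns e₁ (#2 , #1) x)) (λ x → x) refl)
      (identity-by F₃² F₃² (λ x → columns e₁ (#2 , #1) (columns e₁ (#1 , #1) x)) (λ x → x) refl)
    , (λ x y → identity-by (F₃² ×E F₃²) F₃² (λ (x , y) → columns e₁ (#1 , #1) (x ⊕ y)) (λ (x , y) → columns e₁ (#1 , #1) x ⊕ columns e₁ (#1 , #1) y) refl (x , y))
    , (λ c x → identity-by (finE 3 ×E F₃²) F₃² (λ (c , x) → columns e₁ (#1 , #1) (c ⊙ x)) (λ (c , x) → c ⊙ columns e₁ (#1 , #1) x) refl (c , x))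
  transposition = mk↔ₛ′ (λ (a , b) → b , a) (λ (a , b) → b , a) (λ _ → refl) (λ _ → refl) , (λ _ _ → refl) , (λ _ _ → refl)

  nonzero? : 𝔽₃² → Bool
  nonzero? x = not (does (Enum._≟ᵉ_ F₃² x (#0 , #0)))

  nonzero-• : ∀ g x → nonzero? x ≡ true → nonzero? (g • x) ≡ true
  nonzero-• g x nz = subst (λ z → nonzero? z ≡ true) (sym (•-columns g x)) (∨-skip (∨-skip
    (Enum.check (F₃² ×E F₃² ×E F₃²) (λ (p , q , x) → not (does (det p q *₃ det p q Fin.≟ #1)) ∨ (not (nonzero? x) ∨ nonzero? (columns p q x)))
      refl (g • e₁ , g • e₂ , x)) (does-true⁻ (Δ g *₃ Δ g Fin.≟ #1) (Δ² g))) nz)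

-- GP(8,3) and signed nonzero vectors over 𝔽₃.

module MöbiusKantorGraph where

  open import Defs
  open Automorphisms
  open NormalForms
  open ClosedWalks using (all-sound; any-sound; ∧-true; ∨-true; does-true; T≡)
  open FiniteGraphs
  open ConfigurationActions
  open import Data.Fin as Fin using (Fin)
  open import Data.Bool using (Bool; true; false; not; _∧_)
  open import Data.Bool.ListAction using (all)
  open import Data.Product using (_×_; _,_; proj₁)
  open import Data.List using ([]; _∷_)
  open import Data.List.Relation.Unary.All using ([]; _∷_)
  open import Data.Vec using ([]; _∷_; lookup)
  open import Function.Bundles using (Inverse)
  open import Relation.Binary.PropositionalEquality using (_≡_; _≢_; refl; sym; trans; cong; cong₂; subst; module ≡-Reasoning)
  open import Relation.Nullary using (yes; no; does; contradiction)
  open import Algebra.Bundles.Raw using (RawGroup)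
  open Models
  open GeneralLinear
  open Inverse using (to; from; strictlyInverseˡ; strictlyInverseʳ)

  implied : ∀ {X} (A : Enum X) (f g : X → Bool) → all (λ x → f x ⇒ᵇ g x) (Enum.elems A) ≡ true → ∀ x → f x ≡ true → g x ≡ true
  implied A f g ok x = ∨-skip (Enum.check A (λ x → f x ⇒ᵇ g x) ok x)

  σ-scaled : ∀ g c x → σ g • (c ⊙ D x) ≡ (Δ g *₃ c) ⊙ D (g • x)
  σ-scaled g c x = begin
    Δ g ⊙ D (g • D (c ⊙ D x))   ≡⟨ cong (λ z → Δ g ⊙ D (g • z)) (trans (D-⊙ c (D x)) (cong (c ⊙_) (D-D x))) ⟩
    Δ g ⊙ D (g • (c ⊙ x))       ≡⟨ cong (λ z → Δ g ⊙ D z) (•-⊙ g c x) ⟩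
    Δ g ⊙ D (c ⊙ (g • x))       ≡⟨ cong (Δ g ⊙_) (D-⊙ c (g • x)) ⟩
    Δ g ⊙ (c ⊙ D (g • x))       ≡⟨ ⊙-⊙ (Δ g) c (D (g • x)) ⟩
    (Δ g *₃ c) ⊙ D (g • x)      ∎
    where open ≡-Reasoning

  •-zero : ∀ g → g • (#0 , #0) ≡ (#0 , #0)
  •-zero g = •-⊙ g #0 (#0 , #0)

  -- A linear map vanishing nowhere but at zero cannot send e₁ to its own negative.
  no-sign : ∀ g → g • e₁ ≢ #2 ⊙ (g • e₁)
  no-sign g e = fixed-zero (g • e₁) (nonzero-• g e₁ refl) e
    where
    fixed-zero : ∀ x → nonzero? x ≡ true → x ≢ #2 ⊙ x
    fixed-zero x nz e′ = contradiction (trans (sym (does-true⁻ (Enum._≟ᵉ_ F₃² x (#2 ⊙ x)) e′))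
      (not-true (implied F₃² nonzero? (λ x → not (does (Enum._≟ᵉ_ F₃² x (#2 ⊙ x)))) refl x nz))) λ ()
      where
      not-true : ∀ {b} → not b ≡ true → b ≡ false
      not-true {false} _ = refl

  -- GP(8,3) lives on the pairs (x , ε) of a nonzero vector and a sign, and (x , ε) ~ (z , -ε) when det x z = ε.
  module MöbiusKantor where

    Γ : FiniteGraph (GPV 8) (GPAdj 8 3)
    Γ = petersen 7 3

    X : Set
    X = 𝔽₃² × 𝔽₃

    E : Enum X
    E = F₃² ×E finE 3

    valid? : X → Bool
    valid? (x , ε) = nonzero? x ∧ not (does (ε Fin.≟ #0))

    same : X → X → Bool
    same x y = does (Enum._≟ᵉ_ E x y)

    adjX : X → X → Bool
    adjX (x , ε) (z , ε′) = does (ε′ Fin.≟ (#2 *₃ ε)) ∧ does (det x z Fin.≟ ε)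

    decode : GPV 8 → X
    decode (u i) = lookup
      ( ((#0 , #1) , #1) ∷ ((#2 , #0) , #2) ∷ ((#1 , #1) , #1) ∷ ((#1 , #2) , #2)
      ∷ ((#0 , #2) , #1) ∷ ((#1 , #0) , #2) ∷ ((#2 , #2) , #1) ∷ ((#2 , #1) , #2) ∷ []) i
    decode (v i) = lookup
      ( ((#2 , #2) , #2) ∷ ((#2 , #1) , #1) ∷ ((#0 , #1) , #2) ∷ ((#2 , #0) , #1)
      ∷ ((#1 , #1) , #2) ∷ ((#1 , #2) , #1) ∷ ((#0 , #2) , #2) ∷ ((#1 , #0) , #1) ∷ []) i

    open Encoding Γ E valid? same decode (u #0) using (encode; exactModel)

    -- Sealed, since unfolding Δ inside the vertex encoding makes conversion checking explode.
    opaque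

      linear : G → X → X
      linear g (x , ε) = g • x , Δ g *₃ ε

      -- `D` reverses determinants, and the opposite scalars at the two ends of an edge compensate
      -- for this. Conjugation by this symmetry induces σ on GL(2,3).
      dual : X → X
      dual (x , ε) = ε ⊙ D x , ε

    private
      unit-* : ∀ a ε → a *₃ a ≡ #1 → not (does (ε Fin.≟ #0)) ≡ true → not (does ((a *₃ ε) Fin.≟ #0)) ≡ true
      unit-* a ε p q = implied (finE 3 ×E finE 3) (λ (a , ε) → does ((a *₃ a) Fin.≟ #1) ∧ not (does (ε Fin.≟ #0)))
        (λ (a , ε) → not (does ((a *₃ ε) Fin.≟ #0))) refl (a , ε) (cong₂ _∧_ (does-true⁻ ((a *₃ a) Fin.≟ #1) p) q)

      cancel : ∀ a b ε → a *₃ b ≡ #1 → a *₃ (b *₃ ε) ≡ ε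
      cancel a b ε e = trans (sym (*₃-assoc a b ε)) (trans (cong (_*₃ ε) e) (1-*₃ ε))

      exchange : ∀ a ε → a *₃ (#2 *₃ ε) ≡ #2 *₃ (a *₃ ε)
      exchange a ε = trans (sym (*₃-assoc a #2 ε)) (trans (cong (_*₃ ε) (*₃-comm a #2)) (*₃-assoc #2 a ε))

    opaque
      unfolding linear dual

      linear-valid : ∀ g {x} → valid? x ≡ true → valid? (linear g x) ≡ true
      linear-valid g {x , ε} vx = let p , q = ∧-true {nonzero? x} vx in
        cong₂ _∧_ (nonzero-• g x p) (unit-* (Δ g) ε (Δ² g) q)

      linear-adj : ∀ g {x y} → adjX x y ≡ true → adjX (linear g x) (linear g y) ≡ true
      linear-adj g {x , ε} {z , ε′} e = let p , q = ∧-true {does (ε′ Fin.≟ (#2 *₃ ε))} e in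
        cong₂ _∧_ (does-true⁻ ((Δ g *₃ ε′) Fin.≟ (#2 *₃ (Δ g *₃ ε))) (trans (cong (Δ g *₃_) (does-true (ε′ Fin.≟ (#2 *₃ ε)) p)) (exchange (Δ g) ε)))
                  (does-true⁻ (det (g • x) (g • z) Fin.≟ (Δ g *₃ ε)) (trans (det-• g x z) (cong (Δ g *₃_) (does-true (det x z Fin.≟ ε) q))))

      linear-cong : ∀ {g h} → g GL.≈ h → ∀ x → linear g x ≡ linear h x
      linear-cong {g} {h} e (x , ε) = cong₂ (λ z δ → z , δ *₃ ε) (e x) (Δ-cong {g} {h} e)

      linear-∙ : ∀ g h x → linear (g GL.∙ h) x ≡ linear g (linear h x)
      linear-∙ g h (x , ε) = cong (g • h • x ,_) (trans (cong (_*₃ ε) (Δ-∙ g h)) (*₃-assoc (Δ g) (Δ h) ε))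

      linear-ε : ∀ x → linear GL.ε x ≡ x
      linear-ε (x , ε) = cong (x ,_) (1-*₃ ε)

      linear-⁻¹ˡ : ∀ g x → linear (g GL.⁻¹) (linear g x) ≡ x
      linear-⁻¹ˡ g (x , ε) = cong₂ _,_ (strictlyInverseʳ (proj₁ g) x)
        (cancel (Δ (g GL.⁻¹)) (Δ g) ε (trans (*₃-comm (Δ (g GL.⁻¹)) (Δ g)) (Δ-inverse g)))

      linear-⁻¹ʳ : ∀ g x → linear g (linear (g GL.⁻¹) x) ≡ x
      linear-⁻¹ʳ g (x , ε) = cong₂ _,_ (strictlyInverseˡ (proj₁ g) x) (cancel (Δ g) (Δ (g GL.⁻¹)) ε (Δ-inverse g))

      dual-valid : ∀ {x} → valid? x ≡ true → valid? (dual x) ≡ true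
      dual-valid {x} = implied E valid? (λ x → valid? (dual x)) refl x

      dual-adj : ∀ {x y} → valid? x ≡ true → valid? y ≡ true → adjX x y ≡ true → adjX (dual x) (dual y) ≡ true
      dual-adj {x} {y} vx vy e = implied (E ×E E) (λ (x , y) → valid? x ∧ (valid? y ∧ adjX x y)) (λ (x , y) → adjX (dual x) (dual y)) refl (x , y)
        (cong₂ _∧_ vx (cong₂ _∧_ vy e))

      dual-dual : ∀ x → valid? x ≡ true → dual (dual x) ≡ x
      dual-dual x vx = does-true (Enum._≟ᵉ_ E (dual (dual x)) x) (implied E valid? (λ x → same (dual (dual x)) x) refl x vx)

      dual-linear : ∀ g x → dual (linear g x) ≡ linear (σ g) (dual x)
      dual-linear g (x , ε) = begin
        (Δ g *₃ ε) ⊙ D (g • x) , Δ g *₃ ε         ≡⟨ cong (_, Δ g *₃ ε) (sym (σ-scaled g ε x)) ⟩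
        σ g • (ε ⊙ D x) , Δ g *₃ ε                ≡⟨ cong (λ δ → σ g • (ε ⊙ D x) , δ *₃ ε) (sym (Δ-σ g)) ⟩
        σ g • (ε ⊙ D x) , Δ (σ g) *₃ ε            ∎
        where open ≡-Reasoning

      linear-determines : ∀ g h x ε → linear g (x , ε) ≡ linear h (x , ε) → g • x ≡ h • x
      linear-determines g h x ε = cong proj₁

      linear-dual-determines : ∀ g h x → linear g (dual (D x , #1)) ≡ linear h (dual (D x , #1)) → g • x ≡ h • x
      linear-dual-determines g h x e = subst (λ z → g • z ≡ h • z) (trans (1-⊙ (D (D x))) (D-D x)) (cong proj₁ e)

      -- At (e₁ , 1) and (e₁ , 2) a linear map produces the same vector, while a map preceded by
      -- `dual` produces opposite ones.
      not-dual : ∀ g h → linear g (e₁ , #1) ≡ linear h (dual (e₁ , #1)) → linear g (e₁ , #2) ≢ linear h (dual (e₁ , #2))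
      not-dual g h at₁ at₂ = no-sign g (begin
        g • e₁                     ≡⟨ cong proj₁ at₁ ⟩
        h • (#1 ⊙ D e₁)            ≡⟨ •-⊙ h #2 (#2 ⊙ D e₁) ⟩
        #2 ⊙ (h • (#2 ⊙ D e₁))     ≡⟨ cong (λ z → #2 ⊙ proj₁ z) at₂ ⟨
        #2 ⊙ (g • e₁)              ∎)
        where open ≡-Reasoning

    module Acting (𝓜 : Model (GPAdj 8 3) valid? same adjX) where

      open Model 𝓜
      open Exact (λ {x} {y} → does-true (Enum._≟ᵉ_ E x y)) (λ x → does-true⁻ (Enum._≟ᵉ_ E x x) refl)
      open Configurations {_∼_ = GPAdj 8 3} Valid enc dec dec-valid enc-dec

      general-linear : XAct GL₂₃
      general-linear = record
        { act = linear
        ; valid = λ g {x} → linear-valid g {x}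
        ; resp = λ g {x} {y} → resp-≡ (linear g) {x} {y}
        ; adj = λ g {x} {y} → keeps (linear g) (λ {x} → linear-valid g {x}) (λ {x} {y} _ _ → linear-adj g {x} {y}) {x} {y}
        ; act-cong = λ {g} {h} e {x} _ → cong enc (linear-cong {g} {h} e x)
        ; act-∙ = λ g h {x} _ → cong enc (linear-∙ g h x)
        ; act-ε = λ {x} _ → cong enc (linear-ε x)
        ; act-⁻¹ˡ = λ g {x} _ → cong enc (linear-⁻¹ˡ g x)
        ; act-⁻¹ʳ = λ g {x} _ → cong enc (linear-⁻¹ʳ g x)
        }

      duality : Move
      duality = record
        { move = dual
        ; valid = λ {x} → dual-valid {x}
        ; resp = λ {x} {y} → resp-≡ dual {x} {y}
        ; adj = λ {x} {y} → keeps dual (λ {x} → dual-valid {x}) (λ {x} {y} → dual-adj {x} {y}) {x} {y}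
        }

      full-action : XAct (SemiZ2 GL₂₃ σ)
      full-action = semidirect {N = GL₂₃} σ general-linear duality (λ {x} vx → cong enc (dual-dual x vx)) (λ g {x} _ → cong enc (dual-linear g x))

      private
        open XAct full-action using (act) renaming (valid to act-valid)

        agree : ∀ g h → (∀ x → nonzero? x ≡ true → g • x ≡ h • x) → g GL.≈ h
        agree g h e x with Enum._≟ᵉ_ F₃² x (#0 , #0) in eq
        ... | yes refl = trans (•-zero g) (sym (•-zero h))
        ... | no ne = e x (cong (λ d → not (does d)) eq)

        D-nonzero : ∀ x → nonzero? x ≡ true → nonzero? (D x) ≡ true
        D-nonzero = implied F₃² nonzero? (λ x → nonzero? (D x)) refl

        faithful : ∀ {p q} → (∀ {x} → Valid x → enc (act p x) ≡ enc (act q x)) → RawGroup._≈_ (SemiZ2 GL₂₃ σ) p q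
        faithful {p} {q} e = cases p q (λ x vx → enc-inj (act-valid p {x} vx) (act-valid q {x} vx) (e {x} vx))
          where
          cases : ∀ p q → (∀ x → Valid x → act p x ≡ act q x) → RawGroup._≈_ (SemiZ2 GL₂₃ σ) p q
          cases (g , false) (h , false) e = agree g h (λ x nz → linear-determines g h x #1 (e (x , #1) (cong (_∧ true) nz))) , refl
          cases (g , true)  (h , true)  e = agree g h (λ x nz → linear-dual-determines g h x (e (D x , #1) (cong (_∧ true) (D-nonzero x nz)))) , refl
          cases (g , false) (h , true)  e = contradiction (e (e₁ , #2) refl) (not-dual g h (e (e₁ , #1) refl))
          cases (g , true)  (h , false) e = contradiction (sym (e (e₁ , #2) refl)) (not-dual h g (sym (e (e₁ , #1) refl)))

      acting : Action Γ (SemiZ2 GL₂₃ σ)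
      acting = action full-action Γ λ {g} {h} → faithful {g} {h}

    open Transitivity Γ (Acting.acting
      (exactModel refl (λ {x} {y} → does-true (Enum._≟ᵉ_ E x y)) (λ x → does-true⁻ (Enum._≟ᵉ_ E x x) refl) adjX refl refl))

    opaque
      unfolding linear dual

      möbius-kantor : Represents (SemiZ2 GL₂₃ σ) (GPV 8) (GPAdj 8 3)
      möbius-kantor = represents 10
        ( (encode (e₁ , #1) , (unipotent , false) ∷ (transposition , false) ∷ [])
        ∷ (encode (e₂ , #2) , (unipotent , false) ∷ [])
        ∷ (encode ((#1 , #1) , #2) , (GL.ε , true) ∷ []) ∷ []) refl

-- GP(24,5) as a Cayley graph of GL(2,3).

module FosterGraph where

  open import Defs
  open Automorphisms
  open NormalForms
  open ClosedWalks using (all-sound; any-sound; ∧-true; ∨-true; does-true; T≡)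
  open FiniteGraphs
  open ConfigurationActions
  open import Level using (0ℓ)
  open import Data.Nat using (suc)
  open import Data.Fin as Fin using (Fin; suc)
  open import Data.Bool using (Bool; true; false; not; _∧_)
  open import Data.Bool.ListAction using (all; any)
  open import Data.Product using (∃; _×_; _,_; proj₁)
  open import Data.List using ([]; _∷_; allFin)
  open import Data.List.Relation.Unary.All using ([]; _∷_)
  open import Data.Vec using ([]; _∷_; lookup)
  open import Function.Bundles using (Inverse)
  open import Relation.Binary.PropositionalEquality using (_≡_; refl; sym; trans; cong; cong₂; subst; module ≡-Reasoning)
  open import Relation.Nullary using (yes; no; does; contradiction)
  open import Algebra.Bundles.Raw using (RawGroup)
  open Models
  open GeneralLinear
  open Inverse using (to; from; strictlyInverseˡ; strictlyInverseʳ)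

  open MöbiusKantorGraph using (implied; σ-scaled; •-zero; no-sign)

  -- GP(24,5) is the Cayley graph of GL(2,3) for the conjugates of the transposition under the unipotent group;
  -- a matrix is given by its pair of columns.
  module Foster48 where

    Γ : FiniteGraph (GPV 24) (GPAdj 24 5)
    Γ = petersen 23 5

    X : Set
    X = 𝔽₃² × 𝔽₃²

    E : Enum X
    E = F₃² ×E F₃²

    valid? : X → Bool
    valid? (x , y) = not (does (det x y Fin.≟ #0))

    same : X → X → Bool
    same x y = does (Enum._≟ᵉ_ E x y)

    nbr : Fin 3 → X → X
    nbr i (x , y) = y ⊕ (i ⊙ x) , x ⊕ ((#2 *₃ i) ⊙ (y ⊕ (i ⊙ x)))

    adjX : X → X → Bool
    adjX x y = any (λ i → same (nbr i x) y) (allFin 3)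

    decode : GPV 24 → X
    decode (u i) = lookup
      ( ((#0 , #1) , #1 , #0) ∷ ((#1 , #0) , #0 , #1) ∷ ((#2 , #1) , #0 , #1) ∷ ((#2 , #2) , #0 , #2)
      ∷ ((#0 , #2) , #2 , #2) ∷ ((#2 , #0) , #2 , #2) ∷ ((#1 , #2) , #1 , #1) ∷ ((#1 , #1) , #1 , #2)
      ∷ ((#0 , #1) , #1 , #2) ∷ ((#1 , #0) , #2 , #1) ∷ ((#2 , #1) , #1 , #0) ∷ ((#2 , #2) , #1 , #0)
      ∷ ((#0 , #2) , #2 , #0) ∷ ((#2 , #0) , #0 , #2) ∷ ((#1 , #2) , #0 , #2) ∷ ((#1 , #1) , #0 , #1)
      ∷ ((#0 , #1) , #1 , #1) ∷ ((#1 , #0) , #1 , #1) ∷ ((#2 , #1) , #2 , #2) ∷ ((#2 , #2) , #2 , #1)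
      ∷ ((#0 , #2) , #2 , #1) ∷ ((#2 , #0) , #1 , #2) ∷ ((#1 , #2) , #2 , #0) ∷ ((#1 , #1) , #2 , #0) ∷ []) i
    decode (v i) = lookup
      ( ((#1 , #2) , #1 , #0) ∷ ((#1 , #1) , #0 , #2) ∷ ((#0 , #1) , #2 , #1) ∷ ((#1 , #0) , #0 , #2)
      ∷ ((#2 , #1) , #1 , #1) ∷ ((#2 , #2) , #2 , #0) ∷ ((#0 , #2) , #1 , #1) ∷ ((#2 , #0) , #2 , #1)
      ∷ ((#1 , #2) , #0 , #1) ∷ ((#1 , #1) , #2 , #1) ∷ ((#0 , #1) , #2 , #0) ∷ ((#1 , #0) , #2 , #2)
      ∷ ((#2 , #1) , #2 , #0) ∷ ((#2 , #2) , #0 , #1) ∷ ((#0 , #2) , #1 , #2) ∷ ((#2 , #0) , #0 , #1)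
      ∷ ((#1 , #2) , #2 , #2) ∷ ((#1 , #1) , #1 , #0) ∷ ((#0 , #1) , #2 , #2) ∷ ((#1 , #0) , #1 , #2)
      ∷ ((#2 , #1) , #0 , #2) ∷ ((#2 , #2) , #1 , #2) ∷ ((#0 , #2) , #1 , #0) ∷ ((#2 , #0) , #1 , #1) ∷ []) i

    open Encoding Γ E valid? same decode (u #0) using (encode; exactModel)

    -- Sealed, since unfolding det inside the vertex encoding makes conversion checking explode.
    opaque

      linear : G → X → X
      linear g (x , y) = g • x , g • y

      -- On invertible matrices this is σ itself: det(A) D A D for the matrix A with columns x and
      -- y. It inverts `unipotent` and fixes `transposition`, so it preserves the set of generators
      -- of the Cayley graph.
      dual : X → X
      dual (x , y) = det x y ⊙ D x , (#2 *₃ det x y) ⊙ D y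

      -- Right multiplication by the inverse of `unipotent`. It commutes with the left action of
      -- GL(2,3) and permutes the three generators cyclically.
      shear : X → X
      shear (x , y) = x , y ⊕ (#2 ⊙ x)

    -- Conjugation by `dual` acts as σ on the matrices and inverts the shear.
    σ₃ : G × Fin 3 → G × Fin 3
    σ₃ (g , c) = σ g , RawGroup._⁻¹ (Z 3) c

    opaque
      unfolding linear dual shear

      private
        by-check : (φ : X → X) → all (λ (x , y) → (valid? x ∧ (valid? y ∧ adjX x y)) ⇒ᵇ adjX (φ x) (φ y)) (Enum.elems (E ×E E)) ≡ true →
                   ∀ {x y} → valid? x ≡ true → valid? y ≡ true → adjX x y ≡ true → adjX (φ x) (φ y) ≡ true
        by-check φ ok {x} {y} vx vy e = implied (E ×E E) (λ (x , y) → valid? x ∧ (valid? y ∧ adjX x y)) (λ (x , y) → adjX (φ x) (φ y)) ok (x , y)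
          (cong₂ _∧_ vx (cong₂ _∧_ vy e))

      linear-valid : ∀ g {x} → valid? x ≡ true → valid? (linear g x) ≡ true
      linear-valid g {x , y} vx = trans (cong (λ d → not (does (d Fin.≟ #0))) (det-• g x y)) (implied (finE 3 ×E finE 3)
        (λ (a , d) → does ((a *₃ a) Fin.≟ #1) ∧ not (does (d Fin.≟ #0))) (λ (a , d) → not (does ((a *₃ d) Fin.≟ #0))) refl (Δ g , det x y)
        (cong₂ _∧_ (does-true⁻ ((Δ g *₃ Δ g) Fin.≟ #1) (Δ² g)) vx))

      linear-nbr : ∀ g i x → linear g (nbr i x) ≡ nbr i (linear g x)
      linear-nbr g i (x , y) = cong₂ _,_ (shifted i x y)
        (trans (shifted (#2 *₃ i) (y ⊕ (i ⊙ x)) x) (cong (λ z → (g • x) ⊕ ((#2 *₃ i) ⊙ z)) (shifted i x y)))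
        where
        shifted : ∀ i x y → g • (y ⊕ (i ⊙ x)) ≡ (g • y) ⊕ (i ⊙ (g • x))
        shifted i x y = trans (•-⊕ g y (i ⊙ x)) (cong ((g • y) ⊕_) (•-⊙ g i x))

      linear-cong : ∀ {g h} → g GL.≈ h → ∀ x → linear g x ≡ linear h x
      linear-cong e (x , y) = cong₂ _,_ (e x) (e y)

      linear-∙ : ∀ g h x → linear (g GL.∙ h) x ≡ linear g (linear h x)
      linear-∙ g h x = refl

      linear-ε : ∀ x → linear GL.ε x ≡ x
      linear-ε x = refl

      linear-⁻¹ˡ : ∀ g x → linear (g GL.⁻¹) (linear g x) ≡ x
      linear-⁻¹ˡ g (x , y) = cong₂ _,_ (strictlyInverseʳ (proj₁ g) x) (strictlyInverseʳ (proj₁ g) y)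

      linear-⁻¹ʳ : ∀ g x → linear g (linear (g GL.⁻¹) x) ≡ x
      linear-⁻¹ʳ g (x , y) = cong₂ _,_ (strictlyInverseˡ (proj₁ g) x) (strictlyInverseˡ (proj₁ g) y)

      shear-valid : ∀ {x} → valid? x ≡ true → valid? (shear x) ≡ true
      shear-valid {x} = implied E valid? (λ x → valid? (shear x)) refl x

      shear-adj : ∀ {x y} → valid? x ≡ true → valid? y ≡ true → adjX x y ≡ true → adjX (shear x) (shear y) ≡ true
      shear-adj {x} {y} = by-check shear refl {x} {y}

      shear³ : ∀ x → shear (shear (shear x)) ≡ x
      shear³ = identity-by E E (λ x → shear (shear (shear x))) (λ x → x) refl

      linear-shear : ∀ g x → linear g (shear x) ≡ shear (linear g x)
      linear-shear g (x , y) = cong ((g • x) ,_) (trans (•-⊕ g y (#2 ⊙ x)) (cong ((g • y) ⊕_) (•-⊙ g #2 x)))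

      dual-valid : ∀ {x} → valid? x ≡ true → valid? (dual x) ≡ true
      dual-valid {x} = implied E valid? (λ x → valid? (dual x)) refl x

      dual-adj : ∀ {x y} → valid? x ≡ true → valid? y ≡ true → adjX x y ≡ true → adjX (dual x) (dual y) ≡ true
      dual-adj {x} {y} = by-check dual refl {x} {y}

      dual-dual : ∀ x → valid? x ≡ true → dual (dual x) ≡ x
      dual-dual x vx = does-true (Enum._≟ᵉ_ E (dual (dual x)) x) (implied E valid? (λ x → same (dual (dual x)) x) refl x vx)

      dual-linear : ∀ g x → dual (linear g x) ≡ linear (σ g) (dual x)
      dual-linear g (x , y) = begin
        det (g • x) (g • y) ⊙ D (g • x) , (#2 *₃ det (g • x) (g • y)) ⊙ D (g • y)
          ≡⟨ cong (λ d → d ⊙ D (g • x) , (#2 *₃ d) ⊙ D (g • y)) (det-• g x y) ⟩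
        (Δ g *₃ det x y) ⊙ D (g • x) , (#2 *₃ (Δ g *₃ det x y)) ⊙ D (g • y)
          ≡⟨ cong (λ d → (Δ g *₃ det x y) ⊙ D (g • x) , d ⊙ D (g • y)) (exchange (Δ g) (det x y)) ⟩
        (Δ g *₃ det x y) ⊙ D (g • x) , (Δ g *₃ (#2 *₃ det x y)) ⊙ D (g • y)
          ≡⟨ cong₂ _,_ (σ-scaled g (det x y) x) (σ-scaled g (#2 *₃ det x y) y) ⟨
        σ g • (det x y ⊙ D x) , σ g • ((#2 *₃ det x y) ⊙ D y) ∎
        where
        open ≡-Reasoning
        exchange : ∀ a d → #2 *₃ (a *₃ d) ≡ a *₃ (#2 *₃ d)
        exchange a d = trans (sym (*₃-assoc #2 a d)) (trans (cong (_*₃ d) (*₃-comm #2 a)) (*₃-assoc a #2 d))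

      dual-shear : ∀ x → dual (shear x) ≡ shear (shear (dual x))
      dual-shear = identity-by E E (λ x → dual (shear x)) (λ x → shear (shear (dual x))) refl

      linear-determines : ∀ g h x y x′ y′ → linear g (x , y) ≡ linear h (x′ , y′) → g • x ≡ h • x′
      linear-determines g h x y x′ y′ = cong proj₁

      shears : Fin 3 → X → X
      shears #0 x = x
      shears #1 x = shear x
      shears #2 x = shear (shear x)

      first-shears : ∀ g c x y → proj₁ (linear g (shears c (x , y))) ≡ g • x
      first-shears g #0 x y = refl
      first-shears g #1 x y = refl
      first-shears g #2 x y = refl

      first-dual : ∀ g c x y → proj₁ (linear g (shears c (dual (x , y)))) ≡ g • (det x y ⊙ D x)
      first-dual g #0 x y = refl
      first-dual g #1 x y = refl
      first-dual g #2 x y = refl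

      linear-inj : ∀ g {x y} → linear g x ≡ linear g y → x ≡ y
      linear-inj g {x} {y} e = trans (sym (linear-⁻¹ˡ g x)) (trans (cong (linear (g GL.⁻¹)) e) (linear-⁻¹ˡ g y))

      shears-determines : ∀ c d x → valid? x ≡ true → shears c x ≡ shears d x → c ≡ d
      shears-determines c d x vx e = does-true (c Fin.≟ d) (implied (finE 3 ×E finE 3 ×E E)
        (λ (c , d , x) → valid? x ∧ same (shears c x) (shears d x)) (λ (c , d , x) → does (c Fin.≟ d)) refl (c , d , x)
        (cong₂ _∧_ vx (does-true⁻ (Enum._≟ᵉ_ E (shears c x) (shears d x)) e)))

      shears-0 : ∀ x → shears #0 x ≡ x
      shears-0 x = refl

      shears-1 : ∀ x → shears #1 x ≡ shear x
      shears-1 x = refl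

      shears-2 : ∀ x → shears #2 x ≡ shear (shear x)
      shears-2 x = refl

    private
      completion : 𝔽₃² → 𝔽₃²
      completion (#0 , _) = #1 , #0
      completion (suc _ , _) = #0 , #1

      complete-valid : ∀ x → nonzero? x ≡ true → valid? (x , completion x) ≡ true
      complete-valid = implied F₃² nonzero? (λ x → valid? (x , completion x)) refl

      unit-vector : ∀ x → nonzero? x ≡ true → ∃ λ y → ∃ λ z → valid? (y , z) ≡ true × det y z ⊙ D y ≡ x
      unit-vector x nz =
        let (y , z) , _ , e = any-sound {f = good x} {Enum.elems E} (implied F₃² nonzero? (λ x → any (good x) (Enum.elems E)) refl x nz)
            p , q = ∧-true {valid? (y , z)} e
        in y , z , p , does-true (Enum._≟ᵉ_ F₃² (det y z ⊙ D y) x) q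
        where
        good : 𝔽₃² → X → Bool
        good x (y , z) = valid? (y , z) ∧ does (Enum._≟ᵉ_ F₃² (det y z ⊙ D y) x)

    Base : RawGroup 0ℓ 0ℓ
    Base = GL₂₃ ×G Z 3

    module Acting (𝓜 : Model (GPAdj 24 5) valid? same adjX) where

      open Model 𝓜
      open Exact (λ {x} {y} → does-true (Enum._≟ᵉ_ E x y)) (λ x → does-true⁻ (Enum._≟ᵉ_ E x x) refl)
      open Configurations {_∼_ = GPAdj 24 5} Valid enc dec dec-valid enc-dec

      general-linear : XAct GL₂₃
      general-linear = record
        { act = linear
        ; valid = λ g {x} → linear-valid g {x}
        ; resp = λ g {x} {y} → resp-≡ (linear g) {x} {y}
        ; adj = λ g {x} {y} → keeps-neighbours nbr (λ _ _ → refl) (linear g) (λ {x} → linear-valid g {x}) (λ i x _ → i , linear-nbr g i x) {x} {y}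
        ; act-cong = λ {g} {h} e {x} _ → cong enc (linear-cong {g} {h} e x)
        ; act-∙ = λ g h {x} _ → cong enc (linear-∙ g h x)
        ; act-ε = λ {x} _ → cong enc (linear-ε x)
        ; act-⁻¹ˡ = λ g {x} _ → cong enc (linear-⁻¹ˡ g x)
        ; act-⁻¹ʳ = λ g {x} _ → cong enc (linear-⁻¹ʳ g x)
        }

      shearing : Move
      shearing = record
        { move = shear
        ; valid = λ {x} → shear-valid {x}
        ; resp = λ {x} {y} → resp-≡ shear {x} {y}
        ; adj = λ {x} {y} → keeps shear (λ {x} → shear-valid {x}) (λ {x} {y} → shear-adj {x} {y}) {x} {y}
        }

      duality : Move
      duality = record
        { move = dual
        ; valid = λ {x} → dual-valid {x}
        ; resp = λ {x} {y} → resp-≡ dual {x} {y}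
        ; adj = λ {x} {y} → keeps dual (λ {x} → dual-valid {x}) (λ {x} {y} → dual-adj {x} {y}) {x} {y}
        }

      shear-action : XAct (Z 3)
      shear-action = cyclic shearing 3 λ {x} _ → cong enc (shear³ x)

      base-action : XAct Base
      base-action = product {G = GL₂₃} {K = Z 3} general-linear shear-action λ
        { g #0 _ → refl
        ; g #1 {x} _ → cong enc (linear-shear g x)
        ; g #2 {x} _ → cong enc (trans (linear-shear g (shear x)) (cong shear (linear-shear g x))) }

      full-action : XAct (SemiZ2 Base σ₃)
      full-action = semidirect {N = Base} σ₃ base-action duality (λ {x} vx → cong enc (dual-dual x vx)) λ
        { (g , #0) {x} _ → cong enc (dual-linear g x)
        ; (g , #1) {x} _ → cong enc (trans (dual-linear g (shear x)) (cong (linear (σ g)) (dual-shear x)))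
        ; (g , #2) {x} _ → cong enc (trans (dual-linear g (shear (shear x))) (cong (linear (σ g))
            (trans (dual-shear (shear x)) (trans (cong (λ z → shear (shear z)) (dual-shear x)) (cong shear (shear³ (dual x))))))) }

      private
        open XAct full-action using (act) renaming (valid to act-valid)

        act-false : ∀ g c x → act ((g , c) , false) x ≡ linear g (shears c x)
        act-false g #0 x = cong (linear g) (sym (shears-0 x))
        act-false g #1 x = cong (linear g) (sym (shears-1 x))
        act-false g #2 x = cong (linear g) (sym (shears-2 x))

        act-true : ∀ g c x → act ((g , c) , true) x ≡ linear g (shears c (dual x))
        act-true g #0 x = cong (linear g) (sym (shears-0 (dual x)))
        act-true g #1 x = cong (linear g) (sym (shears-1 (dual x)))
        act-true g #2 x = cong (linear g) (sym (shears-2 (dual x)))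

        agree : ∀ g h → (∀ x → nonzero? x ≡ true → g • x ≡ h • x) → g GL.≈ h
        agree g h e x with Enum._≟ᵉ_ F₃² x (#0 , #0) in eq
        ... | yes refl = trans (•-zero g) (sym (•-zero h))
        ... | no ne = e x (cong (λ d → not (does d)) eq)

        same-shears : ∀ g h c d x → Valid x → g GL.≈ h → linear g (shears c x) ≡ linear h (shears d x) → c ≡ d
        same-shears g h c d x vx g≈h e = shears-determines c d x vx
          (linear-inj h (trans (sym (linear-cong {g} {h} g≈h (shears c x))) e))

        not-dual : ∀ g h c d → (∀ x → Valid x → linear g (shears c x) ≡ linear h (shears d (dual x))) → ∀ {A : Set} → A
        not-dual g h c d e = contradiction (begin
            g • e₁                     ≡⟨ at e₂ refl ⟩
            h • (#1 ⊙ D e₁)            ≡⟨ •-⊙ h #2 (#2 ⊙ D e₁) ⟩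
            #2 ⊙ (h • (#2 ⊙ D e₁))     ≡⟨ cong (#2 ⊙_) (at (#0 , #2) refl) ⟨
            #2 ⊙ (g • e₁)              ∎) (no-sign g)
          where
          open ≡-Reasoning
          at : ∀ y → Valid (e₁ , y) → g • e₁ ≡ h • (det e₁ y ⊙ D e₁)
          at y vy = trans (sym (first-shears g c e₁ y)) (trans (cong proj₁ (e (e₁ , y) vy)) (first-dual h d e₁ y))

        faithful : ∀ {p q} → (∀ {x} → Valid x → enc (act p x) ≡ enc (act q x)) → RawGroup._≈_ (SemiZ2 Base σ₃) p q
        faithful {p} {q} e = cases p q (λ x vx → enc-inj (act-valid p {x} vx) (act-valid q {x} vx) (e {x} vx))
          where
          cases : ∀ p q → (∀ x → Valid x → act p x ≡ act q x) → RawGroup._≈_ (SemiZ2 Base σ₃) p q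
          cases ((g , c) , false) ((h , d) , false) e = (g≈h , same-shears g h c d (e₁ , e₂) refl g≈h (e′ (e₁ , e₂) refl)) , refl
            where
            e′ : ∀ x → Valid x → linear g (shears c x) ≡ linear h (shears d x)
            e′ x vx = trans (sym (act-false g c x)) (trans (e x vx) (act-false h d x))
            g≈h : g GL.≈ h
            g≈h = agree g h λ x nz → trans (sym (first-shears g c x (completion x)))
              (trans (cong proj₁ (e′ (x , completion x) (complete-valid x nz))) (first-shears h d x (completion x)))
          cases ((g , c) , true) ((h , d) , true) e = (g≈h , same-shears g h c d (dual (e₁ , e₂)) (dual-valid {e₁ , e₂} refl) g≈h (e′ (e₁ , e₂) refl)) , refl
            where
            e′ : ∀ x → Valid x → linear g (shears c (dual x)) ≡ linear h (shears d (dual x))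
            e′ x vx = trans (sym (act-true g c x)) (trans (e x vx) (act-true h d x))
            g≈h : g GL.≈ h
            g≈h = agree g h λ x nz → let y , z , vyz , eq = unit-vector x nz in subst (λ w → g • w ≡ h • w) eq
              (trans (sym (first-dual g c y z)) (trans (cong proj₁ (e′ (y , z) vyz)) (first-dual h d y z)))
          cases ((g , c) , false) ((h , d) , true) e = not-dual g h c d
            (λ x vx → trans (sym (act-false g c x)) (trans (e x vx) (act-true h d x)))
          cases ((g , c) , true) ((h , d) , false) e = not-dual h g d c
            (λ x vx → trans (sym (act-false h d x)) (trans (sym (e x vx)) (act-true g c x)))

      acting : Action Γ (SemiZ2 Base σ₃)
      acting = action full-action Γ λ {g} {h} → faithful {g} {h}

    open Transitivity Γ (Acting.acting
      (exactModel refl (λ {x} {y} → does-true (Enum._≟ᵉ_ E x y)) (λ x → does-true⁻ (Enum._≟ᵉ_ E x x) refl) adjX refl refl))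

    opaque
      unfolding linear dual shear

      foster48 : Represents (SemiZ2 Base σ₃) (GPV 24) (GPAdj 24 5)
      foster48 = represents 10
        ( (encode (e₁ , e₂) , ((unipotent , #0) , false) ∷ ((transposition , #0) , false) ∷ [])
        ∷ (encode (e₂ , e₁) , ((unipotent , #1) , false) ∷ [])
        ∷ (encode (nbr #1 (e₁ , e₂)) , (RawGroup.ε Base , true) ∷ []) ∷ []) refl

    private
      Z₃ : RawGroup 0ℓ 0ℓ
      Z₃ = Z 3
      module Z₃ = RawGroup Z₃

      neg-∙ : ∀ c d → (c Z₃.∙ d) Z₃.⁻¹ ≡ (c Z₃.⁻¹) Z₃.∙ (d Z₃.⁻¹)
      neg-∙ c d = identity-by (finE 3 ×E finE 3) (finE 3) (λ (c , d) → (c Z₃.∙ d) Z₃.⁻¹) (λ (c , d) → (c Z₃.⁻¹) Z₃.∙ (d Z₃.⁻¹)) refl (c , d)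

      neg-neg : ∀ c → (c Z₃.⁻¹) Z₃.⁻¹ ≡ c
      neg-neg = identity-by (finE 3) (finE 3) (λ c → (c Z₃.⁻¹) Z₃.⁻¹) (λ c → c) refl

    σ₃-isInvolAut : IsInvolAut Base σ₃
    σ₃-isInvolAut = InvolutiveAutomorphism.isInvolAut Base σ₃
      (λ (e , e′) → (λ x → sym (e x)) , sym e′) (λ (e , e′) (d , d′) → (λ x → trans (e x) (d x)) , trans e′ d′)
      (λ { {g , _} {h , _} (e , refl) → σ-cong {g} {h} e , refl })
      (λ (g , c) (h , d) → σ-∙ g h , neg-∙ c d) (σ-ε , refl) (λ (g , c) → σ-⁻¹ g , refl) (λ (g , c) → σ-invol g , neg-neg c)

-- D(GP(10,2)), the double cover of the dodecahedron.

module DodecahedronCover where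

  open import Defs
  open Automorphisms
  open NormalForms
  open ClosedWalks using (all-sound; any-sound; ∧-true; ∨-true; does-true; T≡)
  open FiniteGraphs
  open ConfigurationActions
  open Models
  open GeneralLinear using (identity-by)
  open import Level using (0ℓ)
  open import Data.Nat as ℕ using (ℕ; zero; suc)
  open import Data.Nat.Divisibility using (_∣_; ∣m+n∣m⇒∣n; ∣m∣n⇒∣m+n; ∣-refl; divides)
  open import Data.Nat.Properties using (+-comm)
  open import Data.Fin as Fin using (Fin; zero; suc; toℕ)
  open import Data.Bool using (Bool; true; false; not; _∧_; _xor_; if_then_else_)
  open import Data.Bool.Properties using (not-involutive)
  open import Data.Bool.ListAction using (all; any)
  open import Data.Product using (_×_; _,_; proj₁)
  open import Data.List using (List; []; _∷_; _++_; allFin; length)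
  open import Data.List.Properties using (length-++)
  open import Data.Vec using ([]; _∷_; lookup)
  open import Function.Bundles using (_↔_; Inverse; mk↔ₛ′)
  open import Relation.Binary.PropositionalEquality using (_≡_; _≢_; refl; sym; trans; cong; cong₂; subst)
  open import Relation.Nullary using (does; contradiction)
  open import Algebra.Bundles.Raw using (RawGroup)
  open Inverse using (to; from; strictlyInverseˡ; strictlyInverseʳ)

  -- The dodecahedron lives on the ordered pairs of distinct elements of Fin 5.
  module Dodecahedron where

    #4 : Fin 5
    #4 = suc #3

    private
      _<?ᵇ_ : Fin 5 → Fin 5 → Bool
      i <?ᵇ j = toℕ i ℕ.<ᵇ toℕ j

      _≠ᵇ_ : Fin 5 → Fin 5 → Bool
      i ≠ᵇ j = not (toℕ i ℕ.≡ᵇ toℕ j)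

      evenOrder : Fin 5 → Fin 5 → Fin 5 → Fin 5 → Fin 5 → Bool
      evenOrder a b c d e = (c ≠ᵇ a) ∧ (c ≠ᵇ b) ∧ (c ≠ᵇ d) ∧ (c ≠ᵇ e) ∧ not
        ((b <?ᵇ a) xor (c <?ᵇ a) xor (d <?ᵇ a) xor (e <?ᵇ a) xor (c <?ᵇ b) xor
         (d <?ᵇ b) xor (e <?ᵇ b) xor (d <?ᵇ c) xor (e <?ᵇ c) xor (e <?ᵇ d))

    -- (i , j) ~ (l , k) when i j m k l is an even arrangement of Fin 5 for the remaining element m.
    near : Fin 5 → Fin 5 → Fin 5 → Fin 5 → Bool
    near i j l k = ((i ≠ᵇ j) ∧ (i ≠ᵇ k) ∧ (i ≠ᵇ l) ∧ (j ≠ᵇ k) ∧ (j ≠ᵇ l) ∧ (k ≠ᵇ l)) ∧ any (λ m → evenOrder i j m k l) (allFin 5)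

    private
      near-by : (f g : Fin 5 × Fin 5 × Fin 5 × Fin 5 → Bool) →
                all (λ x → f x ≡ᵇ g x) (Enum.elems (finE 5 ×E finE 5 ×E finE 5 ×E finE 5)) ≡ true → ∀ x → f x ≡ g x
      near-by f g ok x = ≡ᵇ-sound (Enum.check (finE 5 ×E finE 5 ×E finE 5 ×E finE 5) (λ x → f x ≡ᵇ g x) ok x)

    near-swap : ∀ i j l k → near j i k l ≡ near i j l k
    near-swap i j l k = near-by (λ (i , j , l , k) → near j i k l) (λ (i , j , l , k) → near i j l k) refl (i , j , l , k)

    -- A transposition makes an even arrangement odd, and exchanging its first two entries makes it
    -- even again. Exchanging the entries of a pair is the antipodal map of the dodecahedron.
    near-transposed : ∀ p q → p ≢ q → ∀ i j l k → near (swapF p q i) (swapF p q j) (swapF p q l) (swapF p q k) ≡ near j i l k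
    near-transposed p q p≢q i j l k = ≡ᵇ-sound (∨-skip (Enum.check (finE 5 ×E finE 5 ×E finE 5 ×E finE 5 ×E finE 5 ×E finE 5)
      (λ (p , q , i , j , l , k) → (p ≠ᵇ q) ⇒ᵇ (near (swapF p q i) (swapF p q j) (swapF p q l) (swapF p q k) ≡ᵇ near j i l k)) refl (p , q , i , j , l , k))
      (distinct p q p≢q))
      where
      distinct : ∀ p q → p ≢ q → (p ≠ᵇ q) ≡ true
      distinct p q p≢q = ∨-skip (Enum.check (finE 5 ×E finE 5) (λ (p , q) → not (p =ᶠ q) ⇒ᵇ (p ≠ᵇ q)) refl (p , q))
        (cong not (dec-false (p Fin.≟ q) p≢q))
        where open import Relation.Nullary.Decidable using (dec-false)

    -- Transpositions are removed two at a time, whereby the two exchanges of the first pair cancel.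
    near-even : ∀ ts → 2 ∣ length ts → ∀ i j l k →
                near (applyT ts i) (applyT ts j) (applyT ts l) (applyT ts k) ≡ near i j l k
    near-even [] _ i j l k = refl
    near-even (t ∷ []) (divides zero ()) i j l k
    near-even (t ∷ []) (divides (suc _) ()) i j l k
    near-even (((p , q) , p≢q) ∷ ((r , s) , r≢s) ∷ ts) even i j l k =
      trans (near-transposed p q p≢q (swapF r s (applyT ts i)) (swapF r s (applyT ts j)) (swapF r s (applyT ts l)) (swapF r s (applyT ts k)))
        (trans (near-transposed r s r≢s (applyT ts j) (applyT ts i) (applyT ts l) (applyT ts k))
          (near-even ts (∣m+n∣m⇒∣n even ∣-refl) i j l k))

    A₅ : RawGroup 0ℓ 0ℓ
    A₅ = Alt 5

    Base : RawGroup 0ℓ 0ℓ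
    Base = A₅ ×G Z 2 ×G Z 2

    near-alternating : ∀ (g : RawGroup.Carrier A₅) i j l k →
      near (to (proj₁ g) i) (to (proj₁ g) j) (to (proj₁ g) l) (to (proj₁ g) k) ≡ near i j l k
    near-alternating (f , ts , even , e) i j l k rewrite e i | e j | e l | e k = near-even ts even i j l k

    swap-swap : ∀ p q x → swapF p q (swapF p q x) ≡ x
    swap-swap p q x = identity-by (finE 5 ×E finE 5 ×E finE 5) (finE 5) (λ (p , q , x) → swapF p q (swapF p q x)) (λ (p , q , x) → x) refl (p , q , x)

    π : Fin 5 → Fin 5
    π = swapF #0 #1

    π-π : ∀ x → π (π x) ≡ x
    π-π = swap-swap #0 #1

    applyT-++ : ∀ (ts us : List (Transp 5)) x → applyT (ts ++ us) x ≡ applyT ts (applyT us x)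
    applyT-++ [] us x = refl
    applyT-++ (((p , q) , _) ∷ ts) us x = cong (swapF p q) (applyT-++ ts us x)

    conjugate : RawGroup.Carrier A₅ → RawGroup.Carrier A₅
    conjugate (f , ts , even , e) =
        mk↔ₛ′ (λ x → π (to f (π x))) (λ x → π (from f (π x)))
          (λ x → trans (cong (λ z → π (to f z)) (π-π (from f (π x)))) (trans (cong π (strictlyInverseˡ f (π x))) (π-π x)))
          (λ x → trans (cong (λ z → π (from f z)) (π-π (to f (π x)))) (trans (cong π (strictlyInverseʳ f (π x))) (π-π x)))
      , (π₀ ∷ ts ++ π₀ ∷ [])
      , subst (λ m → 2 ∣ suc m) (sym (trans (length-++ ts) (+-comm (length ts) 1))) (∣m∣n⇒∣m+n (∣-refl {2}) even)
      , λ x → cong π (trans (e (π x)) (sym (applyT-++ ts (π₀ ∷ []) x)))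
      where
      π₀ : Transp 5
      π₀ = (#0 , #1) , λ ()

    σ : RawGroup.Carrier Base → RawGroup.Carrier Base
    σ (g , a , b) = conjugate g , b , a

    σ-isInvolAut : IsInvolAut Base σ
    σ-isInvolAut = GeneralLinear.InvolutiveAutomorphism.isInvolAut Base σ
      (λ (e , p , q) → (λ x → sym (e x)) , sym p , sym q)
      (λ (e , p , q) (e′ , p′ , q′) → (λ x → trans (e x) (e′ x)) , trans p p′ , trans q q′)
      (λ (e , p , q) → (λ x → cong π (e (π x))) , q , p)
      (λ (g , _) (h , _) → (λ x → cong (λ z → π (to (proj₁ g) z)) (sym (π-π (to (proj₁ h) (π x))))) , refl , refl)
      (π-π , refl , refl)
      (λ _ → (λ _ → refl) , refl , refl)
      (λ (g , _) → (λ x → trans (π-π _) (cong (to (proj₁ g)) (π-π x))) , refl , refl)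

    Γ : FiniteGraph (DV 10) (DAdj 10 2)
    Γ = doubleCover 9 2

    X : Set
    X = Fin 5 × Fin 5 × Bool

    E : Enum X
    E = finE 5 ×E finE 5 ×E boolE

    valid? : X → Bool
    valid? (i , j , _) = not (i =ᶠ j)

    same : X → X → Bool
    same x y = does (Enum._≟ᵉ_ E x y)

    adjX : X → X → Bool
    adjX (i , j , a) (l , k , b) = (a xor b) ∧ near i j l k

    dec : DV 10 → X
    dec (u i , b) = let p , q = lookup ((#0 , #1) ∷ (#3 , #4) ∷ (#1 , #2) ∷ (#0 , #3) ∷ (#2 , #4) ∷ (#1 , #0) ∷ (#4 , #3) ∷ (#2 , #1) ∷ (#3 , #0) ∷ (#4 , #2) ∷ []) i
      in if b then (q , p , b) else (p , q , b)
    dec (v i , b) = let p , q = lookup ((#2 , #3) ∷ (#2 , #0) ∷ (#4 , #0) ∷ (#4 , #1) ∷ (#3 , #1) ∷ (#3 , #2) ∷ (#0 , #2) ∷ (#0 , #4) ∷ (#1 , #4) ∷ (#1 , #3) ∷ []) i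
      in if b then (q , p , b) else (p , q , b)

    open Encoding Γ E valid? same dec (u #0 , false) using (encode; exactModel)

    module Acting (𝓜 : Model (DAdj 10 2) valid? same adjX) where

      open Model 𝓜 hiding (dec)
      open Exact (λ {x} {y} → does-true (Enum._≟ᵉ_ E x y)) (λ x → does-true⁻ (Enum._≟ᵉ_ E x x) refl)
      open Configurations {_∼_ = DAdj 10 2} Valid enc (Model.dec 𝓜) dec-valid enc-dec

      permute : Fin 5 ↔ Fin 5 → X → X
      permute f (i , j , b) = to f i , to f j , b

      -- A transposition of the five points preserves adjacency only up to the antipodal map. `turn`
      -- applies it on both layers and the antipodal map on one of them, which restores adjacency
      -- between layers. Conjugation by `turn` exchanges `lift` with `reflect`, the antipodal map
      -- combined with the change of layer.
      reflect lift turn : X → X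
      reflect (i , j , b) = j , i , not b
      lift (i , j , b) = i , j , not b
      turn (i , j , false) = π j , π i , false
      turn (i , j , true)  = π i , π j , true

      private
        permute-valid : ∀ f {x} → Valid x → Valid (permute f x)
        permute-valid f {i , j , b} vx = trans (cong not (=ᶠ-image f i j)) vx

        swapped : ∀ i j → not (i =ᶠ j) ≡ true → not (j =ᶠ i) ≡ true
        swapped i j = ∨-skip (Enum.check (finE 5 ×E finE 5) (λ (i , j) → not (i =ᶠ j) ⇒ᵇ not (j =ᶠ i)) refl (i , j))

        π-valid : ∀ i j → not (i =ᶠ j) ≡ true → not (π i =ᶠ π j) ≡ true
        π-valid i j = ∨-skip (Enum.check (finE 5 ×E finE 5) (λ (i , j) → not (i =ᶠ j) ⇒ᵇ not (π i =ᶠ π j)) refl (i , j))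

        not-not : ∀ a b → not a xor not b ≡ a xor b
        not-not false b = not-involutive b
        not-not true  b = refl

      alternating : XAct A₅
      alternating = record
        { act = λ (f , _) → permute f
        ; valid = λ (f , _) {x} → permute-valid f {x}
        ; resp = λ (f , _) {x} {y} → resp-≡ (permute f) {x} {y}
        ; adj = λ g@(f , _) {x} {y} → keeps (permute f) (λ {x} → permute-valid f {x})
            (λ {(i , j , a)} {(l , k , b)} _ _ → trans (cong ((a xor b) ∧_) (near-alternating g i j l k))) {x} {y}
        ; act-cong = λ e {(i , j , b)} _ → cong₂ (λ i j → enc (i , j , b)) (e i) (e j)
        ; act-∙ = λ _ _ _ → refl
        ; act-ε = λ _ → refl
        ; act-⁻¹ˡ = λ (f , _) {(i , j , b)} _ → cong₂ (λ i j → enc (i , j , b)) (strictlyInverseʳ f i) (strictlyInverseʳ f j)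
        ; act-⁻¹ʳ = λ (f , _) {(i , j , b)} _ → cong₂ (λ i j → enc (i , j , b)) (strictlyInverseˡ f i) (strictlyInverseˡ f j)
        }

      reflecting lifting turning : Move
      reflecting = record
        { move = reflect
        ; valid = λ { {i , j , _} → swapped i j }
        ; resp = λ {x} {y} → resp-≡ reflect {x} {y}
        ; adj = λ {x} {y} → keeps reflect (λ { {i , j , _} → swapped i j })
            (λ {(i , j , a)} {(l , k , b)} _ _ → trans (cong₂ _∧_ (not-not a b) (near-swap i j l k))) {x} {y}
        }
      lifting = record
        { move = lift
        ; valid = λ vx → vx
        ; resp = λ {x} {y} → resp-≡ lift {x} {y}
        ; adj = λ {x} {y} → keeps lift (λ vx → vx)
            (λ {(i , j , a)} {(l , k , b)} _ _ → trans (cong (_∧ near i j l k) (not-not a b))) {x} {y}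
        }
      turning = record
        { move = turn
        ; valid = λ {x} → turn-valid x
        ; resp = λ {x} {y} → resp-≡ turn {x} {y}
        ; adj = λ {x} {y} → keeps turn (λ {x} → turn-valid x) (λ {x} {y} _ _ → turn-adj x y) {x} {y}
        }
        where
        turn-valid : ∀ x → Valid x → Valid (turn x)
        turn-valid (i , j , false) vx = swapped (π i) (π j) (π-valid i j vx)
        turn-valid (i , j , true)  vx = π-valid i j vx
        turn-adj : ∀ x y → adjX x y ≡ true → adjX (turn x) (turn y) ≡ true
        turn-adj (i , j , false) (l , k , true) = trans (near-transposed #0 #1 (λ ()) j i l k)
        turn-adj (i , j , true) (l , k , false) = trans (trans (near-transposed #0 #1 (λ ()) i j k l) (near-swap i j l k))
        turn-adj (_ , _ , false) (_ , _ , false) ()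
        turn-adj (_ , _ , true) (_ , _ , true) ()

      switches : XAct (Z 2 ×G Z 2)
      switches = product {G = Z 2} {K = Z 2}
        (cyclic reflecting 2 λ {(i , j , b)} _ → cong (λ c → enc (i , j , c)) (not-involutive b))
        (cyclic lifting 2 λ {(i , j , b)} _ → cong (λ c → enc (i , j , c)) (not-involutive b))
        λ { zero zero _ → refl ; zero (suc zero) _ → refl ; (suc zero) zero _ → refl ; (suc zero) (suc zero) _ → refl }

      base-action : XAct Base
      base-action = product {G = A₅} {K = Z 2 ×G Z 2} alternating switches λ
        { _ (zero , zero) _ → refl ; _ (zero , suc zero) _ → refl ; _ (suc zero , zero) _ → refl ; _ (suc zero , suc zero) _ → refl }

      private
        turn-turn : ∀ x → turn (turn x) ≡ x
        turn-turn (i , j , false) = cong₂ (λ i j → i , j , false) (π-π i) (π-π j)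
        turn-turn (i , j , true)  = cong₂ (λ i j → i , j , true) (π-π i) (π-π j)

        turn-permute : ∀ g x → turn (permute (proj₁ g) x) ≡ permute (proj₁ (conjugate g)) (turn x)
        turn-permute g (i , j , false) = cong₂ (λ i j → π (to (proj₁ g) i) , π (to (proj₁ g) j) , false) (sym (π-π j)) (sym (π-π i))
        turn-permute g (i , j , true)  = cong₂ (λ i j → π (to (proj₁ g) i) , π (to (proj₁ g) j) , true) (sym (π-π i)) (sym (π-π j))

        turn-switches : ∀ a b x → turn (XAct.act switches (a , b) x) ≡ XAct.act switches (b , a) (turn x)
        turn-switches zero       zero       x = refl
        turn-switches zero       (suc zero) (i , j , false) = refl
        turn-switches zero       (suc zero) (i , j , true)  = refl
        turn-switches (suc zero) zero       (i , j , false) = refl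
        turn-switches (suc zero) zero       (i , j , true)  = refl
        turn-switches (suc zero) (suc zero) (i , j , false) = refl
        turn-switches (suc zero) (suc zero) (i , j , true)  = refl

      full-action : XAct (SemiZ2 Base σ)
      full-action = semidirect {N = Base} σ base-action turning (λ {x} _ → cong enc (turn-turn x))
        λ (g , a , b) {x} _ → cong enc (trans (turn-permute g (XAct.act switches (a , b) x)) (cong (permute (proj₁ (conjugate g))) (turn-switches a b x)))

      private
        open XAct full-action using (act) renaming (valid to act-valid)

        -- The shape of every group element on a single layer: a map h of the five points, possibly
        -- an exchange of the entries, and the layer of arrival.
        placed : (Fin 5 → Fin 5) → Bool → Bool → Fin 5 → Fin 5 → X
        placed h false t i j = h i , h j , t
        placed h true  t i j = h j , h i , t

        bit : Fin 2 → Bool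
        bit zero = false
        bit (suc zero) = true

        bit-inj : ∀ a b → bit a ≡ bit b → a ≡ b
        bit-inj zero zero _ = refl
        bit-inj (suc zero) (suc zero) _ = refl
        bit-inj zero (suc zero) ()
        bit-inj (suc zero) zero ()

        π^ : Bool → Fin 5 → Fin 5
        π^ false x = x
        π^ true  x = π x

        π^-π^ : ∀ c x → π^ c (π^ c x) ≡ x
        π^-π^ false x = refl
        π^-π^ true  x = π-π x

        act-placed : ∀ g a b c i j ε → act ((g , a , b) , c) (i , j , ε) ≡
          placed (λ x → to (proj₁ g) (π^ c x)) (bit a xor (c ∧ not ε)) (ε xor (bit a xor bit b)) i j
        act-placed g zero       zero       false i j false = refl
        act-placed g zero       zero       false i j true  = refl
        act-placed g zero       zero       true  i j false = refl
        act-placed g zero       zero       true  i j true  = refl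
        act-placed g zero       (suc zero) false i j false = refl
        act-placed g zero       (suc zero) false i j true  = refl
        act-placed g zero       (suc zero) true  i j false = refl
        act-placed g zero       (suc zero) true  i j true  = refl
        act-placed g (suc zero) zero       false i j false = refl
        act-placed g (suc zero) zero       false i j true  = refl
        act-placed g (suc zero) zero       true  i j false = refl
        act-placed g (suc zero) zero       true  i j true  = refl
        act-placed g (suc zero) (suc zero) false i j false = refl
        act-placed g (suc zero) (suc zero) false i j true  = refl
        act-placed g (suc zero) (suc zero) true  i j false = refl
        act-placed g (suc zero) (suc zero) true  i j true  = refl

        Injective : (Fin 5 → Fin 5) → Set
        Injective h = ∀ {x y} → h x ≡ h y → x ≡ y

        placed-level : ∀ h s t h′ s′ t′ {i j} → placed h s t i j ≡ placed h′ s′ t′ i j → t ≡ t′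
        placed-level h false t h′ false t′ e = cong (λ (_ , _ , t) → t) e
        placed-level h false t h′ true  t′ e = cong (λ (_ , _ , t) → t) e
        placed-level h true  t h′ false t′ e = cong (λ (_ , _ , t) → t) e
        placed-level h true  t h′ true  t′ e = cong (λ (_ , _ , t) → t) e

        placed-side : ∀ h s t h′ s′ t′ → Injective h → Injective h′ →
          (∀ {i j} → not (i =ᶠ j) ≡ true → placed h s t i j ≡ placed h′ s′ t′ i j) → s ≡ s′
        placed-side h false t h′ false t′ inj inj′ e = refl
        placed-side h true  t h′ true  t′ inj inj′ e = refl
        placed-side h false t h′ true  t′ inj inj′ e = contradiction
          (inj′ (trans (sym (cong proj₁ (e {#0} {#1} refl))) (cong proj₁ (e {#0} {#2} refl)))) λ ()
        placed-side h true  t h′ false t′ inj inj′ e = contradiction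
          (inj (trans (cong proj₁ (e {#0} {#1} refl)) (sym (cong proj₁ (e {#0} {#2} refl))))) λ ()

        other : Fin 5 → Fin 5
        other zero = #1
        other (suc _) = #0

        distinct : ∀ i → not (i =ᶠ other i) ≡ true
        distinct zero = refl
        distinct (suc _) = refl

        placed-map : ∀ h s t h′ t′ → (∀ {i j} → not (i =ᶠ j) ≡ true → placed h s t i j ≡ placed h′ s t′ i j) → ∀ i → h i ≡ h′ i
        placed-map h false t h′ t′ e i = cong proj₁ (e {i} {other i} (distinct i))
        placed-map h true  t h′ t′ e i = cong (λ (_ , x , _) → x) (e {i} {other i} (distinct i))

        xor-cancelˡ : ∀ a {b b′} → a xor b ≡ a xor b′ → b ≡ b′
        xor-cancelˡ false e = e
        xor-cancelˡ true {false} {false} _ = refl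
        xor-cancelˡ true {true} {true} _ = refl

        to-injective : ∀ (g : RawGroup.Carrier A₅) c → Injective (λ x → to (proj₁ g) (π^ c x))
        to-injective (f , _) c {x} {y} e = trans (sym (back x)) (trans (cong (λ z → π^ c (from f z)) e) (back y))
          where
          back : ∀ x → π^ c (from f (to f (π^ c x))) ≡ x
          back x = trans (cong (π^ c) (strictlyInverseʳ f (π^ c x))) (π^-π^ c x)

        -- On the layer `true` the move `turn` does not exchange the entries, so this layer
        -- determines a. The other layer then determines c, after which g and b can be read off.
        faithful : ∀ {p q} → (∀ {x} → Valid x → enc (act p x) ≡ enc (act q x)) → RawGroup._≈_ (SemiZ2 Base σ) p q
        faithful {p@((g , a , b) , c)} {q@((g′ , a′ , b′) , c′)} e = finish a≡ c≡
          where
          h h′ : Fin 5 → Fin 5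
          h x = to (proj₁ g) (π^ c x)
          h′ x = to (proj₁ g′) (π^ c′ x)
          compared : ∀ ε {i j} → not (i =ᶠ j) ≡ true →
            placed h (bit a xor (c ∧ not ε)) (ε xor (bit a xor bit b)) i j ≡ placed h′ (bit a′ xor (c′ ∧ not ε)) (ε xor (bit a′ xor bit b′)) i j
          compared ε {i} {j} ne = trans (sym (act-placed g a b c i j ε)) (trans
            (enc-inj (act-valid p {i , j , ε} ne) (act-valid q {i , j , ε} ne) (e {i , j , ε} ne)) (act-placed g′ a′ b′ c′ i j ε))
          sides : ∀ ε → bit a xor (c ∧ not ε) ≡ bit a′ xor (c′ ∧ not ε)
          sides ε = placed-side h _ (ε xor (bit a xor bit b)) h′ _ (ε xor (bit a′ xor bit b′)) (λ {x} {y} → to-injective g c {x} {y}) (λ {x} {y} → to-injective g′ c′ {x} {y}) (compared ε)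
          plain : ∀ a c → bit a xor (c ∧ false) ≡ bit a
          plain zero       false = refl
          plain zero       true  = refl
          plain (suc zero) false = refl
          plain (suc zero) true  = refl
          a≡ : a ≡ a′
          a≡ = bit-inj a a′ (trans (sym (plain a c)) (trans (sides true) (plain a′ c′)))
          right : ∀ c → c ∧ true ≡ c
          right false = refl
          right true  = refl
          c≡ : c ≡ c′
          c≡ = trans (sym (right c)) (trans (xor-cancelˡ (bit a) (trans (sides false) (cong (λ a → bit a xor (c′ ∧ true)) (sym a≡)))) (right c′))
          finish : a ≡ a′ → c ≡ c′ → RawGroup._≈_ (SemiZ2 Base σ) p q
          finish refl refl =
            ( (λ x → trans (cong (to (proj₁ g)) (sym (π^-π^ c x))) (trans
                (placed-map h _ (true xor (bit a xor bit b)) h′ (true xor (bit a xor bit b′)) (compared true) (π^ c x)) (cong (to (proj₁ g′)) (π^-π^ c x))))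
            , refl
            , bit-inj b b′ (xor-cancelˡ (bit a) (placed-level h (bit a xor (c ∧ true)) _ h′ (bit a xor (c ∧ true)) _ (compared false {#0} {#1} refl)))) , refl

      acting : Action Γ (SemiZ2 Base σ)
      acting = action full-action Γ λ {g} {h} → faithful {g} {h}

    open Transitivity Γ (Acting.acting
      (exactModel refl (λ {x} {y} → does-true (Enum._≟ᵉ_ E x y)) (λ x → does-true⁻ (Enum._≟ᵉ_ E x x) refl) adjX refl refl))

    private
      transposition : Transp 5 → Fin 5 ↔ Fin 5
      transposition ((p , q) , _) = mk↔ₛ′ (swapF p q) (swapF p q) (swap-swap p q) (swap-swap p q)

      twoSwaps : (s t : Transp 5) → RawGroup.Carrier A₅
      twoSwaps s t = ↔-trans (transposition t) (transposition s) , (s ∷ t ∷ []) , divides 1 refl , λ _ → refl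
        where open import Function.Properties.Inverse using (↔-trans)

      t₀₁ t₁₂ t₂₃ t₃₄ : Transp 5
      t₀₁ = (#0 , #1) , λ ()
      t₁₂ = (#1 , #2) , λ ()
      t₂₃ = (#2 , #3) , λ ()
      t₃₄ = (#3 , #4) , λ ()

      ι : RawGroup.Carrier A₅
      ι = RawGroup.ε A₅

    dodecahedron : Represents (SemiZ2 Base σ) (DV 10) (DAdj 10 2)
    dodecahedron = represents 7
      ( (encode (#0 , #1 , false) , ((twoSwaps t₀₁ t₁₂ , #0 , #0) , false) ∷ ((twoSwaps t₁₂ t₂₃ , #0 , #0) , false) ∷ ((twoSwaps t₂₃ t₃₄ , #0 , #0) , false)
                                    ∷ ((ι , #0 , #1) , false) ∷ [])
      ∷ (encode (#4 , #3 , true) , ((twoSwaps t₂₃ t₃₄ , #0 , #0) , false) ∷ [])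
      ∷ (encode (#2 , #4 , true) , ((twoSwaps t₀₁ t₃₄ , #1 , #1) , false) ∷ [])
      ∷ (encode (#1 , #2 , false) , ((ι , #0 , #0) , true) ∷ []) ∷ []) refl

-- The isomorphism between D(GP(5,2)) and GP(10,3).

module DesarguesIsomorphism where

  open import Defs
  open Automorphisms
  open NormalForms
  open ClosedWalks using (all-sound; ∧-true)
  open FiniteGraphs
  open Models using (≡ᵇ-sound)
  open DesarguesGraph
  open import Data.Nat using (ℕ; suc)
  open import Data.Fin using (Fin; suc; toℕ)
  open import Data.Bool using (Bool; true; false; not; _∧_)
  open import Data.Bool.ListAction using (all)
  open import Data.Product using (_×_; _,_; proj₁; proj₂)
  open import Data.List.Relation.Unary.All as All using (All)
  open import Data.Vec using ([]; _∷_; lookup)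
  open import Relation.Binary.PropositionalEquality using (_≡_; refl; sym; trans)

  module _ {V W : Set} {_∼_ : V → V → Set} {_≈_ : W → W → Set} (Γ : FiniteGraph V _∼_) (Δ : FiniteGraph W _≈_) where
    private
      module Γ = FiniteGraph Γ
      module Δ = FiniteGraph Δ

    isomorphic : (f : V → W) (g : W → V) → all (λ w → f (g w) Δ.≐ w) Δ.vs ≡ true →
      all (λ x → (g (f x) Γ.≐ x) ∧ all (λ y → Γ.adj x y ≡ᵇ Δ.adj (f x) (f y)) Γ.vs) Γ.vs ≡ true → GraphIso V _∼_ W _≈_
    isomorphic f g ok₁ ok₂ = record
      { f = f ; g = g ; fg = fg ; gf = λ x → Γ.≐-sound (proj₁ (at x))
      ; f-adj = λ {x} {y} e → Δ.adj⇒ (trans (sym (same-adj x y)) (Γ.⇒adj e))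
      ; g-adj = λ {x} {y} e → Γ.adj⇒ (trans (same-adj (g x) (g y)) (pulled e)) }
      where
      fg : ∀ w → f (g w) ≡ w
      fg w = Δ.≐-sound (All.lookup (all-sound {f = λ w → f (g w) Δ.≐ w} {Δ.vs} ok₁) (Δ.complete w))
      at : ∀ x → (g (f x) Γ.≐ x) ≡ true × all (λ y → Γ.adj x y ≡ᵇ Δ.adj (f x) (f y)) Γ.vs ≡ true
      at x = ∧-true {g (f x) Γ.≐ x}
        (All.lookup (all-sound {f = λ x → (g (f x) Γ.≐ x) ∧ all (λ y → Γ.adj x y ≡ᵇ Δ.adj (f x) (f y)) Γ.vs} {Γ.vs} ok₂) (Γ.complete x))
      same-adj : ∀ x y → Γ.adj x y ≡ Δ.adj (f x) (f y)
      same-adj x y = ≡ᵇ-sound (All.lookup (all-sound {f = λ y → Γ.adj x y ≡ᵇ Δ.adj (f x) (f y)} {Γ.vs} (proj₂ (at x))) (Γ.complete y))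
      pulled : ∀ {x y} → x ≈ y → Δ.adj (f (g x)) (f (g y)) ≡ true
      pulled {x} {y} e rewrite fg x | fg y = Δ.⇒adj e

  private
    parity : ℕ → Bool
    parity 0 = false
    parity (suc i) = not (parity i)

    -- ℤ/10 as ℤ/5 × ℤ/2.
    residue : Fin 10 → Fin 5
    residue i = lookup (#0 ∷ #1 ∷ #2 ∷ #3 ∷ suc #3 ∷ #0 ∷ #1 ∷ #2 ∷ #3 ∷ suc #3 ∷ []) i

    lift : Fin 5 → Bool → Fin 10
    lift i false = lookup (#0 ∷ shift 6 #0 ∷ #2 ∷ shift 8 #0 ∷ shift 4 #0 ∷ []) i
    lift i true  = lookup (shift 5 #0 ∷ #1 ∷ shift 7 #0 ∷ #3 ∷ shift 9 #0 ∷ []) i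

    -- Inner edges correspond because 3 = -2 modulo 5. The parity is complemented on inner vertices
    -- so that spokes change layers too.
    project : GPV 10 → DV 5
    project (u i) = u (residue i) , parity (toℕ i)
    project (v i) = v (residue i) , not (parity (toℕ i))

    unproject : DV 5 → GPV 10
    unproject (u i , b) = u (lift i b)
    unproject (v i , b) = v (lift i (not b))

  desargues-10-3 : Represents (S 5 ×G Z 2) (GPV 10) (GPAdj 10 3)
  desargues-10-3 = transport (isomorphic (doubleCover 4 2) (petersen 9 3) unproject project refl refl) Kneser.desargues

-- Assembly of the families and the exceptional graphs.

open Automorphisms using (A≅)
open Families using (theorem-i; theorem-ii; theorem-iii; theorem-iv; bipartite-double)
open GeneralLinear using (σ; σ-isInvolAut)
open DesarguesIsomorphism using (desargues-10-3)
open import Data.Nat.Divisibility using (divides; _∣?_)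
open import Relation.Nullary.Decidable using (from-no)

open import Defs
open import Data.Nat using (ℕ; _+_; _*_; _∸_; _≤_; _<_; ⌊_/2⌋)
open import Data.Nat.Divisibility using (_∣_)
open import Data.Product using (Σ; ∃; _×_; _,_)
open import Relation.Nullary using (¬_)
open import Relation.Binary.PropositionalEquality using (_≡_; refl)

theorem1p3 : ((n k : ℕ) → 1 ≤ k → 2 * k < n →
    ((¬ (2 ∣ n) → ¬ (2 ∣ k) →
    ((¬ (k ²≡1[mod n ]) × ¬ (k ²≡-1[mod n ]) → A n k ≅ F (2 * n))
    × (k ²≡1[mod n ] → A n k ≅ J (2 * n) k)
    × (k ²≡-1[mod n ] → A n k ≅ H (2 * n) k)))
    × (¬ (2 ∣ n) → 2 ∣ k → ¬ (n ≡ 5 × k ≡ 2) →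
    ((¬ (k ²≡1[mod n ]) × ¬ (k ²≡-1[mod n ]) → A n k ≅ F (2 * n))
    × (k ²≡1[mod n ] → A n k ≅ J (2 * n) (n ∸ k))
    × (k ²≡-1[mod n ] → A n k ≅ H (2 * n) (n ∸ k))))
    × (2 ∣ n → ¬ (2 ∣ k) →
    ¬ (n ≡ 4 × k ≡ 1) → ¬ (n ≡ 8 × k ≡ 3) → ¬ (n ≡ 10 × k ≡ 3) →
    ¬ (n ≡ 12 × k ≡ 5) → ¬ (n ≡ 24 × k ≡ 5) →
    ((¬ (k ²≡1[mod n ]) × ¬ (k ²≡-1[mod n ]) → A n k ≅ F n ≀S₂)
    × (k ²≡1[mod n ] → A n k ≅ J n k ≀S₂)
    × (k ²≡-1[mod n ] → A n k ≅ H n k ≀S₂)))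
    × (2 ∣ n → 2 ∣ k → ¬ (n ≡ 10 × k ≡ 2) →
    ((k ²≡1[mod ⌊ n /2⌋ ] → A n k ≅ L n k)
    × (k ²≡-1[mod ⌊ n /2⌋ ] → A n k ≅ M n k)
    × (n ≡ 4 * k → A n k ≅ N n k)
    × (¬ (k ²≡1[mod ⌊ n /2⌋ ]) × ¬ (k ²≡-1[mod ⌊ n /2⌋ ]) × ¬ (n ≡ 4 * k) →
    A n k ≅ K n k)))))
    × (A 5 2 ≅ S 5 ×G Z 2)
    × (A 4 1 ≅ (S 4 ×G Z 2) ≀S₂)
    × (∃ λ σ → IsInvolAut GL₂₃ σ × (A 8 3 ≅ SemiZ2 GL₂₃ σ ≀S₂))
    × (A 10 3 ≅ (S 5 ×G Z 2) ≀S₂)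
    × (A 12 5 ≅ (S 4 ×G S 3) ≀S₂)
    × (∃ λ σ → IsInvolAut (GL₂₃ ×G Z 3) σ × (A 24 5 ≅ SemiZ2 (GL₂₃ ×G Z 3) σ ≀S₂))
    × (∃ λ σ → IsInvolAut (Alt 5 ×G Z 2 ×G Z 2) σ × (A 10 2 ≅ SemiZ2 (Alt 5 ×G Z 2 ×G Z 2) σ))
theorem1p3 =
    (λ n k 1≤k 2k<n → theorem-i 1≤k 2k<n , theorem-ii 1≤k 2k<n , theorem-iii 1≤k 2k<n , theorem-iv 1≤k 2k<n)
  , A≅ DesarguesGraph.Kneser.desargues
  , bipartite-double (divides 2 refl) (from-no (2 ∣? 1)) Models.Cube.cube
  , (σ , σ-isInvolAut , bipartite-double (divides 4 refl) (from-no (2 ∣? 3)) MöbiusKantorGraph.MöbiusKantor.möbius-kantor)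
  , bipartite-double (divides 5 refl) (from-no (2 ∣? 3)) desargues-10-3
  , bipartite-double (divides 6 refl) (from-no (2 ∣? 5)) NauruGraph.Star.nauru
  , (FosterGraph.Foster48.σ₃ , FosterGraph.Foster48.σ₃-isInvolAut , bipartite-double (divides 12 refl) (from-no (2 ∣? 5)) FosterGraph.Foster48.foster48)
  , (DodecahedronCover.Dodecahedron.σ , DodecahedronCover.Dodecahedron.σ-isInvolAut , A≅ DodecahedronCover.Dodecahedron.dodecahedron)
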